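{- Let $\ell_0,\dots,\ell_4\in\mathbb{Z}$ be admissible. Then every set $E\subseteq\mathbb{N}$ with $d_{\mathrm{mult}}(E)>0$ contains distinct $x,y\in\mathbb{N}$ of the form $x=k\ell_0(m+\ell_1n)(m+\ell_2n)$, $y=k\ell_0(m+\ell_3n)(m+\ell_4n)$ for some $k,m,n\in\mathbb{Z}$.
   Context: Integers $\ell_0,\dots,\ell_4$ are admissible if $\ell_0>0$, $\ell_1\neq\ell_2$, $\ell_3\neq\ell_4$, and $\{\ell_1,\ell_2\}\neq\{\ell_3,\ell_4\}$. Let $p_1,p_2,\dots$ be the sequence of primes and $\Phi_M=\{p_1^{k_1}\cdots p_M^{k_M}\colon0\leq k_1,\dots,k_M\leq M\}$. The (upper) multiplicative density of $E\subseteq\mathbb{N}$ is $d_{\mathrm{mult}}(E)=\limsup_{M\to+\infty}|E\cap\Phi_M|/|\Phi_M|$. -}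

module Defs where

open import Data.Nat as ℕ using (ℕ; zero; suc; _≤_; _<_)
open import Data.Nat.Primality using (Prime; prime?)
open import Data.Integer as ℤ using (ℤ; +_)
open import Data.Fin using (Fin; toℕ)
open import Data.List using (List; length; filter; upTo)
open import Data.List.Membership.Propositional using (_∈_)
open import Data.List.Relation.Unary.All using (All)
open import Data.List.Relation.Unary.Unique.Propositional using (Unique)
open import Data.Product using (Σ; ∃; ∃-syntax; _×_)
open import Data.Sum using (_⊎_)
open import Relation.Nullary using (¬_)
open import Relation.Binary.PropositionalEquality using (_≡_)

primesBelow : ℕ → ℕ
primesBelow p = length (filter prime? (upTo p))

-- p is the i-th prime, 0-indexed (so p_1 of the paper is IsNthPrime 0 2).
IsNthPrime : ℕ → ℕ → Set
IsNthPrime i p = Prime p × primesBelow p ≡ i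

prodFin : (M : ℕ) → (Fin M → ℕ) → ℕ
prodFin zero    f = 1
prodFin (suc M) f = f Data.Fin.zero ℕ.* prodFin M (λ i → f (Data.Fin.suc i))

InΦ : ℕ → ℕ → Set
InΦ M x = Σ (Fin M → ℕ) λ p → Σ (Fin M → Fin (suc M)) λ k →
  ((i : Fin M) → IsNthPrime (toℕ i) (p i)) ×
  x ≡ prodFin M (λ i → p i ℕ.^ toℕ (k i))

HasAtLeast : (ℕ → Set) → ℕ → Set
HasAtLeast P c = Σ (List ℕ) λ xs → Unique xs × All P xs × c ≤ length xs

HasAtMost : (ℕ → Set) → ℕ → Set
HasAtMost P d = Σ (List ℕ) λ xs → ((x : ℕ) → P x → x ∈ xs) × length xs ≤ d

-- d_mult(E) > 0, i.e. limsup_M |E ∩ Φ_M| / |Φ_M| > 0, i.e. there is b ≥ 1 such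
-- that for infinitely many M, b · |E ∩ Φ_M| > |Φ_M|.
PositiveMultDensity : (ℕ → Set) → Set
PositiveMultDensity E = Σ ℕ λ b → 1 ≤ b × ((M₀ : ℕ) → Σ ℕ λ M → M₀ ≤ M ×
  Σ ℕ λ c → Σ ℕ λ d →
    HasAtLeast (λ x → E x × InΦ M x) c × HasAtMost (InΦ M) d × d < b ℕ.* c)

Admissible : ℤ → ℤ → ℤ → ℤ → ℤ → Set
Admissible ℓ₀ ℓ₁ ℓ₂ ℓ₃ ℓ₄ =
  ℤ.0ℤ ℤ.< ℓ₀ × ¬ (ℓ₁ ≡ ℓ₂) × ¬ (ℓ₃ ≡ ℓ₄) ×
  ¬ ((ℓ₁ ≡ ℓ₃ × ℓ₂ ≡ ℓ₄) ⊎ (ℓ₁ ≡ ℓ₄ × ℓ₂ ≡ ℓ₃))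

{-# OPTIONS --safe #-}
-- Counting the pairs x = g y inside a suitable part of E ∩ Φ_M gives a positive definite function φ on (ℚ , ·) whose
-- averages over quotients of any prescribed finite set are bounded below.  After a translation of m the ratio of the two
-- forms is s q = (1 + a q)(1 + b q) / (1 + e q) with q = n / m, and some q with φ (s q) > 0 is needed.  Here q is drawn from
-- finite laws that are almost invariant under affine maps.  For such laws the factors z + x with distinct x are nearly
-- orthogonal with respect to φ, so by Cauchy–Schwarz linear factors can be exchanged on average.  Put q ∘ z = q z / (q + z)
-- and D q = q − e s q / (a b).  An affine change of z turns s (q ∘ z) into s q (z − 1/a)(z − 1/b) / ((z + q)(z + D q)), and
-- exchanging all four factors for generic ones bounds the mean of φ (s (q ∘ z)) below by the mean of φ_z (s q), where φ_z is
-- φ averaged over ratios of products (z + x)(z + x′).  If φ_z 1 is often much smaller than φ 1, induct on the energy φ 1.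
-- Otherwise φ is almost invariant under those ratios, hence s q acts like (a b / e) q, and a random walk with steps
-- (a b / e) q cannot avoid itself because of the lower bound on the averages of φ.
module Submission where

open import Data.Empty using (⊥-elim)
open import Data.Integer.Base as ℤ using (ℤ; 0ℤ; ∣_∣)
import Data.Integer.Divisibility.Signed as Signed
import Data.Integer.Properties as ℤ
open import Data.List.Base using (List; []; _∷_; _++_; map; length; concat; cartesianProductWith; deduplicate; downFrom; filter; upTo)
open import Data.List.Membership.Propositional using (_∈_)
open import Data.List.Membership.Propositional.Properties using (∈-++⁺ʳ; ∈-++⁺ˡ; ∈-++⁻; ∈-cartesianProductWith⁺; ∈-concat⁺′; ∈-deduplicate⁺; ∈-filter⁻; ∈-map⁺; ∈-map⁻; ∈-∃++)
open import Data.List.Properties using (filter-++; filter-accept; length-++; length-deduplicate; length-downFrom; length-filter; length-map; length-upTo; upTo-∷ʳ)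
open import Data.List.Relation.Unary.All as All using (All; []; _∷_)
open import Data.List.Relation.Unary.All.Properties using (++⁺; ++⁻ʳ; ++⁻ˡ; concat⁺; concat⁻; map⁺; map⁻)
open import Data.List.Relation.Unary.AllPairs as AllPairs using (AllPairs; []; _∷_)
open import Data.List.Relation.Unary.Any using (here; there)
open import Data.List.Relation.Unary.Unique.DecPropositional.Properties using (deduplicate-!)
open import Data.List.Relation.Unary.Unique.Propositional using (Unique)
import Data.List.Relation.Unary.Unique.Propositional.Properties as Unique
open import Data.Nat.Base as ℕ using (ℕ)
open import Data.Nat.ListAction using (product)
import Data.Nat.Properties as ℕ
open import Data.Product.Base using (Σ; _×_; _,_; proj₁; proj₂)
open import Data.Sum.Base using (_⊎_; inj₁; inj₂)
open import Function.Base using (id; _∘_; const)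
open import Relation.Binary.Definitions using (tri<; tri≈; tri>)
open import Relation.Binary.PropositionalEquality
open import Relation.Nullary using (¬_; Dec; yes; no)
open import Tactic.RingSolver using (solve-∀)

-- The order of choices shapes the proof. A state comes from a finite part of E, and that part can
-- be cut out only after the finite list of ratios and the divisor required of x are known. Hence
-- laws, lists and lower bounds are fixed before φ and hold for all states at once, and each stage
-- of the induction returns a mixture of candidate laws; which component works depends on φ. No
-- limit object occurs: `Ev` stands for an invariant mean on the line, and a later law is chosen
-- invariant relative to the finite supports of earlier ones. The obstacle is the factor z + D q. It
-- is a function of q, so it cannot be averaged independently of z + q, and within one law the
-- differences to be exchanged need not be orthogonal. They are nearly orthogonal for two laws of
-- which one is chosen after the other. A tower of many laws therefore carries out the exchange, its
-- diagonal being diluted by its length. Orthogonality reduces to the fact that the positions D q,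
-- normalised by a test pair, rarely coincide; there the distinctness of the roots enters.

-- Rational arithmetic with a total inverse.

module Arithmetic where
  open import Data.Maybe.Base using (just; nothing)
  open import Data.Rational
  open import Data.Rational.Properties
  open import Level using (0ℓ)
  import Tactic.RingSolver.Core.AlmostCommutativeRing as ACR

  ring : ACR.AlmostCommutativeRing 0ℓ 0ℓ
  ring = ACR.fromCommutativeRing +-*-commutativeRing isZero
    where
    isZero : ∀ x → _
    isZero x with 0ℚ ≟ x
    ... | yes p = just p
    ... | no _ = nothing

  2ℚ : ℚ
  2ℚ = 1ℚ + 1ℚ

  -- Inequalities are proved by exhibiting the slack `d` as a visibly nonnegative expression; what
  -- remains is a ring identity.
  ≤-by : ∀ {d x y} → 0ℚ ≤ d → d ≡ y - x → x ≤ y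
  ≤-by {d} {x} {y} d≥0 eq = subst₂ _≤_ (l x) (trans (cong (x +_) eq) (r x y)) (+-monoʳ-≤ x d≥0)
    where
    l : ∀ x → x + 0ℚ ≡ x
    l = solve-∀ ring
    r : ∀ x y → x + (y - x) ≡ y
    r = solve-∀ ring

  <-by : ∀ {d x y} → 0ℚ < d → d ≡ y - x → x < y
  <-by {d} {x} {y} d>0 eq = subst₂ _<_ (l x) (trans (cong (x +_) eq) (r x y)) (+-monoʳ-< x d>0)
    where
    l : ∀ x → x + 0ℚ ≡ x
    l = solve-∀ ring
    r : ∀ x y → x + (y - x) ≡ y
    r = solve-∀ ring

  diff≥0 : ∀ {x y} → x ≤ y → 0ℚ ≤ y - x
  diff≥0 {x} {y} p = subst (_≤ y - x) (+-inverseʳ x) (+-monoˡ-≤ (- x) p)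

  diff>0 : ∀ {x y} → x < y → 0ℚ < y - x
  diff>0 {x} {y} p = subst (_< y - x) (+-inverseʳ x) (+-monoˡ-< (- x) p)

  +≥0 : ∀ {x y} → 0ℚ ≤ x → 0ℚ ≤ y → 0ℚ ≤ x + y
  +≥0 p q = +-mono-≤ p q

  +>0 : ∀ {x y} → 0ℚ < x → 0ℚ ≤ y → 0ℚ < x + y
  +>0 p q = +-mono-<-≤ p q

  *≥0 : ∀ {x y} → 0ℚ ≤ x → 0ℚ ≤ y → 0ℚ ≤ x * y
  *≥0 {x} {y} p q = nonNegative⁻¹ _ {{nonNeg*nonNeg⇒nonNeg x {{nonNegative p}} y {{nonNegative q}}}}

  *>0 : ∀ {x y} → 0ℚ < x → 0ℚ < y → 0ℚ < x * y
  *>0 {x} {y} p q = positive⁻¹ _ {{pos*pos⇒pos x {{positive p}} y {{positive q}}}}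

  0≤1 : 0ℚ ≤ 1ℚ
  0≤1 = nonNegative⁻¹ 1ℚ

  0<1 : 0ℚ < 1ℚ
  0<1 = positive⁻¹ 1ℚ

  *-monoˡ : ∀ {c x y} → 0ℚ ≤ c → x ≤ y → c * x ≤ c * y
  *-monoˡ {c} {x} {y} p q = *-monoˡ-≤-nonNeg c {{nonNegative p}} q

  *-cancel : ∀ {c x y} → 0ℚ < c → c * x ≤ c * y → x ≤ y
  *-cancel {c} p q = *-cancelˡ-≤-pos c {{positive p}} q

  >⇒≢ : ∀ {x} → 0ℚ < x → x ≢ 0ℚ
  >⇒≢ p eq = <-irrefl (sym eq) p

  square≥0 : ∀ x → 0ℚ ≤ x * x
  square≥0 x with ≤-total 0ℚ x
  ... | inj₁ p = *≥0 p p
  ... | inj₂ p = subst (0ℚ ≤_) (l x) (*≥0 (neg-antimono-≤ p) (neg-antimono-≤ p))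
    where
    l : ∀ x → (- x) * (- x) ≡ x * x
    l = solve-∀ ring

  -- Total inversion: inv 0 = 0.

  abstract
    inv : ℚ → ℚ
    inv p with p ≟ 0ℚ
    ... | yes _ = 0ℚ
    ... | no p≢0 = 1/_ p {{≢-nonZero p≢0}}

    inv-0 : inv 0ℚ ≡ 0ℚ
    inv-0 with 0ℚ ≟ 0ℚ
    ... | yes _ = refl
    ... | no p = ⊥-elim (p refl)

    inv-r : ∀ {p} → p ≢ 0ℚ → p * inv p ≡ 1ℚ
    inv-r {p} p≢0 with p ≟ 0ℚ
    ... | yes q = ⊥-elim (p≢0 q)
    ... | no q = *-inverseʳ p {{≢-nonZero q}}

    inv-pos : ∀ {p} → 0ℚ < p → 0ℚ < inv p
    inv-pos {p} p>0 with p ≟ 0ℚ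
    ... | yes q = ⊥-elim (>⇒≢ p>0 q)
    ... | no q = positive⁻¹ _ {{1/pos⇒pos p {{positive p>0}}}}

  inv-unique : ∀ {p q} → p * q ≡ 1ℚ → inv p ≡ q
  inv-unique {p} {q} eq = begin
    inv p           ≡⟨ sym (*-identityʳ _) ⟩
    inv p * 1ℚ      ≡⟨ cong (inv p *_) (sym eq) ⟩
    inv p * (p * q) ≡⟨ l (inv p) p q ⟩
    p * inv p * q   ≡⟨ cong (_* q) (inv-r p≢0) ⟩
    1ℚ * q          ≡⟨ *-identityˡ q ⟩
    q ∎
    where
    open ≡-Reasoning
    p≢0 : p ≢ 0ℚ
    p≢0 refl = 1≢0 (trans (sym eq) (*-zeroˡ q))
    l : ∀ i p q → i * (p * q) ≡ p * i * q
    l = solve-∀ ring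

  inv-1 : inv 1ℚ ≡ 1ℚ
  inv-1 = inv-unique {1ℚ} {1ℚ} (*-identityˡ 1ℚ)

  inv-≢0 : ∀ {p} → p ≢ 0ℚ → inv p ≢ 0ℚ
  inv-≢0 {p} p≢0 eq = 1≢0 (trans (sym (inv-r p≢0)) (trans (cong (p *_) eq) (*-zeroʳ p)))

  *-≢0 : ∀ {p q} → p ≢ 0ℚ → q ≢ 0ℚ → p * q ≢ 0ℚ
  *-≢0 {p} {q} p≢0 q≢0 eq = q≢0 (begin
    q                 ≡⟨ sym (*-identityˡ q) ⟩
    1ℚ * q            ≡⟨ cong (_* q) (sym (inv-r p≢0)) ⟩
    p * inv p * q     ≡⟨ l p (inv p) q ⟩
    inv p * (p * q)   ≡⟨ cong (inv p *_) eq ⟩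
    inv p * 0ℚ        ≡⟨ *-zeroʳ (inv p) ⟩
    0ℚ ∎)
    where
    open ≡-Reasoning
    l : ∀ p i q → p * i * q ≡ i * (p * q)
    l = solve-∀ ring

  inv-* : ∀ p q → inv (p * q) ≡ inv p * inv q
  inv-* p q = go (p ≟ 0ℚ) (q ≟ 0ℚ)
    where
    open ≡-Reasoning
    l : ∀ p q i j → p * q * (i * j) ≡ p * i * (q * j)
    l = solve-∀ ring
    go : Dec (p ≡ 0ℚ) → Dec (q ≡ 0ℚ) → inv (p * q) ≡ inv p * inv q
    go (yes e) _ = begin
      inv (p * q)   ≡⟨ cong (λ x → inv (x * q)) e ⟩
      inv (0ℚ * q)  ≡⟨ cong inv (*-zeroˡ q) ⟩
      inv 0ℚ        ≡⟨ inv-0 ⟩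
      0ℚ            ≡⟨ sym (*-zeroˡ (inv q)) ⟩
      0ℚ * inv q    ≡⟨ cong (_* inv q) (sym (trans (cong inv e) inv-0)) ⟩
      inv p * inv q ∎
    go (no _) (yes e) = begin
      inv (p * q)   ≡⟨ cong (λ x → inv (p * x)) e ⟩
      inv (p * 0ℚ)  ≡⟨ cong inv (*-zeroʳ p) ⟩
      inv 0ℚ        ≡⟨ inv-0 ⟩
      0ℚ            ≡⟨ sym (*-zeroʳ (inv p)) ⟩
      inv p * 0ℚ    ≡⟨ cong (inv p *_) (sym (trans (cong inv e) inv-0)) ⟩
      inv p * inv q ∎
    go (no a) (no b) = inv-unique {p * q} {inv p * inv q} (begin
      p * q * (inv p * inv q)   ≡⟨ l p q (inv p) (inv q) ⟩
      p * inv p * (q * inv q)   ≡⟨ cong₂ _*_ (inv-r a) (inv-r b) ⟩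
      1ℚ * 1ℚ                   ≡⟨ *-identityˡ 1ℚ ⟩
      1ℚ ∎)

  inv-inv : ∀ p → inv (inv p) ≡ p
  inv-inv p = go (p ≟ 0ℚ)
    where
    go : Dec (p ≡ 0ℚ) → inv (inv p) ≡ p
    go (yes refl) = trans (cong inv inv-0) inv-0
    go (no a) = inv-unique {inv p} {p} (trans (*-comm (inv p) p) (inv-r a))

  cancel-ratio : ∀ {c} → c ≢ 0ℚ → ∀ g h → c * g * inv (c * h) ≡ g * inv h
  cancel-ratio {c} c≢0 g h = begin
    c * g * inv (c * h)       ≡⟨ cong (c * g *_) (inv-* c h) ⟩
    c * g * (inv c * inv h)   ≡⟨ l c g (inv c) (inv h) ⟩
    c * inv c * (g * inv h)   ≡⟨ cong (_* (g * inv h)) (inv-r c≢0) ⟩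
    1ℚ * (g * inv h)          ≡⟨ *-identityˡ _ ⟩
    g * inv h ∎
    where
    open ≡-Reasoning
    l : ∀ c g i h → c * g * (i * h) ≡ c * i * (g * h)
    l = solve-∀ ring

  ratio-unique : ∀ {a b c} → b ≢ 0ℚ → a ≡ c * b → a * inv b ≡ c
  ratio-unique {a} {b} {c} b≢0 eq = begin
    a * inv b         ≡⟨ cong (_* inv b) eq ⟩
    c * b * inv b     ≡⟨ *-assoc c b (inv b) ⟩
    c * (b * inv b)   ≡⟨ cong (c *_) (inv-r b≢0) ⟩
    c * 1ℚ            ≡⟨ *-identityʳ c ⟩
    c ∎
    where open ≡-Reasoning

  fromℕ : ℕ → ℚ
  fromℕ ℕ.zero = 0ℚ
  fromℕ (ℕ.suc n) = 1ℚ + fromℕ n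

  fromℕ≥0 : ∀ n → 0ℚ ≤ fromℕ n
  fromℕ≥0 ℕ.zero = ≤-refl
  fromℕ≥0 (ℕ.suc n) = +≥0 0≤1 (fromℕ≥0 n)

  fromℕ-suc>0 : ∀ n → 0ℚ < fromℕ (ℕ.suc n)
  fromℕ-suc>0 n = +>0 0<1 (fromℕ≥0 n)

  fromℕ-/1 : ∀ n → fromℕ n ≡ ℤ.+ n / 1
  fromℕ-/1 ℕ.zero = refl
  fromℕ-/1 (ℕ.suc n) = trans (cong (1ℚ +_) (fromℕ-/1 n)) (toℚᵘ-injective (ℚᵘ.≃-trans (toℚᵘ-homo-+ 1ℚ (ℤ.+ n / 1)) (ℚᵘ.≃-trans (ℚᵘ.+-cong {toℚᵘ 1ℚ} {ℚᵘ.1ℚᵘ} ℚᵘ.≃-refl (toℚᵘ-fromℚᵘ (ℚᵘ.mkℚᵘ (ℤ.+ n) 0))) (ℚᵘ.≃-trans (ℚᵘ.*≡* (e n)) (ℚᵘ.≃-sym (toℚᵘ-fromℚᵘ (ℚᵘ.mkℚᵘ (ℤ.+ ℕ.suc n) 0)))))))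
    where
    import Data.Rational.Unnormalised.Base as ℚᵘ
    import Data.Rational.Unnormalised.Properties as ℚᵘ
    e : ∀ n → (ℤ.+ 1 ℤ.* ℤ.+ 1 ℤ.+ ℤ.+ n ℤ.* ℤ.+ 1) ℤ.* ℤ.+ 1 ≡ ℤ.+ ℕ.suc n ℤ.* ℤ.+ 1
    e n = cong (ℤ._* ℤ.+ 1) (cong (λ i → ℤ.+ 1 ℤ.+ i) (ℤ.*-identityʳ (ℤ.+ n)))

  abstract
    archimedean : ∀ x → Σ ℕ λ n → x ≤ fromℕ n
    archimedean x@(mkℚ n d c) = ℤ.∣ n ∣ , subst (x ≤_) (sym (fromℕ-/1 ℤ.∣ n ∣)) (toℚᵘ-cancel-≤ (ℚᵘ.≤-trans (ℚᵘ.*≤* le) (ℚᵘ.≤-reflexive (ℚᵘ.≃-sym (toℚᵘ-fromℚᵘ (ℚᵘ.mkℚᵘ (ℤ.+ ℤ.∣ n ∣) 0))))))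
      where
      import Data.Rational.Unnormalised.Base as ℚᵘ
      import Data.Rational.Unnormalised.Properties as ℚᵘ
      i≤∣i∣ : ∀ i → i ℤ.≤ ℤ.+ ℤ.∣ i ∣
      i≤∣i∣ (ℤ.+ i) = ℤ.≤-refl
      i≤∣i∣ ℤ.-[1+ i ] = ℤ.-≤+
      le : n ℤ.* ℤ.+ 1 ℤ.≤ ℤ.+ ℤ.∣ n ∣ ℤ.* ℤ.+ ℕ.suc d
      le = ℤ.≤-trans (ℤ.≤-reflexive (ℤ.*-identityʳ n)) (ℤ.≤-trans (i≤∣i∣ n) (subst (ℤ._≤ ℤ.+ ℤ.∣ n ∣ ℤ.* ℤ.+ ℕ.suc d) (ℤ.*-identityʳ _) (ℤ.*-monoˡ-≤-nonNeg (ℤ.+ ℤ.∣ n ∣) {ℤ.+ 1} {ℤ.+ ℕ.suc d} (ℤ.+≤+ (ℕ.s≤s ℕ.z≤n)))))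

    small : ∀ {ρ} → 0ℚ < ρ → Σ ℕ λ n → inv (fromℕ (ℕ.suc n)) ≤ ρ
    small {ρ} ρ>0 = n , *-cancel N>0 (subst₂ _≤_ (sym (inv-r (>⇒≢ N>0))) refl (≤-trans (≤-reflexive (trans (sym (inv-r (>⇒≢ ρ>0))) (*-comm ρ (inv ρ)))) (≤-trans (*-monoʳ-≤-nonNeg ρ {{nonNegative (<⇒≤ ρ>0)}} le) (*-monoʳ-≤-nonNeg ρ {{nonNegative (<⇒≤ ρ>0)}} step))))
      where
      n : ℕ
      n = proj₁ (archimedean (inv ρ))
      le : inv ρ ≤ fromℕ n
      le = proj₂ (archimedean (inv ρ))
      N>0 : 0ℚ < fromℕ (ℕ.suc n)
      N>0 = fromℕ-suc>0 n
      step : fromℕ n ≤ 1ℚ + fromℕ n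
      step = ≤-by 0≤1 (l (fromℕ n))
        where
        l : ∀ x → 1ℚ ≡ 1ℚ + x - x
        l = solve-∀ ring

open Arithmetic

-- Finitely supported laws and positive definite states.

module Averages where
  open import Data.Rational
  open import Data.Rational.Properties

  E : ∀ {A : Set} → List (ℚ × A) → (A → ℚ) → ℚ
  E [] f = 0ℚ
  E ((w , a) ∷ l) f = w * f a + E l f

  E-cong : ∀ {A} (l : List (ℚ × A)) {f g} → (∀ a → f a ≡ g a) → E l f ≡ E l g
  E-cong [] eq = refl
  E-cong ((w , a) ∷ l) eq = cong₂ (λ x y → w * x + y) (eq a) (E-cong l eq)

  E-zero : ∀ {A} (l : List (ℚ × A)) → E l (λ _ → 0ℚ) ≡ 0ℚ
  E-zero [] = refl
  E-zero ((w , a) ∷ l) = trans (cong (w * 0ℚ +_) (E-zero l)) (p w)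
    where
    p : ∀ w → w * 0ℚ + 0ℚ ≡ 0ℚ
    p = solve-∀ ring

  E-+ : ∀ {A} (l : List (ℚ × A)) f g → E l (λ a → f a + g a) ≡ E l f + E l g
  E-+ [] f g = refl
  E-+ ((w , a) ∷ l) f g = trans (cong (w * (f a + g a) +_) (E-+ l f g)) (p w (f a) (g a) (E l f) (E l g))
    where
    p : ∀ w x y s t → w * (x + y) + (s + t) ≡ w * x + s + (w * y + t)
    p = solve-∀ ring

  E-* : ∀ {A} (l : List (ℚ × A)) c f → E l (λ a → c * f a) ≡ c * E l f
  E-* [] c f = sym (*-zeroʳ c)
  E-* ((w , a) ∷ l) c f = trans (cong (w * (c * f a) +_) (E-* l c f)) (p w c (f a) (E l f))
    where
    p : ∀ w c x s → w * (c * x) + c * s ≡ c * (w * x + s)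
    p = solve-∀ ring

  E-- : ∀ {A} (l : List (ℚ × A)) f g → E l (λ a → f a - g a) ≡ E l f - E l g
  E-- [] f g = refl
  E-- ((w , a) ∷ l) f g = trans (cong (w * (f a - g a) +_) (E-- l f g)) (p w (f a) (g a) (E l f) (E l g))
    where
    p : ∀ w x y s t → w * (x - y) + (s - t) ≡ w * x + s - (w * y + t)
    p = solve-∀ ring

  E-swap : ∀ {A B} (l : List (ℚ × A)) (m : List (ℚ × B)) (F : A → B → ℚ) →
    E l (λ a → E m (F a)) ≡ E m (λ b → E l (λ a → F a b))
  E-swap [] m F = sym (E-zero m)
  E-swap ((w , a) ∷ l) m F = begin
    w * E m (F a) + E l (λ a → E m (F a))
      ≡⟨ cong₂ _+_ (sym (E-* m w (F a))) (E-swap l m F) ⟩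
    E m (λ b → w * F a b) + E m (λ b → E l (λ a → F a b))
      ≡⟨ sym (E-+ m _ _) ⟩
    E m (λ b → w * F a b + E l (λ a → F a b)) ∎
    where open ≡-Reasoning

  E-++ : ∀ {A} (l m : List (ℚ × A)) f → E (l ++ m) f ≡ E l f + E m f
  E-++ [] m f = sym (+-identityˡ _)
  E-++ ((w , a) ∷ l) m f = trans (cong (w * f a +_) (E-++ l m f)) (sym (+-assoc (w * f a) (E l f) (E m f)))

  E-reweight : ∀ {A B} (l : List (ℚ × A)) c (g : A → B) f →
    E (map (λ p → c * proj₁ p , g (proj₂ p)) l) f ≡ c * E l (f ∘ g)
  E-reweight [] c g f = sym (*-zeroʳ c)
  E-reweight ((w , a) ∷ l) c g f = trans (cong (c * w * f (g a) +_) (E-reweight l c g f)) (p c w (f (g a)) (E l (f ∘ g)))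
    where
    p : ∀ c w x s → c * w * x + c * s ≡ c * (w * x + s)
    p = solve-∀ ring

  E-mono : ∀ {A} (l : List (ℚ × A)) {f g} → All (λ p → 0ℚ ≤ proj₁ p) l →
    All (λ p → f (proj₂ p) ≤ g (proj₂ p)) l → E l f ≤ E l g
  E-mono [] [] [] = ≤-refl
  E-mono ((w , a) ∷ l) (p ∷ ps) (q ∷ qs) = +-mono-≤ (*-monoˡ p q) (E-mono l ps qs)

  record Law (A : Set) : Set where
    constructor law
    field
      list   : List (ℚ × A)
      nonneg : All (λ p → 0ℚ ≤ proj₁ p) list
      total  : E list (λ _ → 1ℚ) ≡ 1ℚ

  open Law

  abstract
    toList : ∀ {A} → Law A → List (ℚ × A)
    toList = list

    support : ∀ {A} → Law A → List A
    support μ = map proj₂ (list μ)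

    𝔼 : ∀ {A} → Law A → (A → ℚ) → ℚ
    𝔼 μ f = E (list μ) f

  -- Quantifies over every listed point, those of weight zero included, so that a support is just a
  -- finite list on which conditions can be imposed one by one.
  Supp : ∀ {A} → Law A → (A → Set) → Set
  Supp μ P = All P (support μ)

  Supp-all : ∀ {A} (μ : Law A) {P : A → Set} → (∀ a → P a) → Supp μ P
  Supp-all μ f = All.universal f (support μ)

  abstract
    𝔼-def : ∀ {A} (μ : Law A) f → 𝔼 μ f ≡ E (toList μ) f
    𝔼-def μ f = refl

    𝔼-cong : ∀ {A} (μ : Law A) {f g} → (∀ a → f a ≡ g a) → 𝔼 μ f ≡ 𝔼 μ g
    𝔼-cong μ h = E-cong (list μ) h

    𝔼-+ : ∀ {A} (μ : Law A) f g → 𝔼 μ (λ a → f a + g a) ≡ 𝔼 μ f + 𝔼 μ g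
    𝔼-+ μ = E-+ (list μ)

    𝔼-- : ∀ {A} (μ : Law A) f g → 𝔼 μ (λ a → f a - g a) ≡ 𝔼 μ f - 𝔼 μ g
    𝔼-- μ = E-- (list μ)

    𝔼-* : ∀ {A} (μ : Law A) c f → 𝔼 μ (λ a → c * f a) ≡ c * 𝔼 μ f
    𝔼-* μ = E-* (list μ)

    𝔼-swap : ∀ {A B} (μ : Law A) (ν : Law B) (F : A → B → ℚ) →
      𝔼 μ (λ a → 𝔼 ν (F a)) ≡ 𝔼 ν (λ b → 𝔼 μ (λ a → F a b))
    𝔼-swap μ ν = E-swap (list μ) (list ν)

    𝔼-mono : ∀ {A} (μ : Law A) {f g} → Supp μ (λ a → f a ≤ g a) → 𝔼 μ f ≤ 𝔼 μ g
    𝔼-mono μ h = E-mono (list μ) (nonneg μ) (map⁻ h)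

    𝔼-const : ∀ {A} (μ : Law A) c → 𝔼 μ (λ _ → c) ≡ c
    𝔼-const μ c = begin
      E (list μ) (λ _ → c)      ≡⟨ E-cong (list μ) (λ _ → sym (*-identityʳ c)) ⟩
      E (list μ) (λ _ → c * 1ℚ) ≡⟨ E-* (list μ) c (λ _ → 1ℚ) ⟩
      c * E (list μ) (λ _ → 1ℚ) ≡⟨ cong (c *_) (total μ) ⟩
      c * 1ℚ                    ≡⟨ *-identityʳ c ⟩
      c ∎
      where open ≡-Reasoning

  𝔼-mono′ : ∀ {A} (μ : Law A) {f g} → (∀ a → f a ≤ g a) → 𝔼 μ f ≤ 𝔼 μ g
  𝔼-mono′ μ h = 𝔼-mono μ (Supp-all μ h)

  𝔼-+c : ∀ {A} (μ : Law A) f c → 𝔼 μ (λ a → f a + c) ≡ 𝔼 μ f + c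
  𝔼-+c μ f c = trans (𝔼-+ μ f (λ _ → c)) (cong (𝔼 μ f +_) (𝔼-const μ c))

  𝔼-≤c : ∀ {A} (μ : Law A) {f c} → Supp μ (λ a → f a ≤ c) → 𝔼 μ f ≤ c
  𝔼-≤c μ {f} {c} h = subst (𝔼 μ f ≤_) (𝔼-const μ c) (𝔼-mono μ h)

  𝔼-c≤ : ∀ {A} (μ : Law A) {f c} → Supp μ (λ a → c ≤ f a) → c ≤ 𝔼 μ f
  𝔼-c≤ μ {f} {c} h = subst (_≤ 𝔼 μ f) (𝔼-const μ c) (𝔼-mono μ h)

  𝔼-cong∈ : ∀ {A} (μ : Law A) {f g} → Supp μ (λ a → f a ≡ g a) → 𝔼 μ f ≡ 𝔼 μ g
  𝔼-cong∈ μ h = ≤-antisym (𝔼-mono μ (All.map ≤-reflexive h)) (𝔼-mono μ (All.map (≤-reflexive ∘ sym) h))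

  𝔼-pos : ∀ {A} (μ : Law A) {f} → 0ℚ < 𝔼 μ f → Σ A λ a → a ∈ support μ × 0ℚ < f a
  𝔼-pos {A} μ {f} h = go (support μ) (λ le → <-irrefl {0ℚ} refl (<-≤-trans h (𝔼-≤c μ le)))
    where
    go : ∀ l → ¬ All (λ a → f a ≤ 0ℚ) l → Σ A λ a → a ∈ l × 0ℚ < f a
    step : ∀ a l → Dec (0ℚ < f a) → ¬ All (λ a → f a ≤ 0ℚ) (a ∷ l) → Σ A λ b → b ∈ a ∷ l × 0ℚ < f b
    go [] n = ⊥-elim (n [])
    go (a ∷ l) n = step a l (0ℚ <? f a) n
    step a l (yes p) n = a , here refl , p
    step a l (no p) n = let (b , m , q) = go l (λ ps → n (≮⇒≥ p ∷ ps)) in b , there m , q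

  module _ {A B : Set} where
    bindl : List (ℚ × A) → (A → List (ℚ × B)) → List (ℚ × B)
    bindl [] k = []
    bindl ((w , a) ∷ l) k = map (λ p → w * proj₁ p , proj₂ p) (k a) ++ bindl l k

    E-bindl : ∀ l k f → E (bindl l k) f ≡ E l (λ a → E (k a) f)
    E-bindl [] k f = refl
    E-bindl ((w , a) ∷ l) k f = trans (E-++ (map (λ p → w * proj₁ p , proj₂ p) (k a)) (bindl l k) f)
      (cong₂ _+_ (E-reweight (k a) w id f) (E-bindl l k f))

    bindl-nonneg : ∀ l k → All (λ p → 0ℚ ≤ proj₁ p) l → (∀ a → All (λ p → 0ℚ ≤ proj₁ p) (k a)) →
      All (λ p → 0ℚ ≤ proj₁ p) (bindl l k)
    bindl-nonneg [] k [] h = []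
    bindl-nonneg ((w , a) ∷ l) k (p ∷ ps) h = ++⁺ (map⁺ (All.map (λ q → *≥0 p q) (h a))) (bindl-nonneg l k ps h)

    bindl-All : ∀ l k {P : B → Set} → All (λ p → All (λ q → P (proj₂ q)) (k (proj₂ p))) l → All (λ q → P (proj₂ q)) (bindl l k)
    bindl-All [] k [] = []
    bindl-All ((w , a) ∷ l) k (p ∷ ps) = ++⁺ (map⁺ p) (bindl-All l k ps)

  sum : ∀ {A : Set} → List A → (A → ℚ) → ℚ
  sum [] f = 0ℚ
  sum (a ∷ l) f = f a + sum l f

  sum-1 : ∀ {A : Set} (l : List A) → sum l (λ _ → 1ℚ) ≡ fromℕ (length l)
  sum-1 [] = refl
  sum-1 (a ∷ l) = cong (1ℚ +_) (sum-1 l)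

  E-const-weights : ∀ {A : Set} w (l : List A) f → E (map (λ a → w , a) l) f ≡ w * sum l f
  E-const-weights w [] f = sym (*-zeroʳ w)
  E-const-weights w (a ∷ l) f = trans (cong (w * f a +_) (E-const-weights w l f)) (sym (*-distribˡ-+ w (f a) (sum l f)))

  abstract
    point : ∀ {A} → A → Law A
    point a = law ((1ℚ , a) ∷ []) (0≤1 ∷ []) refl

    𝔼-point : ∀ {A} (a : A) f → 𝔼 (point a) f ≡ f a
    𝔼-point a f = p (f a)
      where
      p : ∀ x → 1ℚ * x + 0ℚ ≡ x
      p = solve-∀ ring

    Supp-point : ∀ {A} {a : A} {P} → P a → Supp (point a) P
    Supp-point p = p ∷ []

    bind : ∀ {A B} → Law A → (A → Law B) → Law B
    bind μ k = law (bindl (list μ) (λ a → list (k a))) (bindl-nonneg (list μ) _ (nonneg μ) (λ a → nonneg (k a)))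
      (trans (E-bindl (list μ) _ (λ _ → 1ℚ)) (trans (E-cong (list μ) (λ a → total (k a))) (total μ)))

    𝔼-bind : ∀ {A B} (μ : Law A) (k : A → Law B) f → 𝔼 (bind μ k) f ≡ 𝔼 μ (λ a → 𝔼 (k a) f)
    𝔼-bind μ k f = E-bindl (list μ) (λ a → list (k a)) f

    Supp-bind : ∀ {A B} (μ : Law A) (k : A → Law B) {P} → Supp μ (λ a → Supp (k a) P) → Supp (bind μ k) P
    Supp-bind μ k {P} h = map⁺ (bindl-All (list μ) (λ a → list (k a)) (All.map map⁻ (map⁻ h)))

    uniform : ∀ {A : Set} → A → List A → Law A
    uniform a l = law (map (λ a → inv (fromℕ (length (a ∷ l))) , a) (a ∷ l)) (map⁺ (All.universal (λ _ → <⇒≤ (inv-pos N>0)) (a ∷ l)))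
      (trans (E-const-weights (inv (fromℕ (length (a ∷ l)))) (a ∷ l) (λ _ → 1ℚ)) (trans (cong (inv (fromℕ (length (a ∷ l))) *_) (sum-1 (a ∷ l)))
        (trans (*-comm (inv (fromℕ (length (a ∷ l)))) (fromℕ (length (a ∷ l)))) (inv-r (>⇒≢ N>0)))))
      where
      N>0 : 0ℚ < fromℕ (length (a ∷ l))
      N>0 = fromℕ-suc>0 (length l)

    𝔼-uniform : ∀ {A : Set} (a : A) l f → 𝔼 (uniform a l) f ≡ inv (fromℕ (length (a ∷ l))) * sum (a ∷ l) f
    𝔼-uniform a l f = E-const-weights (inv (fromℕ (length (a ∷ l)))) (a ∷ l) f

    Supp-uniform : ∀ {A : Set} (a : A) l {P} → All P (a ∷ l) → Supp (uniform a l) P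
    Supp-uniform a l h = map⁺ (map⁺ h)

  _⊗_ : ∀ {A B} → Law A → Law B → Law (A × B)
  μ ⊗ ν = bind μ (λ a → bind ν (λ b → point (a , b)))

  𝔼-⊗ : ∀ {A B} (μ : Law A) (ν : Law B) f → 𝔼 (μ ⊗ ν) f ≡ 𝔼 μ (λ a → 𝔼 ν (λ b → f (a , b)))
  𝔼-⊗ μ ν f = trans (𝔼-bind μ _ f) (𝔼-cong μ (λ a → trans (𝔼-bind ν _ f) (𝔼-cong ν (λ b → 𝔼-point (a , b) f))))

  Supp-⊗ : ∀ {A B} (μ : Law A) (ν : Law B) {P} → Supp μ (λ a → Supp ν (λ b → P (a , b))) → Supp (μ ⊗ ν) P
  Supp-⊗ μ ν h = Supp-bind μ _ (All.map (λ q → Supp-bind ν _ (All.map Supp-point q)) h)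

  -- A real positive definite function on the multiplicative group: `φ (g * inv h)` is the inner
  -- product of vectors of length at most 1 attached to g and h. The argument 0 is tolerated because
  -- `inv` is total.
  record State (φ : ℚ → ℚ) : Set where
    field
      φ≥0  : ∀ g → 0ℚ ≤ φ g
      φ≤1  : ∀ g → φ g ≤ 1ℚ
      φ-inv : ∀ g → φ (inv g) ≡ φ g
      pd   : ∀ l → 0ℚ ≤ E l (λ g → E l (λ h → φ (g * inv h)))

    swap-ratio : ∀ g h → φ (g * inv h) ≡ φ (h * inv g)
    swap-ratio g h = trans (sym (φ-inv _)) (cong φ (trans (inv-* g (inv h)) (trans (cong (inv g *_) (inv-inv h)) (*-comm (inv g) h))))

  -- The polarised form of a state on differences g − h.
  Q : (φ : ℚ → ℚ) (g h g′ h′ : ℚ) → ℚ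
  Q φ g h g′ h′ = φ (g * inv g′) - φ (g * inv h′) - φ (h * inv g′) + φ (h * inv h′)

  module _ {φ} (S : State φ) where
    open State S

    Q-sym : ∀ g h g′ h′ → Q φ g h g′ h′ ≡ Q φ g′ h′ g h
    Q-sym g h g′ h′ = trans (cong₂ _+_ (cong₂ _-_ (cong₂ _-_ (swap-ratio g g′) (swap-ratio g h′)) (swap-ratio h g′)) (swap-ratio h h′))
      (p (φ (g′ * inv g)) (φ (h′ * inv g)) (φ (g′ * inv h)) (φ (h′ * inv h)))
      where
      p : ∀ a b c d → a - b - c + d ≡ a - c - b + d
      p = solve-∀ ring

    Q≤2 : ∀ g h g′ h′ → Q φ g h g′ h′ ≤ 2ℚ
    Q≤2 g h g′ h′ = ≤-by
      (+≥0 (+≥0 (diff≥0 (φ≤1 (g * inv g′))) (diff≥0 (φ≤1 (h * inv h′)))) (+≥0 (φ≥0 (g * inv h′)) (φ≥0 (h * inv g′))))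
      (p (φ (g * inv g′)) (φ (g * inv h′)) (φ (h * inv g′)) (φ (h * inv h′)))
      where
      p : ∀ a b c d → 1ℚ - a + (1ℚ - d) + (b + c) ≡ 1ℚ + 1ℚ - (a - b - c + d)
      p = solve-∀ ring

    -- Positivity of τ v − Σ wᵢ (gᵢ − hᵢ).
    pd-diff : ∀ {A} (I : List (ℚ × A)) (v τ : ℚ) (g h : A → ℚ) →
      2ℚ * (τ * E I (λ i → φ (v * inv (g i)) - φ (v * inv (h i))))
        ≤ τ * τ + E I (λ i → E I (λ j → Q φ (g i) (h i) (g j) (h j)))
    pd-diff I v τ g h = ≤-by (+≥0 (pd l) (*≥0 (square≥0 τ) (diff≥0 (φ≤1 (v * inv v))))) (trans (cong (_+ τ * τ * (1ℚ - φ (v * inv v))) main)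
         (fin τ (φ (v * inv v)) D EQ))
      where
      open ≡-Reasoning
      l₁ = map (λ p → - 1ℚ * proj₁ p , g (proj₂ p)) I
      l₂ = map (λ p → 1ℚ * proj₁ p , h (proj₂ p)) I
      l = (τ , v) ∷ l₁ ++ l₂
      D = E I (λ i → φ (v * inv (g i)) - φ (v * inv (h i)))
      EQ = E I (λ i → E I (λ j → Q φ (g i) (h i) (g j) (h j)))
      split : ∀ f → E l f ≡ τ * f v - E I (λ i → f (g i) - f (h i))
      split f = begin
        τ * f v + E (l₁ ++ l₂) f ≡⟨ cong (τ * f v +_) (E-++ l₁ l₂ f) ⟩
        τ * f v + (E l₁ f + E l₂ f) ≡⟨ cong (τ * f v +_) (cong₂ _+_ (E-reweight I (- 1ℚ) g f) (E-reweight I 1ℚ h f)) ⟩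
        τ * f v + (- 1ℚ * E I (f ∘ g) + 1ℚ * E I (f ∘ h)) ≡⟨ p (τ * f v) (E I (f ∘ g)) (E I (f ∘ h)) ⟩
        τ * f v - (E I (f ∘ g) - E I (f ∘ h)) ≡⟨ cong (λ y → τ * f v - y) (sym (E-- I (f ∘ g) (f ∘ h))) ⟩
        τ * f v - E I (λ i → f (g i) - f (h i)) ∎
        where
        p : ∀ x a b → x + (- 1ℚ * a + 1ℚ * b) ≡ x - (a - b)
        p = solve-∀ ring
      F : ℚ → ℚ
      F x = E l (λ y → φ (x * inv y))
      F-eq : ∀ x → F x ≡ τ * φ (x * inv v) - E I (λ j → φ (x * inv (g j)) - φ (x * inv (h j)))
      F-eq x = split (λ y → φ (x * inv y))
      F-diff : ∀ i → F (g i) - F (h i) ≡ τ * (φ (v * inv (g i)) - φ (v * inv (h i))) - E I (λ j → Q φ (g i) (h i) (g j) (h j))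
      F-diff i = begin
        F (g i) - F (h i) ≡⟨ cong₂ _-_ (F-eq (g i)) (F-eq (h i)) ⟩
        (τ * φ (g i * inv v) - A₁) - (τ * φ (h i * inv v) - A₂)
          ≡⟨ cong₂ (λ x y → (τ * x - A₁) - (τ * y - A₂)) (swap-ratio (g i) v) (swap-ratio (h i) v) ⟩
        (τ * φ (v * inv (g i)) - A₁) - (τ * φ (v * inv (h i)) - A₂) ≡⟨ p τ (φ (v * inv (g i))) (φ (v * inv (h i))) A₁ A₂ ⟩
        τ * (φ (v * inv (g i)) - φ (v * inv (h i))) - (A₁ - A₂)
          ≡⟨ cong (λ y → τ * (φ (v * inv (g i)) - φ (v * inv (h i))) - y) (trans (sym (E-- I _ _)) (E-cong I (λ j → q (φ (g i * inv (g j))) (φ (g i * inv (h j))) (φ (h i * inv (g j))) (φ (h i * inv (h j)))))) ⟩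
        τ * (φ (v * inv (g i)) - φ (v * inv (h i))) - E I (λ j → Q φ (g i) (h i) (g j) (h j)) ∎
        where
        A₁ = E I (λ j → φ (g i * inv (g j)) - φ (g i * inv (h j)))
        A₂ = E I (λ j → φ (h i * inv (g j)) - φ (h i * inv (h j)))
        p : ∀ τ x y a b → (τ * x - a) - (τ * y - b) ≡ τ * (x - y) - (a - b)
        p = solve-∀ ring
        q : ∀ a b c d → (a - b) - (c - d) ≡ a - b - c + d
        q = solve-∀ ring
      main : E l F ≡ τ * (τ * φ (v * inv v) - D) - (τ * D - EQ)
      main = begin
        E l F ≡⟨ split F ⟩
        τ * F v - E I (λ i → F (g i) - F (h i))
          ≡⟨ cong₂ (λ x y → τ * x - y) (F-eq v) (trans (E-cong I F-diff) (trans (E-- I _ _) (cong (_- EQ) (E-* I τ _)))) ⟩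
        τ * (τ * φ (v * inv v) - D) - (τ * D - EQ) ∎
      fin : ∀ τ x D E → τ * (τ * x - D) - (τ * D - E) + τ * τ * (1ℚ - x) ≡ τ * τ + E - (1ℚ + 1ℚ) * (τ * D)
      fin = solve-∀ ring

    cauchy-schwarz : ∀ {A} (Z : Law ℚ) (I : Law A) (v : ℚ → ℚ) (g h : ℚ → A → ℚ) {τ} → 0ℚ < τ →
      𝔼 Z (λ z → 𝔼 I (λ i → 𝔼 I (λ j → Q φ (g z i) (h z i) (g z j) (h z j)))) ≤ τ * τ →
      𝔼 Z (λ z → 𝔼 I (λ i → φ (v z * inv (g z i)) - φ (v z * inv (h z i)))) ≤ τ
    cauchy-schwarz Z I v g h {τ} τ>0 bound = *-cancel τ>0 (*-cancel {2ℚ} (+>0 0<1 0≤1) (begin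
      2ℚ * (τ * 𝔼 Z (λ z → 𝔼 I (D z))) ≡⟨ sym (trans (𝔼-* Z 2ℚ _) (cong (2ℚ *_) (𝔼-* Z τ _))) ⟩
      𝔼 Z (λ z → 2ℚ * (τ * 𝔼 I (D z))) ≤⟨ 𝔼-mono′ Z pointwise ⟩
      𝔼 Z (λ z → τ * τ + 𝔼 I (λ i → 𝔼 I (q z i))) ≡⟨ 𝔼-+ Z (λ _ → τ * τ) _ ⟩
      𝔼 Z (λ _ → τ * τ) + 𝔼 Z (λ z → 𝔼 I (λ i → 𝔼 I (q z i))) ≡⟨ cong (_+ 𝔼 Z (λ z → 𝔼 I (λ i → 𝔼 I (q z i)))) (𝔼-const Z (τ * τ)) ⟩
      τ * τ + 𝔼 Z (λ z → 𝔼 I (λ i → 𝔼 I (q z i))) ≤⟨ +-monoʳ-≤ (τ * τ) bound ⟩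
      τ * τ + τ * τ ≡⟨ p (τ * τ) ⟩
      2ℚ * (τ * τ) ∎))
      where
      open ≤-Reasoning
      D : ℚ → _ → ℚ
      D z i = φ (v z * inv (g z i)) - φ (v z * inv (h z i))
      q : ℚ → _ → _ → ℚ
      q z i j = Q φ (g z i) (h z i) (g z j) (h z j)
      pointwise : ∀ z → 2ℚ * (τ * 𝔼 I (D z)) ≤ τ * τ + 𝔼 I (λ i → 𝔼 I (q z i))
      pointwise z = subst₂ (λ x y → 2ℚ * (τ * x) ≤ τ * τ + y) (sym (𝔼-def I (D z)))
        (sym (trans (𝔼-def I _) (E-cong (toList I) (λ i → 𝔼-def I (q z i)))))
        (pd-diff (toList I) (v z) τ (g z) (h z))
      p : ∀ x → x + x ≡ (1ℚ + 1ℚ) * x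
      p = solve-∀ ring

open Averages

-- Almost invariant laws for the affine group of the line.

module AffineInvariance where
  open import Data.Rational
  open import Data.Rational.Properties

  _≈[_]_ : ℚ → ℚ → ℚ → Set
  x ≈[ τ ] y = x ≤ y + τ × y ≤ x + τ

  half : ℚ → ℚ
  half x = ½ * x

  half>0 : ∀ {x} → 0ℚ < x → 0ℚ < half x
  half>0 p = *>0 (positive⁻¹ ½) p

  half+half : ∀ x → half x + half x ≡ x
  half+half x = trans (sym (*-distribʳ-+ x ½ ½)) (*-identityˡ x)

  -- One inequality is enough: applied to `1ℚ - G` it gives the other, see `InvF-≈`.
  InvF : ℚ → (ℚ → ℚ) → Law ℚ → Set
  InvF η f Z = ∀ G → (∀ z → 0ℚ ≤ G z) → (∀ z → G z ≤ 1ℚ) → 𝔼 Z (λ z → G (f z)) ≤ 𝔼 Z G + η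

  Inv : ℚ → ℚ → ℚ → Law ℚ → Set
  Inv η α β = InvF η (λ z → α * z + β)

  InvF-mono : ∀ {η η′ f Z} → η ≤ η′ → InvF η f Z → InvF η′ f Z
  InvF-mono {Z = Z} le h G p q = ≤-trans (h G p q) (+-monoʳ-≤ (𝔼 Z G) le)

  InvF-≈ : ∀ {η f Z} → InvF η f Z → ∀ G → (∀ z → 0ℚ ≤ G z) → (∀ z → G z ≤ 1ℚ) →
    𝔼 Z G ≈[ η ] 𝔼 Z (λ z → G (f z))
  InvF-≈ {η} {f} {Z} h G p q = ≤-by (diff≥0 h′) (e (𝔼 Z G) (𝔼 Z (λ z → G (f z))) η) , h G p q
    where
    G′ : ℚ → ℚ
    G′ z = 1ℚ - G z
    𝔼′ : ∀ F → 𝔼 Z (λ z → 1ℚ - F z) ≡ 1ℚ - 𝔼 Z F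
    𝔼′ F = trans (𝔼-- Z (const 1ℚ) F) (cong (_- 𝔼 Z F) (𝔼-const Z 1ℚ))
    h′ : 1ℚ - 𝔼 Z (λ z → G (f z)) ≤ 1ℚ - 𝔼 Z G + η
    h′ = subst₂ (λ x y → x ≤ y + η) (𝔼′ (λ z → G (f z))) (𝔼′ G)
      (h G′ (λ z → diff≥0 (q z)) (λ z → ≤-by (p z) (e₁ (G z))))
      where
      e₁ : ∀ x → x ≡ 1ℚ - (1ℚ - x)
      e₁ = solve-∀ ring
    e : ∀ x y η → 1ℚ - x + η - (1ℚ - y) ≡ y + η - x
    e = solve-∀ ring

  -- Pairs with nonpositive slope impose nothing, so that lists `Γ` can be concatenated and compared
  -- without proofs of positivity attached.
  Meets : List (ℚ × ℚ) → ℚ → ℚ → Law ℚ → Set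
  Meets Γ η β Z = All (λ p → 0ℚ < proj₁ p → Inv η (proj₁ p) (proj₂ p) Z) Γ × Supp Z (β <_)

  -- P holds eventually: for all laws that are sufficiently invariant and sufficiently far to the right.
  Ev : (Law ℚ → Set) → Set
  Ev P = Σ (List (ℚ × ℚ)) λ Γ → Σ ℚ λ η → Σ ℚ λ β → 0ℚ < η × (∀ Z → Meets Γ η β Z → P Z)

  Ev-map : ∀ {P P′ : Law ℚ → Set} → (∀ Z → P Z → P′ Z) → Ev P → Ev P′
  Ev-map f (Γ , η , β , p , h) = Γ , η , β , p , λ Z m → f Z (h Z m)

  Ev-true : ∀ {P : Law ℚ → Set} → (∀ Z → P Z) → Ev P
  Ev-true f = [] , 1ℚ , 0ℚ , 0<1 , λ Z _ → f Z

  Ev-inv : ∀ {η α} β → 0ℚ < η → 0ℚ < α → Ev (Inv η α β)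
  Ev-inv {η} {α} β p q = (α , β) ∷ [] , η , 0ℚ , p , λ { Z (h ∷ [] , _) → h q }

  Ev-> : ∀ β → Ev (λ Z → Supp Z (β <_))
  Ev-> β = [] , 1ℚ , β , 0<1 , λ Z m → proj₂ m

  ⊓>0 : ∀ {x y} → 0ℚ < x → 0ℚ < y → 0ℚ < x ⊓ y
  ⊓>0 {x} {y} p q with ⊓-sel x y
  ... | inj₁ e = subst (0ℚ <_) (sym e) p
  ... | inj₂ e = subst (0ℚ <_) (sym e) q

  Meets-weaken : ∀ {Γ η β η′ β′ Z} → η ≤ η′ → β′ ≤ β → Meets Γ η β Z → Meets Γ η′ β′ Z
  Meets-weaken {Z = Z} le le′ (a , b) =
    All.map (λ {p} f q → InvF-mono {f = λ z → proj₁ p * z + proj₂ p} {Z = Z} le (f q)) a , All.map (≤-<-trans le′) b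

  Ev-∧ : ∀ {P P′} → Ev P → Ev P′ → Ev (λ Z → P Z × P′ Z)
  Ev-∧ (Γ , η , β , p , h) (Γ′ , η′ , β′ , p′ , h′) =
    Γ ++ Γ′ , η ⊓ η′ , β ⊔ β′ , ⊓>0 p p′ , λ Z m →
      h Z (Meets-weaken {Z = Z} (p⊓q≤p η η′) (p≤p⊔q β β′) (++⁻ˡ Γ (proj₁ m) , proj₂ m)) ,
      h′ Z (Meets-weaken {Z = Z} (p⊓q≤q η η′) (p≤q⊔p β β′) (++⁻ʳ Γ (proj₁ m) , proj₂ m))

  Ev-All : ∀ {A : Set} {P : A → Law ℚ → Set} {l : List A} → All (λ a → Ev (P a)) l → Ev (λ Z → All (λ a → P a Z) l)
  Ev-All [] = Ev-true (λ _ → [])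
  Ev-All (p ∷ ps) = Ev-map (λ Z → λ { (x , y) → x ∷ y }) (Ev-∧ p (Ev-All ps))

  -- Følner laws for the affine group

  sum-shift : ∀ (a : ℕ → ℚ) n → sum (downFrom n) (a ∘ ℕ.suc) ≡ sum (downFrom n) a + (a n - a 0)
  sum-shift a ℕ.zero = p (a 0)
    where
    p : ∀ x → 0ℚ ≡ 0ℚ + (x - x)
    p = solve-∀ ring
  sum-shift a (ℕ.suc n) = trans (cong (a (ℕ.suc n) +_) (sum-shift a n)) (p (a (ℕ.suc n)) (sum (downFrom n) a) (a n) (a 0))
    where
    p : ∀ x s y z → x + (s + (y - z)) ≡ y + s + (x - z)
    p = solve-∀ ring

  pow : (ℚ → ℚ) → ℕ → ℚ → ℚ
  pow f ℕ.zero z = z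
  pow f (ℕ.suc k) z = f (pow f k z)

  image : (ℚ → ℚ) → Law ℚ → Law ℚ
  image f Z = bind Z (λ z → point (f z))

  𝔼-image : ∀ f Z G → 𝔼 (image f Z) G ≡ 𝔼 Z (λ z → G (f z))
  𝔼-image f Z G = trans (𝔼-bind Z _ G) (𝔼-cong Z (λ z → 𝔼-point (f z) G))

  Supp-image : ∀ f Z {P} → Supp Z (λ z → P (f z)) → Supp (image f Z) P
  Supp-image f Z h = Supp-bind Z _ (All.map Supp-point h)

  orbit : (ℚ → ℚ) → ℕ → Law ℚ → Law ℚ
  orbit f n Z = bind (uniform n (downFrom n)) (λ k → image (pow f k) Z)

  𝔼-orbit : ∀ f n Z G → 𝔼 (orbit f n Z) G ≡ 𝔼 (uniform n (downFrom n)) (λ k → 𝔼 Z (λ z → G (pow f k z)))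
  𝔼-orbit f n Z G = trans (𝔼-bind (uniform n (downFrom n)) _ G) (𝔼-cong (uniform n (downFrom n)) (λ k → 𝔼-image (pow f k) Z G))

  -- Telescoping: applying `f` raises all exponents by one, so only the two ends of the orbit
  -- differ, and each has weight 1/(n + 1).
  orbit-inv : ∀ f n Z → InvF (inv (fromℕ (ℕ.suc n))) f (orbit f n Z)
  orbit-inv f n Z G p q = begin
    𝔼 (orbit f n Z) (λ z → G (f z)) ≡⟨ 𝔼-orbit f n Z (λ z → G (f z)) ⟩
    𝔼 U (a ∘ ℕ.suc) ≡⟨ 𝔼-uniform n (downFrom n) (a ∘ ℕ.suc) ⟩
    w * sum (downFrom (ℕ.suc n)) (a ∘ ℕ.suc) ≡⟨ cong (w *_) (sum-shift a (ℕ.suc n)) ⟩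
    w * (sum (downFrom (ℕ.suc n)) a + (a (ℕ.suc n) - a 0)) ≤⟨ *-monoˡ w≥0 (+-monoʳ-≤ (sum (downFrom (ℕ.suc n)) a) le) ⟩
    w * (sum (downFrom (ℕ.suc n)) a + 1ℚ) ≡⟨ e w (sum (downFrom (ℕ.suc n)) a) ⟩
    w * sum (downFrom (ℕ.suc n)) a + w ≡⟨ cong₂ _+_ (trans (sym (𝔼-uniform n (downFrom n) a)) (sym (𝔼-orbit f n Z G))) w-eq ⟩
    𝔼 (orbit f n Z) G + inv (fromℕ (ℕ.suc n)) ∎
    where
    open ≤-Reasoning
    U = uniform n (downFrom n)
    w = inv (fromℕ (length (n ∷ downFrom n)))
    w-eq : w ≡ inv (fromℕ (ℕ.suc n))
    w-eq = cong (λ k → inv (fromℕ (ℕ.suc k))) (length-downFrom n)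
    w≥0 : 0ℚ ≤ w
    w≥0 = <⇒≤ (inv-pos (fromℕ-suc>0 (length (downFrom n))))
    a : ℕ → ℚ
    a k = 𝔼 Z (λ z → G (pow f k z))
    le : a (ℕ.suc n) - a 0 ≤ 1ℚ
    le = ≤-by (+≥0 (diff≥0 (𝔼-≤c Z (Supp-all Z (λ z → q (pow f (ℕ.suc n) z))))) (𝔼-c≤ Z (Supp-all Z (λ z → p z))))
      (e′ (a (ℕ.suc n)) (a 0))
      where
      e′ : ∀ x y → 1ℚ - x + y ≡ 1ℚ - (x - y)
      e′ = solve-∀ ring
    e : ∀ w s → w * (s + 1ℚ) ≡ w * s + w
    e = solve-∀ ring

  pow-comm : ∀ {f g : ℚ → ℚ} → (∀ z → f (g z) ≡ g (f z)) → ∀ k z → pow f k (g z) ≡ g (pow f k z)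
  pow-comm c ℕ.zero z = refl
  pow-comm {f} c (ℕ.suc k) z = trans (cong f (pow-comm c k z)) (c (pow f k z))

  orbit-keeps : ∀ {f g η} n Z → (∀ z → f (g z) ≡ g (f z)) → InvF η g Z → InvF η g (orbit f n Z)
  orbit-keeps {f} {g} {η} n Z c h G p q = begin
    𝔼 (orbit f n Z) (λ z → G (g z)) ≡⟨ 𝔼-orbit f n Z (λ z → G (g z)) ⟩
    𝔼 U (λ k → 𝔼 Z (λ z → G (g (pow f k z)))) ≡⟨ 𝔼-cong U (λ k → 𝔼-cong Z (λ z → cong G (sym (pow-comm c k z)))) ⟩
    𝔼 U (λ k → 𝔼 Z (λ z → G (pow f k (g z)))) ≤⟨ 𝔼-mono′ U (λ k → h (G ∘ pow f k) (λ z → p _) (λ z → q _)) ⟩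
    𝔼 U (λ k → 𝔼 Z (λ z → G (pow f k z)) + η) ≡⟨ 𝔼-+c U _ η ⟩
    𝔼 U (λ k → 𝔼 Z (λ z → G (pow f k z))) + η ≡⟨ cong (_+ η) (sym (𝔼-orbit f n Z G)) ⟩
    𝔼 (orbit f n Z) G + η ∎
    where
    open ≤-Reasoning
    U = uniform n (downFrom n)

  module _ (act : ℚ → ℚ → ℚ) (act-comm : ∀ a b z → act a (act b z) ≡ act b (act a z)) where

    folner-act : ∀ {η} → 0ℚ < η → List ℚ → ℚ → Law ℚ
    folner-act p [] u = point u
    folner-act p (a ∷ as) u = orbit (act a) (proj₁ (small p)) (folner-act p as u)

    -- The maps commute, so averaging along the orbit of one more of them keeps the invariance
    -- gained for the others.
    folner-act-inv : ∀ {η} (p : 0ℚ < η) as u → All (λ a → InvF η (act a) (folner-act p as u)) as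
    folner-act-inv p [] u = []
    folner-act-inv p (a ∷ as) u =
      InvF-mono {f = act a} {Z = folner-act p (a ∷ as) u} (proj₂ (small p)) (orbit-inv (act a) (proj₁ (small p)) (folner-act p as u)) ∷
      All.map (λ {b} h → orbit-keeps {act a} {act b} (proj₁ (small p)) (folner-act p as u) (act-comm a b) h) (folner-act-inv p as u)

    folner-act-supp : ∀ {η} (p : 0ℚ < η) as u {P : ℚ → Set} → P u → All (λ a → ∀ {z} → P z → P (act a z)) as →
      Supp (folner-act p as u) P
    folner-act-supp p [] u Pu [] = Supp-point Pu
    folner-act-supp p (a ∷ as) u {P} Pu (h ∷ hs) = Supp-bind (uniform (proj₁ (small p)) (downFrom (proj₁ (small p)))) _ (Supp-all (uniform (proj₁ (small p)) (downFrom (proj₁ (small p)))) (λ k →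
      Supp-image (pow (act a) k) (folner-act p as u) (All.map (λ Pz → powP k Pz) (folner-act-supp p as u Pu hs))))
      where
      powP : ∀ k {z} → P z → P (pow (act a) k z)
      powP ℕ.zero Pz = Pz
      powP (ℕ.suc k) Pz = h (powP k Pz)

  upper-bound : (l : List ℚ) → Σ ℚ λ u → All (_≤ u) l
  upper-bound [] = 0ℚ , []
  upper-bound (x ∷ l) = x ⊔ proj₁ (upper-bound l) , p≤p⊔q x (proj₁ (upper-bound l)) ∷
    All.map (λ p → ≤-trans p (p≤q⊔p x (proj₁ (upper-bound l)))) (proj₂ (upper-bound l))

  -- A slope on which `Meets` imposes nothing is replaced by the harmless dilation 1.
  plus : ℚ → ℚ
  plus α with 0ℚ <? α
  ... | yes _ = α
  ... | no _ = 1ℚ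

  plus>0 : ∀ α → 0ℚ < plus α
  plus>0 α with 0ℚ <? α
  ... | yes p = p
  ... | no _ = 0<1

  plus-eq : ∀ {α} → 0ℚ < α → plus α ≡ α
  plus-eq {α} p with 0ℚ <? α
  ... | yes _ = refl
  ... | no q = ⊥-elim (q p)

  abstract
    *-swap : ∀ a b z → a * (b * z) ≡ b * (a * z)
    *-swap = solve-∀ ring

    +-swap : ∀ a b z → a + (b + z) ≡ b + (a + z)
    +-swap = solve-∀ ring

  translate-inv : ∀ {η} u T b → InvF η (b +_) T → InvF η (b +_) (image (u +_) T)
  translate-inv {η} u T b h G p q = subst₂ _≤_
    (trans (𝔼-cong T (λ t → cong G (+-swap u b t))) (sym (𝔼-image (u +_) T (λ z → G (b + z)))))
    (cong (_+ η) (sym (𝔼-image (u +_) T G)))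
    (h (λ z → G (u + z)) (λ z → p (u + z)) (λ z → q (u + z)))

  -- From α r t + b = α r (t + b / (α r)): the translation that the inner variable t has to absorb
  -- at scale r.
  shift : ℚ → ℚ × ℚ → ℚ
  shift r (α , b) = b * inv (plus α * r)

  scaled : Law ℚ → Law ℚ → Law ℚ
  scaled Λ T = bind Λ (λ r → image (r *_) T)

  𝔼-scaled : ∀ Λ T G → 𝔼 (scaled Λ T) G ≡ 𝔼 Λ (λ r → 𝔼 T (λ t → G (r * t)))
  𝔼-scaled Λ T G = trans (𝔼-bind Λ _ G) (𝔼-cong Λ (λ r → 𝔼-image (r *_) T G))

  -- Average over dilations outside and over translations inside: the inner average absorbs the translation part of
  -- z ↦ α z + b at the scale set by the dilation.
  scaled-inv : ∀ {η} Λ T (α b : ℚ) → 0ℚ < α → Supp Λ (0ℚ <_) → InvF (half η) (plus α *_) Λ →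
    Supp Λ (λ r → InvF (half η) (shift r (α , b) +_) T) → Inv η α b (scaled Λ T)
  scaled-inv {η} Λ T α b α>0 Λ>0 hΛ hT G p q = begin
    𝔼 (scaled Λ T) (λ z → G (α * z + b)) ≡⟨ 𝔼-scaled Λ T (λ z → G (α * z + b)) ⟩
    𝔼 Λ (λ r → 𝔼 T (λ t → G (α * (r * t) + b)))
      ≡⟨ 𝔼-cong∈ Λ (All.map (λ {r} r>0 → 𝔼-cong T (λ t → cong G (e r t r>0))) Λ>0) ⟩
    𝔼 Λ (λ r → 𝔼 T (λ t → G (α * r * (shift r (α , b) + t))))
      ≤⟨ 𝔼-mono Λ (All.map (λ {r} h → h (λ z → G (α * r * z)) (λ z → p (α * r * z)) (λ z → q (α * r * z))) hT) ⟩
    𝔼 Λ (λ r → 𝔼 T (λ t → G (α * r * t)) + half η) ≡⟨ 𝔼-+c Λ (λ r → 𝔼 T (λ t → G (α * r * t))) (half η) ⟩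
    𝔼 Λ (λ r → 𝔼 T (λ t → G (α * r * t))) + half η
      ≤⟨ +-monoˡ-≤ (half η) (subst (λ a → 𝔼 Λ (λ r → Ψ (a * r)) ≤ 𝔼 Λ Ψ + half η) (plus-eq α>0)
         (hΛ Ψ (λ r → 𝔼-c≤ T (Supp-all T (λ t → p (r * t)))) (λ r → 𝔼-≤c T (Supp-all T (λ t → q (r * t)))))) ⟩
    𝔼 Λ Ψ + half η + half η ≡⟨ cong (λ x → x + half η + half η) (sym (𝔼-scaled Λ T G)) ⟩
    𝔼 (scaled Λ T) G + half η + half η
      ≡⟨ trans (+-assoc (𝔼 (scaled Λ T) G) (half η) (half η)) (cong (𝔼 (scaled Λ T) G +_) (half+half η)) ⟩
    𝔼 (scaled Λ T) G + η ∎
    where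
    open ≤-Reasoning
    Ψ : ℚ → ℚ
    Ψ r = 𝔼 T (λ t → G (r * t))
    e : ∀ r t → 0ℚ < r → α * (r * t) + b ≡ α * r * (shift r (α , b) + t)
    e r t r>0 = sym (trans (cong (λ x → α * r * (b * inv (x * r) + t)) (plus-eq α>0))
      (trans (e₁ (α * r) b (inv (α * r)) t) (trans (cong (λ x → x * b + α * r * t) (inv-r (>⇒≢ (*>0 α>0 r>0)))) (e₂ b α r t))))
      where
      e₁ : ∀ c b i t → c * (b * i + t) ≡ c * i * b + c * t
      e₁ = solve-∀ ring
      e₂ : ∀ b α r t → 1ℚ * b + α * r * t ≡ α * (r * t) + b
      e₂ = solve-∀ ring

  scaled-lower : ∀ Λ T β u → Supp Λ (0ℚ <_) → Supp Λ (λ r → β * inv r ≤ u) → Supp T (u <_) → Supp (scaled Λ T) (β <_)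
  scaled-lower Λ T β u Λ>0 le lt = Supp-bind Λ _ (All.zipWith (λ {r} → λ { (r>0 , h) →
      Supp-image (r *_) T (All.map (λ {t} k → subst (_< r * t) (e r r>0)
        (*-monoʳ-<-pos r {{positive r>0}} (≤-<-trans h k))) lt) }) (Λ>0 , le))
    where
    e : ∀ x → 0ℚ < x → x * (β * inv x) ≡ β
    e x p = trans (e′ x β (inv x)) (trans (cong (_* β) (inv-r (>⇒≢ p))) (*-identityˡ β))
      where
      e′ : ∀ x b i → x * (b * i) ≡ x * i * b
      e′ = solve-∀ ring

  Supp-upper : ∀ {A} (μ : Law A) (f : A → ℚ) → Σ ℚ λ u → Supp μ (λ a → f a ≤ u)
  Supp-upper μ f = proj₁ (upper-bound (map f (support μ))) , map⁻ (proj₂ (upper-bound (map f (support μ))))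

  far-right : ∀ T u l → Supp T (λ t → - t ≤ l) → Supp (image (u + l + 1ℚ +_) T) (u <_)
  far-right T u l h = Supp-image (u + l + 1ℚ +_) T (All.map (λ {t} k → <-by (+>0 0<1 (diff≥0 k)) (e u l t)) h)
    where
    e : ∀ s l t → 1ℚ + (l - - t) ≡ (s + l + 1ℚ + t) - s
    e = solve-∀ ring

  translate-right : ∀ {η} bs u T → All (λ b → InvF η (b +_) T) bs → (Σ ℚ λ l → Supp T (λ t → - t ≤ l)) →
    Σ (Law ℚ) λ T → All (λ b → InvF η (b +_) T) bs × Supp T (u <_)
  translate-right bs u T h (l , k) =
    image (u + l + 1ℚ +_) T , All.map (λ {b} → translate-inv (u + l + 1ℚ) T b) h , far-right T u l k

  translations : ∀ {η} → 0ℚ < η → (bs : List ℚ) (u : ℚ) →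
    Σ (Law ℚ) λ T → All (λ b → InvF η (b +_) T) bs × Supp T (u <_)
  translations p bs u = translate-right bs u (folner-act _+_ +-swap p bs 0ℚ) (folner-act-inv _+_ +-swap p bs 0ℚ)
    (Supp-upper (folner-act _+_ +-swap p bs 0ℚ) (λ t → - t))

  dilations : ∀ {η} → 0ℚ < η → (αs : List ℚ) → All (0ℚ <_) αs →
    Σ (Law ℚ) λ Λ → All (λ a → InvF η (a *_) Λ) αs × Supp Λ (0ℚ <_)
  dilations p αs h = folner-act _*_ *-swap p αs 1ℚ , folner-act-inv _*_ *-swap p αs 1ℚ ,
    folner-act-supp _*_ *-swap p αs 1ℚ 0<1 (All.map (λ a>0 {z} z>0 → *>0 a>0 z>0) h)

  shifts : List (ℚ × ℚ) → List ℚ → List ℚ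
  shifts Γ [] = []
  shifts Γ (r ∷ l) = map (shift r) Γ ++ shifts Γ l

  shifts-All : ∀ {P : ℚ → Set} Γ l → All P (shifts Γ l) → All (λ r → All (λ γ → P (shift r γ)) Γ) l
  shifts-All Γ [] _ = []
  shifts-All Γ (r ∷ l) h = map⁻ (++⁻ˡ (map (shift r) Γ) h) ∷ shifts-All Γ l (++⁻ʳ (map (shift r) Γ) h)

  -- The dilation law is chosen first. The translation law then has to absorb only the finitely many
  -- shifts coming from its support, and to start so far right that every dilation in that support
  -- still carries it beyond β.
  folner : ∀ Γ {η} β → 0ℚ < η → Σ (Law ℚ) (Meets Γ η β)
  folner Γ {η} β η>0 = go₁ (dilations (half>0 η>0) (map (plus ∘ proj₁) Γ) (map⁺ (All.universal (plus>0 ∘ proj₁) Γ)))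
    where
    go₃ : ∀ Λ u → All (λ a → InvF (half η) (a *_) Λ) (map (plus ∘ proj₁) Γ) → Supp Λ (0ℚ <_) → Supp Λ (λ r → β * inv r ≤ u) →
      (Σ (Law ℚ) λ T → All (λ b → InvF (half η) (b +_) T) (shifts Γ (support Λ)) × Supp T (u <_)) → Σ (Law ℚ) (Meets Γ η β)
    go₃ Λ u hΛ Λ>0 hu (T , hT , lt) = scaled Λ T ,
      All.tabulate (λ {γ} m α>0 → scaled-inv Λ T (proj₁ γ) (proj₂ γ) α>0 Λ>0 (All.lookup (map⁻ hΛ) m)
        (All.map (λ h → All.lookup h m) (shifts-All Γ (support Λ) hT))) ,
      scaled-lower Λ T β u Λ>0 hu lt
    go₂ : ∀ Λ → All (λ a → InvF (half η) (a *_) Λ) (map (plus ∘ proj₁) Γ) → Supp Λ (0ℚ <_) →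
      (Σ ℚ λ u → Supp Λ (λ r → β * inv r ≤ u)) → Σ (Law ℚ) (Meets Γ η β)
    go₂ Λ hΛ Λ>0 (u , hu) = go₃ Λ u hΛ Λ>0 hu (translations (half>0 η>0) (shifts Γ (support Λ)) u)
    go₁ : (Σ (Law ℚ) λ Λ → All (λ a → InvF (half η) (a *_) Λ) (map (plus ∘ proj₁) Γ) × Supp Λ (0ℚ <_)) → Σ (Law ℚ) (Meets Γ η β)
    go₁ (Λ , hΛ , Λ>0) = go₂ Λ hΛ Λ>0 (Supp-upper Λ (λ r → β * inv r))

  Ev-law : ∀ {P} → Ev P → Σ (Law ℚ) P
  Ev-law (Γ , η , β , p , h) = proj₁ (folner Γ β p) , h (proj₁ (folner Γ β p)) (proj₂ (folner Γ β p))

open AffineInvariance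

-- Near orthogonality of linear factors and their exchange.

module Grids where
  open import Data.Rational
  open import Data.Rational.Properties

  ≈-sym : ∀ {x y τ} → x ≈[ τ ] y → y ≈[ τ ] x
  ≈-sym (p , q) = q , p

  ≈-trans : ∀ {x y z σ τ} → x ≈[ σ ] y → y ≈[ τ ] z → x ≈[ σ + τ ] z
  ≈-trans {x} {y} {z} {σ} {τ} (p , p′) (q , q′) =
    ≤-by (+≥0 (diff≥0 p) (diff≥0 q)) (e x y z σ τ) , ≤-by (+≥0 (diff≥0 p′) (diff≥0 q′)) (e′ x y z σ τ)
    where
    e : ∀ x y z σ τ → (y + σ - x) + (z + τ - y) ≡ z + (σ + τ) - x
    e = solve-∀ ring
    e′ : ∀ x y z σ τ → (x + σ - y) + (y + τ - z) ≡ x + (σ + τ) - z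
    e′ = solve-∀ ring

  ≈-respˡ : ∀ {x x′ y τ} → x ≡ x′ → x ≈[ τ ] y → x′ ≈[ τ ] y
  ≈-respˡ refl h = h

  ≈-respʳ : ∀ {x y y′ τ} → y ≡ y′ → x ≈[ τ ] y → x ≈[ τ ] y′
  ≈-respʳ refl h = h

  ≈-𝔼 : ∀ {A} (μ : Law A) {f g τ} → Supp μ (λ a → f a ≈[ τ ] g a) → 𝔼 μ f ≈[ τ ] 𝔼 μ g
  ≈-𝔼 μ {f} {g} {τ} h =
    ≤-trans (𝔼-mono μ (All.map proj₁ h)) (≤-reflexive (𝔼-+c μ g τ)) ,
    ≤-trans (𝔼-mono μ (All.map proj₂ h)) (≤-reflexive (𝔼-+c μ f τ))

  abstract
    δ : ℚ → ℚ → ℚ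
    δ x y with x ≟ y
    ... | yes _ = 1ℚ
    ... | no _ = 0ℚ

    δ-case : ∀ x y → (x ≡ y × δ x y ≡ 1ℚ) ⊎ (x ≢ y × δ x y ≡ 0ℚ)
    δ-case x y with x ≟ y
    ... | yes p = inj₁ (p , refl)
    ... | no p = inj₂ (p , refl)

  δ≥0 : ∀ x y → 0ℚ ≤ δ x y
  δ≥0 x y with δ-case x y
  ... | inj₁ (_ , e) = subst (0ℚ ≤_) (sym e) 0≤1
  ... | inj₂ (_ , e) = ≤-reflexive (sym e)

  δ≤1 : ∀ x y → δ x y ≤ 1ℚ
  δ≤1 x y with δ-case x y
  ... | inj₁ (_ , e) = ≤-reflexive e
  ... | inj₂ (_ , e) = subst (_≤ 1ℚ) (sym e) 0≤1

  δ-≢ : ∀ {x y} → x ≢ y → δ x y ≡ 0ℚ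
  δ-≢ {x} {y} n with δ-case x y
  ... | inj₁ (p , _) = ⊥-elim (n p)
  ... | inj₂ (_ , e) = e

  δ-≡ : ∀ {x y} → x ≡ y → δ x y ≡ 1ℚ
  δ-≡ {x} {y} eq = go (δ-case x y)
    where
    go : _ → δ x y ≡ 1ℚ
    go (inj₁ (_ , q)) = q
    go (inj₂ (n , _)) = ⊥-elim (n eq)

  δ-mono : ∀ x y x′ y′ → (x ≡ y → x′ ≡ y′) → δ x y ≤ δ x′ y′
  δ-mono x y x′ y′ f with δ-case x y | δ-case x′ y′
  ... | inj₁ (p , e) | inj₁ (_ , e′) = ≤-reflexive (trans e (sym e′))
  ... | inj₁ (p , e) | inj₂ (n , _) = ⊥-elim (n (f p))
  ... | inj₂ (_ , e) | _ = subst (_≤ δ x′ y′) (sym e) (δ≥0 x′ y′)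

  δ-sym : ∀ x y → δ x y ≡ δ y x
  δ-sym x y = ≤-antisym (δ-mono x y y x sym) (δ-mono y x x y sym)

  -- Bounds the probability that two independent draws collide, which is the loss in every
  -- orthogonality argument below.
  Spread : ℚ → Law ℚ → Set
  Spread ρ X = ∀ c → 𝔼 X (λ x → δ c x) ≤ ρ

  spread-image : ∀ {ρ X c} {f : ℚ → ℚ} x₀ → Spread ρ X → (∀ x → c ≡ f x → x₀ ≡ x) → 𝔼 X (λ x → δ c (f x)) ≤ ρ
  spread-image {ρ} {X} {c} {f} x₀ h inj = ≤-trans (𝔼-mono′ X (λ x → δ-mono c (f x) x₀ x (inj x))) (h x₀)

  fromℕ-mono-< : ∀ {m n} → m ℕ.≤ n → fromℕ m < fromℕ (ℕ.suc n)
  fromℕ-mono-< {ℕ.zero} {n} ℕ.z≤n = fromℕ-suc>0 n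
  fromℕ-mono-< {ℕ.suc m} (ℕ.s≤s h) = +-monoʳ-< 1ℚ (fromℕ-mono-< h)

  below : ∀ n → All (λ k → fromℕ k < fromℕ n) (downFrom n)
  below ℕ.zero = []
  below (ℕ.suc n) = <ⁿ ∷ All.map (λ p → <-trans p <ⁿ) (below n)
    where
    <ⁿ : fromℕ n < 1ℚ + fromℕ n
    <ⁿ = <-by 0<1 (e (fromℕ n))
      where
      e : ∀ x → 1ℚ ≡ 1ℚ + x - x
      e = solve-∀ ring

  sum-zero : ∀ {A : Set} {l : List A} {f} → All (λ a → f a ≡ 0ℚ) l → sum l f ≡ 0ℚ
  sum-zero [] = refl
  sum-zero (p ∷ ps) = cong₂ _+_ p (sum-zero ps)

  sum-δ : ∀ c n → sum (downFrom n) (λ k → δ c (fromℕ k)) ≤ 1ℚ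
  sum-δ c ℕ.zero = 0≤1
  sum-δ c (ℕ.suc n) = go (δ-case c (fromℕ n))
    where
    s = sum (downFrom n) (λ k → δ c (fromℕ k))
    go : (c ≡ fromℕ n × δ c (fromℕ n) ≡ 1ℚ) ⊎ (c ≢ fromℕ n × δ c (fromℕ n) ≡ 0ℚ) → δ c (fromℕ n) + s ≤ 1ℚ
    go (inj₁ (p , e)) = ≤-reflexive (trans (cong₂ _+_ e (sum-zero {l = downFrom n} (All.map (λ {k} q → δ-≢ (λ r → <-irrefl (trans (sym r) p) q)) (below n)))) (+-identityʳ 1ℚ))
    go (inj₂ (_ , e)) = subst (_≤ 1ℚ) (sym (trans (cong (_+ s) e) (+-identityˡ s))) (sum-δ c n)

  record Grid (ρ : ℚ) : Set where
    field
      grid   : Law ℚ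
      spread : Spread ρ grid
      bound  : ℚ
      inside : Supp grid (λ x → 0ℚ ≤ x × x < bound)

  mkGrid : ∀ {ρ} → 0ℚ < ρ → Grid ρ
  mkGrid {ρ} ρ>0 = record { grid = image′ ; spread = sp ; bound = fromℕ (ℕ.suc n) ; inside = ins }
    where
    n = proj₁ (small ρ>0)
    U : Law ℕ
    U = uniform n (downFrom n)
    image′ : Law ℚ
    image′ = bind U (λ k → point (fromℕ k))
    sp : Spread ρ image′
    sp c = begin
      𝔼 image′ (δ c) ≡⟨ trans (𝔼-bind U _ (δ c)) (𝔼-cong U (λ k → 𝔼-point (fromℕ k) (δ c))) ⟩
      𝔼 U (λ k → δ c (fromℕ k)) ≡⟨ 𝔼-uniform n (downFrom n) (λ k → δ c (fromℕ k)) ⟩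
      w * sum (downFrom (ℕ.suc n)) (λ k → δ c (fromℕ k)) ≤⟨ *-monoˡ (<⇒≤ (inv-pos (fromℕ-suc>0 (length (downFrom n))))) (sum-δ c (ℕ.suc n)) ⟩
      w * 1ℚ ≡⟨ *-identityʳ w ⟩
      w ≡⟨ cong (λ k → inv (fromℕ (ℕ.suc k))) (length-downFrom n) ⟩
      inv (fromℕ (ℕ.suc n)) ≤⟨ proj₂ (small ρ>0) ⟩
      ρ ∎
      where
      open ≤-Reasoning
      w = inv (fromℕ (length (n ∷ downFrom n)))
    ins : Supp image′ (λ x → 0ℚ ≤ x × x < fromℕ (ℕ.suc n))
    ins = Supp-bind U _ (Supp-uniform n (downFrom n) (All.map (λ {k} p → Supp-point (fromℕ≥0 k , p)) (below (ℕ.suc n))))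

  -- The limiting value may depend on the multipliers but not on the positions, provided these
  -- differ. In `Q` the four values then cancel, so differences of linear factors with equal
  -- multiplier are almost orthogonal.
  Near : (ℚ → ℚ) → Law ℚ → (ℚ → ℚ) → ℚ → (k s k′ s′ : ℚ) → Set
  Near φ Z K τ k s k′ s′ = s ≢ s′ → 𝔼 Z (λ z → φ (k * (z + s) * inv (k′ * (z + s′)))) ≈[ τ ] K (k * inv k′)

  module _ {φ} (S : State φ) (Z : Law ℚ) where
    open State S

    Near-swap : ∀ {K τ k s k′ s′} → K (k * inv k′) ≡ K (k′ * inv k) → Near φ Z K τ k s k′ s′ → Near φ Z K τ k′ s′ k s
    Near-swap {K} {τ} {k} {s} {k′} {s′} e h n = ≈-respʳ e (≈-respˡ (𝔼-cong Z (λ z → swap-ratio (k * (z + s)) (k′ * (z + s′)))) (h (n ∘ sym)))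

    -- Index pairs without coinciding positions contribute at most 4ε to the mean of `Q`. A
    -- coincidence costs at most 2 by `Q≤2`, and the expected number of coincidences is at most 4ε.
    -- The total 4ε + 2 · 4ε explains the constant 12.
    replace-≤ : ∀ {A} (I : Law A) (k p q : A → ℚ) (K : ℚ → ℚ) {ε τ} → 0ℚ < τ → 0ℚ ≤ ε → fromℕ 12 * ε ≤ τ * τ →
      Supp I (λ i → Supp I (λ j → (Near φ Z K ε (k i) (p i) (k j) (p j) × Near φ Z K ε (k i) (p i) (k j) (q j)) ×
                                  (Near φ Z K ε (k i) (q i) (k j) (p j) × Near φ Z K ε (k i) (q i) (k j) (q j)))) →
      𝔼 I (λ i → 𝔼 I (λ j → δ (p i) (p j))) ≤ ε → 𝔼 I (λ i → 𝔼 I (λ j → δ (p i) (q j))) ≤ ε →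
      𝔼 I (λ i → 𝔼 I (λ j → δ (q i) (p j))) ≤ ε → 𝔼 I (λ i → 𝔼 I (λ j → δ (q i) (q j))) ≤ ε →
      (v : ℚ → ℚ) →
      𝔼 Z (λ z → 𝔼 I (λ i → φ (v z * inv (k i * (z + p i))))) ≤ 𝔼 Z (λ z → 𝔼 I (λ i → φ (v z * inv (k i * (z + q i))))) + τ
    replace-≤ I k p q K {ε} {τ} τ>0 ε≥0 le near c₁ c₂ c₃ c₄ v = ≤-by (diff≥0 cs) (fin (𝔼 Z (λ z → 𝔼 I (λ i → φ (v z * inv (g z i))))) (𝔼 Z (λ z → 𝔼 I (λ i → φ (v z * inv (h z i))))) τ)
      where
      g h : ℚ → _ → ℚ
      g z i = k i * (z + p i)
      h z i = k i * (z + q i)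
      m : (a b : ℚ → _ → ℚ) → _ → _ → ℚ
      m a b i j = 𝔼 Z (λ z → φ (a z i * inv (b z j)))
      c : _ → _ → ℚ
      c i j = δ (p i) (p j) + δ (p i) (q j) + δ (q i) (p j) + δ (q i) (q j)
      q̄ : ∀ i j → 𝔼 Z (λ z → Q φ (g z i) (h z i) (g z j) (h z j)) ≡ m g g i j - m g h i j - m h g i j + m h h i j
      q̄ i j = trans (𝔼-+ Z _ _) (cong (_+ m h h i j) (trans (𝔼-- Z _ _) (cong (_- m h g i j) (𝔼-- Z _ _))))
      far : ∀ {κ a b c d} → a ≈[ ε ] κ → b ≈[ ε ] κ → c ≈[ ε ] κ → d ≈[ ε ] κ → a - b - c + d ≤ fromℕ 4 * ε
      far {κ} {a} {b} {c} {d} A B C D = ≤-by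
        (+≥0 (+≥0 (diff≥0 (proj₁ A)) (diff≥0 (proj₂ B))) (+≥0 (diff≥0 (proj₂ C)) (diff≥0 (proj₁ D)))) (e κ a b c d ε)
        where
        e : ∀ κ a b c d ε → κ + ε - a + (b + ε - κ) + (c + ε - κ + (κ + ε - d)) ≡ (1ℚ + (1ℚ + (1ℚ + (1ℚ + 0ℚ)))) * ε - (a - b - c + d)
        e = solve-∀ ring
      δ+ : ∀ {w x y z} → 1ℚ ≤ w + x + y + z → 2ℚ ≤ fromℕ 4 * ε + 2ℚ * (w + x + y + z)
      δ+ {w} {x} {y} {z} o = ≤-by (+≥0 (*≥0 (fromℕ≥0 4) ε≥0) (*≥0 (<⇒≤ (+>0 0<1 0≤1)) (diff≥0 o))) (e (fromℕ 4 * ε) (w + x + y + z))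
        where
        e : ∀ a b → a + (1ℚ + 1ℚ) * (b - 1ℚ) ≡ a + (1ℚ + 1ℚ) * b - (1ℚ + 1ℚ)
        e = solve-∀ ring
      one : ∀ {w x y z} → 0ℚ ≤ w → 0ℚ ≤ x → 0ℚ ≤ y → 0ℚ ≤ z → (w ≡ 1ℚ) ⊎ (x ≡ 1ℚ) ⊎ (y ≡ 1ℚ) ⊎ (z ≡ 1ℚ) → 1ℚ ≤ w + x + y + z
      one {w} {x} {y} {z} W X Y Z′ (inj₁ refl) = ≤-by (+≥0 X (+≥0 Y Z′)) (e x y z)
        where
        e : ∀ x y z → x + (y + z) ≡ 1ℚ + x + y + z - 1ℚ
        e = solve-∀ ring
      one {w} {x} {y} {z} W X Y Z′ (inj₂ (inj₁ refl)) = ≤-by (+≥0 W (+≥0 Y Z′)) (e w y z)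
        where
        e : ∀ x y z → x + (y + z) ≡ x + 1ℚ + y + z - 1ℚ
        e = solve-∀ ring
      one {w} {x} {y} {z} W X Y Z′ (inj₂ (inj₂ (inj₁ refl))) = ≤-by (+≥0 W (+≥0 X Z′)) (e w x z)
        where
        e : ∀ x y z → x + (y + z) ≡ x + y + 1ℚ + z - 1ℚ
        e = solve-∀ ring
      one {w} {x} {y} {z} W X Y Z′ (inj₂ (inj₂ (inj₂ refl))) = ≤-by (+≥0 W (+≥0 X Y)) (e w x y)
        where
        e : ∀ x y z → x + (y + z) ≡ x + y + z + 1ℚ - 1ℚ
        e = solve-∀ ring
      c≥0 : ∀ i j → 0ℚ ≤ c i j
      c≥0 i j = +≥0 (+≥0 (+≥0 (δ≥0 _ _) (δ≥0 _ _)) (δ≥0 _ _)) (δ≥0 _ _)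
      Qij : _ → _ → ℚ
      Qij i j = 𝔼 Z (λ z → Q φ (g z i) (h z i) (g z j) (h z j))
      hit : ∀ i j → (δ (p i) (p j) ≡ 1ℚ) ⊎ (δ (p i) (q j) ≡ 1ℚ) ⊎ (δ (q i) (p j) ≡ 1ℚ) ⊎ (δ (q i) (q j) ≡ 1ℚ) → Qij i j ≤ fromℕ 4 * ε + 2ℚ * c i j
      hit i j o = ≤-trans (𝔼-≤c Z (Supp-all Z (λ z → Q≤2 S (g z i) (h z i) (g z j) (h z j))))
        (δ+ {δ (p i) (p j)} {δ (p i) (q j)} {δ (q i) (p j)} {δ (q i) (q j)} (one (δ≥0 _ _) (δ≥0 _ _) (δ≥0 _ _) (δ≥0 _ _) o))
      pair : ∀ i j → (Near φ Z K ε (k i) (p i) (k j) (p j) × Near φ Z K ε (k i) (p i) (k j) (q j)) ×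
                     (Near φ Z K ε (k i) (q i) (k j) (p j) × Near φ Z K ε (k i) (q i) (k j) (q j)) →
             Qij i j ≤ fromℕ 4 * ε + 2ℚ * c i j
      pair i j ((n₁ , n₂) , (n₃ , n₄)) = go (δ-case (p i) (p j)) (δ-case (p i) (q j)) (δ-case (q i) (p j)) (δ-case (q i) (q j))
        where
        go : _ → _ → _ → _ → Qij i j ≤ fromℕ 4 * ε + 2ℚ * c i j
        go (inj₁ (_ , e)) _ _ _ = hit i j (inj₁ e)
        go (inj₂ _) (inj₁ (_ , e)) _ _ = hit i j (inj₂ (inj₁ e))
        go (inj₂ _) (inj₂ _) (inj₁ (_ , e)) _ = hit i j (inj₂ (inj₂ (inj₁ e)))
        go (inj₂ _) (inj₂ _) (inj₂ _) (inj₁ (_ , e)) = hit i j (inj₂ (inj₂ (inj₂ e)))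
        go (inj₂ (a₁ , _)) (inj₂ (a₂ , _)) (inj₂ (a₃ , _)) (inj₂ (a₄ , _)) =
          ≤-trans (≤-reflexive (q̄ i j)) (≤-trans (far (n₁ a₁) (n₂ a₂) (n₃ a₃) (n₄ a₄))
            (≤-by (*≥0 (<⇒≤ (+>0 0<1 0≤1)) (c≥0 i j)) (e (fromℕ 4 * ε) (2ℚ * c i j))))
          where
          e : ∀ x y → y ≡ x + y - x
          e = solve-∀ ring
      total-c : 𝔼 I (λ i → 𝔼 I (λ j → c i j)) ≤ fromℕ 4 * ε
      total-c = ≤-trans (≤-reflexive (trans (𝔼-cong I (λ i → trans (𝔼-+ I _ _) (cong (_+ 𝔼 I (λ j → δ (q i) (q j))) (trans (𝔼-+ I _ _) (cong (_+ 𝔼 I (λ j → δ (q i) (p j))) (𝔼-+ I _ _))))))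
          (trans (𝔼-+ I _ _) (cong (_+ 𝔼 I (λ i → 𝔼 I (λ j → δ (q i) (q j)))) (trans (𝔼-+ I _ _) (cong (_+ 𝔼 I (λ i → 𝔼 I (λ j → δ (q i) (p j)))) (𝔼-+ I _ _)))))))
        (≤-trans (+-mono-≤ (+-mono-≤ (+-mono-≤ c₁ c₂) c₃) c₄) (≤-reflexive (e ε)))
        where
        e : ∀ ε → ε + ε + ε + ε ≡ (1ℚ + (1ℚ + (1ℚ + (1ℚ + 0ℚ)))) * ε
        e = solve-∀ ring
      bound : 𝔼 Z (λ z → 𝔼 I (λ i → 𝔼 I (λ j → Q φ (g z i) (h z i) (g z j) (h z j)))) ≤ τ * τ
      bound = begin
        𝔼 Z (λ z → 𝔼 I (λ i → 𝔼 I (λ j → Q φ (g z i) (h z i) (g z j) (h z j))))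
          ≡⟨ trans (𝔼-swap Z I _) (𝔼-cong I (λ i → 𝔼-swap Z I _)) ⟩
        𝔼 I (λ i → 𝔼 I (λ j → Qij i j)) ≤⟨ 𝔼-mono I (All.map (λ {i} s → 𝔼-mono I (All.map (λ {j} → pair i j) s)) near) ⟩
        𝔼 I (λ i → 𝔼 I (λ j → fromℕ 4 * ε + 2ℚ * c i j))
          ≡⟨ trans (𝔼-cong I (λ i → affine (c i))) (affine (λ i → 𝔼 I (c i))) ⟩
        fromℕ 4 * ε + 2ℚ * 𝔼 I (λ i → 𝔼 I (λ j → c i j)) ≤⟨ +-monoʳ-≤ (fromℕ 4 * ε) (*-monoˡ (<⇒≤ (+>0 0<1 0≤1)) total-c) ⟩
        fromℕ 4 * ε + 2ℚ * (fromℕ 4 * ε) ≡⟨ e ε ⟩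
        fromℕ 12 * ε ≤⟨ le ⟩
        τ * τ ∎
        where
        open ≤-Reasoning
        affine : ∀ f → 𝔼 I (λ i → fromℕ 4 * ε + 2ℚ * f i) ≡ fromℕ 4 * ε + 2ℚ * 𝔼 I f
        affine f = trans (𝔼-+ I (λ _ → fromℕ 4 * ε) (λ i → 2ℚ * f i)) (cong₂ _+_ (𝔼-const I (fromℕ 4 * ε)) (𝔼-* I 2ℚ f))
        e : ∀ ε → fromℕ 4 * ε + 2ℚ * (fromℕ 4 * ε) ≡ fromℕ 12 * ε
        e ε = e₁ (fromℕ 4) 2ℚ ε
          where
          e₁ : ∀ a b ε → a * ε + b * (a * ε) ≡ (a + b * a) * ε
          e₁ = solve-∀ ring
      cs : 𝔼 Z (λ z → 𝔼 I (λ i → φ (v z * inv (g z i)))) - 𝔼 Z (λ z → 𝔼 I (λ i → φ (v z * inv (h z i)))) ≤ τ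
      cs = subst (_≤ τ) (trans (𝔼-cong Z (λ z → 𝔼-- I _ _)) (𝔼-- Z _ _)) (cauchy-schwarz S Z I v g h τ>0 bound)
      fin : ∀ a b τ → τ - (a - b) ≡ b + τ - a
      fin = solve-∀ ring

    replace : ∀ {A} (I : Law A) (k p q : A → ℚ) (K : ℚ → ℚ) {ε τ} → 0ℚ < τ → 0ℚ ≤ ε → fromℕ 12 * ε ≤ τ * τ →
      Supp I (λ i → Supp I (λ j → (Near φ Z K ε (k i) (p i) (k j) (p j) × Near φ Z K ε (k i) (p i) (k j) (q j)) ×
                                  (Near φ Z K ε (k i) (q i) (k j) (p j) × Near φ Z K ε (k i) (q i) (k j) (q j)))) →
      𝔼 I (λ i → 𝔼 I (λ j → δ (p i) (p j))) ≤ ε →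
      𝔼 I (λ i → 𝔼 I (λ j → δ (q i) (p j))) ≤ ε → 𝔼 I (λ i → 𝔼 I (λ j → δ (q i) (q j))) ≤ ε →
      (v : ℚ → ℚ) →
      𝔼 Z (λ z → 𝔼 I (λ i → φ (v z * inv (k i * (z + p i))))) ≈[ τ ] 𝔼 Z (λ z → 𝔼 I (λ i → φ (v z * inv (k i * (z + q i)))))
    replace I k p q K {ε} τ>0 ε≥0 le near c₁ c₃ c₄ v =
      replace-≤ I k p q K τ>0 ε≥0 le near c₁ c₂ c₃ c₄ v ,
      replace-≤ I k q p K τ>0 ε≥0 le (All.map (All.map λ { ((a , b) , (c , d)) → (d , c) , (b , a) }) near) c₄ c₃ c₂ c₁ v
      where
      c₂ : 𝔼 I (λ i → 𝔼 I (λ j → δ (p i) (q j))) ≤ ε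
      c₂ = subst (_≤ ε) (trans (𝔼-swap I I (λ i j → δ (q i) (p j))) (𝔼-cong I (λ i → 𝔼-cong I (λ j → δ-sym (q j) (p i))))) c₃

open Grids

-- Correlations of two linear factors.

module LinearFactors where
  open import Data.Rational
  open import Data.Rational.Properties

  -- An increasing affine change of z moves any two positions to 0 and 1; `κ` and `κ′` record the
  -- two orders in which they can occur.
  κ : (ℚ → ℚ) → Law ℚ → ℚ → ℚ
  κ φ Z k = 𝔼 Z (λ z → φ (k * (z * inv (z + 1ℚ))))

  κ′ : (ℚ → ℚ) → Law ℚ → ℚ → ℚ
  κ′ φ Z k = 𝔼 Z (λ z → φ (k * ((z + 1ℚ) * inv z)))

  cancel-scale : ∀ {c} → c ≢ 0ℚ → ∀ k x k′ y → k * (c * x) * inv (k′ * (c * y)) ≡ k * inv k′ * (x * inv y)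
  cancel-scale {c} c≢0 k x k′ y = begin
    k * (c * x) * inv (k′ * (c * y))            ≡⟨ cong (k * (c * x) *_) (trans (inv-* k′ (c * y)) (cong (inv k′ *_) (inv-* c y))) ⟩
    k * (c * x) * (inv k′ * (inv c * inv y))    ≡⟨ e k c x (inv k′) (inv c) (inv y) ⟩
    c * inv c * (k * inv k′ * (x * inv y))      ≡⟨ cong (_* (k * inv k′ * (x * inv y))) (inv-r c≢0) ⟩
    1ℚ * (k * inv k′ * (x * inv y))             ≡⟨ *-identityˡ _ ⟩
    k * inv k′ * (x * inv y) ∎
    where
    open ≡-Reasoning
    e : ∀ k c x i j l → k * (c * x) * (i * (j * l)) ≡ c * j * (k * i * (x * l))
    e = solve-∀ ring

  near-< : ∀ {τ s s′} → 0ℚ < τ → s < s′ → Ev (λ Z → ∀ φ → State φ → ∀ k k′ →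
    𝔼 Z (λ z → φ (k * (z + s) * inv (k′ * (z + s′)))) ≈[ τ ] κ φ Z (k * inv k′))
  near-< {τ} {s} {s′} τ>0 lt = Ev-map go (Ev-inv (- s) τ>0 α>0)
    where
    α = s′ - s
    α>0 : 0ℚ < α
    α>0 = diff>0 lt
    e₁ : ∀ s s′ z → (s′ - s) * z + - s + s ≡ (s′ - s) * z
    e₁ = solve-∀ ring
    e₂ : ∀ s s′ z → (s′ - s) * z + - s + s′ ≡ (s′ - s) * (z + 1ℚ)
    e₂ = solve-∀ ring
    go : ∀ Z → Inv τ α (- s) Z → ∀ φ → State φ → ∀ k k′ →
      𝔼 Z (λ z → φ (k * (z + s) * inv (k′ * (z + s′)))) ≈[ τ ] κ φ Z (k * inv k′)
    go Z h φ S k k′ = ≈-respʳ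
      (𝔼-cong Z (λ z → cong φ (trans (cong₂ (λ x y → k * x * inv (k′ * y)) (e₁ s s′ z) (e₂ s s′ z)) (cancel-scale (>⇒≢ α>0) k z k′ (z + 1ℚ)))))
      (InvF-≈ {f = λ z → α * z + - s} {Z = Z} h (λ z → φ (k * (z + s) * inv (k′ * (z + s′)))) (λ z → State.φ≥0 S _) (λ z → State.φ≤1 S _))

  near-> : ∀ {τ s s′} → 0ℚ < τ → s′ < s → Ev (λ Z → ∀ φ → State φ → ∀ k k′ →
    𝔼 Z (λ z → φ (k * (z + s) * inv (k′ * (z + s′)))) ≈[ τ ] κ′ φ Z (k * inv k′))
  near-> {τ} {s} {s′} τ>0 lt = Ev-map go (Ev-inv (- s′) τ>0 α>0)
    where
    α = s - s′
    α>0 : 0ℚ < α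
    α>0 = diff>0 lt
    e₁ : ∀ s s′ z → (s - s′) * z + - s′ + s′ ≡ (s - s′) * z
    e₁ = solve-∀ ring
    e₂ : ∀ s s′ z → (s - s′) * z + - s′ + s ≡ (s - s′) * (z + 1ℚ)
    e₂ = solve-∀ ring
    go : ∀ Z → Inv τ α (- s′) Z → ∀ φ → State φ → ∀ k k′ →
      𝔼 Z (λ z → φ (k * (z + s) * inv (k′ * (z + s′)))) ≈[ τ ] κ′ φ Z (k * inv k′)
    go Z h φ S k k′ = ≈-respʳ
      (𝔼-cong Z (λ z → cong φ (trans (cong₂ (λ x y → k * x * inv (k′ * y)) (e₂ s s′ z) (e₁ s s′ z)) (cancel-scale (>⇒≢ α>0) k (z + 1ℚ) k′ z))))
      (InvF-≈ {f = λ z → α * z + - s′} {Z = Z} h (λ z → φ (k * (z + s) * inv (k′ * (z + s′)))) (λ z → State.φ≥0 S _) (λ z → State.φ≤1 S _))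

  Ev-∀∈ : ∀ {A : Set} {P : A → Law ℚ → Set} (l : List A) → (∀ a → Ev (P a)) → Ev (λ Z → All (λ a → P a Z) l)
  Ev-∀∈ l f = Ev-All (All.universal f l)

  -- Without multipliers the two orders agree, because φ(g⁻¹) = φ(g).
  near-1 : ∀ {τ} s s′ → 0ℚ < τ → Ev (λ Z → ∀ φ → State φ → Near φ Z (κ φ Z) τ 1ℚ s 1ℚ s′)
  near-1 {τ} s s′ τ>0 with <-cmp s s′
  ... | tri< lt _ _ = Ev-map (λ Z h φ S _ → h φ S 1ℚ 1ℚ) (near-< τ>0 lt)
  ... | tri≈ _ eq _ = Ev-true (λ Z φ S n → ⊥-elim (n eq))
  ... | tri> _ _ gt = Ev-map (λ Z h φ S → Near-swap S Z {κ φ Z} {τ} {1ℚ} {s′} {1ℚ} {s} refl (λ _ → h φ S 1ℚ 1ℚ)) (near-< τ>0 gt)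

  module _ {τ} (τ>0 : 0ℚ < τ) where
    private
      ε : ℚ
      ε = inv (fromℕ 12) * (τ * τ)
      ε>0 : 0ℚ < ε
      ε>0 = *>0 (inv-pos (fromℕ-suc>0 11)) (*>0 τ>0 τ>0)

    twelve : fromℕ 12 * ε ≤ τ * τ
    twelve = ≤-reflexive (trans (sym (*-assoc (fromℕ 12) (inv (fromℕ 12)) (τ * τ))) (trans (cong (_* (τ * τ)) (inv-r (>⇒≢ (fromℕ-suc>0 11)))) (*-identityˡ (τ * τ))))

    -- The factor z + m correlates with a grid on its left through `κ′` and with a copy of the grid
    -- on its right through `κ`. Without multipliers both orders are already known to agree, so
    -- `replace` may carry the grid across m while the multiplier k stays on the side of z + m.
    -- Hence the two values agree for every k.
    κ≈κ′ : Ev (λ Z → ∀ φ → State φ → ∀ k → κ′ φ Z k ≈[ τ + τ + τ ] κ φ Z k)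
    κ≈κ′ = Ev-map conclude (Ev-∧ nears (Ev-∧ lefts rights))
      where
      open Grid (mkGrid ε>0)
      I = grid
      m = bound
      q : ℚ → ℚ
      q i = m + 1ℚ + i
      nears : Ev (λ Z → Supp I (λ i → Supp I (λ j → ∀ φ → State φ →
        (Near φ Z (κ φ Z) ε 1ℚ i 1ℚ j × Near φ Z (κ φ Z) ε 1ℚ i 1ℚ (q j)) ×
        (Near φ Z (κ φ Z) ε 1ℚ (q i) 1ℚ j × Near φ Z (κ φ Z) ε 1ℚ (q i) 1ℚ (q j)))))
      nears = Ev-∀∈ (support I) (λ i → Ev-∀∈ (support I) (λ j →
        Ev-map (λ Z → λ { ((a , b) , (c , d)) φ S → (a φ S , b φ S) , (c φ S , d φ S) })
          (Ev-∧ (Ev-∧ (near-1 i j ε>0) (near-1 i (q j) ε>0)) (Ev-∧ (near-1 (q i) j ε>0) (near-1 (q i) (q j) ε>0)))))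
      m<q : ∀ {j} → 0ℚ ≤ j → m < q j
      m<q {j} le = <-by (+>0 0<1 le) (e m j)
        where
        e : ∀ m j → 1ℚ + j ≡ m + 1ℚ + j - m
        e = solve-∀ ring
      c₁ : 𝔼 I (λ i → 𝔼 I (λ j → δ i j)) ≤ ε
      c₁ = 𝔼-≤c I (Supp-all I spread)
      c₃ : 𝔼 I (λ i → 𝔼 I (λ j → δ (q i) j)) ≤ ε
      c₃ = 𝔼-≤c I (Supp-all I (λ i → spread (q i)))
      c₄ : 𝔼 I (λ i → 𝔼 I (λ j → δ (q i) (q j))) ≤ ε
      c₄ = 𝔼-≤c I (Supp-all I (λ i → spread-image {f = q} i spread (λ j eq → +-cancel eq)))
        where
        +-cancel : ∀ {i j} → q i ≡ q j → i ≡ j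
        +-cancel {i} {j} eq = trans (e m i) (trans (cong (λ x → x - (m + 1ℚ)) eq) (sym (e m j)))
          where
          e : ∀ m i → i ≡ m + 1ℚ + i - (m + 1ℚ)
          e = solve-∀ ring
      lefts : Ev (λ Z → Supp I (λ i → ∀ φ → State φ → ∀ k k′ →
        𝔼 Z (λ z → φ (k * (z + m) * inv (k′ * (z + i)))) ≈[ τ ] κ′ φ Z (k * inv k′)))
      lefts = Ev-All (All.map (λ h → near-> τ>0 (proj₂ h)) inside)
      rights : Ev (λ Z → Supp I (λ i → ∀ φ → State φ → ∀ k k′ →
        𝔼 Z (λ z → φ (k * (z + m) * inv (k′ * (z + q i)))) ≈[ τ ] κ φ Z (k * inv k′)))
      rights = Ev-All (All.map (λ h → near-< τ>0 (m<q (proj₁ h))) inside)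
      k/1 : ∀ k → k * inv 1ℚ ≡ k
      k/1 k = trans (cong (k *_) inv-1) (*-identityʳ k)
      conclude : ∀ Z → _ → ∀ φ → State φ → ∀ k → κ′ φ Z k ≈[ τ + τ + τ ] κ φ Z k
      conclude Z (near , left , right) φ S k = ≈-trans (≈-trans (≈-sym L) M) R
        where
        v : ℚ → ℚ
        v z = k * (z + m)
        M : 𝔼 Z (λ z → 𝔼 I (λ i → φ (v z * inv (1ℚ * (z + i))))) ≈[ τ ] 𝔼 Z (λ z → 𝔼 I (λ i → φ (v z * inv (1ℚ * (z + q i)))))
        M = replace S Z I (const 1ℚ) id q (κ φ Z) τ>0 (<⇒≤ ε>0) twelve (All.map (All.map (λ f → f φ S)) near) c₁ c₃ c₄ v
        L : 𝔼 Z (λ z → 𝔼 I (λ i → φ (v z * inv (1ℚ * (z + i))))) ≈[ τ ] κ′ φ Z k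
        L = ≈-respˡ (sym (𝔼-swap Z I _)) (≈-respʳ (𝔼-const I (κ′ φ Z k))
          (≈-𝔼 I (All.map (λ h → ≈-respʳ (cong (κ′ φ Z) (k/1 k)) (h φ S k 1ℚ)) left)))
        R : 𝔼 Z (λ z → 𝔼 I (λ i → φ (v z * inv (1ℚ * (z + q i))))) ≈[ τ ] κ φ Z k
        R = ≈-respˡ (sym (𝔼-swap Z I _)) (≈-respʳ (𝔼-const I (κ φ Z k))
          (≈-𝔼 I (All.map (λ h → ≈-respʳ (cong (κ φ Z) (k/1 k)) (h φ S k 1ℚ)) right)))

  ≈-mono : ∀ {x y σ τ} → σ ≤ τ → x ≈[ σ ] y → x ≈[ τ ] y
  ≈-mono {x} {y} le (p , q) = ≤-trans p (+-monoʳ-≤ y le) , ≤-trans q (+-monoʳ-≤ x le)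

  near : ∀ {τ} s s′ → 0ℚ < τ → Ev (λ Z → ∀ φ → State φ → ∀ k k′ → Near φ Z (κ φ Z) τ k s k′ s′)
  near {τ} s s′ τ>0 = go (<-cmp s s′)
    where
    -- One σ pays for the affine change and three for `κ≈κ′`.
    σ = half (half τ)
    σ>0 : 0ℚ < σ
    σ>0 = half>0 (half>0 τ>0)
    4σ : σ + (σ + σ + σ) ≡ τ
    4σ = trans (e σ) (trans (cong₂ _+_ (half+half (half τ)) (half+half (half τ))) (half+half τ))
      where
      e : ∀ σ → σ + (σ + σ + σ) ≡ σ + σ + (σ + σ)
      e = solve-∀ ring
    σ≤τ : σ ≤ τ
    σ≤τ = ≤-by (+≥0 (+≥0 (<⇒≤ σ>0) (<⇒≤ σ>0)) (<⇒≤ σ>0)) (trans (e σ) (cong (_- σ) 4σ))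
      where
      e : ∀ σ → σ + σ + σ ≡ σ + (σ + σ + σ) - σ
      e = solve-∀ ring
    go : _ → _
    go (tri< lt _ _) = Ev-map (λ Z h φ S k k′ _ → ≈-mono σ≤τ (h φ S k k′)) (near-< σ>0 lt)
    go (tri≈ _ eq _) = Ev-true (λ Z φ S k k′ n → ⊥-elim (n eq))
    go (tri> _ _ gt) = Ev-map (λ Z → λ { (h , h′) φ S k k′ _ →
        subst (𝔼 Z (λ z → φ (k * (z + s) * inv (k′ * (z + s′)))) ≈[_] κ φ Z (k * inv k′)) 4σ (≈-trans (h φ S k k′) (h′ φ S (k * inv k′))) })
      (Ev-∧ (near-> σ>0 gt) (κ≈κ′ σ>0))

open LinearFactors

-- Exchanging one factor of a pair.

module FactorReplacement where
  open import Data.Rational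
  open import Data.Rational.Properties

  -- The tolerance at which `replace` has error σ, since 12 times it is σ².
  eps : ℚ → ℚ
  eps σ = inv (fromℕ 12) * (σ * σ)

  eps>0 : ∀ {σ} → 0ℚ < σ → 0ℚ < eps σ
  eps>0 p = *>0 (inv-pos (fromℕ-suc>0 11)) (*>0 p p)

  -- Two normalisations at 2σ each, with one exchange at σ between them.
  5× : ℚ → ℚ
  5× σ = σ + σ + σ + (σ + σ)

  -- Replacing the factor z + D q by z + x, x ∈ X, in correlations of the pairs (z + q)(z + D q) with the test pairs
  -- (z + p₁)(z + p₁ + λ).  Both are normalised so that the test pair becomes z (z + 1) and q becomes y; what is left is a
  -- family of single factors z + t, to which `replace` applies.
  module Replace {A : Set} (P : Law A) (p₁ lam hh : A → ℚ) (𝒟 X : Law ℚ) (k D : ℚ → ℚ) {σ} (σ>0 : 0ℚ < σ)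
    (lam>0 : Supp P (λ a → 0ℚ < lam a)) (𝒟-inv : Supp P (λ a → Inv σ (lam a) (p₁ a) 𝒟)) (X-spread : Spread (eps σ) X) where

    at : A → ℚ → ℚ
    at a y = lam a * y + p₁ a

    norm : A → ℚ → ℚ
    norm a t = (t - p₁ a) * inv (lam a)

    F : (ℚ → ℚ) → Law ℚ → A → ℚ → ℚ → ℚ
    F φ Z a q t = 𝔼 Z (λ z → φ (hh a * ((z + p₁ a) * (z + (p₁ a + lam a))) * inv (k q * ((z + q) * (z + t)))))

    v : ℚ → ℚ → ℚ
    v y z = z * (z + 1ℚ) * inv (z + y)

    mult : ℚ → A → ℚ
    mult y a = inv (hh a) * k (at a y)

    -- For fixed q the position `D q` is a single point, and Cauchy-Schwarz would gain nothing.
    -- After the normalisation y is fixed instead and the test pair a varies; the hypothesis says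
    -- that the normalised positions then rarely coincide.
    module _ (c₄ : Supp 𝒟 (λ y → 𝔼 P (λ a → 𝔼 P (λ b → δ (norm a (D (at a y))) (norm b (D (at b y))))) ≤ eps σ)) where

      Ready : Law ℚ → Set
      Ready Z = Supp P (λ a → Inv σ (lam a) (- p₁ a) Z) ×
        Supp 𝒟 (λ y → Supp P (λ a → Supp P (λ b → Supp X (λ x → Supp X (λ x′ → ∀ φ → State φ → ∀ m m′ →
          (Near φ Z (κ φ Z) (eps σ) m (norm a x) m′ (norm b x′) × Near φ Z (κ φ Z) (eps σ) m (norm a x) m′ (norm b (D (at b y)))) ×
          (Near φ Z (κ φ Z) (eps σ) m (norm a (D (at a y))) m′ (norm b x′) ×
           Near φ Z (κ φ Z) (eps σ) m (norm a (D (at a y))) m′ (norm b (D (at b y)))))))))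

      ready : Ev Ready
      ready = Ev-∧ (Ev-All (All.map (λ {a} h → Ev-inv (- p₁ a) σ>0 h) lam>0))
        (Ev-∀∈ (support 𝒟) λ y → Ev-∀∈ (support P) λ a → Ev-∀∈ (support P) λ b → Ev-∀∈ (support X) λ x → Ev-∀∈ (support X) λ x′ →
          Ev-map (λ Z → λ { ((f , g) , (h , i)) φ S m m′ → (f φ S m m′ , g φ S m m′) , (h φ S m m′ , i φ S m m′) })
            (Ev-∧ (Ev-∧ (near (norm a x) (norm b x′) (eps>0 σ>0)) (near (norm a x) (norm b (D (at b y))) (eps>0 σ>0)))
                  (Ev-∧ (near (norm a (D (at a y))) (norm b x′) (eps>0 σ>0)) (near (norm a (D (at a y))) (norm b (D (at b y))) (eps>0 σ>0)))))

      module _ (Z : Law ℚ) (rdy : Ready Z) (φ : ℚ → ℚ) (S : State φ) where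
        open State S

        F₁ : A → ℚ → ℚ → ℚ
        F₁ a q t = 𝔼 Z (λ z → φ (hh a * (z * (z + 1ℚ)) * inv (k q * ((z + norm a q) * (z + norm a t)))))

        F₁∈ : ∀ a q t → 0ℚ ≤ F₁ a q t × F₁ a q t ≤ 1ℚ
        F₁∈ a q t = 𝔼-c≤ Z (Supp-all Z (λ z → φ≥0 _)) , 𝔼-≤c Z (Supp-all Z (λ z → φ≤1 _))

        step₁ : ∀ {a} → 0ℚ < lam a → Inv σ (lam a) (- p₁ a) Z → ∀ q t → F φ Z a q t ≈[ σ ] F₁ a q t
        step₁ {a} l>0 h q t = ≈-respʳ (𝔼-cong Z (λ z → cong φ (eq z)))
          (InvF-≈ {f = λ z → lam a * z + - p₁ a} {Z = Z} h
            (λ z → φ (hh a * ((z + p₁ a) * (z + (p₁ a + lam a))) * inv (k q * ((z + q) * (z + t))))) (λ z → φ≥0 _) (λ z → φ≤1 _))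
          where
          l = lam a
          e₀ : ∀ l p z → l * z + - p + p ≡ l * z
          e₀ = solve-∀ ring
          e₁ : ∀ l p z → l * z + - p + (p + l) ≡ l * (z + 1ℚ)
          e₁ = solve-∀ ring
          e₂ : ∀ z t → l * z + - p₁ a + t ≡ l * (z + norm a t)
          e₂ z t = sym (trans (e l (p₁ a) z t (inv l)) (trans (cong (λ c → l * z + c * (t - p₁ a)) (inv-r (>⇒≢ l>0))) (e′ (l * z) t (p₁ a))))
            where
            e : ∀ l p z t i → l * (z + (t - p) * i) ≡ l * z + l * i * (t - p)
            e = solve-∀ ring
            e′ : ∀ w t p → w + 1ℚ * (t - p) ≡ w + - p + t
            e′ = solve-∀ ring
          open ≡-Reasoning
          e₃ : ∀ h l x y → h * (l * x * (l * y)) ≡ l * l * (h * (x * y))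
          e₃ = solve-∀ ring
          eq : ∀ z → hh a * ((l * z + - p₁ a + p₁ a) * (l * z + - p₁ a + (p₁ a + l))) * inv (k q * ((l * z + - p₁ a + q) * (l * z + - p₁ a + t)))
            ≡ hh a * (z * (z + 1ℚ)) * inv (k q * ((z + norm a q) * (z + norm a t)))
          eq z = begin
            hh a * ((l * z + - p₁ a + p₁ a) * (l * z + - p₁ a + (p₁ a + l))) * inv (k q * ((l * z + - p₁ a + q) * (l * z + - p₁ a + t)))
              ≡⟨ cong₂ (λ x y → x * inv y) (trans (cong₂ (λ x y → hh a * (x * y)) (e₀ l (p₁ a) z) (e₁ l (p₁ a) z)) (e₃ (hh a) l z (z + 1ℚ)))
                   (trans (cong₂ (λ x y → k q * (x * y)) (e₂ z q) (e₂ z t)) (e₃ (k q) l (z + norm a q) (z + norm a t))) ⟩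
            l * l * (hh a * (z * (z + 1ℚ))) * inv (l * l * (k q * ((z + norm a q) * (z + norm a t))))
              ≡⟨ cancel-ratio (*-≢0 (>⇒≢ l>0) (>⇒≢ l>0)) _ _ ⟩
            hh a * (z * (z + 1ℚ)) * inv (k q * ((z + norm a q) * (z + norm a t))) ∎

        N : ℚ → A → ℚ → ℚ
        N y a t = 𝔼 Z (λ z → φ (v y z * inv (mult y a * (z + norm a t))))

        step₂ : ∀ {a} → 0ℚ < lam a → ∀ y t → F₁ a (at a y) t ≡ N y a t
        step₂ {a} l>0 y t = 𝔼-cong Z (λ z → cong φ (trans (cong (λ x → hh a * (z * (z + 1ℚ)) * inv (k (at a y) * ((z + x) * (z + norm a t)))) ny) (eq z)))
          where
          ny : norm a (at a y) ≡ y
          ny = trans (e (lam a) y (p₁ a) (inv (lam a))) (trans (cong (_* y) (inv-r (>⇒≢ l>0))) (*-identityˡ y))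
            where
            e : ∀ l y p i → (l * y + p - p) * i ≡ l * i * y
            e = solve-∀ ring
          eq : ∀ z → hh a * (z * (z + 1ℚ)) * inv (k (at a y) * ((z + y) * (z + norm a t))) ≡ v y z * inv (mult y a * (z + norm a t))
          eq z = begin
            h * w * inv (m * (u * s)) ≡⟨ cong (h * w *_) (trans (inv-* m (u * s)) (cong (inv m *_) (inv-* u s))) ⟩
            h * w * (inv m * (inv u * inv s)) ≡⟨ e h w (inv m) (inv u) (inv s) ⟩
            w * inv u * (h * inv m * inv s) ≡⟨ cong (λ x → w * inv u * (x * inv m * inv s)) (sym (inv-inv h)) ⟩
            w * inv u * (inv (inv h) * inv m * inv s) ≡⟨ cong (λ x → w * inv u * x) (sym (trans (inv-* (inv h * m) s) (cong (_* inv s) (inv-* (inv h) m)))) ⟩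
            w * inv u * inv (inv h * m * s) ∎
            where
            open ≡-Reasoning
            h = hh a
            w = z * (z + 1ℚ)
            m = k (at a y)
            u = z + y
            s = z + norm a t
            e : ∀ h w m u s → h * w * (m * (u * s)) ≡ w * u * (h * m * s)
            e = solve-∀ ring

        -- One σ is spent on the affine change of z and one on q = `at a y`, by the invariance of
        -- `𝒟`. Afterwards `v y` no longer depends on a, so the whole family of factors is tested
        -- against one vector.
        normalise : (t : ℚ → ℚ → ℚ) →
          𝔼 P (λ a → 𝔼 𝒟 (λ q → 𝔼 X (λ x → F φ Z a q (t q x)))) ≈[ σ + σ ]
          𝔼 𝒟 (λ y → 𝔼 P (λ a → 𝔼 X (λ x → N y a (t (at a y) x))))
        normalise t = ≈-trans
          (≈-𝔼 P (All.zipWith (λ { (l>0 , h) → ≈-𝔼 𝒟 (Supp-all 𝒟 (λ q → ≈-𝔼 X (Supp-all X (λ x → step₁ l>0 h q (t q x))))) }) (lam>0 , proj₁ rdy)))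
          (≈-respʳ (𝔼-swap P 𝒟 _) (≈-𝔼 P (All.zipWith (λ {a} → λ { (l>0 , h) →
            ≈-respʳ (𝔼-cong 𝒟 (λ y → 𝔼-cong X (λ x → step₂ l>0 y (t (at a y) x))))
              (InvF-≈ {f = λ y → lam a * y + p₁ a} {Z = 𝒟} h (λ q → 𝔼 X (λ x → F₁ a q (t q x)))
                (λ q → 𝔼-c≤ X (Supp-all X (λ x → proj₁ (F₁∈ a q (t q x))))) (λ q → 𝔼-≤c X (Supp-all X (λ x → proj₂ (F₁∈ a q (t q x)))))) }) (lam>0 , 𝒟-inv))))

        order : ∀ y (t : A → ℚ → ℚ) → 𝔼 P (λ a → 𝔼 X (λ x → N y a (t a x))) ≡
          𝔼 Z (λ z → 𝔼 (P ⊗ X) (λ i → φ (v y z * inv (mult y (proj₁ i) * (z + norm (proj₁ i) (t (proj₁ i) (proj₂ i)))))))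
        order y t = sym (trans (𝔼-swap Z (P ⊗ X) _) (𝔼-⊗ P X _))

        spread-norm : ∀ c {a} → 0ℚ < lam a → 𝔼 X (λ x → δ c (norm a x)) ≤ eps σ
        spread-norm c {a} l>0 = spread-image {X = X} {c = c} {f = norm a} (c * lam a + p₁ a) X-spread (λ x eq →
          trans (cong (λ w → w * lam a + p₁ a) eq) (trans (e x (p₁ a) (inv (lam a)) (lam a)) (trans (cong (λ w → w * (x - p₁ a) + p₁ a) (inv-r (>⇒≢ l>0))) (e′ x (p₁ a)))))
          where
          e : ∀ x p i l → (x - p) * i * l + p ≡ l * i * (x - p) + p
          e = solve-∀ ring
          e′ : ∀ x p → 1ℚ * (x - p) + p ≡ x
          e′ = solve-∀ ring

        swapped : Supp 𝒟 (λ y → 𝔼 P (λ a → 𝔼 X (λ x → N y a x)) ≈[ σ ] 𝔼 P (λ a → 𝔼 X (λ x → N y a (D (at a y)))))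
        swapped = All.zipWith (λ {y} → λ { (n , c) → ≈-respˡ (sym (order y (λ a x → x))) (≈-respʳ (sym (order y (λ a x → D (at a y))))
          (replace S Z (P ⊗ X) (λ i → mult y (proj₁ i)) (λ i → norm (proj₁ i) (proj₂ i)) (λ i → norm (proj₁ i) (D (at (proj₁ i) y))) (κ φ Z)
            σ>0 (<⇒≤ (eps>0 σ>0)) (twelve σ>0)
            (Supp-⊗ P X (All.map (λ {a} n₁ → All.tabulate (λ {x} mx → Supp-⊗ P X (All.map (λ {b} n₂ → All.map (λ n₃ → n₃ φ S (mult y a) (mult y b)) (All.lookup n₂ mx)) n₁))) n))
            (𝔼-≤c (P ⊗ X) (Supp-all (P ⊗ X) (λ i → small-row (norm (proj₁ i) (proj₂ i)))))
            (𝔼-≤c (P ⊗ X) (Supp-all (P ⊗ X) (λ i → small-row (norm (proj₁ i) (D (at (proj₁ i) y))))))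
            (subst (_≤ eps σ) (sym (trans (𝔼-⊗ P X _) (𝔼-cong P (λ a → trans (𝔼-const X _) (trans (𝔼-⊗ P X _) (𝔼-cong P (λ b → 𝔼-const X _))))))) c)
            (v y))) }) (proj₂ rdy , c₄)
          where
          small-row : ∀ c → 𝔼 (P ⊗ X) (λ j → δ c (norm (proj₁ j) (proj₂ j))) ≤ eps σ
          small-row c = subst (_≤ eps σ) (sym (𝔼-⊗ P X _)) (𝔼-≤c P (All.map (λ l>0 → spread-norm c l>0) lam>0))

        result : 𝔼 P (λ a → 𝔼 𝒟 (λ q → 𝔼 X (λ x → F φ Z a q x))) ≈[ 5× σ ] 𝔼 P (λ a → 𝔼 𝒟 (λ q → 𝔼 X (λ x → F φ Z a q (D q))))
        result = ≈-trans (≈-trans (normalise (λ q x → x)) (≈-𝔼 𝒟 swapped)) (≈-sym (normalise (λ q x → D q)))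

open FactorReplacement

-- Injectivity of the normalised positions of D q.

module RootPositions where
  open import Data.Rational
  open import Data.Rational.Properties

  cancel-≡ : ∀ {c x y} → c ≢ 0ℚ → c * x ≡ c * y → x ≡ y
  cancel-≡ {c} {x} {y} c≢0 eq = trans (sym (u x)) (trans (cong (inv c *_) eq) (u y))
    where
    e : ∀ c i x → i * (c * x) ≡ c * i * x
    e = solve-∀ ring
    u : ∀ x → inv c * (c * x) ≡ x
    u x = trans (e c (inv c) x) (trans (cong (_* x) (inv-r c≢0)) (*-identityˡ x))

  zero-factor : ∀ {c x y d} → 0ℚ < c → d ≡ (x - y) * c → d ≡ 0ℚ → x ≡ y
  zero-factor {c} {x} {y} c>0 eq z = trans (e x y) (trans (cong (_+ y) (cancel-≡ (>⇒≢ c>0) (trans (*-comm c (x - y)) (trans (sym eq) (trans z (sym (*-zeroʳ c))))))) (+-identityˡ y))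
    where
    e : ∀ x y → x ≡ x - y + y
    e = solve-∀ ring

  ≡⇒diff0 : ∀ {x y} → x ≡ y → x - y ≡ 0ℚ
  ≡⇒diff0 {x} refl = +-inverseʳ x

  module Roots (a b e : ℚ) (a>0 : 0ℚ < a) (b>0 : 0ℚ < b) (e>0 : 0ℚ < e) (a≢e : a ≢ e) (b≢e : b ≢ e) where

    θ : ℚ
    θ = e * inv (a * b)

    θ>0 : 0ℚ < θ
    θ>0 = *>0 e>0 (inv-pos (*>0 a>0 b>0))

    1+>0 : ∀ {c q} → 0ℚ < c → 0ℚ < q → 0ℚ < 1ℚ + c * q
    1+>0 p q = +>0 0<1 (<⇒≤ (*>0 p q))

    abstract
      s : ℚ → ℚ
      s q = (1ℚ + a * q) * (1ℚ + b * q) * inv (1ℚ + e * q)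

      s-def : ∀ q → s q ≡ (1ℚ + a * q) * (1ℚ + b * q) * inv (1ℚ + e * q)
      s-def q = refl

    s>0 : ∀ {q} → 0ℚ < q → 0ℚ < s q
    s>0 {q} q>0 = subst (0ℚ <_) (sym (s-def q)) (*>0 (*>0 (1+>0 a>0 q>0) (1+>0 b>0 q>0)) (inv-pos (1+>0 e>0 q>0)))

    s-mul : ∀ {q} → 0ℚ < q → s q * (1ℚ + e * q) ≡ (1ℚ + a * q) * (1ℚ + b * q)
    s-mul {q} q>0 = trans (cong (_* (1ℚ + e * q)) (s-def q)) (trans (p ((1ℚ + a * q) * (1ℚ + b * q)) (inv (1ℚ + e * q)) (1ℚ + e * q)) (trans (cong ((1ℚ + a * q) * (1ℚ + b * q) *_) (inv-r (>⇒≢ (1+>0 e>0 q>0)))) (*-identityʳ _)))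
      where
      p : ∀ x i y → x * i * y ≡ x * (y * i)
      p = solve-∀ ring

    D : ℚ → ℚ
    D q = q - θ * s q

    -- The position of D q relative to the pair (p , p + u) when q = u y + p.
    position : ∀ {u p y} → 0ℚ < u → (D (u * y + p) - p) * inv u ≡ y - θ * (s (u * y + p) * inv u)
    position {u} {p} {y} u>0 = trans (q u y p θ (s (u * y + p)) (inv u)) (trans (cong (λ c → c * y - θ * (s (u * y + p) * inv u)) (inv-r (>⇒≢ u>0))) (cong (_- θ * (s (u * y + p) * inv u)) (*-identityˡ y)))
      where
      q : ∀ u y p θ s i → (u * y + p - θ * s - p) * i ≡ u * i * y - θ * (s * i)
      q = solve-∀ ring

    -- By `position` both sides are the same y minus θ s / u.
    same-position : ∀ {u p u′ p′ y} → 0ℚ < u → 0ℚ < u′ →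
      (D (u * y + p) - p) * inv u ≡ (D (u′ * y + p′) - p′) * inv u′ →
      s (u * y + p) * u′ ≡ s (u′ * y + p′) * u
    same-position {u} {p} {u′} {p′} {y} u>0 u′>0 eq = begin
      s₁ * u′                     ≡⟨ sym (trans (r s₁ u′ u (inv u)) (trans (cong (s₁ * u′ *_) (inv-r (>⇒≢ u>0))) (*-identityʳ (s₁ * u′)))) ⟩
      s₁ * inv u * (u * u′)       ≡⟨ cong (_* (u * u′)) ratio ⟩
      s₂ * inv u′ * (u * u′)      ≡⟨ trans (r′ s₂ u u′ (inv u′)) (trans (cong (s₂ * u *_) (inv-r (>⇒≢ u′>0))) (*-identityʳ (s₂ * u))) ⟩
      s₂ * u ∎
      where
      open ≡-Reasoning
      s₁ = s (u * y + p)
      s₂ = s (u′ * y + p′)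
      r : ∀ s v u i → s * i * (u * v) ≡ s * v * (u * i)
      r = solve-∀ ring
      r′ : ∀ s u v i → s * i * (u * v) ≡ s * u * (v * i)
      r′ = solve-∀ ring
      w : ∀ y x → x ≡ y - (y - x)
      w = solve-∀ ring
      ratio : s₁ * inv u ≡ s₂ * inv u′
      ratio = cancel-≡ (>⇒≢ θ>0) (trans (w y (θ * (s₁ * inv u))) (trans (cong (λ x → y - x) (trans (sym (position u>0)) (trans eq (position u′>0)))) (sym (w y (θ * (s₂ * inv u′))))))

    Y>0 : ∀ {y} → 1ℚ < y → 0ℚ < y - 1ℚ
    Y>0 = diff>0

    at>0 : ∀ {u r y} → 0ℚ < u → 0ℚ < r → 1ℚ < y → 0ℚ < u * y + (r - u)
    at>0 {u} {r} {y} u>0 r>0 y>1 = subst (0ℚ <_) (p u r y) (+>0 r>0 (<⇒≤ (*>0 u>0 (Y>0 y>1))))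
      where
      p : ∀ u r y → r + u * (y - 1ℚ) ≡ u * y + (r - u)
      p = solve-∀ ring

    -- After clearing denominators the difference of the two sides is x - x′ times a bracket. The
    -- only term of doubtful sign in the bracket is a b (e r - 1), which is why 1 ≤ e r is demanded.
    position-injective₁ : ∀ {r y x x′} → 0ℚ < r → 1ℚ ≤ e * r → 1ℚ < y → x < r → x′ < r →
      (D ((r - x) * y + x) - x) * inv (r - x) ≡ (D ((r - x′) * y + x′) - x′) * inv (r - x′) → x ≡ x′
    position-injective₁ {r} {y} {x} {x′} r>0 er≥1 y>1 x<r x′<r eq = zero-factor bracket>0 (poly a b e r y x x′) (≡⇒diff0 (begin
        N q * ((1ℚ + e * q′) * u′)            ≡⟨ cong (_* ((1ℚ + e * q′) * u′)) (sym (s-mul q>0)) ⟩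
        s q * (1ℚ + e * q) * ((1ℚ + e * q′) * u′) ≡⟨ p (s q) (1ℚ + e * q) (1ℚ + e * q′) u′ ⟩
        s q * u′ * ((1ℚ + e * q) * (1ℚ + e * q′)) ≡⟨ cong (_* ((1ℚ + e * q) * (1ℚ + e * q′))) (same-position u>0 u′>0 eq) ⟩
        s q′ * u * ((1ℚ + e * q) * (1ℚ + e * q′)) ≡⟨ p′ (s q′) (1ℚ + e * q) (1ℚ + e * q′) u ⟩
        s q′ * (1ℚ + e * q′) * ((1ℚ + e * q) * u) ≡⟨ cong (_* ((1ℚ + e * q) * u)) (s-mul q′>0) ⟩
        N q′ * ((1ℚ + e * q) * u) ∎))
      where
      open ≡-Reasoning
      N : ℚ → ℚ
      N q = (1ℚ + a * q) * (1ℚ + b * q)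
      u = r - x
      u′ = r - x′
      u>0 = diff>0 x<r
      u′>0 = diff>0 x′<r
      q = u * y + x
      q′ = u′ * y + x′
      shape : ∀ r x y → (r - x) * y + (r - (r - x)) ≡ (r - x) * y + x
      shape = solve-∀ ring
      q>0 : 0ℚ < q
      q>0 = subst (0ℚ <_) (shape r x y) (at>0 u>0 r>0 y>1)
      q′>0 : 0ℚ < q′
      q′>0 = subst (0ℚ <_) (shape r x′ y) (at>0 u′>0 r>0 y>1)
      p : ∀ s f f′ u → s * f * (f′ * u) ≡ s * u * (f * f′)
      p = solve-∀ ring
      p′ : ∀ s f f′ u → s * u * (f * f′) ≡ s * f′ * (f * u)
      p′ = solve-∀ ring
      bracket : ℚ
      bracket = (1ℚ + a * r) * (1ℚ + b * r) * ((1ℚ + e * r) + e * (y - 1ℚ) * (u + u′)) + (y - 1ℚ) * (y - 1ℚ) * (e * (a + b) + a * b * (e * r - 1ℚ)) * (u * u′)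
      bracket>0 : 0ℚ < bracket
      bracket>0 = +>0 (*>0 (*>0 (1+>0 a>0 r>0) (1+>0 b>0 r>0)) (+>0 (1+>0 e>0 r>0) (*≥0 (<⇒≤ (*>0 e>0 (Y>0 y>1))) (+≥0 (<⇒≤ u>0) (<⇒≤ u′>0)))))
        (*≥0 (*≥0 (<⇒≤ (*>0 (Y>0 y>1) (Y>0 y>1))) (+≥0 (<⇒≤ (*>0 e>0 (+>0 a>0 (<⇒≤ b>0)))) (*≥0 (<⇒≤ (*>0 a>0 b>0)) (diff≥0 er≥1)))) (<⇒≤ (*>0 u>0 u′>0)))
      poly : ∀ a b e r y x x′ →
        (1ℚ + a * ((r - x) * y + x)) * (1ℚ + b * ((r - x) * y + x)) * ((1ℚ + e * ((r - x′) * y + x′)) * (r - x′))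
        - (1ℚ + a * ((r - x′) * y + x′)) * (1ℚ + b * ((r - x′) * y + x′)) * ((1ℚ + e * ((r - x) * y + x)) * (r - x))
        ≡ (x - x′) * ((1ℚ + a * r) * (1ℚ + b * r) * ((1ℚ + e * r) + e * (y - 1ℚ) * ((r - x) + (r - x′))) + (y - 1ℚ) * (y - 1ℚ) * (e * (a + b) + a * b * (e * r - 1ℚ)) * ((r - x) * (r - x′)))
      poly = solve-∀ ring

    Den : ℚ → ℚ → ℚ
    Den Y r = a * b * ((1ℚ + e * r) * (1ℚ + e * r)) + e * e * Y * ((1ℚ + a * r) * (1ℚ + b * r))

    W : ℚ → ℚ → ℚ
    W Y r = (b * (1ℚ + e * r) + e * Y * (1ℚ + b * r)) * (a * (1ℚ + e * r) + e * Y * (1ℚ + a * r))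

    -- Up to a constant, W is a multiple of `Den`, so W / Den determines `Den` as soon as that
    -- constant is nonzero; it is, because a and b differ from e and Y > 0.
    W-Den : ∀ Y r → W Y r ≡ (Y + 1ℚ) * Den Y r - Y * ((a - e) * (b - e))
    W-Den = poly a b e
      where
      poly : ∀ a b e Y r → (b * (1ℚ + e * r) + e * Y * (1ℚ + b * r)) * (a * (1ℚ + e * r) + e * Y * (1ℚ + a * r))
        ≡ (Y + 1ℚ) * (a * b * ((1ℚ + e * r) * (1ℚ + e * r)) + e * e * Y * ((1ℚ + a * r) * (1ℚ + b * r))) - Y * ((a - e) * (b - e))
      poly = solve-∀ ring

    -- With denominators cleared, 1 + a q and 1 + b q contain the factors 1 + a r and 1 + b r. Hence
    -- s at the new point q is s r times the explicit quotient W / Den.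
    s-at : ∀ {r y} → 0ℚ < r → 1ℚ < y → s (θ * s r * y + D r) * Den (y - 1ℚ) r ≡ W (y - 1ℚ) r * s r
    s-at {r} {y} r>0 y>1 = cancel-≡ (>⇒≢ E>0) (begin
      E₀ * (s q * Den Y r)        ≡⟨ cong (λ x → E₀ * (s q * x)) (sym fe) ⟩
      E₀ * (s q * (a * b * E₀ * (1ℚ + e * q)))  ≡⟨ g₁ E₀ (s q) a b (1ℚ + e * q) ⟩
      b * E₀ * (a * E₀) * (s q * (1ℚ + e * q)) ≡⟨ cong (b * E₀ * (a * E₀) *_) (s-mul q>0) ⟩
      b * E₀ * (a * E₀) * ((1ℚ + a * q) * (1ℚ + b * q)) ≡⟨ g₂ (b * E₀) (a * E₀) (1ℚ + a * q) (1ℚ + b * q) ⟩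
      b * E₀ * (1ℚ + a * q) * (a * E₀ * (1ℚ + b * q)) ≡⟨ cong₂ _*_ fa fb ⟩
      (1ℚ + a * r) * (b * E₀ + e * Y * (1ℚ + b * r)) * ((1ℚ + b * r) * (a * E₀ + e * Y * (1ℚ + a * r)))
        ≡⟨ g₃ (1ℚ + a * r) (1ℚ + b * r) (b * E₀ + e * Y * (1ℚ + b * r)) (a * E₀ + e * Y * (1ℚ + a * r)) ⟩
      W Y r * ((1ℚ + a * r) * (1ℚ + b * r)) ≡⟨ cong (W Y r *_) (sym (s-mul r>0)) ⟩
      W Y r * (s r * E₀) ≡⟨ g₄ (W Y r) (s r) E₀ ⟩
      E₀ * (W Y r * s r) ∎)
      where
      open ≡-Reasoning
      Y = y - 1ℚ
      E₀ = 1ℚ + e * r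
      E>0 : 0ℚ < E₀
      E>0 = 1+>0 e>0 r>0
      q = θ * s r * y + D r
      q>0 : 0ℚ < q
      q>0 = subst (0ℚ <_) (h (θ * s r) r y) (+>0 r>0 (<⇒≤ (*>0 (*>0 θ>0 (s>0 r>0)) (Y>0 y>1))))
        where
        h : ∀ u r y → r + u * (y - 1ℚ) ≡ u * y + (r - u)
        h = solve-∀ ring
      lin : a * b * E₀ * q ≡ a * b * E₀ * r + e * Y * ((1ℚ + a * r) * (1ℚ + b * r))
      lin = trans (h₁ a b E₀ e (inv (a * b)) (s r) y r)
        (trans (cong₂ (λ x w → a * b * E₀ * r + x * (e * Y) * w) (inv-r (>⇒≢ (*>0 a>0 b>0))) (s-mul r>0)) (h₂ (a * b * E₀ * r) (e * Y) ((1ℚ + a * r) * (1ℚ + b * r))))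
        where
        h₁ : ∀ a b E e i s y r → a * b * E * (e * i * s * y + (r - e * i * s)) ≡ a * b * E * r + a * b * i * (e * (y - 1ℚ)) * (s * E)
        h₁ = solve-∀ ring
        h₂ : ∀ x z w → x + 1ℚ * z * w ≡ x + z * w
        h₂ = solve-∀ ring
      fa : b * E₀ * (1ℚ + a * q) ≡ (1ℚ + a * r) * (b * E₀ + e * Y * (1ℚ + b * r))
      fa = trans (h₁ a b E₀ q) (trans (cong (b * E₀ +_) lin) (h₂ a b e Y r))
        where
        h₁ : ∀ a b E q → b * E * (1ℚ + a * q) ≡ b * E + a * b * E * q
        h₁ = solve-∀ ring
        h₂ : ∀ a b e Y r → b * (1ℚ + e * r) + (a * b * (1ℚ + e * r) * r + e * Y * ((1ℚ + a * r) * (1ℚ + b * r))) ≡ (1ℚ + a * r) * (b * (1ℚ + e * r) + e * Y * (1ℚ + b * r))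
        h₂ = solve-∀ ring
      fb : a * E₀ * (1ℚ + b * q) ≡ (1ℚ + b * r) * (a * E₀ + e * Y * (1ℚ + a * r))
      fb = trans (h₁ a b E₀ q) (trans (cong (a * E₀ +_) lin) (h₂ a b e Y r))
        where
        h₁ : ∀ a b E q → a * E * (1ℚ + b * q) ≡ a * E + a * b * E * q
        h₁ = solve-∀ ring
        h₂ : ∀ a b e Y r → a * (1ℚ + e * r) + (a * b * (1ℚ + e * r) * r + e * Y * ((1ℚ + a * r) * (1ℚ + b * r))) ≡ (1ℚ + b * r) * (a * (1ℚ + e * r) + e * Y * (1ℚ + a * r))
        h₂ = solve-∀ ring
      fe : a * b * E₀ * (1ℚ + e * q) ≡ Den Y r
      fe = trans (h₁ a b e E₀ q) (trans (cong (λ x → a * b * E₀ + e * x) lin) (h₂ a b e Y r))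
        where
        h₁ : ∀ a b e E q → a * b * E * (1ℚ + e * q) ≡ a * b * E + e * (a * b * E * q)
        h₁ = solve-∀ ring
        h₂ : ∀ a b e Y r → a * b * (1ℚ + e * r) + e * (a * b * (1ℚ + e * r) * r + e * Y * ((1ℚ + a * r) * (1ℚ + b * r))) ≡ a * b * ((1ℚ + e * r) * (1ℚ + e * r)) + e * e * Y * ((1ℚ + a * r) * (1ℚ + b * r))
        h₂ = solve-∀ ring
      g₁ : ∀ E s a b f → E * (s * (a * b * E * f)) ≡ b * E * (a * E) * (s * f)
      g₁ = solve-∀ ring
      g₂ : ∀ x y f g → x * y * (f * g) ≡ x * f * (y * g)
      g₂ = solve-∀ ring
      g₃ : ∀ A B w w′ → A * w * (B * w′) ≡ w * w′ * (A * B)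
      g₃ = solve-∀ ring
      g₄ : ∀ w s E → w * (s * E) ≡ E * (w * s)
      g₄ = solve-∀ ring

    -- Equal positions give equal quotients W / Den, hence equal `Den` by `W-Den`, and `Den` is
    -- strictly increasing in r > 0.
    position-injective₂ : ∀ {y r r′} → 0ℚ < r → 0ℚ < r′ → 1ℚ < y →
      (D (θ * s r * y + D r) - D r) * inv (θ * s r) ≡ (D (θ * s r′ * y + D r′) - D r′) * inv (θ * s r′) → r ≡ r′
    position-injective₂ {y} {r} {r′} r>0 r′>0 y>1 eq = zero-factor bracket>0 (poly a b e Y r r′) (≡⇒diff0 den)
      where
      open ≡-Reasoning
      Y = y - 1ℚ
      q = θ * s r * y + D r
      q′ = θ * s r′ * y + D r′
      ss : s q * s r′ ≡ s q′ * s r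
      ss = cancel-≡ (>⇒≢ θ>0) (trans (h θ (s q) (s r′)) (trans (same-position (*>0 θ>0 (s>0 r>0)) (*>0 θ>0 (s>0 r′>0)) eq) (sym (h θ (s q′) (s r)))))
        where
        h : ∀ t x y → t * (x * y) ≡ x * (t * y)
        h = solve-∀ ring
      WD : W Y r * Den Y r′ ≡ W Y r′ * Den Y r
      WD = cancel-≡ (>⇒≢ (*>0 (s>0 r>0) (s>0 r′>0))) (begin
        s r * s r′ * (W Y r * Den Y r′)         ≡⟨ h (s r) (s r′) (W Y r) (Den Y r′) ⟩
        W Y r * s r * (s r′ * Den Y r′)         ≡⟨ cong (_* (s r′ * Den Y r′)) (sym (s-at r>0 y>1)) ⟩
        s q * Den Y r * (s r′ * Den Y r′)       ≡⟨ h′ (s q) (Den Y r) (s r′) (Den Y r′) ⟩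
        s q * s r′ * (Den Y r * Den Y r′)       ≡⟨ cong (_* (Den Y r * Den Y r′)) ss ⟩
        s q′ * s r * (Den Y r * Den Y r′)       ≡⟨ h″ (s q′) (s r) (Den Y r) (Den Y r′) ⟩
        s q′ * Den Y r′ * (s r * Den Y r)       ≡⟨ cong (_* (s r * Den Y r)) (s-at r′>0 y>1) ⟩
        W Y r′ * s r′ * (s r * Den Y r)         ≡⟨ h‴ (W Y r′) (s r′) (s r) (Den Y r) ⟩
        s r * s r′ * (W Y r′ * Den Y r) ∎)
        where
        h : ∀ x y w d → x * y * (w * d) ≡ w * x * (y * d)
        h = solve-∀ ring
        h′ : ∀ x d y d′ → x * d * (y * d′) ≡ x * y * (d * d′)
        h′ = solve-∀ ring
        h″ : ∀ x y d d′ → x * y * (d * d′) ≡ x * d′ * (y * d)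
        h″ = solve-∀ ring
        h‴ : ∀ w y x d → w * y * (x * d) ≡ x * y * (w * d)
        h‴ = solve-∀ ring
      c : ℚ
      c = Y * ((a - e) * (b - e))
      c≢0 : c ≢ 0ℚ
      c≢0 = *-≢0 (>⇒≢ (Y>0 y>1)) (*-≢0 (nz a≢e) (nz b≢e))
        where
        h : ∀ x y → x ≡ x - y + y
        h = solve-∀ ring
        nz : ∀ {x y} → x ≢ y → x - y ≢ 0ℚ
        nz {x} {y} n z = n (trans (h x y) (trans (cong (_+ y) z) (+-identityˡ y)))
      den : Den Y r ≡ Den Y r′
      den = cancel-≡ c≢0 (begin
        c * Den Y r ≡⟨ h Y c (Den Y r) (Den Y r′) ⟩
        (Y + 1ℚ) * (Den Y r * Den Y r′) - ((Y + 1ℚ) * Den Y r′ - c) * Den Y r ≡⟨ cong (λ w → (Y + 1ℚ) * (Den Y r * Den Y r′) - w * Den Y r) (sym (W-Den Y r′)) ⟩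
        (Y + 1ℚ) * (Den Y r * Den Y r′) - W Y r′ * Den Y r ≡⟨ cong (λ w → (Y + 1ℚ) * (Den Y r * Den Y r′) - w) (sym WD) ⟩
        (Y + 1ℚ) * (Den Y r * Den Y r′) - W Y r * Den Y r′ ≡⟨ cong (λ w → (Y + 1ℚ) * (Den Y r * Den Y r′) - w * Den Y r′) (W-Den Y r) ⟩
        (Y + 1ℚ) * (Den Y r * Den Y r′) - ((Y + 1ℚ) * Den Y r - c) * Den Y r′ ≡⟨ h′ Y c (Den Y r) (Den Y r′) ⟩
        c * Den Y r′ ∎)
        where
        h : ∀ Y c d d′ → c * d ≡ (Y + 1ℚ) * (d * d′) - ((Y + 1ℚ) * d′ - c) * d
        h = solve-∀ ring
        h′ : ∀ Y c d d′ → (Y + 1ℚ) * (d * d′) - ((Y + 1ℚ) * d - c) * d′ ≡ c * d′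
        h′ = solve-∀ ring
      bracket : ℚ
      bracket = a * b * e * ((1ℚ + e * r) + (1ℚ + e * r′)) + e * e * Y * (a * (1ℚ + b * r) + b * (1ℚ + a * r′))
      bracket>0 : 0ℚ < bracket
      bracket>0 = +>0 (*>0 (*>0 (*>0 a>0 b>0) e>0) (+>0 (1+>0 e>0 r>0) (<⇒≤ (1+>0 e>0 r′>0))))
        (<⇒≤ (*>0 (*>0 (*>0 e>0 e>0) (Y>0 y>1)) (+>0 (*>0 a>0 (1+>0 b>0 r>0)) (<⇒≤ (*>0 b>0 (1+>0 a>0 r′>0))))))
      poly : ∀ a b e Y r r′ →
        (a * b * ((1ℚ + e * r) * (1ℚ + e * r)) + e * e * Y * ((1ℚ + a * r) * (1ℚ + b * r)))
        - (a * b * ((1ℚ + e * r′) * (1ℚ + e * r′)) + e * e * Y * ((1ℚ + a * r′) * (1ℚ + b * r′)))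
        ≡ (r - r′) * (a * b * e * ((1ℚ + e * r) + (1ℚ + e * r′)) + e * e * Y * (a * (1ℚ + b * r) + b * (1ℚ + a * r′)))
      poly = solve-∀ ring

open RootPositions

-- Near orthogonality of paired factors across two laws.

module PairedFactors where
  open import Data.Rational
  open import Data.Rational.Properties

  module Pairs (a b e : ℚ) (a>0 : 0ℚ < a) (b>0 : 0ℚ < b) (e>0 : 0ℚ < e) (a≢e : a ≢ e) (b≢e : b ≢ e) where

    open Roots a b e a>0 b>0 e>0 a≢e b≢e public

    k : ℚ → ℚ
    k q = inv (s q)

    pairX pairD : ℚ → ℚ × ℚ → ℚ
    pairX z i = k (proj₁ i) * ((z + proj₁ i) * (z + proj₂ i))
    pairD z i = k (proj₁ i) * ((z + proj₁ i) * (z + D (proj₁ i)))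

    -- Two laws occur because the invariance demanded of `new` is read off from `old`; for a law
    -- against itself only the bound `Cross≤2` is available.
    Cross : (ℚ → ℚ) → Law ℚ → Law ℚ → Law ℚ → Law ℚ → ℚ
    Cross φ Z X new old = 𝔼 Z (λ z → 𝔼 (new ⊗ X) (λ i → 𝔼 (old ⊗ X) (λ j →
      Q φ (pairX z i) (pairD z i) (pairX z j) (pairD z j))))

    Cross-sym : ∀ {φ} → State φ → ∀ Z X d d′ → Cross φ Z X d d′ ≡ Cross φ Z X d′ d
    Cross-sym S Z X d d′ = 𝔼-cong Z (λ z → trans (𝔼-swap (d ⊗ X) (d′ ⊗ X) _)
      (𝔼-cong (d′ ⊗ X) (λ j → 𝔼-cong (d ⊗ X) (λ i → Q-sym S (pairX z i) (pairD z i) (pairX z j) (pairD z j)))))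

    Cross≤2 : ∀ {φ} → State φ → ∀ Z X d d′ → Cross φ Z X d d′ ≤ 2ℚ
    Cross≤2 S Z X d d′ = 𝔼-≤c Z (Supp-all Z (λ z → 𝔼-≤c (d ⊗ X) (Supp-all (d ⊗ X) (λ i → 𝔼-≤c (d′ ⊗ X) (Supp-all (d′ ⊗ X) (λ j →
      Q≤2 S (pairX z i) (pairD z i) (pairX z j) (pairD z j)))))))

    -- What `old` must satisfy for its test pairs to have positive gaps and to meet the hypotheses
    -- of `position-injective₁`, and for draws from it to collide rarely.
    record Old (σ : ℚ) (X : Law ℚ) (old : Law ℚ) : Set where
      field
        old>0  : Supp old (0ℚ <_)
        old≥   : Supp old (λ r → 1ℚ ≤ e * r)
        old>X  : Supp X (λ x → Supp old (x <_))
        spread : Spread (eps σ) old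

    module _ {σ} (σ>0 : 0ℚ < σ) (X : Law ℚ) (X-spread : Spread (eps σ) X) (old : Law ℚ) (O : Old σ X old) where
      open Old O

      -- Invariance under the maps that put q in standard position relative to the two kinds of test
      -- pairs, with positions x , r and D r , r. The bound by 1 is the condition on y in both
      -- injectivity lemmas.
      record New (new : Law ℚ) : Set where
        field
          new>1   : Supp new (1ℚ <_)
          new-inv : Supp old (λ r → Supp X (λ x → Inv σ (r - x) x new))
          new-inv′ : Supp old (λ r → Inv σ (θ * s r) (D r) new)

      new-ev : Ev New
      new-ev = Ev-map (λ new → λ { (p , q , r) → record { new>1 = p ; new-inv = q ; new-inv′ = r } })
        (Ev-∧ (Ev-> 1ℚ) (Ev-∧
          (Ev-All (All.tabulate λ {r} mr → Ev-All (All.tabulate λ {x} mx → Ev-inv x σ>0 (diff>0 (All.lookup (All.lookup old>X mx) mr)))))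
          (Ev-All (All.map (λ {r} p → Ev-inv (D r) σ>0 (*>0 θ>0 (s>0 p))) old>0))))

      module _ {new : Law ℚ} (N : New new) where
        open New N

        -- Test pairs (z + r)(z + x): r stays fixed, and the average over x separates the root
        -- positions.
        module First (r : ℚ) (r>0 : 0ℚ < r) (er≥1 : 1ℚ ≤ e * r) (x<r : Supp X (_< r)) (n-inv : Supp X (λ x → Inv σ (r - x) x new)) where
          open Replace X (λ x → x) (λ x → r - x) (const (k r)) new X k D σ>0 (All.map diff>0 x<r) n-inv X-spread public

          c₄ : Supp new (λ y → 𝔼 X (λ x → 𝔼 X (λ x′ → δ (norm x (D (at x y))) (norm x′ (D (at x′ y))))) ≤ eps σ)
          c₄ = All.map (λ {y} y>1 → ≤-trans
            (𝔼-mono X (All.map (λ {x} p → 𝔼-mono X (All.map (λ {x′} p′ → δ-mono _ _ x x′ (position-injective₁ r>0 er≥1 y>1 p p′)) x<r)) x<r))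
            (𝔼-≤c X (Supp-all X (λ x → X-spread x)))) new>1

        -- Test pairs (z + r)(z + D r): no free x is left, so the average over r itself has to
        -- separate the root positions.
        module Second where
          open Replace old D (λ r → θ * s r) k new X k D σ>0 (All.map (λ p → *>0 θ>0 (s>0 p)) old>0) new-inv′ X-spread public

          c₄ : Supp new (λ y → 𝔼 old (λ r → 𝔼 old (λ r′ → δ (norm r (D (at r y))) (norm r′ (D (at r′ y))))) ≤ eps σ)
          c₄ = All.map (λ {y} y>1 → ≤-trans
            (𝔼-mono old (All.map (λ {r} p → 𝔼-mono old (All.map (λ {r′} p′ → δ-mono _ _ r r′ (position-injective₂ p p′ y>1)) old>0)) old>0))
            (𝔼-≤c old (Supp-all old (λ r → spread r)))) new>1

        First-result : Law ℚ → ℚ → Set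
        First-result Z r = ∀ φ → State φ →
          𝔼 X (λ x′ → 𝔼 new (λ q → 𝔼 X (λ x → 𝔼 Z (λ z → φ (pairX z (r , x′) * inv (pairX z (q , x)))))))
          ≈[ 5× σ ] 𝔼 X (λ x′ → 𝔼 new (λ q → 𝔼 X (λ x → 𝔼 Z (λ z → φ (pairX z (r , x′) * inv (pairD z (q , x)))))))

        first : Supp old (λ r → Ev (λ Z → First-result Z r))
        first = All.tabulate λ {r} m → go r (All.lookup old>0 m) (All.lookup old≥ m) (All.map (λ h → All.lookup h m) old>X) (All.lookup new-inv m)
          where
          go : ∀ r → 0ℚ < r → 1ℚ ≤ e * r → Supp X (_< r) → Supp X (λ x → Inv σ (r - x) x new) → Ev (λ Z → First-result Z r)
          go r r>0 er≥1 x<r n-inv = Ev-map (λ Z rdy φ S → ≈-respˡ (fix Z φ (λ z q x → k q * ((z + q) * (z + x)))) (≈-respʳ (fix Z φ (λ z q x → k q * ((z + q) * (z + D q)))) (First.result r r>0 er≥1 x<r n-inv (First.c₄ r r>0 er≥1 x<r n-inv) Z rdy φ S)))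
            (First.ready r r>0 er≥1 x<r n-inv (First.c₄ r r>0 er≥1 x<r n-inv))
            where
            sh : ∀ k r x z → k * ((z + x) * (z + (x + (r - x)))) ≡ k * ((z + r) * (z + x))
            sh = solve-∀ ring
            fix : ∀ Z φ (h : ℚ → ℚ → ℚ → ℚ) →
              𝔼 X (λ x′ → 𝔼 new (λ q → 𝔼 X (λ x → 𝔼 Z (λ z → φ (k r * ((z + x′) * (z + (x′ + (r - x′)))) * inv (h z q x))))))
              ≡ 𝔼 X (λ x′ → 𝔼 new (λ q → 𝔼 X (λ x → 𝔼 Z (λ z → φ (k r * ((z + r) * (z + x′)) * inv (h z q x))))))
            fix Z φ h = 𝔼-cong X (λ x′ → 𝔼-cong new (λ q → 𝔼-cong X (λ x → 𝔼-cong Z (λ z → cong (λ w → φ (w * inv (h z q x))) (sh (k r) r x′ z)))))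

        Second-result : Law ℚ → Set
        Second-result Z = ∀ φ → State φ →
          𝔼 old (λ r → 𝔼 new (λ q → 𝔼 X (λ x → 𝔼 Z (λ z → φ (pairD z (r , x) * inv (pairX z (q , x)))))))
          ≈[ 5× σ ] 𝔼 old (λ r → 𝔼 new (λ q → 𝔼 X (λ x → 𝔼 Z (λ z → φ (pairD z (r , x) * inv (pairD z (q , x)))))))

        second : Ev Second-result
        second = Ev-map (λ Z rdy φ S → ≈-respˡ (fix Z φ (λ z q x → k q * ((z + q) * (z + x)))) (≈-respʳ (fix Z φ (λ z q x → k q * ((z + q) * (z + D q)))) (Second.result Second.c₄ Z rdy φ S)))
          (Second.ready Second.c₄)
          where
          sh : ∀ k r t z → k * ((z + (r - t)) * (z + (r - t + t))) ≡ k * ((z + r) * (z + (r - t)))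
          sh = solve-∀ ring
          fix : ∀ Z φ (h : ℚ → ℚ → ℚ → ℚ) →
            𝔼 old (λ r → 𝔼 new (λ q → 𝔼 X (λ x → 𝔼 Z (λ z → φ (k r * ((z + D r) * (z + (D r + θ * s r))) * inv (h z q x))))))
            ≡ 𝔼 old (λ r → 𝔼 new (λ q → 𝔼 X (λ x → 𝔼 Z (λ z → φ (k r * ((z + r) * (z + D r)) * inv (h z q x))))))
          fix Z φ h = 𝔼-cong old (λ r → 𝔼-cong new (λ q → 𝔼-cong X (λ x → 𝔼-cong Z (λ z → cong (λ w → φ (w * inv (h z q x))) (sh (k r) r (θ * s r) z)))))

        -- The averaged differences of `new` are tested against the two halves of the differences of
        -- `old` separately; `first` and `second` bound these by `5× σ` each.
        cross : Ev (λ Z → ∀ φ → State φ → Cross φ Z X new old ≤ 5× σ + 5× σ)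
        cross = Ev-map go (Ev-∧ (Ev-All first) second)
          where
          go : ∀ Z → Supp old (First-result Z) × Second-result Z → ∀ φ → State φ → Cross φ Z X new old ≤ 5× σ + 5× σ
          go Z (f , g) φ S = begin
            Cross φ Z X new old ≡⟨ reorder ⟩
            (G₁ - G₂) - (H₁ - H₂) ≤⟨ ≤-by (+≥0 (diff≥0 (proj₁ G)) (diff≥0 (proj₂ H))) (fin G₁ G₂ H₁ H₂ (5× σ)) ⟩
            5× σ + 5× σ ∎
            where
            open ≤-Reasoning
            open State S
            mean : (ℚ → ℚ × ℚ → ℚ × ℚ → ℚ) → ℚ
            mean f = 𝔼 (old ⊗ X) (λ j → 𝔼 (new ⊗ X) (λ i → 𝔼 Z (λ z → f z i j)))
            G₁ = mean (λ z i j → φ (pairX z j * inv (pairX z i)))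
            G₂ = mean (λ z i j → φ (pairX z j * inv (pairD z i)))
            H₁ = mean (λ z i j → φ (pairD z j * inv (pairX z i)))
            H₂ = mean (λ z i j → φ (pairD z j * inv (pairD z i)))
            mean-- : ∀ f g → mean (λ z i j → f z i j - g z i j) ≡ mean f - mean g
            mean-- f g = trans (𝔼-cong (old ⊗ X) (λ j → trans (𝔼-cong (new ⊗ X) (λ i → 𝔼-- Z _ _)) (𝔼-- (new ⊗ X) _ _))) (𝔼-- (old ⊗ X) _ _)
            unfold : ∀ f → mean f ≡ 𝔼 old (λ r → 𝔼 X (λ x′ → 𝔼 new (λ q → 𝔼 X (λ x → 𝔼 Z (λ z → f z (q , x) (r , x′))))))
            unfold f = trans (𝔼-⊗ old X _) (𝔼-cong old (λ r → 𝔼-cong X (λ x′ → 𝔼-⊗ new X _)))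
            sp : ∀ z i j → Q φ (pairX z i) (pairD z i) (pairX z j) (pairD z j) ≡
              (φ (pairX z j * inv (pairX z i)) - φ (pairX z j * inv (pairD z i))) - (φ (pairD z j * inv (pairX z i)) - φ (pairD z j * inv (pairD z i)))
            sp z i j = trans (Q-sym S (pairX z i) (pairD z i) (pairX z j) (pairD z j)) (p (φ (pairX z j * inv (pairX z i))) (φ (pairX z j * inv (pairD z i))) (φ (pairD z j * inv (pairX z i))) (φ (pairD z j * inv (pairD z i))))
              where
              p : ∀ a b c d → a - b - c + d ≡ (a - b) - (c - d)
              p = solve-∀ ring
            reorder : Cross φ Z X new old ≡ (G₁ - G₂) - (H₁ - H₂)
            reorder = trans (trans (𝔼-swap Z (new ⊗ X) _) (trans (𝔼-cong (new ⊗ X) (λ i → 𝔼-swap Z (old ⊗ X) _)) (𝔼-swap (new ⊗ X) (old ⊗ X) _)))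
              (trans (𝔼-cong (old ⊗ X) (λ j → 𝔼-cong (new ⊗ X) (λ i → 𝔼-cong Z (λ z → sp z i j))))
                (trans (mean-- _ _) (cong₂ _-_ (mean-- _ _) (mean-- _ _))))
            G : G₁ ≈[ 5× σ ] G₂
            G = ≈-respˡ (sym (unfold _)) (≈-respʳ (sym (unfold _)) (≈-𝔼 old (All.map (λ h → h φ S) f)))
            H : H₁ ≈[ 5× σ ] H₂
            H = ≈-respˡ (sym (trans (unfold _) (𝔼-cong old (λ r → 𝔼-const X _)))) (≈-respʳ (sym (trans (unfold _) (𝔼-cong old (λ r → 𝔼-const X _)))) (g φ S))
            fin : ∀ a b c d t → (b + t - a) + (c + t - d) ≡ t + t - ((a - b) - (c - d))
            fin = solve-∀ ring

open PairedFactors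

-- Spread from invariance, exchange along a tower, and the edge identity.

module EdgeIdentity where
  open import Data.Rational
  open import Data.Rational.Properties

  -- A heavy atom would reappear after translation by each point of a fine grid, and a single point
  -- can be hit by only a small proportion of these translations.
  spread-ev : ∀ {ρ} → 0ℚ < ρ → Ev (Spread ρ)
  spread-ev {ρ} ρ>0 = Ev-map go (Ev-∀∈ (support N) (λ j → Ev-inv {half ρ} {1ℚ} j (half>0 ρ>0) 0<1))
    where
    open Grid (mkGrid (half>0 ρ>0)) renaming (grid to N; spread to N-spread)
    go : ∀ Z → Supp N (λ j → Inv (half ρ) 1ℚ j Z) → Spread ρ Z
    go Z h c = begin
      𝔼 Z (δ c) ≡⟨ sym (𝔼-const N (𝔼 Z (δ c))) ⟩
      𝔼 N (λ j → 𝔼 Z (δ c)) ≤⟨ 𝔼-mono N (All.map (λ {j} i → proj₁ (InvF-≈ {f = λ z → 1ℚ * z + j} {Z = Z} i (δ c) (δ≥0 c) (δ≤1 c))) h) ⟩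
      𝔼 N (λ j → 𝔼 Z (λ z → δ c (1ℚ * z + j)) + half ρ) ≡⟨ 𝔼-+c N (λ j → 𝔼 Z (λ z → δ c (1ℚ * z + j))) (half ρ) ⟩
      𝔼 N (λ j → 𝔼 Z (λ z → δ c (1ℚ * z + j))) + half ρ ≡⟨ cong (_+ half ρ) (𝔼-swap N Z (λ j z → δ c (1ℚ * z + j))) ⟩
      𝔼 Z (λ z → 𝔼 N (λ j → δ c (1ℚ * z + j))) + half ρ
        ≤⟨ +-monoˡ-≤ (half ρ) (𝔼-≤c Z (Supp-all Z (λ z → spread-image {X = N} {c = c} {f = λ j → 1ℚ * z + j} (c - 1ℚ * z) N-spread (λ j eq → trans (cong (_- 1ℚ * z) eq) (e (1ℚ * z) j))))) ⟩
      half ρ + half ρ ≡⟨ half+half ρ ⟩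
      ρ ∎
      where
      open ≤-Reasoning
      e : ∀ x j → x + j - x ≡ j
      e = solve-∀ ring

  sum-≤ : ∀ {A : Set} {c} {l : List A} {f : A → ℚ} → All (λ x → f x ≤ c) l → sum l f ≤ c * fromℕ (length l)
  sum-≤ {c = c} [] = ≤-reflexive (sym (*-zeroʳ c))
  sum-≤ {c = c} {x ∷ l} (p ∷ ps) = ≤-trans (+-mono-≤ p (sum-≤ ps)) (≤-reflexive (e c (fromℕ (length l))))
    where
    e : ∀ c n → c + c * n ≡ c * (1ℚ + n)
    e = solve-∀ ring

  sum-+ : ∀ {A : Set} (l : List A) f g → sum l (λ x → f x + g x) ≡ sum l f + sum l g
  sum-+ [] f g = refl
  sum-+ (x ∷ l) f g = trans (cong (f x + g x +_) (sum-+ l f g)) (e (f x) (g x) (sum l f) (sum l g))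
    where
    e : ∀ a b s t → a + b + (s + t) ≡ a + s + (b + t)
    e = solve-∀ ring

  module _ {A : Set} (B : A → A → ℚ) {c : ℚ} (c≥0 : 0ℚ ≤ c) (B-sym : ∀ x y → B x y ≡ B y x) (B≤2 : ∀ x y → B x y ≤ 2ℚ) where

    sum-sum-≤ : ∀ {l} → AllPairs (λ x y → B x y ≤ c) l →
      sum l (λ x → sum l (B x)) ≤ 2ℚ * fromℕ (length l) + c * (fromℕ (length l) * fromℕ (length l))
    sum-sum-≤ [] = ≤-reflexive (e c)
      where
      e : ∀ c → 0ℚ ≡ (1ℚ + 1ℚ) * 0ℚ + c * (0ℚ * 0ℚ)
      e = solve-∀ ring
    sum-sum-≤ {x ∷ l} (p ∷ ps) = begin
      B x x + sum l (B x) + sum l (λ y → B y x + sum l (B y)) ≡⟨ cong (B x x + sum l (B x) +_) (sum-+ l (λ y → B y x) (λ y → sum l (B y))) ⟩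
      B x x + sum l (B x) + (sum l (λ y → B y x) + sum l (λ y → sum l (B y)))
        ≤⟨ +-mono-≤ (+-mono-≤ (B≤2 x x) (sum-≤ p)) (+-mono-≤ (sum-≤ (All.map (λ {y} h → ≤-trans (≤-reflexive (B-sym y x)) h) p)) (sum-sum-≤ ps)) ⟩
      2ℚ + c * n + (c * n + (2ℚ * n + c * (n * n))) ≤⟨ ≤-by c≥0 (e c n 2ℚ) ⟩
      2ℚ * (1ℚ + n) + c * ((1ℚ + n) * (1ℚ + n)) ∎
      where
      open ≤-Reasoning
      n = fromℕ (length l)
      e : ∀ c n t → c ≡ t * (1ℚ + n) + c * ((1ℚ + n) * (1ℚ + n)) - (t + c * n + (c * n + (t * n + c * (n * n))))
      e = solve-∀ ring

    -- The pairwise bound says nothing about the diagonal, but there the trivial bound 2 suffices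
    -- because its weight is 1/N.
    mean-≤ : ∀ {x l} → AllPairs (λ x y → B x y ≤ c) (x ∷ l) →
      𝔼 (uniform x l) (λ y → 𝔼 (uniform x l) (B y)) ≤ 2ℚ * inv (fromℕ (length (x ∷ l))) + c
    mean-≤ {x} {l} ps = begin
      𝔼 (uniform x l) (λ y → 𝔼 (uniform x l) (B y)) ≡⟨ trans (𝔼-cong (uniform x l) (λ y → 𝔼-uniform x l (B y))) (trans (𝔼-* (uniform x l) w _) (cong (w *_) (𝔼-uniform x l _))) ⟩
      w * (w * sum (x ∷ l) (λ y → sum (x ∷ l) (B y))) ≤⟨ *-monoˡ w≥0 (*-monoˡ w≥0 (sum-sum-≤ ps)) ⟩
      w * (w * (2ℚ * n + c * (n * n))) ≡⟨ e w n c 2ℚ ⟩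
      n * w * (2ℚ * w + n * w * c) ≡⟨ cong (λ u → u * (2ℚ * w + u * c)) (inv-r (>⇒≢ (fromℕ-suc>0 (length l)))) ⟩
      1ℚ * (2ℚ * w + 1ℚ * c) ≡⟨ e′ (2ℚ * w) c ⟩
      2ℚ * w + c ∎
      where
      open ≤-Reasoning
      n = fromℕ (length (x ∷ l))
      w = inv n
      w≥0 : 0ℚ ≤ w
      w≥0 = <⇒≤ (inv-pos (fromℕ-suc>0 (length l)))
      e : ∀ w n c t → w * (w * (t * n + c * (n * n))) ≡ n * w * (t * w + n * w * c)
      e = solve-∀ ring
      e′ : ∀ x c → 1ℚ * (x + 1ℚ * c) ≡ x + c
      e′ = solve-∀ ring

  module Key (a b e : ℚ) (a>0 : 0ℚ < a) (b>0 : 0ℚ < b) (e>0 : 0ℚ < e) (a≢e : a ≢ e) (b≢e : b ≢ e) where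

    open Pairs a b e a>0 b>0 e>0 a≢e b≢e public

    old-ev : ∀ {σ} → 0ℚ < σ → ∀ X → Ev (Old σ X)
    old-ev {σ} σ>0 X = Ev-map (λ d → λ { (p , q , r , t) → record
        { old>0 = p ; old≥ = All.map (λ lt → ≤-trans (≤-reflexive (sym (inv-r (>⇒≢ e>0)))) (*-monoˡ (<⇒≤ e>0) (<⇒≤ lt))) q ; old>X = r ; spread = t } })
      (Ev-∧ (Ev-> 0ℚ) (Ev-∧ (Ev-> (inv e)) (Ev-∧ (Ev-∀∈ (support X) (λ x → Ev-> x)) (spread-ev (eps>0 σ>0)))))

    -- Cauchy-Schwarz is applied to all levels at once. The uncontrolled self-correlation of a level
    -- becomes harmless because it is only one of the many terms in `mean-≤`.
    replace-D : ∀ {σ τ φ} → 0ℚ < σ → 0ℚ < τ → State φ → ∀ Z X d ds →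
      AllPairs (λ d d′ → Cross φ Z X d d′ ≤ 5× σ + 5× σ) (d ∷ ds) →
      2ℚ * inv (fromℕ (length (d ∷ ds))) + (5× σ + 5× σ) ≤ τ * τ → (v : ℚ → ℚ) →
      𝔼 Z (λ z → 𝔼 (uniform d ds) (λ d → 𝔼 (d ⊗ X) (λ i → φ (v z * inv (pairX z i)))))
      ≤ 𝔼 Z (λ z → 𝔼 (uniform d ds) (λ d → 𝔼 (d ⊗ X) (λ i → φ (v z * inv (pairD z i))))) + τ
    replace-D {σ} {τ} {φ} σ>0 τ>0 S Z X d ds ps le v = ≤-by (diff≥0 cs) (fin X̄ D̄ τ)
      where
      U = uniform d ds
      I = bind U (λ d → d ⊗ X)
      X̄ = 𝔼 Z (λ z → 𝔼 U (λ d → 𝔼 (d ⊗ X) (λ i → φ (v z * inv (pairX z i)))))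
      D̄ = 𝔼 Z (λ z → 𝔼 U (λ d → 𝔼 (d ⊗ X) (λ i → φ (v z * inv (pairD z i)))))
      5σ≥0 : 0ℚ ≤ 5× σ + 5× σ
      5σ≥0 = +≥0 p p
        where
        σ≥0 = <⇒≤ σ>0
        p : 0ℚ ≤ 5× σ
        p = +≥0 (+≥0 (+≥0 σ≥0 σ≥0) σ≥0) (+≥0 σ≥0 σ≥0)
      q : ℚ → ℚ × ℚ → ℚ × ℚ → ℚ
      q z i j = Q φ (pairX z i) (pairD z i) (pairX z j) (pairD z j)
      bound : 𝔼 Z (λ z → 𝔼 I (λ i → 𝔼 I (λ j → q z i j))) ≤ τ * τ
      bound = begin
        𝔼 Z (λ z → 𝔼 I (λ i → 𝔼 I (λ j → q z i j)))
          ≡⟨ 𝔼-cong Z (λ z → trans (𝔼-bind U _ _) (𝔼-cong U (λ d → trans (𝔼-cong (d ⊗ X) (λ i → 𝔼-bind U _ _)) (𝔼-swap (d ⊗ X) U _)))) ⟩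
        𝔼 Z (λ z → 𝔼 U (λ d → 𝔼 U (λ d′ → 𝔼 (d ⊗ X) (λ i → 𝔼 (d′ ⊗ X) (λ j → q z i j)))))
          ≡⟨ trans (𝔼-swap Z U _) (𝔼-cong U (λ d → 𝔼-swap Z U _)) ⟩
        𝔼 U (λ d → 𝔼 U (λ d′ → Cross φ Z X d d′)) ≤⟨ mean-≤ (Cross φ Z X) 5σ≥0 (Cross-sym S Z X) (Cross≤2 S Z X) ps ⟩
        2ℚ * inv (fromℕ (length (d ∷ ds))) + (5× σ + 5× σ) ≤⟨ le ⟩
        τ * τ ∎
        where open ≤-Reasoning
      cs : X̄ - D̄ ≤ τ
      cs = subst (_≤ τ) (trans (𝔼-cong Z (λ z → trans (𝔼-bind U _ _) (trans (𝔼-cong U (λ d → 𝔼-- (d ⊗ X) _ _)) (𝔼-- U _ _)))) (𝔼-- Z _ _))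
        (cauchy-schwarz S Z I v pairX pairD τ>0 bound)
      fin : ∀ a b τ → τ - (a - b) ≡ b + τ - a
      fin = solve-∀ ring

    -- Here both positions, x and q, are spread in their own right, so a single law suffices. The
    -- multiplier k q varies with q, which is the reason for having `near` with arbitrary
    -- multipliers.
    replace-q : ∀ {σ} → 0ℚ < σ → ∀ X d → Spread (eps σ) X → Old σ X d → Ev (λ Z → ∀ φ → State φ → (v : ℚ → ℚ) →
      𝔼 Z (λ z → 𝔼 (d ⊗ X) (λ i → φ (v z * inv (k (proj₁ i) * (z + proj₂ i))))) ≈[ σ ]
      𝔼 Z (λ z → 𝔼 (d ⊗ X) (λ i → φ (v z * inv (k (proj₁ i) * (z + proj₁ i))))))
    replace-q {σ} σ>0 X d X-spread O = Ev-map go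
      (Ev-∀∈ (support (d ⊗ X)) λ i → Ev-∀∈ (support (d ⊗ X)) λ j →
        Ev-∧ (Ev-∧ (near (proj₂ i) (proj₂ j) ε>0) (near (proj₂ i) (proj₁ j) ε>0)) (Ev-∧ (near (proj₁ i) (proj₂ j) ε>0) (near (proj₁ i) (proj₁ j) ε>0)))
      where
      open Old O
      ε>0 = eps>0 σ>0
      go : ∀ Z → _ → _
      go Z h φ S v = replace S Z (d ⊗ X) (k ∘ proj₁) proj₂ proj₁ (κ φ Z) σ>0 (<⇒≤ ε>0) (twelve σ>0)
        (All.map (λ {i} → All.map (λ {j} → λ { ((p , q) , (r , t)) →
          (p φ S (k (proj₁ i)) (k (proj₁ j)) , q φ S (k (proj₁ i)) (k (proj₁ j))) , (r φ S (k (proj₁ i)) (k (proj₁ j)) , t φ S (k (proj₁ i)) (k (proj₁ j))) })) h)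
        (𝔼-≤c (d ⊗ X) (Supp-all (d ⊗ X) (λ i → onX (proj₂ i))))
        (𝔼-≤c (d ⊗ X) (Supp-all (d ⊗ X) (λ i → onX (proj₁ i))))
        (𝔼-≤c (d ⊗ X) (Supp-all (d ⊗ X) (λ i → subst (_≤ eps σ) (sym (trans (𝔼-⊗ d X _) (𝔼-cong d (λ q → 𝔼-const X _)))) (spread (proj₁ i)))))
        v
        where
        onX : ∀ c → 𝔼 (d ⊗ X) (λ j → δ c (proj₂ j)) ≤ eps σ
        onX c = subst (_≤ eps σ) (sym (𝔼-⊗ d X _)) (𝔼-≤c d (Supp-all d (λ _ → X-spread c)))

    infixl 8 _∘ₘ_
    -- For positive arguments this is addition of reciprocals: 1 / (q ∘ₘ z) = 1 / q + 1 / z.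
    _∘ₘ_ : ℚ → ℚ → ℚ
    q ∘ₘ z = q * z * inv (q + z)

    -- The numerator of 1 + c (q ∘ₘ z) over the denominator z + q.
    lift-root : ∀ c q z → ℚ
    lift-root c q z = (1ℚ + c * q) * z + q

    s-∘ : ∀ {q z} → 0ℚ < q → 0ℚ < z → s (q ∘ₘ z) ≡ lift-root a q z * lift-root b q z * inv ((z + q) * lift-root e q z)
    s-∘ {q} {z} q>0 z>0 = trans (s-def (q ∘ₘ z)) (begin
      (1ℚ + a * (q ∘ₘ z)) * (1ℚ + b * (q ∘ₘ z)) * inv (1ℚ + e * (q ∘ₘ z))
        ≡⟨ cong₂ (λ x y → x * inv y) (cong₂ _*_ (root a) (root b)) (root e) ⟩
      lift-root a q z * i * (lift-root b q z * i) * inv (lift-root e q z * i)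
        ≡⟨ cong₂ _*_ (h₁ (lift-root a q z) (lift-root b q z) i) (cong inv (*-comm (lift-root e q z) i)) ⟩
      i * (lift-root a q z * lift-root b q z * i) * inv (i * lift-root e q z)
        ≡⟨ cancel-ratio (inv-≢0 (>⇒≢ w>0)) (lift-root a q z * lift-root b q z * i) (lift-root e q z) ⟩
      lift-root a q z * lift-root b q z * i * inv (lift-root e q z) ≡⟨ *-assoc (lift-root a q z * lift-root b q z) i (inv (lift-root e q z)) ⟩
      lift-root a q z * lift-root b q z * (i * inv (lift-root e q z)) ≡⟨ cong (lift-root a q z * lift-root b q z *_) (sym (inv-* (z + q) (lift-root e q z))) ⟩
      lift-root a q z * lift-root b q z * inv ((z + q) * lift-root e q z) ∎)
      where
      open ≡-Reasoning
      i = inv (z + q)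
      w>0 : 0ℚ < z + q
      w>0 = +>0 z>0 (<⇒≤ q>0)
      h₁ : ∀ x y i → x * i * (y * i) ≡ i * (x * y * i)
      h₁ = solve-∀ ring
      root : ∀ c → 1ℚ + c * (q ∘ₘ z) ≡ lift-root c q z * i
      root c = trans (cong₂ (λ x y → x + c * (q * z * inv y)) (sym (inv-r (>⇒≢ w>0))) (+-comm q z)) (h c q z i)
        where
        h : ∀ c q z i → (z + q) * i + c * (q * z * i) ≡ ((1ℚ + c * q) * z + q) * i
        h = solve-∀ ring

    slope : ℚ → ℚ
    slope q = (1ℚ + a * q) * (1ℚ + b * q) * inv (a * b * (q * q))

    slope>0 : ∀ {q} → 0ℚ < q → 0ℚ < slope q
    slope>0 q>0 = *>0 (*>0 (1+>0 a>0 q>0) (1+>0 b>0 q>0)) (inv-pos (*>0 (*>0 a>0 b>0) (*>0 q>0 q>0)))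

    roots : ℚ → ℚ
    roots z = (z + - inv a) * (z + - inv b)

    -- Put w + q = slope q · (z + q). Multiplied by a b q², each of the four factors in w becomes a
    -- factor of s (q ∘ₘ z) times a function of q alone. These functions are A, B, A B and s q, and
    -- they cancel against k q = 1 / s q.
    edge-arg : ∀ {q z} → 0ℚ < q → 0ℚ < z →
      roots (slope q * z + (slope q * q - q)) * inv (k q * ((slope q * z + (slope q * q - q) + q) * (slope q * z + (slope q * q - q) + D q)))
      ≡ s (q ∘ₘ z)
    edge-arg {q} {z} q>0 z>0 = trans (begin
      (w + - inv a) * (w + - inv b) * inv (k q * ((w + q) * (w + D q)))
        ≡⟨ sym (cancel-ratio (>⇒≢ (*>0 c>0 c>0)) _ _) ⟩
      c * c * ((w + - inv a) * (w + - inv b)) * inv (c * c * (k q * ((w + q) * (w + D q))))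
        ≡⟨ cong₂ (λ x y → x * inv y) (trans (p₁ c (w + - inv a) (w + - inv b)) (cong₂ _*_ fa fb)) (trans (p₂ c (k q) (w + q) (w + D q)) (cong₂ (λ x y → k q * (x * y)) fq fD)) ⟩
      A * (B * z + q) * (B * (A * z + q)) * inv (k q * (A * B * (z + q) * (s q * (C * z + q))))
        ≡⟨ cong₂ (λ x y → x * inv y) (p₃ A B (A * z + q) (B * z + q)) (trans (p₄ (k q) (A * B) (z + q) (s q) (C * z + q)) (cong (λ x → A * B * (x * ((z + q) * (C * z + q)))) (inv-r (>⇒≢ (s>0 q>0))))) ⟩
      A * B * ((A * z + q) * (B * z + q)) * inv (A * B * (1ℚ * ((z + q) * (C * z + q))))
        ≡⟨ cancel-ratio (>⇒≢ (*>0 (1+>0 a>0 q>0) (1+>0 b>0 q>0))) _ _ ⟩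
      (A * z + q) * (B * z + q) * inv (1ℚ * ((z + q) * (C * z + q))) ≡⟨ cong (λ x → (A * z + q) * (B * z + q) * inv x) (*-identityˡ ((z + q) * (C * z + q))) ⟩
      (A * z + q) * (B * z + q) * inv ((z + q) * (C * z + q)) ∎) (sym (s-∘ q>0 z>0))
      where
      open ≡-Reasoning
      A = 1ℚ + a * q
      B = 1ℚ + b * q
      C = 1ℚ + e * q
      w = slope q * z + (slope q * q - q)
      c = a * b * (q * q)
      c>0 : 0ℚ < c
      c>0 = *>0 (*>0 a>0 b>0) (*>0 q>0 q>0)
      cs : c * slope q ≡ A * B
      cs = trans (h c (A * B) (inv c)) (trans (cong (_* (A * B)) (inv-r (>⇒≢ c>0))) (*-identityˡ (A * B)))
        where
        h : ∀ c x i → c * (x * i) ≡ c * i * x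
        h = solve-∀ ring
      fq : c * (w + q) ≡ A * B * (z + q)
      fq = trans (h c (slope q) z q) (cong (_* (z + q)) cs)
        where
        h : ∀ c m z q → c * (m * z + (m * q - q) + q) ≡ c * m * (z + q)
        h = solve-∀ ring
      fa : c * (w + - inv a) ≡ A * (B * z + q)
      fa = trans (h a b q w (inv a)) (trans (cong₂ (λ x y → x - a * b * (q * q) * q - b * (q * q) * y) fq (inv-r (>⇒≢ a>0))) (h′ a b q z))
        where
        h : ∀ a b q w i → a * b * (q * q) * (w + - i) ≡ a * b * (q * q) * (w + q) - a * b * (q * q) * q - b * (q * q) * (a * i)
        h = solve-∀ ring
        h′ : ∀ a b q z → (1ℚ + a * q) * (1ℚ + b * q) * (z + q) - a * b * (q * q) * q - b * (q * q) * 1ℚ ≡ (1ℚ + a * q) * ((1ℚ + b * q) * z + q)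
        h′ = solve-∀ ring
      fb : c * (w + - inv b) ≡ B * (A * z + q)
      fb = trans (h a b q w (inv b)) (trans (cong₂ (λ x y → x - a * b * (q * q) * q - a * (q * q) * y) fq (inv-r (>⇒≢ b>0))) (h′ a b q z))
        where
        h : ∀ a b q w i → a * b * (q * q) * (w + - i) ≡ a * b * (q * q) * (w + q) - a * b * (q * q) * q - a * (q * q) * (b * i)
        h = solve-∀ ring
        h′ : ∀ a b q z → (1ℚ + a * q) * (1ℚ + b * q) * (z + q) - a * b * (q * q) * q - a * (q * q) * 1ℚ ≡ (1ℚ + b * q) * ((1ℚ + a * q) * z + q)
        h′ = solve-∀ ring
      fD : c * (w + D q) ≡ s q * (C * z + q)
      fD = trans (h (a * b) q w (s q) e (inv (a * b))) (trans (cong₂ (λ x y → x - y * (e * (q * q) * s q)) fq (inv-r (>⇒≢ (*>0 a>0 b>0))))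
        (trans (cong (λ x → x * (z + q) - 1ℚ * (e * (q * q) * s q)) (sym (s-mul q>0))) (h′ e q z (s q))))
        where
        h : ∀ m q w s e i → m * (q * q) * (w + (q - e * i * s)) ≡ m * (q * q) * (w + q) - m * i * (e * (q * q) * s)
        h = solve-∀ ring
        h′ : ∀ e q z s → s * (1ℚ + e * q) * (z + q) - 1ℚ * (e * (q * q) * s) ≡ s * ((1ℚ + e * q) * z + q)
        h′ = solve-∀ ring
      p₁ : ∀ c x y → c * c * (x * y) ≡ c * x * (c * y)
      p₁ = solve-∀ ring
      p₂ : ∀ c k x y → c * c * (k * (x * y)) ≡ k * (c * x * (c * y))
      p₂ = solve-∀ ring
      p₃ : ∀ A B x y → A * y * (B * x) ≡ A * B * (x * y)
      p₃ = solve-∀ ring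
      p₄ : ∀ k m x s y → k * (m * x * (s * y)) ≡ m * (s * k * (x * y))
      p₄ = solve-∀ ring

    edge : ∀ {η} → 0ℚ < η → ∀ {q} → 0ℚ < q → Ev (λ Z → ∀ φ → State φ →
      𝔼 Z (λ z → φ (roots z * inv (k q * ((z + q) * (z + D q))))) ≈[ η ] 𝔼 Z (λ z → φ (s (q ∘ₘ z))))
    edge {η} η>0 {q} q>0 = Ev-map (λ Z → λ { (h , z>0) φ S → ≈-respʳ (𝔼-cong∈ Z (All.map (λ p → cong φ (edge-arg q>0 p)) z>0))
        (InvF-≈ {f = λ z → slope q * z + (slope q * q - q)} {Z = Z} h (λ z → φ (roots z * inv (k q * ((z + q) * (z + D q))))) (λ z → State.φ≥0 S _) (λ z → State.φ≤1 S _)) })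
      (Ev-∧ (Ev-inv (slope q * q - q) η>0 (slope>0 q>0)) (Ev-> 0ℚ))

open EdgeIdentity

-- The tower estimate for four factors.

module TowerEstimate where
  open import Data.Rational
  open import Data.Rational.Properties

  Ev-→ : ∀ {A : Set} {P : Law ℚ → Set} → Dec A → (A → Ev P) → Ev (λ Z → A → P Z)
  Ev-→ (yes x) f = Ev-map (λ Z p _ → p) (f x)
  Ev-→ (no n) f = Ev-true (λ Z x → ⊥-elim (n x))

  -- The state belonging to the mean of the vectors h drawn from `Y`; with `Y = products X z` it is
  -- the averaged state φ_z of the induction.
  twist : (ℚ → ℚ) → Law ℚ → ℚ → ℚ
  twist φ Y g = 𝔼 Y (λ h → 𝔼 Y (λ h′ → φ (g * (h * inv h′))))

  products : Law ℚ → ℚ → Law ℚ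
  products X z = bind X (λ x → bind X (λ y → point ((z + x) * (z + y))))

  𝔼-products : ∀ X z f → 𝔼 (products X z) f ≡ 𝔼 X (λ x → 𝔼 X (λ y → f ((z + x) * (z + y))))
  𝔼-products X z f = trans (𝔼-bind X _ f) (𝔼-cong X (λ x → trans (𝔼-bind X _ f) (𝔼-cong X (λ y → 𝔼-point ((z + x) * (z + y)) f))))

  -- A supply of laws that carry `Pay` and in addition satisfy any prescribed eventual property. The
  -- induction hypothesis takes this form because each level of a tower is subject to conditions
  -- read off from the earlier levels.
  Source : (Law ℚ → Set) → Set₁
  Source Pay = ∀ {P : Law ℚ → Set} → Ev P → Σ (Law ℚ) λ d → P d × Pay d

  module Chain (a b e : ℚ) (a>0 : 0ℚ < a) (b>0 : 0ℚ < b) (e>0 : 0ℚ < e) (a≢e : a ≢ e) (b≢e : b ≢ e) (a<b : a < b) where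

    open Key a b e a>0 b>0 e>0 a≢e b≢e public

    -- Invariance is available for positive slopes only, so a pair x₁ < x₂ has to be mapped in order
    -- onto the positions of the factors of `roots`; these satisfy -1/a < -1/b because a < b.
    gap : ℚ
    gap = - inv b - - inv a

    gap>0 : 0ℚ < gap
    gap>0 = diff>0 (neg-antimono-< (subst₂ _<_ (h b a (>⇒≢ a>0)) (trans (cong (_* inv b) (*-comm (inv a) b)) (trans (*-assoc b (inv a) (inv b)) (trans (cong (b *_) (*-comm (inv a) (inv b))) (trans (sym (*-assoc b (inv b) (inv a))) (trans (cong (_* inv a) (inv-r (>⇒≢ b>0))) (*-identityˡ (inv a)))))))
        (*-monoˡ-<-pos (inv b) {{positive (inv-pos b>0)}} (*-monoʳ-<-pos (inv a) {{positive (inv-pos a>0)}} a<b))))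
      where
      h : ∀ b a → a ≢ 0ℚ → inv a * a * inv b ≡ inv b
      h b a n = trans (cong (_* inv b) (trans (*-comm (inv a) a) (inv-r n))) (*-identityˡ (inv b))

    scale : ℚ → ℚ → ℚ
    scale x₁ x₂ = (x₂ - x₁) * inv gap

    scale>0 : ∀ {x₁ x₂} → x₁ < x₂ → 0ℚ < scale x₁ x₂
    scale>0 lt = *>0 (diff>0 lt) (inv-pos gap>0)

    -- The affine coordinate in which x₁ becomes -1/a and x₂ becomes -1/b.
    place : ℚ → ℚ → ℚ → ℚ
    place x₁ x₂ x = - inv a + (x - x₁) * inv (scale x₁ x₂)

    Xs : Law ℚ → ℚ → ℚ → Law ℚ
    Xs X x₁ x₂ = image (place x₁ x₂) X

    Xs-spread : ∀ {ρ X x₁ x₂} → x₁ < x₂ → Spread ρ X → Spread ρ (Xs X x₁ x₂)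
    Xs-spread {ρ} {X} {x₁} {x₂} lt sp c = subst (_≤ ρ) (sym (𝔼-image (place x₁ x₂) X (δ c)))
      (spread-image {X = X} {c = c} {f = place x₁ x₂} ((c - - inv a) * l + x₁) sp (λ x eq → trans (cong (λ w → (w - - inv a) * l + x₁) eq)
        (trans (h (- inv a) x x₁ (inv l) l) (trans (cong (λ w → w * (x - x₁) + x₁) (inv-r (>⇒≢ (scale>0 lt)))) (h′ x x₁)))))
      where
      l = scale x₁ x₂
      h : ∀ r x y i l → (r + (x - y) * i - r) * l + y ≡ l * i * (x - y) + y
      h = solve-∀ ring
      h′ : ∀ x y → 1ℚ * (x - y) + y ≡ x
      h′ = solve-∀ ring

    lift : ∀ {η x₁ x₂} → 0ℚ < η → x₁ < x₂ → Ev (λ Z → ∀ φ → State φ → ∀ m x₃ x₄ →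
      𝔼 Z (λ z → φ ((z + x₁) * (z + x₂) * inv (m * ((z + x₃) * (z + x₄))))) ≈[ η ]
      𝔼 Z (λ z → φ (roots z * inv (m * ((z + place x₁ x₂ x₃) * (z + place x₁ x₂ x₄))))))
    lift {η} {x₁} {x₂} η>0 lt = Ev-map (λ Z h φ S m x₃ x₄ → ≈-respʳ (𝔼-cong Z (λ z → cong φ (arg z m x₃ x₄)))
        (InvF-≈ {f = λ z → l * z + (l * - inv a - x₁)} {Z = Z} h (λ z → φ ((z + x₁) * (z + x₂) * inv (m * ((z + x₃) * (z + x₄))))) (λ z → State.φ≥0 S _) (λ z → State.φ≤1 S _)))
      (Ev-inv (l * - inv a - x₁) η>0 l>0)
      where
      l = scale x₁ x₂
      l>0 : 0ℚ < l
      l>0 = scale>0 lt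
      f₁ : ∀ z → l * z + (l * - inv a - x₁) + x₁ ≡ l * (z + - inv a)
      f₁ z = h l z (- inv a) x₁
        where
        h : ∀ l z r x → l * z + (l * r - x) + x ≡ l * (z + r)
        h = solve-∀ ring
      f₂ : ∀ z → l * z + (l * - inv a - x₁) + x₂ ≡ l * (z + - inv b)
      f₂ z = trans (h l z (- inv a) x₁ x₂) (trans (cong (λ w → l * (z + - inv a) + w) (sym lg)) (h′ l z (- inv a) (- inv b)))
        where
        h : ∀ l z r x y → l * z + (l * r - x) + y ≡ l * (z + r) + (y - x)
        h = solve-∀ ring
        h′ : ∀ l z r r′ → l * (z + r) + l * (r′ - r) ≡ l * (z + r′)
        h′ = solve-∀ ring
        lg : l * gap ≡ x₂ - x₁
        lg = trans (*-assoc (x₂ - x₁) (inv gap) gap) (trans (cong ((x₂ - x₁) *_) (trans (*-comm (inv gap) gap) (inv-r (>⇒≢ gap>0)))) (*-identityʳ (x₂ - x₁)))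
      f₃ : ∀ z x → l * z + (l * - inv a - x₁) + x ≡ l * (z + place x₁ x₂ x)
      f₃ z x = sym (trans (h l z (- inv a) x x₁ (inv l)) (trans (cong (λ w → l * (z + - inv a) + w * (x - x₁)) (inv-r (>⇒≢ l>0))) (h′ l z (- inv a) x x₁)))
        where
        h : ∀ l z r x y i → l * (z + (r + (x - y) * i)) ≡ l * (z + r) + l * i * (x - y)
        h = solve-∀ ring
        h′ : ∀ l z r x y → l * (z + r) + 1ℚ * (x - y) ≡ l * z + (l * r - y) + x
        h′ = solve-∀ ring
      arg : ∀ z m x₃ x₄ → let w = l * z + (l * - inv a - x₁) in
        (w + x₁) * (w + x₂) * inv (m * ((w + x₃) * (w + x₄))) ≡ roots z * inv (m * ((z + place x₁ x₂ x₃) * (z + place x₁ x₂ x₄)))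
      arg z m x₃ x₄ = trans (cong₂ (λ x y → x * inv y) (trans (cong₂ _*_ (f₁ z) (f₂ z)) (h l (z + - inv a) (z + - inv b)))
          (trans (cong₂ (λ x y → m * (x * y)) (f₃ z x₃) (f₃ z x₄)) (h′ l m (z + place x₁ x₂ x₃) (z + place x₁ x₂ x₄))))
        (cancel-ratio (*-≢0 (>⇒≢ l>0) (>⇒≢ l>0)) (roots z) _)
        where
        h : ∀ l x y → l * x * (l * y) ≡ l * l * (x * y)
        h = solve-∀ ring
        h′ : ∀ l m x y → m * (l * x * (l * y)) ≡ l * l * (m * (x * y))
        h′ = solve-∀ ring

    module Build {σ} (σ>0 : 0ℚ < σ) (X : Law ℚ) (X-spread : Spread (eps σ) X) where

      -- The same tower has to serve every pair x₁ < x₂ of `X`, each of which rescales `X` in its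
      -- own way.
      Linked : Law ℚ → Set
      Linked d = Supp X (λ x₁ → Supp X (λ x₂ → x₁ < x₂ → Old σ (Xs X x₁ x₂) d))

      Pair : Law ℚ → Law ℚ → Set
      Pair new old = Supp X (λ x₁ → Supp X (λ x₂ → x₁ < x₂ → Ev (λ Z → ∀ φ → State φ → Cross φ Z (Xs X x₁ x₂) new old ≤ 5× σ + 5× σ)))

      linked : Ev Linked
      linked = Ev-∀∈ (support X) (λ x₁ → Ev-∀∈ (support X) (λ x₂ → Ev-→ (x₁ <? x₂) (λ lt → old-ev σ>0 (Xs X x₁ x₂))))

      pair : ∀ {old} → Linked old → Ev (λ new → Pair new old)
      pair {old} L = Ev-All (All.map (λ {x₁} L₁ → Ev-All (All.map (λ {x₂} O → Ev-→ (x₁ <? x₂) (λ lt →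
        Ev-map (λ new N → cross σ>0 (Xs X x₁ x₂) (Xs-spread lt X-spread) old (O lt) N)
          (new-ev σ>0 (Xs X x₁ x₂) (Xs-spread lt X-spread) old (O lt)))) L₁)) L)

      record Towers (Pay : Law ℚ → Set) (n : ℕ) : Set where
        field
          top    : Law ℚ
          rest   : List (Law ℚ)
          size   : length rest ≡ n
          each   : All (λ d → Pay d × Linked d) (top ∷ rest)
          pairs  : AllPairs Pair (top ∷ rest)

      module _ {Pay : Law ℚ → Set} (src : Source Pay) where
        -- Later choices are put in front, so that every entry is `new` relative to all entries
        -- behind it.
        towers : ∀ n → Towers Pay n
        towers ℕ.zero = record { top = proj₁ d ; rest = [] ; size = refl ; each = (proj₂ (proj₂ d) , proj₁ (proj₂ d)) ∷ [] ; pairs = [] ∷ [] }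
          where
          d : Σ (Law ℚ) λ d → Linked d × Pay d
          d = src linked
        towers (ℕ.suc n) = record
          { top = proj₁ d ; rest = top ∷ rest ; size = cong ℕ.suc size
          ; each = (proj₂ (proj₂ d) , proj₁ (proj₁ (proj₂ d))) ∷ each ; pairs = proj₂ (proj₁ (proj₂ d)) ∷ pairs }
          where
          open Towers (towers n)
          d : Σ (Law ℚ) λ d → (Linked d × All (Pair d) (top ∷ rest)) × Pay d
          d = src (Ev-∧ linked (Ev-All (All.map (λ h → pair (proj₂ h)) each)))

      module _ {κ₀} (κ>0 : 0ℚ < κ₀) (d : Law ℚ) (ds : List (Law ℚ)) (link : All Linked (d ∷ ds)) (prs : AllPairs Pair (d ∷ ds))
        (le : 2ℚ * inv (fromℕ (length (d ∷ ds))) + (5× σ + 5× σ) ≤ κ₀ * κ₀) where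

        U : Law (Law ℚ)
        U = uniform d ds

        edges : (ℚ → ℚ) → Law ℚ → ℚ
        edges φ Z = 𝔼 U (λ d → 𝔼 d (λ q → 𝔼 Z (λ z → φ (s (q ∘ₘ z)))))

        four : (ℚ → ℚ) → Law ℚ → ℚ → ℚ → ℚ
        four φ Z x₁ x₂ = 𝔼 U (λ d → 𝔼 d (λ q → 𝔼 X (λ x₃ → 𝔼 X (λ x₄ → 𝔼 Z (λ z → φ ((z + x₁) * (z + x₂) * inv (k q * ((z + x₃) * (z + x₄)))))))))

        -- Three times σ for the affine change, the exchange of x₃ for q and the edge identity; κ₀
        -- for the exchange of x₄ for D q.
        err : ℚ
        err = σ + σ + κ₀ + σ

        four-≤ : ∀ {x₁ x₂} → x₁ < x₂ → All (Old σ (Xs X x₁ x₂)) (d ∷ ds) →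
          AllPairs (λ new old → Ev (λ Z → ∀ φ → State φ → Cross φ Z (Xs X x₁ x₂) new old ≤ 5× σ + 5× σ)) (d ∷ ds) →
          Ev (λ Z → ∀ φ → State φ → four φ Z x₁ x₂ ≤ edges φ Z + err)
        four-≤ {x₁} {x₂} lt olds crosses = Ev-map go
          (Ev-∧ (Ev-∧ (lift σ>0 lt) (Ev-AllPairs crosses))
                (Ev-∧ (Ev-All (All.map (λ {d} O → replace-q σ>0 X̂ d (Xs-spread lt X-spread) O) olds))
                      (Ev-All (All.map (λ {d} O → Ev-All (All.map (λ p → edge σ>0 p) (Old.old>0 O))) olds))))
          where
          X̂ = Xs X x₁ x₂
          Ev-AllPairs : ∀ {A : Set} {R : A → A → Law ℚ → Set} {l : List A} → AllPairs (λ x y → Ev (R x y)) l → Ev (λ Z → AllPairs (λ x y → R x y Z) l)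
          Ev-AllPairs [] = Ev-true (λ _ → [])
          Ev-AllPairs (p ∷ ps) = Ev-map (λ Z → λ { (x , y) → x ∷ y }) (Ev-∧ (Ev-All p) (Ev-AllPairs ps))
          go : ∀ Z → _ → ∀ φ → State φ → four φ Z x₁ x₂ ≤ edges φ Z + err
          go Z ((lf , cr) , (rq , ed)) φ S = begin
            four φ Z x₁ x₂ ≤⟨ proj₁ stepA ⟩
            -- x₃ is turned into q before x₄ is turned into D q, because `pairX` in the second
            -- exchange already contains z + q.
            S₂ + σ ≤⟨ +-monoˡ-≤ σ (proj₁ stepC) ⟩
            S₃ + σ + σ ≤⟨ +-monoˡ-≤ σ (+-monoˡ-≤ σ stepB) ⟩
            S₄ + κ₀ + σ + σ ≤⟨ +-monoˡ-≤ σ (+-monoˡ-≤ σ (+-monoˡ-≤ κ₀ (proj₁ stepE))) ⟩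
            edges φ Z + σ + κ₀ + σ + σ ≡⟨ fin (edges φ Z) σ κ₀ ⟩
            edges φ Z + err ∎
            where
            open ≤-Reasoning
            f₂ : ℚ → ℚ → ℚ → ℚ
            f₂ q x₃ x₄ = 𝔼 Z (λ z → φ (roots z * inv (k q * ((z + x₃) * (z + x₄)))))
            S₂ = 𝔼 U (λ d → 𝔼 d (λ q → 𝔼 X̂ (λ x₃ → 𝔼 X̂ (λ x₄ → f₂ q x₃ x₄))))
            S₃ = 𝔼 U (λ d → 𝔼 d (λ q → 𝔼 X̂ (λ x₄ → f₂ q q x₄)))
            S₄ = 𝔼 U (λ d → 𝔼 d (λ q → f₂ q q (D q)))
            fin : ∀ R σ κ → R + σ + κ + σ + σ ≡ R + (σ + σ + κ + σ)
            fin = solve-∀ ring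
            stepA : four φ Z x₁ x₂ ≈[ σ ] S₂
            stepA = ≈-respʳ (𝔼-cong U (λ d → 𝔼-cong d (λ q → sym (trans (𝔼-image (place x₁ x₂) X _) (𝔼-cong X (λ x₃ → 𝔼-image (place x₁ x₂) X _))))))
              (≈-𝔼 U (Supp-all U (λ d → ≈-𝔼 d (Supp-all d (λ q → ≈-𝔼 X (Supp-all X (λ x₃ → ≈-𝔼 X (Supp-all X (λ x₄ → lf φ S (k q) x₃ x₄)))))))))
            stepC : S₂ ≈[ σ ] S₃
            stepC = ≈-respˡ (𝔼-cong U (λ d → r₁ d)) (≈-respʳ (𝔼-cong U (λ d → r₂ d))
              (≈-𝔼 U (Supp-uniform d ds (All.map (λ {d} h → ≈-𝔼 X̂ (Supp-all X̂ (λ x₄ → h φ S (λ z → roots z * inv (z + x₄))))) rq))))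
              where
              arg : ∀ z m u w → roots z * inv w * inv (m * u) ≡ roots z * inv (m * (u * w))
              arg z m u w = trans (cong (roots z * inv w *_) (inv-* m u)) (trans (h (roots z) (inv w) (inv m) (inv u)) (cong (roots z *_) (sym (trans (inv-* m (u * w)) (cong (inv m *_) (inv-* u w))))))
                where
                h : ∀ r w m u → r * w * (m * u) ≡ r * (m * (u * w))
                h = solve-∀ ring
              r₁ : ∀ d → 𝔼 X̂ (λ x₄ → 𝔼 Z (λ z → 𝔼 (d ⊗ X̂) (λ i → φ (roots z * inv (z + x₄) * inv (k (proj₁ i) * (z + proj₂ i))))))
                ≡ 𝔼 d (λ q → 𝔼 X̂ (λ x₃ → 𝔼 X̂ (λ x₄ → f₂ q x₃ x₄)))
              r₁ d = trans (𝔼-cong X̂ (λ x₄ → trans (𝔼-swap Z (d ⊗ X̂) _) (𝔼-⊗ d X̂ _)))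
                (trans (𝔼-swap X̂ d _) (𝔼-cong d (λ q → trans (𝔼-swap X̂ X̂ _) (𝔼-cong X̂ (λ x₃ → 𝔼-cong X̂ (λ x₄ → 𝔼-cong Z (λ z → cong φ (arg z (k q) (z + x₃) (z + x₄)))))))))
              r₂ : ∀ d → 𝔼 X̂ (λ x₄ → 𝔼 Z (λ z → 𝔼 (d ⊗ X̂) (λ i → φ (roots z * inv (z + x₄) * inv (k (proj₁ i) * (z + proj₁ i))))))
                ≡ 𝔼 d (λ q → 𝔼 X̂ (λ x₄ → f₂ q q x₄))
              r₂ d = trans (𝔼-cong X̂ (λ x₄ → trans (𝔼-swap Z (d ⊗ X̂) _) (trans (𝔼-⊗ d X̂ _) (𝔼-cong d (λ q → 𝔼-const X̂ _)))))
                (trans (𝔼-swap X̂ d _) (𝔼-cong d (λ q → 𝔼-cong X̂ (λ x₄ → 𝔼-cong Z (λ z → cong φ (arg z (k q) (z + q) (z + x₄)))))))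
            stepB : S₃ ≤ S₄ + κ₀
            stepB = subst₂ (λ x y → x ≤ y + κ₀)
              (trans (𝔼-swap Z U _) (𝔼-cong U (λ d → trans (𝔼-swap Z (d ⊗ X̂) _) (𝔼-⊗ d X̂ _))))
              (trans (𝔼-swap Z U _) (𝔼-cong U (λ d → trans (𝔼-swap Z (d ⊗ X̂) _) (trans (𝔼-⊗ d X̂ _) (𝔼-cong d (λ q → 𝔼-const X̂ _))))))
              (replace-D σ>0 κ>0 S Z X̂ d ds (AllPairs.map (λ h → h φ S) cr) le roots)
            stepE : S₄ ≈[ σ ] edges φ Z
            stepE = ≈-𝔼 U (Supp-uniform d ds (All.map (λ {d} h → ≈-𝔼 d (All.map (λ f → f φ S) h)) ed))

        -- Written out, the twist is an average over x₁, x₂, x₃, x₄, that is, of `four` over x₁ and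
        -- x₂. For x₁ > x₂ the two numerator factors are interchanged, and the diagonal has mass at
        -- most `eps σ`.
        key : Ev (λ Z → ∀ φ → State φ →
          𝔼 Z (λ z → 𝔼 U (λ d → 𝔼 d (λ q → twist φ (products X z) (s q)))) ≤ edges φ Z + (err + eps σ))
        key = Ev-map go (Ev-All (All.tabulate λ {x₁} m₁ → Ev-All (All.tabulate λ {x₂} m₂ → Ev-→ (x₁ <? x₂) (λ lt →
            four-≤ lt (All.map (λ L → All.lookup (All.lookup L m₁) m₂ lt) link) (AllPairs.map (λ P → All.lookup (All.lookup P m₁) m₂ lt) prs)))))
          where
          go : ∀ Z → Supp X (λ x₁ → Supp X (λ x₂ → x₁ < x₂ → ∀ φ → State φ → four φ Z x₁ x₂ ≤ edges φ Z + err)) → ∀ φ → State φ →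
            𝔼 Z (λ z → 𝔼 U (λ d → 𝔼 d (λ q → twist φ (products X z) (s q)))) ≤ edges φ Z + (err + eps σ)
          go Z h φ S = begin
            𝔼 Z (λ z → 𝔼 U (λ d → 𝔼 d (λ q → twist φ (products X z) (s q)))) ≡⟨ reorder ⟩
            𝔼 X (λ x₁ → 𝔼 X (λ x₂ → four φ Z x₁ x₂))
              ≤⟨ 𝔼-mono X (All.tabulate (λ {x₁} m₁ → 𝔼-mono X (All.tabulate (λ {x₂} m₂ → each x₁ x₂ m₁ m₂ (<-cmp x₁ x₂))))) ⟩
            𝔼 X (λ x₁ → 𝔼 X (λ x₂ → δ x₁ x₂ + (edges φ Z + err))) ≡⟨ 𝔼-cong X (λ x₁ → 𝔼-+c X (δ x₁) (edges φ Z + err)) ⟩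
            𝔼 X (λ x₁ → 𝔼 X (δ x₁) + (edges φ Z + err)) ≡⟨ 𝔼-+c X _ (edges φ Z + err) ⟩
            𝔼 X (λ x₁ → 𝔼 X (δ x₁)) + (edges φ Z + err) ≤⟨ +-monoˡ-≤ (edges φ Z + err) (𝔼-≤c X (Supp-all X X-spread)) ⟩
            eps σ + (edges φ Z + err) ≡⟨ fin (eps σ) (edges φ Z) err ⟩
            edges φ Z + (err + eps σ) ∎
            where
            open ≤-Reasoning
            open State S
            fin : ∀ x y z → x + (y + z) ≡ y + (z + x)
            fin = solve-∀ ring
            f : ℚ → ℚ → ℚ → ℚ → ℚ → ℚ → ℚ
            f z q x₁ x₂ x₃ x₄ = φ ((z + x₁) * (z + x₂) * inv (k q * ((z + x₃) * (z + x₄))))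
            arg : ∀ s w m → s * (w * inv m) ≡ w * inv (inv s * m)
            arg s w m = sym (trans (cong (w *_) (trans (inv-* (inv s) m) (cong (_* inv m) (inv-inv s)))) (p w s (inv m)))
              where
              p : ∀ w s m → w * (s * m) ≡ s * (w * m)
              p = solve-∀ ring
            tw : ∀ z q → twist φ (products X z) (s q) ≡ 𝔼 X (λ x₁ → 𝔼 X (λ x₂ → 𝔼 X (λ x₃ → 𝔼 X (λ x₄ → f z q x₁ x₂ x₃ x₄))))
            tw z q = trans (𝔼-products X z _) (𝔼-cong X (λ x₁ → 𝔼-cong X (λ x₂ → trans (𝔼-products X z _)
              (𝔼-cong X (λ x₃ → 𝔼-cong X (λ x₄ → cong φ (arg (s q) ((z + x₁) * (z + x₂)) ((z + x₃) * (z + x₄)))))))))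
            reorder : 𝔼 Z (λ z → 𝔼 U (λ d → 𝔼 d (λ q → twist φ (products X z) (s q)))) ≡ 𝔼 X (λ x₁ → 𝔼 X (λ x₂ → four φ Z x₁ x₂))
            reorder = begin-equality
              𝔼 Z (λ z → 𝔼 U (λ d → 𝔼 d (λ q → twist φ (products X z) (s q))))
                ≡⟨ trans (𝔼-swap Z U _) (𝔼-cong U (λ d → trans (𝔼-swap Z d _) (𝔼-cong d (λ q → 𝔼-cong Z (λ z → tw z q))))) ⟩
              𝔼 U (λ d → 𝔼 d (λ q → 𝔼 Z (λ z → 𝔼 X (λ x₁ → 𝔼 X (λ x₂ → 𝔼 X (λ x₃ → 𝔼 X (λ x₄ → f z q x₁ x₂ x₃ x₄)))))))
                ≡⟨ 𝔼-cong U (λ d → 𝔼-cong d (λ q → trans (𝔼-swap Z X _) (𝔼-cong X (λ x₁ → trans (𝔼-swap Z X _) (𝔼-cong X (λ x₂ → trans (𝔼-swap Z X _) (𝔼-cong X (λ x₃ → 𝔼-swap Z X _)))))))) ⟩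
              𝔼 U (λ d → 𝔼 d (λ q → 𝔼 X (λ x₁ → 𝔼 X (λ x₂ → 𝔼 X (λ x₃ → 𝔼 X (λ x₄ → 𝔼 Z (λ z → f z q x₁ x₂ x₃ x₄)))))))
                ≡⟨ 𝔼-cong U (λ d → trans (𝔼-swap d X _) (𝔼-cong X (λ x₁ → 𝔼-swap d X _))) ⟩
              𝔼 U (λ d → 𝔼 X (λ x₁ → 𝔼 X (λ x₂ → 𝔼 d (λ q → 𝔼 X (λ x₃ → 𝔼 X (λ x₄ → 𝔼 Z (λ z → f z q x₁ x₂ x₃ x₄)))))))
                ≡⟨ trans (𝔼-swap U X _) (𝔼-cong X (λ x₁ → 𝔼-swap U X _)) ⟩
              𝔼 X (λ x₁ → 𝔼 X (λ x₂ → four φ Z x₁ x₂)) ∎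
            four≤1 : ∀ x₁ x₂ → four φ Z x₁ x₂ ≤ 1ℚ
            four≤1 x₁ x₂ = 𝔼-≤c U (Supp-all U (λ d → 𝔼-≤c d (Supp-all d (λ q → 𝔼-≤c X (Supp-all X (λ x₃ → 𝔼-≤c X (Supp-all X (λ x₄ → 𝔼-≤c Z (Supp-all Z (λ z → φ≤1 _))))))))))
            edges≥0 : 0ℚ ≤ edges φ Z
            edges≥0 = 𝔼-c≤ U (Supp-all U (λ d → 𝔼-c≤ d (Supp-all d (λ q → 𝔼-c≤ Z (Supp-all Z (λ z → φ≥0 _))))))
            err≥0 : 0ℚ ≤ err
            err≥0 = +≥0 (+≥0 (+≥0 (<⇒≤ σ>0) (<⇒≤ σ>0)) (<⇒≤ κ>0)) (<⇒≤ σ>0)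
            four-swap : ∀ x₁ x₂ → four φ Z x₁ x₂ ≡ four φ Z x₂ x₁
            four-swap x₁ x₂ = 𝔼-cong U (λ d → 𝔼-cong d (λ q → 𝔼-cong X (λ x₃ → 𝔼-cong X (λ x₄ → 𝔼-cong Z (λ z →
              cong (λ w → φ (w * inv (k q * ((z + x₃) * (z + x₄))))) (*-comm (z + x₁) (z + x₂)))))))
            raise : ∀ {x y t} → 0ℚ ≤ t → x ≤ y → x ≤ t + y
            raise {x} {y} {t} p q = ≤-by (+≥0 p (diff≥0 q)) (p′ x y t)
              where
              p′ : ∀ x y t → t + (y - x) ≡ t + y - x
              p′ = solve-∀ ring
            each : ∀ x₁ x₂ → _ → _ → _ → four φ Z x₁ x₂ ≤ δ x₁ x₂ + (edges φ Z + err)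
            each x₁ x₂ m₁ m₂ (tri< lt _ _) = raise (δ≥0 x₁ x₂) (All.lookup (All.lookup h m₁) m₂ lt φ S)
            each x₁ x₂ m₁ m₂ (tri> _ _ gt) = raise (δ≥0 x₁ x₂) (≤-trans (≤-reflexive (four-swap x₁ x₂)) (All.lookup (All.lookup h m₂) m₁ gt φ S))
            each x₁ x₂ m₁ m₂ (tri≈ _ eq _) = ≤-trans (four≤1 x₁ x₂) (≤-trans (≤-reflexive (sym (δ-≡ eq))) (≤-trans (≤-reflexive (sym (+-identityʳ (δ x₁ x₂)))) (+-monoʳ-≤ (δ x₁ x₂) (+≥0 edges≥0 err≥0))))

open TowerEstimate

-- Almost invariance when the energy does not drop.

module AlmostInvariance where
  open import Data.Rational
  open import Data.Rational.Properties

  ratio-self : ∀ {φ} → State φ → ∀ {h} → h ≢ 0ℚ → φ (h * inv h) ≡ φ 1ℚ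
  ratio-self {φ} S h≢0 = cong φ (inv-r h≢0)

  -- Elements on which φ is nearly maximal act almost trivially.
  absorb : ∀ {φ} → State φ → ∀ (Z : Law ℚ) (g h : ℚ → ℚ) {τ} → 0ℚ < τ → Supp Z (λ z → h z ≢ 0ℚ) →
    φ 1ℚ - 𝔼 Z (λ z → φ (h z)) ≤ half (τ * τ) → 𝔼 Z (λ z → φ (g z)) ≤ 𝔼 Z (λ z → φ (g z * h z)) + τ
  absorb {φ} S Z g h {τ} τ>0 h≢0 le = ≤-by (diff≥0 cs) (fin (𝔼 Z (λ z → φ (g z))) (𝔼 Z (λ z → φ (g z * h z))) τ)
    where
    open State S
    fin : ∀ a b τ → τ - (a - b) ≡ b + τ - a
    fin = solve-∀ ring
    I : Law ℚ
    I = point 1ℚ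
    K : ℚ → ℚ
    K z = φ (h z)
    -- The squared distance between the vectors of 1 and 1 / h is 2 (φ 1 - φ h), which explains the
    -- half in the hypothesis.
    q : ∀ {z} → h z ≢ 0ℚ → Q φ 1ℚ (inv (h z)) 1ℚ (inv (h z)) ≡ 2ℚ * (φ 1ℚ - K z)
    q {z} n = trans (cong₂ _+_ (cong₂ _-_ (cong₂ _-_ (ratio-self S {1ℚ} 1≢0) (cong φ (trans (*-identityˡ (inv (inv (h z)))) (inv-inv (h z)))))
        (trans (cong φ (trans (cong (inv (h z) *_) inv-1) (*-identityʳ (inv (h z))))) (φ-inv (h z)))) (ratio-self S {inv (h z)} (inv-≢0 n)))
      (p (φ 1ℚ) (K z))
      where
      p : ∀ x y → x - y - y + x ≡ (1ℚ + 1ℚ) * (x - y)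
      p = solve-∀ ring
    bound : 𝔼 Z (λ z → 𝔼 I (λ i → 𝔼 I (λ j → Q φ 1ℚ (inv (h z)) 1ℚ (inv (h z))))) ≤ τ * τ
    bound = begin
      𝔼 Z (λ z → 𝔼 I (λ i → 𝔼 I (λ j → Q φ 1ℚ (inv (h z)) 1ℚ (inv (h z))))) ≡⟨ 𝔼-cong∈ Z (All.map (λ n → trans (trans (𝔼-const I _) (𝔼-const I _)) (q n)) h≢0) ⟩
      𝔼 Z (λ z → 2ℚ * (φ 1ℚ - K z)) ≡⟨ trans (𝔼-* Z 2ℚ _) (cong (2ℚ *_) (trans (𝔼-- Z _ K) (cong (_- 𝔼 Z K) (𝔼-const Z (φ 1ℚ))))) ⟩
      2ℚ * (φ 1ℚ - 𝔼 Z K) ≤⟨ *-monoˡ (<⇒≤ (+>0 0<1 0≤1)) le ⟩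
      2ℚ * half (τ * τ) ≡⟨ trans (p (half (τ * τ))) (half+half (τ * τ)) ⟩
      τ * τ ∎
      where
      open ≤-Reasoning
      p : ∀ x → (1ℚ + 1ℚ) * x ≡ x + x
      p = solve-∀ ring
    cs : 𝔼 Z (λ z → φ (g z)) - 𝔼 Z (λ z → φ (g z * h z)) ≤ τ
    cs = subst (_≤ τ) (trans (𝔼-cong Z (λ z → trans (𝔼-const I _) (cong₂ _-_ (cong φ (trans (cong (g z *_) inv-1) (*-identityʳ (g z)))) (cong φ (cong (g z *_) (inv-inv (h z))))))) (𝔼-- Z _ _))
      (cauchy-schwarz S Z I g (λ z _ → 1ℚ) (λ z _ → inv (h z)) τ>0 bound)

  -- Averaging over products is a contraction.
  twist-≤ : ∀ {φ} → State φ → ∀ X z → Supp X (λ x → z + x ≢ 0ℚ) →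
    twist φ (products X z) 1ℚ ≤ 𝔼 X (λ x → 𝔼 X (λ y → φ ((z + x) * inv (z + y))))
  twist-≤ {φ} S X z n = begin
    twist φ (products X z) 1ℚ ≡⟨ trans (𝔼-products X z _) (𝔼-cong X (λ x₁ → 𝔼-cong X (λ x₂ → trans (𝔼-products X z _) (𝔼-cong X (λ x₃ → 𝔼-cong X (λ x₄ → cong φ (*-identityˡ _))))))) ⟩
    𝔼 X (λ x₁ → 𝔼 X (λ x₂ → 𝔼 X (λ x₃ → 𝔼 X (λ x₄ → f x₁ x₂ x₃ x₄))))
      ≡⟨ trans (𝔼-swap X X _) (𝔼-cong X (λ x₂ → trans (𝔼-cong X (λ x₁ → 𝔼-swap X X _)) (𝔼-swap X X _))) ⟩
    𝔼 X (λ x₂ → 𝔼 X (λ x₄ → N x₂ x₄)) ≤⟨ 𝔼-≤c X (All.map (λ {x₂} n₂ → 𝔼-≤c X (All.map (λ {x₄} n₄ → N≤M n₂ n₄) n)) n) ⟩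
    M ∎
    where
    open ≤-Reasoning
    open State S
    f : ℚ → ℚ → ℚ → ℚ → ℚ
    f x₁ x₂ x₃ x₄ = φ ((z + x₁) * (z + x₂) * inv ((z + x₃) * (z + x₄)))
    N : ℚ → ℚ → ℚ
    N x₂ x₄ = 𝔼 X (λ x₁ → 𝔼 X (λ x₃ → f x₁ x₂ x₃ x₄))
    M : ℚ
    M = 𝔼 X (λ x → 𝔼 X (λ y → φ ((z + x) * inv (z + y))))
    cancelʳ : ∀ {c} → c ≢ 0ℚ → ∀ x y → x * c * inv (y * c) ≡ x * inv y
    cancelʳ {c} c≢0 x y = trans (cong₂ (λ u v → u * inv v) (*-comm x c) (*-comm y c)) (cancel-ratio c≢0 x y)
    diag : ∀ {x₂} → z + x₂ ≢ 0ℚ → N x₂ x₂ ≡ M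
    diag n₂ = 𝔼-cong X (λ x₁ → 𝔼-cong X (λ x₃ → cong φ (cancelʳ n₂ (z + x₁) (z + x₃))))
    N-sym : ∀ x₂ x₄ → N x₂ x₄ ≡ N x₄ x₂
    N-sym x₂ x₄ = trans (𝔼-cong X (λ x₁ → 𝔼-cong X (λ x₃ → swap-ratio ((z + x₁) * (z + x₂)) ((z + x₃) * (z + x₄))))) (𝔼-swap X X _)
    -- Positivity gives 2 N x₂ x₄ ≤ N x₂ x₂ + N x₄ x₄, and on the diagonal the common factor
    -- cancels, leaving `M`.
    N≤M : ∀ {x₂ x₄} → z + x₂ ≢ 0ℚ → z + x₄ ≢ 0ℚ → N x₂ x₄ ≤ M
    N≤M {x₂} {x₄} n₂ n₄ = *-cancel {2ℚ} (+>0 0<1 0≤1) (≤-by EQ≥0 (p (N x₂ x₄) M))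
      where
      p : ∀ n m → m - n - n + m ≡ (1ℚ + 1ℚ) * m - (1ℚ + 1ℚ) * n
      p = solve-∀ ring
      g h : ℚ → ℚ
      g x = (z + x) * (z + x₂)
      h x = (z + x) * (z + x₄)
      zero : ∀ x → (1ℚ + 1ℚ) * (0ℚ * x) ≡ 0ℚ
      zero = solve-∀ ring
      zero+ : ∀ x → 0ℚ * 0ℚ + x ≡ x
      zero+ = solve-∀ ring
      raw : 0ℚ ≤ E (toList X) (λ i → E (toList X) (λ j → Q φ (g i) (h i) (g j) (h j)))
      raw = subst₂ _≤_ (zero (E (toList X) (λ i → φ (1ℚ * inv (g i)) - φ (1ℚ * inv (h i))))) (zero+ (E (toList X) (λ i → E (toList X) (λ j → Q φ (g i) (h i) (g j) (h j))))) (pd-diff S (toList X) 1ℚ 0ℚ g h)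
      EQ≥0 : 0ℚ ≤ M - N x₂ x₄ - N x₂ x₄ + M
      EQ≥0 = subst (0ℚ ≤_) (trans (sym (trans (𝔼-def X _) (E-cong (toList X) (λ i → 𝔼-def X _))))
        (trans (𝔼-cong X (λ i → trans (𝔼-+ X _ _) (cong (_+ 𝔼 X (λ j → φ (h i * inv (h j)))) (trans (𝔼-- X _ _) (cong (_- 𝔼 X (λ j → φ (h i * inv (g j)))) (𝔼-- X _ _))))))
        (trans (𝔼-+ X _ _) (cong₂ _+_ (trans (𝔼-- X _ _) (cong₂ _-_ (trans (𝔼-- X _ _) (cong (_- N x₂ x₄) (diag n₂))) (N-sym x₄ x₂))) (diag n₄))))) raw

  -- The abstract form of positive density: the translates of a dense set by the elements of `L`
  -- cannot be almost disjoint on average, whatever weights are put on them.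
  Mean : ℚ → List ℚ → (ℚ → ℚ) → Set
  Mean δ₀ L φ = ∀ (Y : Law ℚ) → Supp Y (_∈ L) → δ₀ ≤ 𝔼 Y (λ g → 𝔼 Y (λ h → φ (g * inv h)))

  module Structured (a b e : ℚ) (a>0 : 0ℚ < a) (b>0 : 0ℚ < b) (e>0 : 0ℚ < e) (a≢e : a ≢ e) (b≢e : b ≢ e) (a<b : a < b) where

    open Chain a b e a>0 b>0 e>0 a≢e b≢e a<b public

    ω : ℚ
    ω = a * b * inv e

    ω>0 : 0ℚ < ω
    ω>0 = *>0 (*>0 a>0 b>0) (inv-pos e>0)

    -- s q = ω q · (q + 1/b) / q · (q + 1/a) / (q + 1/e), and both ratios are absorbed.
    structured : ∀ {τ} → 0ℚ < τ → ∀ X → Spread (half (half (half (half (τ * τ))))) X → Supp X (0ℚ ≤_) → Ev (λ Z → ∀ φ → State φ →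
      φ 1ℚ - 𝔼 Z (λ z → twist φ (products X z) 1ℚ) ≤ half (half (τ * τ)) →
      𝔼 Z (λ q → φ (ω * q)) ≤ 𝔼 Z (λ q → φ (s q)) + (τ + τ))
    structured {τ} τ>0 X X-spread X≥0 = Ev-map go (Ev-∧ (Ev-> 0ℚ) (Ev-∧
        (Ev-∀∈ (support X) λ x → Ev-∀∈ (support X) λ y → near x y ε>0)
        (Ev-∧ (near (inv a) (inv e) ε>0) (near (inv b) 0ℚ ε>0))))
      where
      -- The tolerated energy drop τ²/4 and four errors ε = τ²/16 add up to τ²/2, the allowance of
      -- `absorb`.
      h₁ h₂ ε : ℚ
      h₁ = half (τ * τ)
      h₂ = half h₁
      ε = half (half h₂)
      h₁>0 = half>0 (*>0 τ>0 τ>0)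
      ε>0 : 0ℚ < ε
      ε>0 = half>0 (half>0 (half>0 h₁>0))
      inv-inj : ∀ {x y} → inv x ≡ inv y → x ≡ y
      inv-inj {x} {y} eq = trans (sym (inv-inv x)) (trans (cong inv eq) (inv-inv y))
      go : ∀ Z → _ → ∀ φ → State φ → φ 1ℚ - 𝔼 Z (λ z → twist φ (products X z) 1ℚ) ≤ half (half (τ * τ)) →
        𝔼 Z (λ q → φ (ω * q)) ≤ 𝔼 Z (λ q → φ (s q)) + (τ + τ)
      go Z (Z>0 , nX , nae , nb) φ S hyp = begin
        𝔼 Z (λ q → φ (ω * q)) ≤⟨ absorb S Z (λ q → ω * q) B τ>0 (All.map B≢0 Z>0) (close B nearB) ⟩
        𝔼 Z (λ q → φ (ω * q * B q)) + τ ≤⟨ +-monoˡ-≤ τ (absorb S Z (λ q → ω * q * B q) A τ>0 (All.map A≢0 Z>0) (close A nearA)) ⟩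
        𝔼 Z (λ q → φ (ω * q * B q * A q)) + τ + τ ≡⟨ trans (+-assoc (𝔼 Z (λ q → φ (ω * q * B q * A q))) τ τ) (cong (_+ (τ + τ)) (𝔼-cong∈ Z (All.map (λ p → cong φ (arg p)) Z>0))) ⟩
        𝔼 Z (λ q → φ (s q)) + (τ + τ) ∎
        where
        open ≤-Reasoning
        open State S
        A B : ℚ → ℚ
        A q = 1ℚ * (q + inv a) * inv (1ℚ * (q + inv e))
        B q = 1ℚ * (q + inv b) * inv (1ℚ * (q + 0ℚ))
        κ₁ : ℚ
        κ₁ = κ φ Z (1ℚ * inv 1ℚ)
        pos₊ : ∀ {q c} → 0ℚ < q → 0ℚ ≤ c → 1ℚ * (q + c) ≢ 0ℚ
        pos₊ {q} {c} p r = >⇒≢ (subst (0ℚ <_) (sym (*-identityˡ (q + c))) (+>0 p r))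
        A≢0 : ∀ {q} → 0ℚ < q → A q ≢ 0ℚ
        A≢0 p = *-≢0 (pos₊ p (<⇒≤ (inv-pos a>0))) (inv-≢0 (pos₊ p (<⇒≤ (inv-pos e>0))))
        B≢0 : ∀ {q} → 0ℚ < q → B q ≢ 0ℚ
        B≢0 p = *-≢0 (pos₊ p (<⇒≤ (inv-pos b>0))) (inv-≢0 (pos₊ p ≤-refl))
        nearA : 𝔼 Z (λ q → φ (A q)) ≈[ ε ] κ₁
        nearA = nae φ S 1ℚ 1ℚ (λ eq → a≢e (inv-inj eq))
        nearB : 𝔼 Z (λ q → φ (B q)) ≈[ ε ] κ₁
        nearB = nb φ S 1ℚ 1ℚ (λ eq → >⇒≢ (inv-pos b>0) eq)
        κ≥0 : 0ℚ ≤ κ₁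
        κ≥0 = 𝔼-c≤ Z (Supp-all Z (λ z → φ≥0 _))
        -- This mean dominates φ_z 1 by `twist-≤`, and off the diagonal each of its terms is close
        -- to `κ₁`. The means of `A` and `B` are close to the same `κ₁`, so a small energy drop
        -- brings them all close to φ 1.
        mean-ratio : 𝔼 Z (λ z → 𝔼 X (λ x → 𝔼 X (λ y → φ ((z + x) * inv (z + y))))) ≤ ε + (κ₁ + ε)
        mean-ratio = ≤-trans (≤-reflexive (trans (𝔼-swap Z X _) (𝔼-cong X (λ x → 𝔼-swap Z X _))))
          (≤-trans (𝔼-mono X (All.map (λ {x} nx → 𝔼-mono X (All.map (λ {y} nxy → each x y nxy (δ-case x y)) nx)) nX))
          (≤-trans (≤-reflexive (trans (𝔼-cong X (λ x → 𝔼-+c X (δ x) (κ₁ + ε))) (𝔼-+c X _ (κ₁ + ε))))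
            (+-monoˡ-≤ (κ₁ + ε) (𝔼-≤c X (Supp-all X X-spread)))))
          where
          κε≥0 : 0ℚ ≤ κ₁ + ε
          κε≥0 = +≥0 κ≥0 (<⇒≤ ε>0)
          each : ∀ x y → (∀ φ → State φ → ∀ m m′ → Near φ Z (κ φ Z) ε m x m′ y) →
            (x ≡ y × δ x y ≡ 1ℚ) ⊎ (x ≢ y × δ x y ≡ 0ℚ) → 𝔼 Z (λ z → φ ((z + x) * inv (z + y))) ≤ δ x y + (κ₁ + ε)
          each x y n (inj₁ (_ , d)) = ≤-trans (𝔼-≤c Z (Supp-all Z (λ z → φ≤1 _))) (≤-trans (≤-reflexive (sym (+-identityʳ 1ℚ))) (+-mono-≤ (≤-reflexive (sym d)) κε≥0))
          each x y n (inj₂ (ne , d)) = ≤-trans (≤-reflexive (𝔼-cong Z (λ z → cong φ (cong₂ (λ u v → u * inv v) (sym (*-identityˡ (z + x))) (sym (*-identityˡ (z + y)))))))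
            (≤-trans (proj₁ (n φ S 1ℚ 1ℚ ne)) (≤-trans (≤-reflexive (sym (+-identityˡ (κ₁ + ε)))) (+-monoˡ-≤ (κ₁ + ε) (≤-reflexive (sym d)))))
        φ1-κ : φ 1ℚ - κ₁ ≤ h₂ + (ε + ε)
        φ1-κ = ≤-by (+≥0 (diff≥0 hyp) (diff≥0 (≤-trans (𝔼-mono Z (All.map (λ {z} p → twist-≤ S X z (All.map (λ q → >⇒≢ (+>0 p q)) X≥0)) Z>0)) mean-ratio)))
          (p (φ 1ℚ) (𝔼 Z (λ z → twist φ (products X z) 1ℚ)) κ₁ h₂ ε)
          where
          p : ∀ f t k h e → h - (f - t) + (e + (k + e) - t) ≡ h + (e + e) - (f - k)
          p = solve-∀ ring
        close : ∀ F → 𝔼 Z (λ q → φ (F q)) ≈[ ε ] κ₁ → φ 1ℚ - 𝔼 Z (λ q → φ (F q)) ≤ half (τ * τ)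
        close F nF = ≤-by (+≥0 (+≥0 (diff≥0 φ1-κ) (diff≥0 (proj₂ nF))) (<⇒≤ ε>0))
          (trans (p (φ 1ℚ) (𝔼 Z (λ q → φ (F q))) κ₁ h₂ ε) (cong (_- (φ 1ℚ - 𝔼 Z (λ q → φ (F q)))) (trans (cong (h₂ +_) (trans (cong₂ _+_ (half+half (half h₂)) (half+half (half h₂))) (half+half h₂))) (half+half h₁))))
          where
          p : ∀ f m k h e → h + (e + e) - (f - k) + (m + e - k) + e ≡ h + (e + e + (e + e)) - (f - m)
          p = solve-∀ ring
        arg : ∀ {q} → 0ℚ < q → ω * q * B q * A q ≡ s q
        arg {q} p = trans (cong₂ (λ x y → ω * q * x * y) (cong₂ (λ u v → u * inv v) (*-identityˡ (q + inv b)) (trans (*-identityˡ (q + 0ℚ)) (+-identityʳ q))) (cong₂ (λ u v → u * inv v) (*-identityˡ (q + inv a)) (*-identityˡ (q + inv e))))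
          (trans (r (a * b) (inv e) q (q + inv b) (inv q) (q + inv a) (inv (q + inv e)))
          (trans (cong (λ u → u * (a * b * ((q + inv a) * (q + inv b)) * (inv e * inv (q + inv e)))) (inv-r (>⇒≢ p)))
          (trans (*-identityˡ _) (trans (cong₂ _*_ (trans (r′ a b (q + inv a) (q + inv b)) (cong₂ _*_ (root a>0) (root b>0))) (trans (sym (inv-* e (q + inv e))) (cong inv (root e>0)))) (sym (s-def q))))))
          where
          r : ∀ m i q x j y l → m * i * q * (x * j) * (y * l) ≡ q * j * (m * (y * x) * (i * l))
          r = solve-∀ ring
          r′ : ∀ a b x y → a * b * (x * y) ≡ a * x * (b * y)
          r′ = solve-∀ ring
          root : ∀ {c} → 0ℚ < c → c * (q + inv c) ≡ 1ℚ + c * q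
          root {c} c>0 = trans (w c q (inv c)) (cong (_+ c * q) (inv-r (>⇒≢ c>0)))
            where
            w : ∀ c q i → c * (q + i) ≡ c * i + c * q
            w = solve-∀ ring

open AlmostInvariance

-- A random walk that cannot avoid itself.

module RandomWalk where
  open import Data.Nat.Properties using (suc-injective)
  open import Data.Rational
  open import Data.Rational.Properties

  sum-mono : ∀ {A : Set} {l : List A} {f g} → All (λ a → f a ≤ g a) l → sum l f ≤ sum l g
  sum-mono [] = ≤-refl
  sum-mono (p ∷ ps) = +-mono-≤ p (sum-mono ps)

  𝔼-sum : ∀ {A B : Set} (μ : Law A) (l : List B) (F : A → B → ℚ) → 𝔼 μ (λ a → sum l (F a)) ≡ sum l (λ b → 𝔼 μ (λ a → F a b))
  𝔼-sum μ [] F = 𝔼-const μ 0ℚ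
  𝔼-sum μ (b ∷ l) F = trans (𝔼-+ μ (λ a → F a b) (λ a → sum l (F a))) (cong (𝔼 μ (λ a → F a b) +_) (𝔼-sum μ l F))

  exists-or-all : ∀ {A : Set} (f : A → ℚ) c (l : List A) → (Σ A λ a → a ∈ l × c < f a) ⊎ All (λ a → f a ≤ c) l
  exists-or-all f c [] = inj₂ []
  exists-or-all f c (a ∷ l) = go (c <? f a) (exists-or-all f c l)
    where
    go : Dec (c < f a) → (Σ _ λ a → a ∈ l × c < f a) ⊎ All (λ a → f a ≤ c) l → (Σ _ λ b → b ∈ a ∷ l × c < f b) ⊎ All (λ a → f a ≤ c) (a ∷ l)
    go (yes p) _ = inj₁ (a , here refl , p)
    go (no p) (inj₁ (b , m , q)) = inj₁ (b , there m , q)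
    go (no p) (inj₂ ps) = inj₂ (≮⇒≥ p ∷ ps)

  Path : Set
  Path = ℚ × List ℚ

  entries : Path → List ℚ
  entries (g , gs) = g ∷ gs

  total-overlap : (ℚ → ℚ) → List ℚ → ℚ
  total-overlap φ l = sum l (λ x → sum l (λ y → φ (x * inv y)))

  overlap-∷ : ∀ {φ} → State φ → ∀ x l → total-overlap φ (x ∷ l) ≤ 1ℚ + 2ℚ * sum l (λ y → φ (x * inv y)) + total-overlap φ l
  overlap-∷ {φ} S x l = begin
    φ (x * inv x) + R + sum l (λ y → φ (y * inv x) + sum l (λ z → φ (y * inv z)))
      ≡⟨ cong (φ (x * inv x) + R +_) (trans (sum-+ l (λ y → φ (y * inv x)) (λ y → sum l (λ z → φ (y * inv z)))) (cong (_+ total-overlap φ l) (sum-cong l (λ y → swap-ratio y x)))) ⟩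
    φ (x * inv x) + R + (R + total-overlap φ l) ≤⟨ +-monoˡ-≤ (R + total-overlap φ l) (+-monoˡ-≤ R (φ≤1 (x * inv x))) ⟩
    1ℚ + R + (R + total-overlap φ l) ≡⟨ e R (total-overlap φ l) ⟩
    1ℚ + 2ℚ * R + total-overlap φ l ∎
    where
    open ≤-Reasoning
    open State S
    R : ℚ
    R = sum l (λ y → φ (x * inv y))
    e : ∀ r t → 1ℚ + r + (r + t) ≡ 1ℚ + (1ℚ + 1ℚ) * r + t
    e = solve-∀ ring
    sum-cong : ∀ {A : Set} (l : List A) {f g : A → ℚ} → (∀ a → f a ≡ g a) → sum l f ≡ sum l g
    sum-cong [] h = refl
    sum-cong (a ∷ l) h = cong₂ _+_ (h a) (sum-cong l h)

  -- A random walk on the positive rationals, with long steps ω q, q ∈ Z, that forget the earlier positions.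
  module Walk {ω} (ω>0 : 0ℚ < ω) {η} (η>0 : 0ℚ < η) {P : Law ℚ → Set} (P-ev : Ev (λ Z → P Z × Supp Z (0ℚ <_))) where

    record Walks (m : ℕ) : Set where
      field
        paths    : Law Path
        steps    : List (Law ℚ)
        steps-P  : All P steps
        count    : ℕ.suc (length steps) ≡ m
        size     : Supp paths (λ p → length (entries p) ≡ m)
        positive-entries : Supp paths (λ p → All (0ℚ <_) (entries p))
        -- The term `fromℕ m` is the diagonal; any two distinct positions overlap by at most c + η
        -- on average if no step has φ-mean above c.
        overlap-≤ : ∀ {φ c} → State φ → 0ℚ ≤ c → All (λ Z → 𝔼 Z (λ q → φ (ω * q)) ≤ c) steps →
          𝔼 paths (λ p → total-overlap φ (entries p)) ≤ fromℕ m + fromℕ m * fromℕ m * (c + η)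

    start : Walks 1
    start = record { paths = point (1ℚ , []) ; steps = [] ; steps-P = [] ; count = refl ; size = Supp-point refl ; positive-entries = Supp-point (0<1 ∷ [])
      ; overlap-≤ = λ {φ} {c} S c≥0 _ → ≤-trans (≤-reflexive (trans (𝔼-point (1ℚ , []) _) (e (φ (1ℚ * inv 1ℚ)))))
          (≤-by (+≥0 (diff≥0 (State.φ≤1 S (1ℚ * inv 1ℚ))) (+≥0 c≥0 (<⇒≤ η>0))) (e′ (φ (1ℚ * inv 1ℚ)) c η)) }
      where
      e : ∀ x → x + 0ℚ + 0ℚ ≡ x
      e = solve-∀ ring
      e′ : ∀ x c η → 1ℚ - x + (c + η) ≡ 1ℚ + 0ℚ + (1ℚ + 0ℚ) * (1ℚ + 0ℚ) * (c + η) - x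
      e′ = solve-∀ ring

    Loose : Law Path → Law ℚ → Set
    Loose paths Z = Supp paths (λ p → All (λ y → 0ℚ < proj₁ p * inv y → Inv η (proj₁ p * inv y) 0ℚ Z) (entries p))

    loose : ∀ paths → Supp paths (λ p → All (0ℚ <_) (entries p)) → Ev (Loose paths)
    loose paths h = Ev-All (All.map (λ {p} h → Ev-All (All.map (λ {y} y>0 →
      Ev-map (λ Z i _ → i) (Ev-inv 0ℚ η>0 (*>0 (head-pos h) (inv-pos y>0)))) h)) h)
      where
      head-pos : ∀ {x} {l : List ℚ} → All (0ℚ <_) (x ∷ l) → 0ℚ < x
      head-pos (p ∷ _) = p

    extend : ∀ {m} → Walks m → Walks (ℕ.suc m)
    extend {m} W = go (Ev-law (Ev-∧ P-ev (loose paths positive-entries)))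
      where
      open Walks W
      go : (Σ (Law ℚ) λ Z → (P Z × Supp Z (0ℚ <_)) × Loose paths Z) → Walks (ℕ.suc m)
      go (Z , (PZ , Z>0) , lo) = record
        { paths = next ; steps = Z ∷ steps ; steps-P = PZ ∷ steps-P ; count = cong ℕ.suc count
        ; size = Supp-bind paths _ (All.map (λ eq → Supp-bind Z _ (Supp-all Z (λ q → Supp-point (cong ℕ.suc eq)))) size)
        ; positive-entries = Supp-bind paths _ (All.map (λ h → Supp-bind Z _ (All.map (λ q>0 → Supp-point (*>0 (*>0 ω>0 q>0) (All.head h) ∷ h)) Z>0)) positive-entries)
        ; overlap-≤ = λ { {φ} {c} S c≥0 (h ∷ hs) → bound S c≥0 h (overlap-≤ S c≥0 hs) } }
        where
        next : Law Path
        next = bind paths (λ p → bind Z (λ q → point (ω * q * proj₁ p , entries p)))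
        module _ {φ} {c} (S : State φ) (c≥0 : 0ℚ ≤ c) (small-step : 𝔼 Z (λ q → φ (ω * q)) ≤ c) where
          open State S
          -- The step law does not feel the dilation by g / y, so a step from g, compared with the
          -- earlier position y, looks like a step from 1 compared with 1.
          fresh : ∀ {g y} → 0ℚ < g → 0ℚ < y → Inv η (g * inv y) 0ℚ Z → 𝔼 Z (λ q → φ (ω * q * g * inv y)) ≤ c + η
          fresh {g} {y} g>0 y>0 inv′ = ≤-trans (≤-reflexive (𝔼-cong Z (λ q → cong φ (e ω q g (inv y)))))
            (≤-trans (inv′ (λ q → φ (ω * q)) (λ q → φ≥0 (ω * q)) (λ q → φ≤1 (ω * q))) (+-monoˡ-≤ η small-step))
            where
            e : ∀ w q g i → w * q * g * i ≡ w * (g * i * q + 0ℚ)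
            e = solve-∀ ring
          step : ∀ {p} → length (entries p) ≡ m → All (0ℚ <_) (entries p) → All (λ y → 0ℚ < proj₁ p * inv y → Inv η (proj₁ p * inv y) 0ℚ Z) (entries p) →
            𝔼 Z (λ q → total-overlap φ (ω * q * proj₁ p ∷ entries p)) ≤ total-overlap φ (entries p) + (1ℚ + 2ℚ * (fromℕ m * (c + η)))
          step {p} len (g>0 ∷ gs>0) is = begin
            𝔼 Z (λ q → total-overlap φ (ω * q * g ∷ l)) ≤⟨ 𝔼-mono′ Z (λ q → overlap-∷ S (ω * q * g) l) ⟩
            𝔼 Z (λ q → 1ℚ + 2ℚ * R q + T) ≡⟨ trans (𝔼-+c Z (λ q → 1ℚ + 2ℚ * R q) T) (cong (_+ T) (trans (𝔼-+ Z (λ _ → 1ℚ) (λ q → 2ℚ * R q)) (cong₂ _+_ (𝔼-const Z 1ℚ) (𝔼-* Z 2ℚ R)))) ⟩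
            1ℚ + 2ℚ * 𝔼 Z R + T ≤⟨ +-monoˡ-≤ T (+-monoʳ-≤ 1ℚ (*-monoˡ (<⇒≤ (+>0 0<1 0≤1)) (≤-trans (≤-reflexive (𝔼-sum Z l (λ q y → φ (ω * q * g * inv y)))) each))) ⟩
            1ℚ + 2ℚ * (fromℕ m * (c + η)) + T ≡⟨ +-comm (1ℚ + 2ℚ * (fromℕ m * (c + η))) T ⟩
            T + (1ℚ + 2ℚ * (fromℕ m * (c + η))) ∎
            where
            open ≤-Reasoning
            g : ℚ
            g = proj₁ p
            l : List ℚ
            l = entries p
            T : ℚ
            T = total-overlap φ l
            R : ℚ → ℚ
            R q = sum l (λ y → φ (ω * q * g * inv y))
            each : sum l (λ y → 𝔼 Z (λ q → φ (ω * q * g * inv y))) ≤ fromℕ m * (c + η)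
            each = subst (λ k → sum l (λ y → 𝔼 Z (λ q → φ (ω * q * g * inv y))) ≤ fromℕ k * (c + η)) len
              (≤-trans (sum-≤ (All.zipWith (λ { (y>0 , i) → fresh g>0 y>0 (i (*>0 g>0 (inv-pos y>0))) }) (g>0 ∷ gs>0 , is))) (≤-reflexive (*-comm (c + η) (fromℕ (length l)))))
          bound : 𝔼 paths (λ p → total-overlap φ (entries p)) ≤ fromℕ m + fromℕ m * fromℕ m * (c + η) →
            𝔼 next (λ p → total-overlap φ (entries p)) ≤ fromℕ (ℕ.suc m) + fromℕ (ℕ.suc m) * fromℕ (ℕ.suc m) * (c + η)
          bound old = begin
            𝔼 next (λ p → total-overlap φ (entries p)) ≡⟨ trans (𝔼-bind paths _ _) (𝔼-cong paths (λ p → trans (𝔼-bind Z _ _) (𝔼-cong Z (λ q → 𝔼-point (ω * q * proj₁ p , entries p) _)))) ⟩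
            𝔼 paths (λ p → 𝔼 Z (λ q → total-overlap φ (ω * q * proj₁ p ∷ entries p)))
              ≤⟨ 𝔼-mono paths (All.zipWith (λ { (len , (h , i)) → step len h i }) (size , All.zip (positive-entries , lo))) ⟩
            𝔼 paths (λ p → total-overlap φ (entries p) + K) ≡⟨ 𝔼-+c paths _ K ⟩
            𝔼 paths (λ p → total-overlap φ (entries p)) + K ≤⟨ +-monoˡ-≤ K old ⟩
            n + n * n * c′ + K ≤⟨ ≤-by (+≥0 c≥0 (<⇒≤ η>0)) (e n c′) ⟩
            1ℚ + n + (1ℚ + n) * (1ℚ + n) * c′ ∎
            where
            open ≤-Reasoning
            n c′ K : ℚ
            n = fromℕ m
            c′ = c + η
            K = 1ℚ + 2ℚ * (n * c′)
            e : ∀ n c → c ≡ 1ℚ + n + (1ℚ + n) * (1ℚ + n) * c - (n + n * n * c + (1ℚ + (1ℚ + 1ℚ) * (n * c)))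
            e = solve-∀ ring

    walks : ∀ m → Walks (ℕ.suc m)
    walks ℕ.zero = start
    walks (ℕ.suc m) = extend (walks m)

  -- The laws and the list are fixed before φ; only the choice of a member of `Zs` depends on φ.
  Escape : ℚ → ℚ → List ℚ → List (Law ℚ) → Set
  Escape ω δ₀ L Zs = ∀ φ → State φ → Mean δ₀ L φ → Σ (Law ℚ) λ Z → Z ∈ Zs × half δ₀ < 𝔼 Z (λ q → φ (ω * q))

  -- An m with 1/(m + 1) ≤ δ₀/8. The walk has m + 1 positions and therefore m steps.
  walk-length : ∀ {δ₀} → 0ℚ < δ₀ → ℕ
  walk-length δ>0 = proj₁ (small (half>0 (half>0 (half>0 δ>0))))

  -- On every path `Mean` forces a mean overlap of at least δ₀. If all steps had φ-mean at most
  -- δ₀/2, the expected mean overlap would be at most 1/(m + 1) + δ₀/2 + δ₀/8, which is at most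
  -- 3δ₀/4.
  walk : ∀ {ω δ₀} → 0ℚ < ω → (δ>0 : 0ℚ < δ₀) → ∀ {P : Law ℚ → Set} → Ev (λ Z → P Z × Supp Z (0ℚ <_)) →
    Σ (List (Law ℚ)) λ Zs → All P Zs × length Zs ≡ walk-length δ>0 × Σ (List ℚ) λ L → All (0ℚ <_) L × Escape ω δ₀ L Zs
  walk {ω} {δ₀} ω>0 δ>0 {P} P-ev = steps , steps-P , suc-injective count , L , L>0 , escape
    where
    t : ℚ
    t = half (half δ₀)
    t>0 : 0ℚ < t
    t>0 = half>0 (half>0 δ>0)
    η : ℚ
    η = half t
    η>0 : 0ℚ < η
    η>0 = half>0 t>0
    open Walk ω>0 η>0 P-ev
    m : ℕ
    m = proj₁ (small η>0)
    W : Walks (ℕ.suc m)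
    W = walks m
    open Walks W
    n w : ℚ
    n = fromℕ (ℕ.suc m)
    w = inv n
    w≥0 : 0ℚ ≤ w
    w≥0 = <⇒≤ (inv-pos (fromℕ-suc>0 m))
    L : List ℚ
    L = concat (map entries (support paths))
    L>0 : All (0ℚ <_) L
    L>0 = concat⁺ (map⁺ positive-entries)
    escape : Escape ω δ₀ L steps
    escape φ S mean = go (exists-or-all (λ Z → 𝔼 Z (λ q → φ (ω * q))) (half δ₀) steps)
      where
      each : Supp paths (λ p → δ₀ ≤ w * w * total-overlap φ (entries p))
      each = All.zipWith (λ { {p} (len , mem) → one p len mem }) (size , All.tabulate (λ mp → All.tabulate (λ mx → ∈-concat⁺′ mx (∈-map⁺ entries mp))))
        where
        one : ∀ p → length (entries p) ≡ ℕ.suc m → All (_∈ L) (entries p) → δ₀ ≤ w * w * total-overlap φ (entries p)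
        one (g , gs) len mem = ≤-trans (mean (uniform g gs) (Supp-uniform g gs mem)) (≤-reflexive
          (trans (𝔼-cong (uniform g gs) (λ x → 𝔼-uniform g gs (λ y → φ (x * inv y)))) (trans (𝔼-* (uniform g gs) w′ _) (trans (cong (w′ *_) (𝔼-uniform g gs _))
          (trans (sym (*-assoc w′ w′ (total-overlap φ (g ∷ gs)))) (cong (λ k → inv (fromℕ k) * inv (fromℕ k) * total-overlap φ (g ∷ gs)) len))))))
          where
          w′ : ℚ
          w′ = inv (fromℕ (length (g ∷ gs)))
      go : _ → Σ (Law ℚ) λ Z → Z ∈ steps × half δ₀ < 𝔼 Z (λ q → φ (ω * q))
      go (inj₁ r) = r
      go (inj₂ all) = ⊥-elim (<-irrefl refl (<-≤-trans t>0 (≤-by (+≥0 (diff≥0 contra) (diff≥0 (proj₂ (small η>0)))) slack)))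
        where
        contra : δ₀ ≤ w + (half δ₀ + η)
        contra = begin
          δ₀ ≤⟨ 𝔼-c≤ paths each ⟩
          𝔼 paths (λ p → w * w * total-overlap φ (entries p)) ≡⟨ 𝔼-* paths (w * w) _ ⟩
          w * w * 𝔼 paths (λ p → total-overlap φ (entries p)) ≤⟨ *-monoˡ (square≥0 w) (overlap-≤ S (<⇒≤ (half>0 δ>0)) all) ⟩
          w * w * (n + n * n * (half δ₀ + η)) ≡⟨ trans (e₁ w n (half δ₀ + η)) (trans (cong (λ u → u * w + u * u * (half δ₀ + η)) (inv-r (>⇒≢ (fromℕ-suc>0 m)))) (e₂ w (half δ₀ + η))) ⟩
          w + (half δ₀ + η) ∎
          where
          open ≤-Reasoning
          e₁ : ∀ w n c → w * w * (n + n * n * c) ≡ n * w * w + n * w * (n * w) * c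
          e₁ = solve-∀ ring
          e₂ : ∀ w c → 1ℚ * w + 1ℚ * 1ℚ * c ≡ w + c
          e₂ = solve-∀ ring
        slack : w + (half δ₀ + η) - δ₀ + (η - w) ≡ 0ℚ - t
        slack = trans (e w (half δ₀) η δ₀) (trans (cong₂ (λ x y → half δ₀ + x - y) (half+half t) (sym (half+half δ₀)))
          (trans (cong (λ x → x + t - (x + x)) (sym (half+half (half δ₀)))) (e′ t)))
          where
          e : ∀ w h η d → w + (h + η) - d + (η - w) ≡ h + (η + η) - d
          e = solve-∀ ring
          e′ : ∀ t → t + t + t - (t + t + (t + t)) ≡ 0ℚ - t
          e′ = solve-∀ ring

open RandomWalk

-- Twisted states and composed laws.

module Composition where
  open import Data.Rational
  open import Data.Rational.Properties

  translates : (Y : Law ℚ) → List (ℚ × ℚ) → List (ℚ × ℚ)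
  translates Y l = bindl l (λ g → map (λ p → 1ℚ * proj₁ p , g * proj₂ p) (toList Y))

  E-translates : ∀ Y l f → E (translates Y l) f ≡ E l (λ g → 𝔼 Y (λ h → f (g * h)))
  E-translates Y l f = trans (E-bindl l _ f) (E-cong l (λ g → trans (E-reweight (toList Y) 1ℚ (g *_) f)
    (trans (*-identityˡ (E (toList Y) (λ h → f (g * h)))) (sym (𝔼-def Y (λ h → f (g * h)))))))

  regroup : ∀ g h g′ h′ → g * h * inv (g′ * h′) ≡ g * inv g′ * (h * inv h′)
  regroup g h g′ h′ = trans (cong (g * h *_) (inv-* g′ h′)) (e g h (inv g′) (inv h′))
    where
    e : ∀ g h i j → g * h * (i * j) ≡ g * i * (h * j)
    e = solve-∀ ring

  -- Positivity on a weighted list is positivity of φ on the list of its translates by `Y`;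
  -- inversion exchanges the two draws from `Y`.
  twist-State : ∀ {φ} → State φ → ∀ Y → State (twist φ Y)
  twist-State {φ} S Y = record
    { φ≥0 = λ g → 𝔼-c≤ Y (Supp-all Y (λ h → 𝔼-c≤ Y (Supp-all Y (λ h′ → φ≥0 _))))
    ; φ≤1 = λ g → 𝔼-≤c Y (Supp-all Y (λ h → 𝔼-≤c Y (Supp-all Y (λ h′ → φ≤1 _))))
    ; φ-inv = λ g → trans (𝔼-cong Y (λ h → 𝔼-cong Y (λ h′ → trans (sym (φ-inv _)) (cong φ (flip g h h′))))) (𝔼-swap Y Y _)
    ; pd = λ l → subst (0ℚ ≤_) (trans (E-translates Y l _) (trans (E-cong l (λ g → trans (𝔼-cong Y (λ h → E-translates Y l _)) (trans (𝔼-def Y _) (trans (E-swap (toList Y) l _)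
          (E-cong l (λ g′ → sym (𝔼-def Y _))))))) (E-cong l (λ g → E-cong l (λ g′ → 𝔼-cong Y (λ h → 𝔼-cong Y (λ h′ → cong φ (regroup g h g′ h′)))))))) (pd (translates Y l)) }
    where
    open State S
    flip : ∀ g h h′ → inv (inv g * (h * inv h′)) ≡ g * (h′ * inv h)
    flip g h h′ = trans (inv-* (inv g) (h * inv h′)) (cong₂ _*_ (inv-inv g) (trans (inv-* h (inv h′)) (trans (cong (inv h *_) (inv-inv h′)) (*-comm (inv h) h′))))

  Mean-⊆ : ∀ {δ₀ L L′ φ} → (∀ {g} → g ∈ L → g ∈ L′) → Mean δ₀ L′ φ → Mean δ₀ L φ
  Mean-⊆ sub mean Y h = mean Y (All.map sub h)

  -- A law on `L` multiplied by an independent draw from `Y` is a law on the product list, and φ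
  -- averaged over its quotients is the twisted average.
  twist-Mean : ∀ {δ₀ L φ} Y → Mean δ₀ (cartesianProductWith _*_ L (support Y)) φ → Mean δ₀ L (twist φ Y)
  twist-Mean {δ₀} {L} {φ} Y mean V h = ≤-trans (mean W (Supp-bind V _ (All.map (λ m → Supp-image _ Y (All.tabulate (λ m′ → ∈-cartesianProductWith⁺ _*_ m m′))) h)))
    (≤-reflexive (trans (W-def _) (trans (𝔼-cong V (λ g → trans (𝔼-cong Y (λ h → W-def _)) (𝔼-swap Y V _))) (𝔼-cong V (λ g → 𝔼-cong V (λ g′ → 𝔼-cong Y (λ h → 𝔼-cong Y (λ h′ → cong φ (regroup g h g′ h′)))))))))
    where
    W : Law ℚ
    W = bind V (λ g → image (g *_) Y)
    W-def : ∀ f → 𝔼 W f ≡ 𝔼 V (λ g → 𝔼 Y (λ h → f (g * h)))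
    W-def f = trans (𝔼-bind V _ f) (𝔼-cong V (λ g → 𝔼-image (g *_) Y f))

  Inv-bind : ∀ {A : Set} {η α β} (μ : Law A) (k : A → Law ℚ) → Supp μ (λ x → Inv η α β (k x)) → Inv η α β (bind μ k)
  Inv-bind {η = η} {α} {β} μ k h G p q = begin
    𝔼 (bind μ k) (λ z → G (α * z + β)) ≡⟨ 𝔼-bind μ k _ ⟩
    𝔼 μ (λ x → 𝔼 (k x) (λ z → G (α * z + β))) ≤⟨ 𝔼-mono μ (All.map (λ i → i G p q) h) ⟩
    𝔼 μ (λ x → 𝔼 (k x) G + η) ≡⟨ 𝔼-+c μ (λ x → 𝔼 (k x) G) η ⟩
    𝔼 μ (λ x → 𝔼 (k x) G) + η ≡⟨ cong (_+ η) (sym (𝔼-bind μ k G)) ⟩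
    𝔼 (bind μ k) G + η ∎
    where open ≤-Reasoning

  Meets-bind : ∀ {A : Set} {Γ η β} (μ : Law A) (k : A → Law ℚ) → Supp μ (λ x → Meets Γ η β (k x)) → Meets Γ η β (bind μ k)
  Meets-bind {Γ = Γ} {η} {β} μ k h =
    All.tabulate (λ {p} m α>0 → Inv-bind {η = η} {proj₁ p} {proj₂ p} μ k (All.map (λ c → All.lookup (proj₁ c) m α>0) h)) ,
    Supp-bind μ k (All.map proj₂ h)

  ∈-≤-sum : ∀ {A : Set} {f : A → ℚ} {a} {l : List A} → (∀ a → 0ℚ ≤ f a) → a ∈ l → f a ≤ sum l f
  ∈-≤-sum {f = f} {a} {x ∷ l} f≥0 (here refl) = ≤-trans (≤-reflexive (sym (+-identityʳ (f a)))) (+-monoʳ-≤ (f a) (sum≥0 l))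
    where
    sum≥0 : ∀ l → 0ℚ ≤ sum l f
    sum≥0 [] = ≤-refl
    sum≥0 (x ∷ l) = +≥0 (f≥0 x) (sum≥0 l)
  ∈-≤-sum {f = f} {a} {x ∷ l} f≥0 (there m) = ≤-trans (∈-≤-sum f≥0 m) (≤-trans (≤-reflexive (sym (+-identityˡ (sum l f)))) (+-monoˡ-≤ (sum l f) (f≥0 x)))

  uniform-≥ : ∀ {A : Set} {x : A} {l a f c} → (∀ a → 0ℚ ≤ f a) → a ∈ (x ∷ l) → c ≤ f a → inv (fromℕ (length (x ∷ l))) * c ≤ 𝔼 (uniform x l) f
  uniform-≥ {x = x} {l} {a} {f} f≥0 m le = ≤-trans (*-monoˡ (<⇒≤ (inv-pos (fromℕ-suc>0 (length l)))) (≤-trans le (∈-≤-sum f≥0 m))) (≤-reflexive (sym (𝔼-uniform x l f)))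

  module Composite (a b e : ℚ) (a>0 : 0ℚ < a) (b>0 : 0ℚ < b) (e>0 : 0ℚ < e) (a≢e : a ≢ e) (b≢e : b ≢ e) (a<b : a < b) where

    open Structured a b e a>0 b>0 e>0 a≢e b≢e a<b public

    compose : Law ℚ → Law ℚ → Law ℚ
    compose d Z = bind d (λ q → image (q ∘ₘ_) Z)

    𝔼-compose : ∀ d Z f → 𝔼 (compose d Z) f ≡ 𝔼 d (λ q → 𝔼 Z (λ z → f (q ∘ₘ z)))
    𝔼-compose d Z f = trans (𝔼-bind d _ f) (𝔼-cong d (λ q → 𝔼-image (q ∘ₘ_) Z f))

    -- q ∘ₘ z exceeds q / 2 once q < z.
    ∘ₘ-lower : ∀ {β q z} → 0ℚ < q → β + β < q → q < z → β < q ∘ₘ z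
    ∘ₘ-lower {β} {q} {z} q>0 β<q q<z = <-by (*>0 (half>0 pos′) (inv-pos w>0)) (trans (cong (_* inv (q + z)) (trans (cong half (e₁ β q z)) (half-double (q * z - β * (q + z)))))
        (trans (e₂ (q * z) β (q + z) (inv (q + z))) (cong (λ u → q * z * inv (q + z) - u) (trans (cong (β *_) (inv-r (>⇒≢ w>0))) (*-identityʳ β)))))
      where
      z>0 : 0ℚ < z
      z>0 = <-trans q>0 q<z
      w>0 : 0ℚ < q + z
      w>0 = +>0 q>0 (<⇒≤ z>0)
      pos′ : 0ℚ < (q - (β + β)) * z + q * (z - q) + q * (q - (β + β))
      pos′ = +>0 (+>0 (*>0 (diff>0 β<q) z>0) (<⇒≤ (*>0 q>0 (diff>0 q<z)))) (<⇒≤ (*>0 q>0 (diff>0 β<q)))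
      e₁ : ∀ β q z → (q - (β + β)) * z + q * (z - q) + q * (q - (β + β)) ≡ q * z - β * (q + z) + (q * z - β * (q + z))
      e₁ = solve-∀ ring
      e₂ : ∀ x β w i → (x - β * w) * i ≡ x * i - β * (w * i)
      e₂ = solve-∀ ring
      half-double : ∀ x → half (x + x) ≡ x
      half-double x = trans (*-distribˡ-+ ½ x x) (half+half x)

    ratio : ℚ → ℚ → ℚ → ℚ
    ratio α β q = (α * q + β) * (α * q + β) * inv (α * (q * q))

    offset : ℚ → ℚ → ℚ → ℚ
    offset α β q = ratio α β q * q - (α * q + β)

    ratio>0 : ∀ {α β q} → 0ℚ < α → 0ℚ < q → 0ℚ < α * q + β → 0ℚ < ratio α β q
    ratio>0 α>0 q>0 A>0 = *>0 (*>0 A>0 A>0) (inv-pos (*>0 α>0 (*>0 q>0 q>0)))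

    -- A(q ∘ z) = A q − α q² / (q + z), and with w = ρ z + c, A q + w = ρ (q + z), the right side is A q − (A q)² / (ρ (q + z)).
    affine-∘ₘ : ∀ {α β q z} → 0ℚ < α → 0ℚ < q → 0ℚ < α * q + β → 0ℚ < z →
      α * (q ∘ₘ z) + β ≡ (α * q + β) ∘ₘ (ratio α β q * z + offset α β q)
    affine-∘ₘ {α} {β} {q} {z} α>0 q>0 A>0 z>0 = sym (ratio-unique′ (begin
      A * (ρ * z + (ρ * q - A)) ≡⟨ e₁ A ρ z q ⟩
      ρ * (A * (q + z)) - A * A ≡⟨ cong (λ u → ρ * (A * (q + z)) - u) (sym AA) ⟩
      ρ * (A * (q + z)) - ρ * (α * (q * q)) ≡⟨ e₂ ρ α β q z ⟩
      ρ * (α * (q * z * 1ℚ) + β * (q + z)) ≡⟨ cong (λ u → ρ * (α * (q * z * u) + β * (q + z))) (sym (inv-r (>⇒≢ w>0))) ⟩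
      ρ * (α * (q * z * ((q + z) * inv (q + z))) + β * (q + z)) ≡⟨ e₃ ρ α β q z (inv (q + z)) A ⟩
      (α * (q * z * inv (q + z)) + β) * (A + (ρ * z + (ρ * q - A))) ∎))
      where
      open ≡-Reasoning
      A ρ : ℚ
      A = α * q + β
      ρ = ratio α β q
      w>0 : 0ℚ < q + z
      w>0 = +>0 q>0 (<⇒≤ z>0)
      AA : ρ * (α * (q * q)) ≡ A * A
      AA = trans (*-assoc (A * A) (inv (α * (q * q))) (α * (q * q))) (trans (cong (A * A *_) (trans (*-comm (inv (α * (q * q))) (α * (q * q))) (inv-r (>⇒≢ (*>0 α>0 (*>0 q>0 q>0)))))) (*-identityʳ (A * A)))
      ratio-unique′ : ∀ {x} → x ≡ (α * (q * z * inv (q + z)) + β) * (A + (ρ * z + (ρ * q - A))) → x * inv (A + (ρ * z + (ρ * q - A))) ≡ α * (q * z * inv (q + z)) + β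
      ratio-unique′ {x} = ratio-unique {x} {A + (ρ * z + (ρ * q - A))} {α * (q * z * inv (q + z)) + β} (>⇒≢ (subst (0ℚ <_) (e₀ A ρ z q) (*>0 (ratio>0 α>0 q>0 A>0) w>0)))
        where
        e₀ : ∀ A ρ z q → ρ * (q + z) ≡ A + (ρ * z + (ρ * q - A))
        e₀ = solve-∀ ring
      e₁ : ∀ A ρ z q → A * (ρ * z + (ρ * q - A)) ≡ ρ * (A * (q + z)) - A * A
      e₁ = solve-∀ ring
      e₂ : ∀ ρ α β q z → ρ * ((α * q + β) * (q + z)) - ρ * (α * (q * q)) ≡ ρ * (α * (q * z * 1ℚ) + β * (q + z))
      e₂ = solve-∀ ring
      e₃ : ∀ ρ α β q z i A → ρ * (α * (q * z * ((q + z) * i)) + β * (q + z)) ≡ (α * (q * z * i) + β) * (A + (ρ * z + (ρ * q - A)))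
      e₃ = solve-∀ ring

    -- The other half of η is left for `Z`, and β is doubled to make up for the halving in
    -- `∘ₘ-lower`. Positivity of α q + β is what `affine-∘ₘ` asks for.
    Admissible-old : List (ℚ × ℚ) → ℚ → ℚ → Law ℚ → Set
    Admissible-old Γ η β d = Meets Γ (half η) (β + β) d × Supp d (λ q → 0ℚ < q × All (λ p → 0ℚ < proj₁ p → 0ℚ < proj₁ p * q + proj₂ p) Γ)

    admissible-old : ∀ Γ {η} β → 0ℚ < η → Ev (Admissible-old Γ η β)
    admissible-old Γ {η} β η>0 = Ev-∧ (Γ , half η , β + β , half>0 η>0 , λ Z m → m)
      (Ev-map (λ d → λ { (p , q) → All.zip (p , swap p q) }) (Ev-∧ (Ev-> 0ℚ) (Ev-∀∈ Γ (λ p → Ev-→ (0ℚ <? proj₁ p) (λ α>0 →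
        Ev-map (λ d → All.map (λ {q} lt → subst₂ _<_ (+-inverseˡ (proj₂ p)) refl (+-monoˡ-< (proj₂ p) (scale-up α>0 lt)))) (Ev-> (inv (proj₁ p) * - proj₂ p)))))))
      where
      scale-up : ∀ {α c q} → 0ℚ < α → inv α * c < q → c < α * q
      scale-up {α} {c} {q} α>0 lt = subst (_< α * q) (trans (sym (*-assoc α (inv α) c)) (trans (cong (_* c) (inv-r (>⇒≢ α>0))) (*-identityˡ c))) (*-monoʳ-<-pos α {{positive α>0}} lt)
      swap : ∀ {d} {R : ℚ × ℚ → ℚ → Set} → Supp d (0ℚ <_) → All (λ p → 0ℚ < proj₁ p → Supp d (R p)) Γ → Supp d (λ q → All (λ p → 0ℚ < proj₁ p → R p q) Γ)
      swap _ h = All.tabulate (λ mq → All.map (λ f α>0 → All.lookup (f α>0) mq) h)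

    -- `Z` comes after d: for every q in the support of d and every map in `Γ` it has to absorb the
    -- inner affine map of `affine-∘ₘ`.
    Compatible : List (ℚ × ℚ) → ℚ → Law ℚ → Law ℚ → Set
    Compatible Γ η d Z = Supp Z (0ℚ <_) × Supp d (λ q → Supp Z (q <_) × All (λ p → 0ℚ < ratio (proj₁ p) (proj₂ p) q → Inv (half η) (ratio (proj₁ p) (proj₂ p) q) (offset (proj₁ p) (proj₂ p) q) Z) Γ)

    compatible : ∀ Γ {η} → 0ℚ < η → ∀ d → Ev (Compatible Γ η d)
    compatible Γ {η} η>0 d = Ev-∧ (Ev-> 0ℚ) (Ev-∀∈ (support d) (λ q → Ev-∧ (Ev-> q) (Ev-∀∈ Γ (λ p →
      Ev-→ (0ℚ <? ratio (proj₁ p) (proj₂ p) q) (λ r>0 → Ev-inv (offset (proj₁ p) (proj₂ p) q) (half>0 η>0) r>0)))))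

    -- The tower estimate speaks of s (q ∘ₘ z), while the induction needs s at a draw from an almost
    -- invariant law. The gap closes because an affine map of q ∘ₘ z splits into the same map of q
    -- and a further affine map of z.
    compose-Meets : ∀ {Γ η β d Z} → Admissible-old Γ η β d → Compatible Γ η d Z → Meets Γ η β (compose d Z)
    compose-Meets {Γ} {η} {β} {d} {Z} ((invs , lower) , pos) (Z>0 , comp) =
      All.tabulate (λ {p} m α>0 → inv′ p α>0 (All.lookup invs m α>0) (All.map (λ { (q>0 , h) → q>0 , All.lookup h m α>0 }) pos) (All.map (λ { (_ , h) → All.lookup h m }) comp)) ,
      Supp-bind d _ (All.zipWith (λ { (lt , ((q>0 , _) , (far , _))) → Supp-image _ Z (All.map (λ q<z → ∘ₘ-lower q>0 lt q<z) far) }) (lower , All.zip (pos , comp)))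
      where
      inv′ : ∀ p → let α = proj₁ p ; β′ = proj₂ p in 0ℚ < α → Inv (half η) α β′ d → Supp d (λ q → 0ℚ < q × 0ℚ < α * q + β′) →
        Supp d (λ q → 0ℚ < ratio α β′ q → Inv (half η) (ratio α β′ q) (offset α β′ q) Z) → Inv η α β′ (compose d Z)
      inv′ (α , β′) α>0 d-inv d>0 Z-inv G p q = begin
        𝔼 (compose d Z) (λ z → G (α * z + β′)) ≡⟨ 𝔼-compose d Z _ ⟩
        𝔼 d (λ q → 𝔼 Z (λ z → G (α * (q ∘ₘ z) + β′)))
          ≡⟨ 𝔼-cong∈ d (All.map (λ { (q>0 , A>0) → 𝔼-cong∈ Z (All.map (λ z>0 → cong G (affine-∘ₘ α>0 q>0 A>0 z>0)) Z>0) }) d>0) ⟩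
        𝔼 d (λ q → 𝔼 Z (λ z → G ((α * q + β′) ∘ₘ (ratio α β′ q * z + offset α β′ q))))
          ≤⟨ 𝔼-mono d (All.zipWith (λ { {x} ((q>0 , A>0) , i) → i (ratio>0 α>0 q>0 A>0) (λ z → G ((α * x + β′) ∘ₘ z)) (λ z → p _) (λ z → q _) }) (d>0 , Z-inv)) ⟩
        𝔼 d (λ q → H (α * q + β′) + half η) ≡⟨ 𝔼-+c d (λ q → H (α * q + β′)) (half η) ⟩
        𝔼 d (λ q → H (α * q + β′)) + half η ≤⟨ +-monoˡ-≤ (half η) (d-inv H (λ x → 𝔼-c≤ Z (Supp-all Z (λ z → p _))) (λ x → 𝔼-≤c Z (Supp-all Z (λ z → q _)))) ⟩
        𝔼 d H + half η + half η ≡⟨ trans (+-assoc (𝔼 d H) (half η) (half η)) (cong₂ _+_ (sym (𝔼-compose d Z G)) (half+half η)) ⟩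
        𝔼 (compose d Z) G + η ∎
        where
        open ≤-Reasoning
        H : ℚ → ℚ
        H x = 𝔼 Z (λ z → G (x ∘ₘ z))

open Composition

-- Choice of the constants.

module Parameters where
  open import Data.Rational
  open import Data.Rational.Properties

  half³ : ℚ → ℚ
  half³ x = half (half (half x))

  half³>0 : ∀ {x} → 0ℚ < x → 0ℚ < half³ x
  half³>0 p = half>0 (half>0 (half>0 p))

  eighths : ∀ x → let h = half³ x in h + h + (h + h) + (h + h + (h + h)) ≡ x
  eighths x = trans (cong₂ _+_ quarter quarter) (half+half x)
    where
    quarter : half³ x + half³ x + (half³ x + half³ x) ≡ half x
    quarter = trans (cong₂ _+_ (half+half (half (half x))) (half+half (half (half x)))) (half+half (half x))

  5×-≤ : ∀ {h x} → 0ℚ < h → h ≤ half³ x → 5× h ≤ x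
  5×-≤ {h} {x} h>0 le = ≤-by (+≥0 (+≥0 (+≥0 h≥0 h≥0) h≥0) (+≥0 (+≥0 (+≥0 d d) (+≥0 d d)) (+≥0 (+≥0 d d) (+≥0 d d)))) (trans (e h (half³ x)) (cong (_- 5× h) (eighths x)))
    where
    h≥0 : 0ℚ ≤ h
    h≥0 = <⇒≤ h>0
    d : 0ℚ ≤ half³ x - h
    d = diff≥0 le
    e : ∀ h k → h + h + h + (k - h + (k - h) + (k - h + (k - h)) + (k - h + (k - h) + (k - h + (k - h)))) ≡
      k + k + (k + k) + (k + k + (k + k)) - (h + h + h + (h + h))
    e = solve-∀ ring

  eps≤ : ∀ {σ} → 0ℚ < σ → σ ≤ 1ℚ → eps σ ≤ σ
  eps≤ {σ} σ>0 le = ≤-trans (*-monoˡ (<⇒≤ (inv-pos (fromℕ-suc>0 11))) (≤-trans (*-monoˡ (<⇒≤ σ>0) le) (≤-reflexive (*-identityʳ σ))))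
    (*-cancel (fromℕ-suc>0 11) (≤-trans (≤-reflexive (trans (sym (*-assoc (fromℕ 12) (inv (fromℕ 12)) σ)) (trans (cong (_* σ) (inv-r (>⇒≢ (fromℕ-suc>0 11)))) (*-identityˡ σ))))
      (≤-by (*≥0 (fromℕ≥0 11) (<⇒≤ σ>0)) (e (fromℕ 11) σ))))
    where
    e : ∀ n σ → n * σ ≡ (1ℚ + n) * σ - σ
    e = solve-∀ ring

  -- `enough` is the hypothesis of `replace-D` for a tower of K + 1 levels, and `error` bounds the
  -- total loss in `key`.
  record Constants (m : ℚ) : Set where
    field
      κ₀ σ   : ℚ
      κ>0    : 0ℚ < κ₀
      σ>0    : 0ℚ < σ
      K      : ℕ
      enough : 2ℚ * inv (fromℕ (ℕ.suc K)) + (5× σ + 5× σ) ≤ κ₀ * κ₀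
      error  : σ + σ + κ₀ + σ + eps σ ≤ m

  abstract
    constants : ∀ {m} → 0ℚ < m → Constants m
    constants {m} m>0 = record { κ₀ = κ₀ ; σ = σ ; κ>0 = κ>0 ; σ>0 = σ>0 ; K = proj₁ sm ; enough = enough ; error = error }
      where
      κ₀ x σ : ℚ
      κ₀ = half m
      x = half (half (κ₀ * κ₀))
      -- κ₀² = 4x is divided equally between the diagonal of the tower and 10σ; the second bound
      -- leaves room in m beside κ₀ = m/2, and σ ≤ 1 gives `eps σ ≤ σ`.
      σ = half³ x ⊓ (half³ (half m) ⊓ 1ℚ)
      κ>0 : 0ℚ < κ₀
      κ>0 = half>0 m>0
      x>0 : 0ℚ < x
      x>0 = half>0 (half>0 (*>0 κ>0 κ>0))
      σ>0 : 0ℚ < σ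
      σ>0 = ⊓>0 (half³>0 x>0) (⊓>0 (half³>0 κ>0) 0<1)
      sm : Σ ℕ λ n → inv (fromℕ (ℕ.suc n)) ≤ x
      sm = small x>0
      enough : 2ℚ * inv (fromℕ (ℕ.suc (proj₁ sm))) + (5× σ + 5× σ) ≤ κ₀ * κ₀
      enough = ≤-trans (+-mono-≤ (≤-trans (*-monoˡ (<⇒≤ (+>0 0<1 0≤1)) (proj₂ sm)) (≤-reflexive (trans (e x) (half+half (half (κ₀ * κ₀))))))
          (≤-trans (+-mono-≤ p p) (≤-reflexive (half+half (half (κ₀ * κ₀)))))) (≤-reflexive (half+half (κ₀ * κ₀)))
        where
        p : 5× σ ≤ x
        p = 5×-≤ σ>0 (p⊓q≤p (half³ x) (half³ (half m) ⊓ 1ℚ))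
        e : ∀ x → (1ℚ + 1ℚ) * x ≡ x + x
        e = solve-∀ ring
      error : σ + σ + κ₀ + σ + eps σ ≤ m
      error = ≤-by (+≥0 (+≥0 (diff≥0 (eps≤ σ>0 (≤-trans (p⊓q≤q (half³ x) (half³ (half m) ⊓ 1ℚ)) (p⊓q≤q (half³ (half m)) 1ℚ))))
          (diff≥0 {5× σ} {half m} (5×-≤ {σ} {half m} σ>0 (≤-trans (p⊓q≤q (half³ x) (half³ (half m) ⊓ 1ℚ)) (p⊓q≤p (half³ (half m)) 1ℚ))))) (<⇒≤ σ>0))
        (trans (e (eps σ) σ (half m)) (cong (_- (σ + σ + κ₀ + σ + eps σ)) (half+half m)))
        where
        e : ∀ ε σ h → σ - ε + (h - (σ + σ + σ + (σ + σ))) + σ ≡ h + h - (σ + σ + h + σ + ε)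
        e = solve-∀ ring

  -- Only finitely many z occur in the supports, so the product lists required by `twist-Mean` can
  -- be joined into one list before φ is known.
  twisted-list : ∀ {δ₀} (V : ℚ → Law ℚ) {L} → All (0ℚ <_) L → ∀ {zs} → All (λ z → Supp (V z) (0ℚ <_)) zs →
    Σ (List ℚ) λ L′ → All (0ℚ <_) L′ × (∀ φ → Mean δ₀ L′ φ → All (λ z → Mean δ₀ L (twist φ (V z))) zs)
  twisted-list V L>0 [] = [] , [] , λ φ mean → []
  twisted-list {δ₀} V {L} L>0 {z ∷ zs} (p ∷ ps) = go (twisted-list V L>0 ps)
    where
    L₁ : List ℚ
    L₁ = cartesianProductWith _*_ L (support (V z))
    L₁>0 : All (0ℚ <_) L₁
    L₁>0 = products>0 L>0
      where
      products>0 : ∀ {L} → All (0ℚ <_) L → All (0ℚ <_) (cartesianProductWith _*_ L (support (V z)))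
      products>0 [] = []
      products>0 (q ∷ qs) = ++⁺ (map⁺ (All.map (*>0 q) p)) (products>0 qs)
    go : _ → Σ (List ℚ) λ L′ → All (0ℚ <_) L′ × (∀ φ → Mean δ₀ L′ φ → All (λ z → Mean δ₀ L (twist φ (V z))) (z ∷ zs))
    go (L′ , L′>0 , h) = L₁ ++ L′ , ++⁺ L₁>0 L′>0 , λ φ mean →
      twist-Mean {δ₀} {L} {φ} (V z) (Mean-⊆ {L′ = L₁ ++ L′} {φ} ∈-++⁺ˡ mean) ∷ h φ (Mean-⊆ {L′ = L₁ ++ L′} {φ} (∈-++⁺ʳ L₁) mean)

open Parameters

-- Induction on the energy φ 1.

module EnergyIncrement where
  open import Data.Rational
  open import Data.Rational.Properties

  module Increment (a b e : ℚ) (a>0 : 0ℚ < a) (b>0 : 0ℚ < b) (e>0 : 0ℚ < e) (a≢e : a ≢ e) (b≢e : b ≢ e) (a<b : a < b) {δ₀} (δ>0 : 0ℚ < δ₀) where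

    open Composite a b e a>0 b>0 e>0 a≢e b≢e a<b public

    -- With τ = δ₀/8 the loss 2τ in `structured` leaves δ₀/4 of the δ₀/2 found by the walk. η′ =
    -- τ²/4 is the drop tolerated there, and half of it, δ₀²/512, is the energy quantum of the
    -- induction.
    τ η′ step : ℚ
    τ = half³ δ₀
    η′ = half (half (τ * τ))
    step = half η′

    τ>0 : 0ℚ < τ
    τ>0 = half³>0 δ>0

    η′>0 : 0ℚ < η′
    η′>0 = half>0 (half>0 (*>0 τ>0 τ>0))

    step>0 : 0ℚ < step
    step>0 = half>0 η′>0

    Payload : ℚ → ℕ → Law ℚ → Set
    Payload ε n d = Σ (List ℚ) λ L → All (0ℚ <_) L × (∀ φ → State φ → Mean δ₀ L φ → φ 1ℚ ≤ fromℕ n * step → ε ≤ 𝔼 d (λ q → φ (s q)))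

    -- ε precedes the eventual property, so the lower bound does not deteriorate when more
    -- invariance is demanded of the law; the list inside `Payload` may still depend on the law.
    Claim : ℕ → Set₁
    Claim n = Σ ℚ λ ε → 0ℚ < ε × Source (Payload ε n)

    join : ∀ {ε n ds} → All (Payload ε n) ds → Σ (List ℚ) λ L → All (0ℚ <_) L ×
      (∀ φ → State φ → Mean δ₀ L φ → φ 1ℚ ≤ fromℕ n * step → All (λ d → ε ≤ 𝔼 d (λ q → φ (s q))) ds)
    join [] = [] , [] , λ φ S mean le → []
    join {ε} {n} {d ∷ ds} ((L , L>0 , h) ∷ ps) = go (join {ε} {n} {ds} ps)
      where
      go : _ → _
      go (L′ , L′>0 , h′) = L ++ L′ , ++⁺ L>0 L′>0 , λ φ S mean le →
        h φ S (Mean-⊆ {L′ = L ++ L′} {φ} ∈-++⁺ˡ mean) le ∷ h′ φ S (Mean-⊆ {L′ = L ++ L′} {φ} (∈-++⁺ʳ L) mean) le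

    -- Vacuous: `Mean` at the single point 1 gives δ₀ ≤ φ 1, against φ 1 ≤ 0.
    claim-zero : Claim 0
    claim-zero = 1ℚ , 0<1 , λ ev → proj₁ (Ev-law ev) , proj₂ (Ev-law ev) , 1ℚ ∷ [] , 0<1 ∷ [] , λ φ S mean le →
      ⊥-elim (<-irrefl refl (<-≤-trans δ>0 (≤-trans (mean (point 1ℚ) (Supp-point (here refl)))
        (≤-trans (≤-reflexive (trans (𝔼-point 1ℚ _) (trans (𝔼-point 1ℚ _) (ratio-self S {1ℚ} 1≢0)))) (≤-trans le (≤-reflexive (*-zeroˡ step)))))))

    gain-μ : ℚ → ℚ
    gain-μ ε′ = ε′ * half η′

    -- The lower of the two cases: half of μ is left after a drop of energy, δ₀/4 in its absence.
    gain : ℚ → ℚ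
    gain ε′ = half (gain-μ ε′) ⊓ half (half δ₀)

    -- Two dilutions by mixing: one law among Z₀ and the steps of the walk, then one of `Z` and
    -- `comp Z`.
    next-ε : ℚ → ℚ
    next-ε ε′ = inv (fromℕ (ℕ.suc (walk-length δ>0))) * (inv (fromℕ 2) * gain ε′)

    gain-μ>0 : ∀ {ε′} → 0ℚ < ε′ → 0ℚ < gain-μ ε′
    gain-μ>0 p = *>0 p (half>0 η′>0)

    next-ε>0 : ∀ {ε′} → 0ℚ < ε′ → 0ℚ < next-ε ε′
    next-ε>0 p = *>0 (inv-pos (fromℕ-suc>0 (walk-length δ>0))) (*>0 (inv-pos (fromℕ-suc>0 1)) (⊓>0 (half>0 (gain-μ>0 p)) (half>0 (half>0 δ>0))))

    edge-mean : Law ℚ → List (Law ℚ) → (ℚ → ℚ) → Law ℚ → ℚ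
    edge-mean top rest φ Z = 𝔼 (uniform top rest) (λ d → 𝔼 d (λ q → 𝔼 Z (λ z → φ (s (q ∘ₘ z)))))

    record Good (X : Law ℚ) (μ : ℚ) (Γ : List (ℚ × ℚ)) (η β : ℚ) (top : Law ℚ) (rest : List (Law ℚ)) (Z : Law ℚ) : Set where
      field
        pushes   : ∀ φ → State φ → 𝔼 Z (λ z → 𝔼 (uniform top rest) (λ d → 𝔼 d (λ q → twist φ (products X z) (s q)))) ≤ edge-mean top rest φ Z + half μ
        straight : ∀ φ → State φ → φ 1ℚ - 𝔼 Z (λ z → twist φ (products X z) 1ℚ) ≤ η′ → 𝔼 Z (λ q → φ (ω * q)) ≤ 𝔼 Z (λ q → φ (s q)) + (τ + τ)
        meets    : Meets Γ η β Z
        fits     : All (λ d → Compatible Γ η d Z) (top ∷ rest)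
        Z>0      : Supp Z (0ℚ <_)

    module Combine {n ε′} (ε′>0 : 0ℚ < ε′) (X : Law ℚ) (X≥0 : Supp X (0ℚ ≤_)) (Γ : List (ℚ × ℚ)) (η β : ℚ) (top : Law ℚ) (rest : List (Law ℚ))
      (each : All (λ d → Payload ε′ n d × Admissible-old Γ η β d) (top ∷ rest)) where

      μ ε : ℚ
      μ = gain-μ ε′
      ε = next-ε ε′

      U : Law (Law ℚ)
      U = uniform top rest

      φz : (ℚ → ℚ) → ℚ → ℚ → ℚ
      φz φ z = twist φ (products X z)

      Good′ : Law ℚ → Set
      Good′ = Good X μ Γ η β top rest

      open Good

      -- `uniform` needs a first entry and `Zs` carries no proof of being nonempty, so one further
      -- good law `Z₀` is supplied.
      module _ (Z₀ : Law ℚ) (Zs : List (Law ℚ)) (goods : All Good′ (Z₀ ∷ Zs)) (count : length Zs ≡ walk-length δ>0)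
        (L₁ : List ℚ) (L₁>0 : All (0ℚ <_) L₁) (escape : Escape ω δ₀ L₁ Zs) where

        -- `comp Z` succeeds when the energy drops under the twists by `Z`; when no drop is large,
        -- some `Z` of the walk succeeds itself. Which case occurs depends on φ, so both are mixed
        -- in advance.
        comp part : Law ℚ → Law ℚ
        comp Z = bind U (λ d → compose d Z)
        part Z = bind (uniform Z (comp Z ∷ [])) id

        D₊ : Law ℚ
        D₊ = bind (uniform Z₀ Zs) part

        comp-Meets : ∀ {Z} → All (λ d → Compatible Γ η d Z) (top ∷ rest) → Meets Γ η β (comp Z)
        comp-Meets {Z} c = Meets-bind {Γ = Γ} {η} {β} U (λ d → compose d Z) (Supp-uniform top rest
          (All.zipWith (λ {d} h → compose-Meets {Γ} {η} {β} {d} {Z} (proj₂ (proj₁ h)) (proj₂ h)) (each , c)))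

        part-Meets : ∀ {Z} → Good′ Z → Meets Γ η β (part Z)
        part-Meets {Z} g = Meets-bind {Γ = Γ} {η} {β} (uniform Z (comp Z ∷ [])) id (Supp-uniform Z (comp Z ∷ [])
          (meets g ∷ comp-Meets (fits g) ∷ []))

        D-Meets : Meets Γ η β D₊
        D-Meets = Meets-bind {Γ = Γ} {η} {β} (uniform Z₀ Zs) part (Supp-uniform Z₀ Zs (All.map part-Meets goods))

        D-≥ : ∀ {F Z W} → (∀ q → 0ℚ ≤ F q) → Z ∈ Z₀ ∷ Zs → W ∈ Z ∷ comp Z ∷ [] → gain ε′ ≤ 𝔼 W F → ε ≤ 𝔼 D₊ F
        D-≥ {F} {Z} {W} F≥0 mZ mW le = begin
          ε ≡⟨ cong (λ k → inv (fromℕ (ℕ.suc k)) * (inv (fromℕ 2) * gain ε′)) (sym count) ⟩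
          inv (fromℕ (ℕ.suc (length Zs))) * (inv (fromℕ 2) * gain ε′)
            ≤⟨ uniform-≥ {x = Z₀} {Zs} {Z} {λ Z → 𝔼 (part Z) F} {inv (fromℕ 2) * gain ε′} (λ Z → 𝔼-c≤ (part Z) (Supp-all (part Z) F≥0)) mZ inner ⟩
          𝔼 (uniform Z₀ Zs) (λ Z → 𝔼 (part Z) F) ≡⟨ sym (𝔼-bind (uniform Z₀ Zs) part F) ⟩
          𝔼 D₊ F ∎
          where
          open ≤-Reasoning
          inner : inv (fromℕ 2) * gain ε′ ≤ 𝔼 (part Z) F
          inner = begin
            inv (fromℕ 2) * gain ε′ ≤⟨ uniform-≥ {x = Z} {comp Z ∷ []} {W} {λ W → 𝔼 W F} {gain ε′} (λ W → 𝔼-c≤ W (Supp-all W F≥0)) mW le ⟩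
            𝔼 (uniform Z (comp Z ∷ [])) (λ W → 𝔼 W F) ≡⟨ sym (𝔼-bind (uniform Z (comp Z ∷ [])) id F) ⟩
            𝔼 (part Z) F ∎

        L₂ : Σ (List ℚ) λ L → All (0ℚ <_) L × (∀ φ → State φ → Mean δ₀ L φ → φ 1ℚ ≤ fromℕ n * step → All (λ d → ε′ ≤ 𝔼 d (λ q → φ (s q))) (top ∷ rest))
        L₂ = join {ε′} {n} (All.map proj₁ each)

        L₃ : Σ (List ℚ) λ L → All (0ℚ <_) L × (∀ φ → Mean δ₀ L φ → All (λ z → Mean δ₀ (proj₁ L₂) (φz φ z)) (concat (map support (Z₀ ∷ Zs))))
        L₃ = twisted-list (products X) (proj₁ (proj₂ L₂)) (concat⁺ (map⁺ (All.map (λ g →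
          All.map (λ z>0 → Supp-bind X _ (All.map (λ x≥0 → Supp-bind X _ (All.map (λ y≥0 → Supp-point (*>0 (+>0 z>0 x≥0) (+>0 z>0 y≥0))) X≥0)) X≥0)) (Z>0 g)) goods)))

        payload : Payload ε (ℕ.suc n) D₊
        payload = proj₁ L₃ ++ L₁ , ++⁺ (proj₁ (proj₂ L₃)) L₁>0 , bound
          where
          bound : ∀ φ → State φ → Mean δ₀ (proj₁ L₃ ++ L₁) φ → φ 1ℚ ≤ fromℕ (ℕ.suc n) * step → ε ≤ 𝔼 D₊ (λ q → φ (s q))
          bound φ S mean energy = cases (exists-or-all (λ Z → φ 1ℚ - 𝔼 Z (λ z → φz φ z 1ℚ)) η′ (Z₀ ∷ Zs))
            where
            open State S
            F≥0 : ∀ q → 0ℚ ≤ φ (s q)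
            F≥0 q = φ≥0 (s q)
            means : All (λ Z → Supp Z (λ z → Mean δ₀ (proj₁ L₂) (φz φ z))) (Z₀ ∷ Zs)
            means = map⁻ (concat⁻ (proj₂ (proj₂ L₃) φ (Mean-⊆ {L′ = proj₁ L₃ ++ L₁} {φ} ∈-++⁺ˡ mean)))
            -- No good z has to be selected. If φ_z 1 is at most n steps, the induction hypothesis
            -- applies to φ_z and the bracket is at most 1; otherwise the bracket is nonpositive,
            -- since φ 1 is at most n + 1 steps and `half η′` is one step.
            low : ∀ z → Mean δ₀ (proj₁ L₂) (φz φ z) → ε′ * (φ 1ℚ - φz φ z 1ℚ - half η′) ≤ 𝔼 U (λ d → 𝔼 d (λ q → φz φ z (s q)))
            low z mean-z = go (φz φ z 1ℚ ≤? fromℕ n * step)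
              where
              Sz : State (φz φ z)
              Sz = twist-State S (products X z)
              go : Dec (φz φ z 1ℚ ≤ fromℕ n * step) → ε′ * (φ 1ℚ - φz φ z 1ℚ - half η′) ≤ 𝔼 U (λ d → 𝔼 d (λ q → φz φ z (s q)))
              go (yes p) = ≤-trans (≤-trans (*-monoˡ (<⇒≤ ε′>0) (≤-by (+≥0 (+≥0 (diff≥0 (φ≤1 1ℚ)) (State.φ≥0 Sz 1ℚ)) (<⇒≤ (half>0 η′>0))) (e₁ (φ 1ℚ) (φz φ z 1ℚ) (half η′)))) (≤-reflexive (*-identityʳ ε′)))
                (𝔼-c≤ U (Supp-uniform top rest (proj₂ (proj₂ L₂) (φz φ z) Sz mean-z p)))
                where
                e₁ : ∀ x y h → 1ℚ - x + y + h ≡ 1ℚ - (x - y - h)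
                e₁ = solve-∀ ring
              go (no p) = ≤-trans (≤-trans (*-monoˡ (<⇒≤ ε′>0) (≤-by (+≥0 (diff≥0 energy) (<⇒≤ (diff>0 (≰⇒> p)))) (e₁ (fromℕ n) step (φ 1ℚ) (φz φ z 1ℚ)))) (≤-reflexive (*-zeroʳ ε′)))
                (𝔼-c≤ U (Supp-all U (λ d → 𝔼-c≤ d (Supp-all d (λ q → State.φ≥0 Sz (s q))))))
                where
                e₁ : ∀ n t x y → (1ℚ + n) * t - x + (y - n * t) ≡ 0ℚ - (x - y - t)
                e₁ = solve-∀ ring
            comp-def : ∀ Z → 𝔼 (comp Z) (λ q → φ (s q)) ≡ edge-mean top rest φ Z
            comp-def Z = trans (𝔼-bind U _ _) (𝔼-cong U (λ d → 𝔼-compose d Z _))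
            -- Averaged over z, a drop above η′ keeps at least η′/2 after subtracting one step,
            -- hence a value of at least μ = ε′ η′/2; `pushes` loses half of it.
            drop : ∀ Z → η′ < φ 1ℚ - 𝔼 Z (λ z → φz φ z 1ℚ) → Supp Z (λ z → Mean δ₀ (proj₁ L₂) (φz φ z)) → Good′ Z → half μ ≤ 𝔼 (comp Z) (λ q → φ (s q))
            drop Z lt mean-Z g = subst (half μ ≤_) (sym (comp-def Z))
              (≤-by (diff≥0 chain) (trans (cong (λ u → edge-mean top rest φ Z + half μ - u) (sym (half+half μ))) (e₁ (edge-mean top rest φ Z) (half μ))))
              where
              e₁ : ∀ E h → E + h - (h + h) ≡ E - h
              e₁ = solve-∀ ring
              chain : μ ≤ edge-mean top rest φ Z + half μ
              chain = begin
                ε′ * half η′ ≤⟨ *-monoˡ (<⇒≤ ε′>0) (≤-by (<⇒≤ (diff>0 lt)) (trans (cong (λ u → φ 1ℚ - 𝔼 Z (λ z → φz φ z 1ℚ) - u) (sym (half+half η′))) (e₃ (φ 1ℚ - 𝔼 Z (λ z → φz φ z 1ℚ)) (half η′)))) ⟩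
                ε′ * (φ 1ℚ - 𝔼 Z (λ z → φz φ z 1ℚ) - half η′)
                  ≡⟨ sym (trans (𝔼-* Z ε′ _) (cong (ε′ *_) (trans (𝔼-- Z _ _) (cong₂ _-_ (trans (𝔼-- Z _ _) (cong (_- 𝔼 Z (λ z → φz φ z 1ℚ)) (𝔼-const Z (φ 1ℚ)))) (𝔼-const Z (half η′)))))) ⟩
                𝔼 Z (λ z → ε′ * (φ 1ℚ - φz φ z 1ℚ - half η′)) ≤⟨ 𝔼-mono Z (All.map (λ {z} h → low z h) mean-Z) ⟩
                𝔼 Z (λ z → 𝔼 U (λ d → 𝔼 d (λ q → φz φ z (s q)))) ≤⟨ pushes g φ S ⟩
                edge-mean top rest φ Z + half μ ∎
                where
                open ≤-Reasoning
                e₃ : ∀ x h → x - (h + h) ≡ x - h - h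
                e₃ = solve-∀ ring
            cases : _ → ε ≤ 𝔼 D₊ (λ q → φ (s q))
            cases (inj₁ (Z , mZ , lt)) = D-≥ F≥0 mZ (there (here refl)) (≤-trans (p⊓q≤p (half μ) (half (half δ₀))) (drop Z lt (All.lookup means mZ) (All.lookup goods mZ)))
            -- All drops are small, so `structured` applies to the law on which the walk escapes and
            -- gives δ₀/2 - 2τ = δ₀/4.
            cases (inj₂ small-drops) = go (escape φ S (Mean-⊆ {L′ = proj₁ L₃ ++ L₁} {φ} (∈-++⁺ʳ (proj₁ L₃)) mean))
              where
              go : _ → ε ≤ 𝔼 D₊ (λ q → φ (s q))
              go (Z , mZ , lt) = D-≥ F≥0 (there mZ) (here refl) (≤-trans (p⊓q≤q (half μ) (half (half δ₀))) (≤-by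
                  (+≥0 (diff≥0 (straight (All.lookup goods (there mZ)) φ S (All.lookup small-drops (there mZ)))) (<⇒≤ (diff>0 lt)))
                  (trans (e₁ (𝔼 Z (λ q → φ (s q))) τ (𝔼 Z (λ q → φ (ω * q))) (half δ₀)) (cong (λ u → 𝔼 Z (λ q → φ (s q)) - u) slack))))
                where
                e₁ : ∀ x t y h → x + (t + t) - y + (y - h) ≡ x - (h - (t + t))
                e₁ = solve-∀ ring
                slack : half δ₀ - (τ + τ) ≡ half (half δ₀)
                slack = trans (cong₂ _-_ (sym (half+half (half δ₀))) (half+half (half (half δ₀)))) (e₂ (half (half δ₀)))
                  where
                  e₂ : ∀ h → h + h - h ≡ h
                  e₂ = solve-∀ ring

      finish : Ev Good′ → Σ (Law ℚ) λ d → Meets Γ η β d × Payload ε (ℕ.suc n) d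
      finish good = go (Ev-law good) (walk ω>0 δ>0 (Ev-map (λ Z h → h , Z>0 h) good))
        where
        go : Σ (Law ℚ) Good′ → (Σ (List (Law ℚ)) λ Zs → All Good′ Zs × length Zs ≡ walk-length δ>0 × Σ (List ℚ) λ L → All (0ℚ <_) L × Escape ω δ₀ L Zs) →
          Σ (Law ℚ) λ d → Meets Γ η β d × Payload ε (ℕ.suc n) d
        go (Z₀ , g₀) (Zs , gs , count , L₁ , L₁>0 , escape) =
          D₊ Z₀ Zs (g₀ ∷ gs) count L₁ L₁>0 escape , D-Meets Z₀ Zs (g₀ ∷ gs) count L₁ L₁>0 escape , payload Z₀ Zs (g₀ ∷ gs) count L₁ L₁>0 escape

    module Step {n : ℕ} {ε′ : ℚ} (ε′>0 : 0ℚ < ε′) (src : Source (Payload ε′ n)) (Γ : List (ℚ × ℚ)) {η : ℚ} (β : ℚ) (η>0 : 0ℚ < η) where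

      Old-payload : Law ℚ → Set
      Old-payload d = Payload ε′ n d × Admissible-old Γ η β d

      source : Source Old-payload
      source {P} ev = go (src {λ d → P d × Admissible-old Γ η β d} (Ev-∧ {P} {Admissible-old Γ η β} ev (admissible-old Γ β η>0)))
        where
        go : Σ (Law ℚ) (λ d → (P d × Admissible-old Γ η β d) × Payload ε′ n d) → Σ (Law ℚ) λ d → P d × Old-payload d
        go (d , (p , q) , r) = d , p , (r , q)

      module _ (C : Constants (half (gain-μ ε′))) (X : Law ℚ) (X-spread : Spread (eps (Constants.σ C)) X)
        (X-fine : Spread (half (half³ (τ * τ))) X) (X≥0 : Supp X (0ℚ ≤_)) where

        open Constants C
        open Build σ>0 X X-spread using (Towers; towers; key)

        from-towers : Towers Old-payload K → Σ (Law ℚ) λ d → Meets Γ η β d × Payload (next-ε ε′) (ℕ.suc n) d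
        from-towers record { top = top ; rest = rest ; size = refl ; each = each ; pairs = pairs } =
          Combine.finish {n} ε′>0 X X≥0 Γ η β top rest (All.map proj₁ each) good
          where
          good : Ev (Good X (gain-μ ε′) Γ η β top rest)
          good = Ev-map (λ Z → λ { (k , t , m , f , p) → record
                { pushes = λ φ S → ≤-trans (k φ S) (+-monoʳ-≤ (edge-mean top rest φ Z) error) ; straight = t ; meets = m ; fits = f ; Z>0 = p } })
              (Ev-∧ (key κ>0 top rest (All.map proj₂ each) pairs enough)
              (Ev-∧ (structured τ>0 X X-fine X≥0) (Ev-∧ (Γ , η , β , η>0 , λ Z m → m)
              (Ev-∧ (Ev-∀∈ (top ∷ rest) (λ d → compatible Γ η>0 d)) (Ev-> 0ℚ)))))

        built : Σ (Law ℚ) λ d → Meets Γ η β d × Payload (next-ε ε′) (ℕ.suc n) d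
        built = from-towers (towers source K)

      build : Σ (Law ℚ) λ d → Meets Γ η β d × Payload (next-ε ε′) (ℕ.suc n) d
      build = go (constants (half>0 (gain-μ>0 ε′>0)))
        where
        go : Constants (half (gain-μ ε′)) → Σ (Law ℚ) λ d → Meets Γ η β d × Payload (next-ε ε′) (ℕ.suc n) d
        go C = go′ (mkGrid (⊓>0 (eps>0 (Constants.σ>0 C)) (half>0 (half³>0 (*>0 τ>0 τ>0)))))
          where
          ρ₁ ρ₂ : ℚ
          ρ₁ = eps (Constants.σ C)
          ρ₂ = half (half³ (τ * τ))
          go′ : Grid (ρ₁ ⊓ ρ₂) → Σ (Law ℚ) λ d → Meets Γ η β d × Payload (next-ε ε′) (ℕ.suc n) d
          go′ record { grid = X ; spread = sp ; inside = ins } =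
            built C X (λ c → ≤-trans (sp c) (p⊓q≤p ρ₁ ρ₂)) (λ c → ≤-trans (sp c) (p⊓q≤q ρ₁ ρ₂)) (All.map proj₁ ins)

    claim : ∀ n → Claim n
    claim ℕ.zero = claim-zero
    claim (ℕ.suc n) = go (claim n)
      where
      go : Claim n → Claim (ℕ.suc n)
      go (ε′ , ε′>0 , src) = next-ε ε′ , next-ε>0 ε′>0 , next
        where
        next : Source (Payload (next-ε ε′) (ℕ.suc n))
        next {P} (Γ , η , β , η>0 , h) = fin (Step.build {n} ε′>0 src Γ β η>0)
          where
          fin : Σ (Law ℚ) (λ d → Meets Γ η β d × Payload (next-ε ε′) (ℕ.suc n) d) → Σ (Law ℚ) (λ d → P d × Payload (next-ε ε′) (ℕ.suc n) d)
          fin (d , m , pay) = d , h d m , pay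

    -- Since φ 1 ≤ 1, a number of stages of at least 1 / step covers every state.
    recurrence : ∀ {P} → Ev P → Σ (Law ℚ) λ d → P d × Σ (List ℚ) λ L → All (0ℚ <_) L ×
      (∀ φ → State φ → Mean δ₀ L φ → 0ℚ < 𝔼 d (λ q → φ (s q)))
    recurrence {P} ev = go (claim N)
      where
      N : ℕ
      N = proj₁ (archimedean (inv step))
      full : 1ℚ ≤ fromℕ N * step
      full = ≤-trans (≤-reflexive (trans (sym (inv-r (>⇒≢ step>0))) (*-comm step (inv step)))) (≤-trans (≤-reflexive (*-comm (inv step) step)) (≤-trans (*-monoˡ (<⇒≤ step>0) (proj₂ (archimedean (inv step)))) (≤-reflexive (*-comm step (fromℕ N)))))
      Result : Set
      Result = Σ (Law ℚ) λ d → P d × Σ (List ℚ) λ L → All (0ℚ <_) L × (∀ φ → State φ → Mean δ₀ L φ → 0ℚ < 𝔼 d (λ q → φ (s q)))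
      go : Claim N → Result
      go (ε , ε>0 , src) = fin (src ev)
        where
        fin : (Σ (Law ℚ) λ d → P d × Payload ε N d) → Result
        fin (d , Pd , L , L>0 , h) = d , Pd , L , L>0 , λ φ S mean → <-≤-trans ε>0 (h φ S mean (≤-trans (State.φ≤1 S 1ℚ) full))

open EnergyIncrement

-- The correlation state of a finite set.

module CorrelationState where
  open import Data.Rational
  open import Data.Rational.Properties

  sum-cong∈ : ∀ {A : Set} {l : List A} {f g} → All (λ a → f a ≡ g a) l → sum l f ≡ sum l g
  sum-cong∈ [] = refl
  sum-cong∈ (p ∷ ps) = cong₂ _+_ p (sum-cong∈ ps)

  sum-cong : ∀ {A : Set} (l : List A) {f g : A → ℚ} → (∀ a → f a ≡ g a) → sum l f ≡ sum l g
  sum-cong l h = sum-cong∈ (All.universal h l)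

  sum-* : ∀ {A : Set} (l : List A) c f → sum l (λ a → c * f a) ≡ c * sum l f
  sum-* [] c f = sym (*-zeroʳ c)
  sum-* (a ∷ l) c f = trans (cong (c * f a +_) (sum-* l c f)) (sym (*-distribˡ-+ c (f a) (sum l f)))

  sum-swap : ∀ {A B : Set} (l : List A) (m : List B) (F : A → B → ℚ) → sum l (λ a → sum m (F a)) ≡ sum m (λ b → sum l (λ a → F a b))
  sum-swap [] m F = sym (sum-zero {l = m} (All.universal (λ _ → refl) m))
  sum-swap (a ∷ l) m F = trans (cong (sum m (F a) +_) (sum-swap l m F)) (sym (sum-+ m (F a) (λ b → sum l (λ a → F a b))))

  sum≥0 : ∀ {A : Set} (l : List A) {f : A → ℚ} → (∀ a → 0ℚ ≤ f a) → 0ℚ ≤ sum l f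
  sum≥0 [] h = ≤-refl
  sum≥0 (a ∷ l) h = +≥0 (h a) (sum≥0 l h)

  sum-pos : ∀ {A : Set} (l : List A) {f : A → ℚ} → (∀ a → 0ℚ ≤ f a) → 0ℚ < sum l f → Σ A λ a → a ∈ l × 0ℚ < f a
  sum-pos [] h p = ⊥-elim (<-irrefl refl p)
  sum-pos (a ∷ l) {f} h p = go (0ℚ <? f a)
    where
    go : Dec (0ℚ < f a) → Σ _ λ b → b ∈ a ∷ l × 0ℚ < f b
    go (yes q) = a , here refl , q
    go (no q) = next (sum-pos l h (<-≤-trans p (≤-trans (+-monoˡ-≤ (sum l f) (≮⇒≥ q)) (≤-reflexive (+-identityˡ (sum l f))))))
      where
      next : _ → Σ _ λ b → b ∈ a ∷ l × 0ℚ < f b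
      next (b , m , r) = b , there m , r

  E-sum : ∀ {A B : Set} (l : List (ℚ × A)) (m : List B) (F : A → B → ℚ) → E l (λ a → sum m (F a)) ≡ sum m (λ b → E l (λ a → F a b))
  E-sum l [] F = E-zero l
  E-sum l (b ∷ m) F = trans (E-+ l (λ a → F a b) (λ a → sum m (F a))) (cong (E l (λ a → F a b) +_) (E-sum l m F))

  E-cong∈ : ∀ {A : Set} {l : List (ℚ × A)} {f g} → All (λ p → f (proj₂ p) ≡ g (proj₂ p)) l → E l f ≡ E l g
  E-cong∈ [] = refl
  E-cong∈ {l = (w , a) ∷ l} (p ∷ ps) = cong₂ (λ x y → w * x + y) p (E-cong∈ ps)

  δ-cong : ∀ {x y x′ y′} → (x ≡ y → x′ ≡ y′) → (x′ ≡ y′ → x ≡ y) → δ x y ≡ δ x′ y′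
  δ-cong {x} {y} {x′} {y′} f g = ≤-antisym (δ-mono x y x′ y′ f) (δ-mono x′ y′ x y g)

  δ-pos : ∀ {x y} → 0ℚ < δ x y → x ≡ y
  δ-pos {x} {y} p = go (δ-case x y)
    where
    go : _ → x ≡ y
    go (inj₁ (q , _)) = q
    go (inj₂ (_ , q)) = ⊥-elim (<-irrefl (sym q) p)

  sum-δ-≤1 : ∀ {A : Set} {l : List A} {f : A → ℚ} → Unique l → (∀ {x y} → f x ≡ f y → x ≡ y) → ∀ k → sum l (λ y → δ k (f y)) ≤ 1ℚ
  sum-δ-≤1 [] inj k = 0≤1
  sum-δ-≤1 {l = a ∷ l} {f} (n ∷ u) inj k = go (δ-case k (f a))
    where
    go : _ → δ k (f a) + sum l (λ y → δ k (f y)) ≤ 1ℚ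
    go (inj₁ (p , q)) = ≤-reflexive (trans (cong₂ _+_ q (sum-zero {l = l} (All.map (λ ne → δ-≢ (λ r → ne (inj (trans (sym p) r)))) n))) (+-identityʳ 1ℚ))
    go (inj₂ (_ , q)) = ≤-trans (≤-reflexive (trans (cong (_+ sum l (λ y → δ k (f y))) q) (+-identityˡ (sum l (λ y → δ k (f y)))))) (sum-δ-≤1 u inj k)

  sum-δ-∈ : ∀ {K : List ℚ} {i} → Unique K → i ∈ K → (F : ℚ → ℚ) → sum K (λ k → δ k i * F k) ≡ F i
  sum-δ-∈ {i ∷ K} (n ∷ u) (here refl) F = trans (cong₂ _+_ (trans (cong (_* F i) (δ-≡ refl)) (*-identityˡ (F i)))
    (sum-zero {l = K} (All.map (λ {k} ne → trans (cong (_* F k) (δ-≢ (λ eq → ne (sym eq)))) (*-zeroˡ (F k))) n))) (+-identityʳ (F i))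
  sum-δ-∈ {k ∷ K} {i} (n ∷ u) (there m) F = trans (cong₂ _+_ (trans (cong (_* F k) (δ-≢ (All.lookup n m))) (*-zeroˡ (F k))) (sum-δ-∈ u m F)) (+-identityˡ (F i))

  module Correlation (A : List ℚ) (A-unique : Unique A) (A≢0 : All (_≢ 0ℚ) A) (N>0 : 0ℚ < fromℕ (length A)) where

    N c : ℚ
    N = fromℕ (length A)
    c = inv N

    c>0 : 0ℚ < c
    c>0 = inv-pos N>0

    -- For nonzero r this is |A ∩ r A| / |A|.
    corr : ℚ → ℚ
    corr r = c * sum A (λ x → sum A (λ y → δ x (r * y)))

    -- Takes care of the convention that 0 is its own inverse: `corr (g * inv h)` vanishes when g or
    -- h is 0, whereas the bare counts of x * inv 0 would not.
    χ : ℚ → ℚ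
    χ g = 1ℚ - δ g 0ℚ

    χ-0 : ∀ {g} → g ≡ 0ℚ → χ g ≡ 0ℚ
    χ-0 eq = trans (cong (λ u → 1ℚ - u) (δ-≡ eq)) (+-inverseʳ 1ℚ)

    χ-1 : ∀ {g} → g ≢ 0ℚ → χ g ≡ 1ℚ
    χ-1 n = trans (cong (λ u → 1ℚ - u) (δ-≢ n)) (+-identityʳ 1ℚ)

    δ-0 : ∀ {x t} → x ≢ 0ℚ → t ≡ 0ℚ → δ x t ≡ 0ℚ
    δ-0 n eq = δ-≢ (λ p → n (trans p eq))

    δ-ratio : ∀ {x} g h y → x ≢ 0ℚ → δ x (g * inv h * y) ≡ χ g * χ h * δ (x * inv g) (y * inv h)
    δ-ratio {x} g h y x≢0 = go (g ≟ 0ℚ) (h ≟ 0ℚ)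
      where
      d : ℚ
      d = δ (x * inv g) (y * inv h)
      go : Dec (g ≡ 0ℚ) → Dec (h ≡ 0ℚ) → δ x (g * inv h * y) ≡ χ g * χ h * δ (x * inv g) (y * inv h)
      go (yes p) _ = trans (δ-0 x≢0 (trans (cong (λ u → u * inv h * y) p) (e (inv h) y))) (sym (trans (cong (λ u → u * χ h * d) (χ-0 p)) (e (χ h) d)))
        where
        e : ∀ i y → 0ℚ * i * y ≡ 0ℚ
        e = solve-∀ ring
      go (no _) (yes p) = trans (δ-0 x≢0 (trans (cong (λ u → g * u * y) (trans (cong inv p) inv-0)) (e g y))) (sym (trans (cong (λ u → χ g * u * d) (χ-0 p)) (e (χ g) d)))
        where
        e : ∀ i y → i * 0ℚ * y ≡ 0ℚ
        e = solve-∀ ring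
      go (no p) (no q) = trans (δ-cong to from) (sym (trans (cong₂ (λ u v → u * v * d) (χ-1 p) (χ-1 q)) (e d)))
        where
        e : ∀ d → 1ℚ * 1ℚ * d ≡ d
        e = solve-∀ ring
        e₁ : ∀ g i y j → g * i * y * j ≡ g * j * (y * i)
        e₁ = solve-∀ ring
        to : x ≡ g * inv h * y → x * inv g ≡ y * inv h
        to eq = trans (cong (_* inv g) eq) (trans (e₁ g (inv h) y (inv g)) (trans (cong (_* (y * inv h)) (inv-r p)) (*-identityˡ (y * inv h))))
        e₂ : ∀ g i y → g * (y * i) ≡ g * i * y
        e₂ = solve-∀ ring
        e₃ : ∀ x g j → g * (x * j) ≡ g * j * x
        e₃ = solve-∀ ring
        from : x * inv g ≡ y * inv h → x ≡ g * inv h * y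
        from eq = trans (sym (trans (e₃ x g (inv g)) (trans (cong (_* x) (inv-r p)) (*-identityˡ x)))) (trans (cong (g *_) eq) (e₂ g (inv h) y))

    -- For nonzero g the indicator function of A / g. Up to the factor c, `corr (g * inv h)` is the
    -- inner product of two such functions, whence positivity.
    feature : ℚ → ℚ → ℚ
    feature g k = χ g * sum A (λ x → δ k (x * inv g))

    corr-features : ∀ {K g} → Unique K → All (λ x → x * inv g ∈ K) A → ∀ h → corr (g * inv h) ≡ c * sum K (λ k → feature g k * feature h k)
    corr-features {K} {g} u keys h = cong (c *_) (begin
      sum A (λ x → sum A (λ y → δ x (g * inv h * y))) ≡⟨ sum-cong∈ (All.map (λ {x} n → sum-cong A (λ y → δ-ratio g h y n)) A≢0) ⟩
      sum A (λ x → sum A (λ y → χ g * χ h * δ (x * inv g) (y * inv h)))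
        ≡⟨ sum-cong∈ (All.map (λ {x} m → sum-cong A (λ y → cong (χ g * χ h *_) (sym (sum-δ-∈ u m (λ k → δ k (y * inv h)))))) keys) ⟩
      sum A (λ x → sum A (λ y → χ g * χ h * sum K (λ k → δ k (x * inv g) * δ k (y * inv h))))
        ≡⟨ sum-cong A (λ x → trans (sum-cong A (λ y → sym (sum-* K (χ g * χ h) _))) (sum-swap A K _)) ⟩
      sum A (λ x → sum K (λ k → sum A (λ y → χ g * χ h * (δ k (x * inv g) * δ k (y * inv h))))) ≡⟨ sum-swap A K _ ⟩
      sum K (λ k → sum A (λ x → sum A (λ y → χ g * χ h * (δ k (x * inv g) * δ k (y * inv h))))) ≡⟨ sum-cong K (λ k → factor (χ g) (χ h) (λ x → δ k (x * inv g)) (λ y → δ k (y * inv h))) ⟩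
      sum K (λ k → feature g k * feature h k) ∎)
      where
      open ≡-Reasoning
      factor : ∀ a b (f f′ : ℚ → ℚ) → sum A (λ x → sum A (λ y → a * b * (f x * f′ y))) ≡ a * sum A f * (b * sum A f′)
      factor a b f f′ = trans (sum-cong A (λ x → trans (sum-cong A (λ y → e a b (f x) (f′ y))) (sum-* A (a * b * f x) f′)))
        (trans (sum-cong A (λ x → e₁ a b (f x) (sum A f′))) (trans (sum-* A (a * b * sum A f′) f) (e₂ a b (sum A f) (sum A f′))))
        where
        e : ∀ a b x y → a * b * (x * y) ≡ a * b * x * y
        e = solve-∀ ring
        e₁ : ∀ a b x s → a * b * x * s ≡ a * b * s * x
        e₁ = solve-∀ ring
        e₂ : ∀ a b s t → a * b * t * s ≡ a * s * (b * t)
        e₂ = solve-∀ ring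

    corr-State : State corr
    corr-State = record
      { φ≥0 = λ g → *≥0 (<⇒≤ c>0) (sum≥0 A (λ x → sum≥0 A (λ y → δ≥0 x (g * y))))
      ; φ≤1 = λ g → ≤-trans (*-monoˡ (<⇒≤ c>0) (≤-trans (sum-mono (All.map (λ n → row g n (g ≟ 0ℚ)) A≢0)) (≤-reflexive (sum-1 A)))) (≤-reflexive (trans (*-comm c N) (inv-r (>⇒≢ N>0))))
      ; φ-inv = λ g → cong (c *_) (trans (sum-cong∈ (All.map (λ {x} n → sum-cong∈ (All.map (λ {y} n′ → flip g n n′ (g ≟ 0ℚ)) A≢0)) A≢0)) (sum-swap A A _))
      ; pd = pd }
      where
      row : ∀ g {x} → x ≢ 0ℚ → Dec (g ≡ 0ℚ) → sum A (λ y → δ x (g * y)) ≤ 1ℚ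
      row g {x} n (yes eq) = ≤-trans (≤-reflexive (sum-zero {l = A} (All.universal (λ y → δ-0 n (trans (cong (_* y) eq) (*-zeroˡ y))) A))) 0≤1
      row g {x} n (no g≢0) = sum-δ-≤1 A-unique (λ {y} {y′} → cancel-≡ {g} {y} {y′} g≢0) x
      flip : ∀ g {x y} → x ≢ 0ℚ → y ≢ 0ℚ → Dec (g ≡ 0ℚ) → δ x (inv g * y) ≡ δ y (g * x)
      flip g {x} {y} n n′ (yes eq) = trans (δ-0 n (trans (cong (_* y) (trans (cong inv eq) inv-0)) (*-zeroˡ y))) (sym (δ-0 n′ (trans (cong (_* x) eq) (*-zeroˡ x))))
      flip g {x} {y} n n′ (no g≢0) = δ-cong (λ eq → sym (trans (cong (g *_) eq) (undo y))) (λ eq → sym (trans (cong (inv g *_) eq) (undo′ x)))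
        where
        e₁ : ∀ g i y → g * (i * y) ≡ g * i * y
        e₁ = solve-∀ ring
        undo : ∀ y → g * (inv g * y) ≡ y
        undo y = trans (e₁ g (inv g) y) (trans (cong (_* y) (inv-r g≢0)) (*-identityˡ y))
        e₂ : ∀ g i y → i * (g * y) ≡ g * i * y
        e₂ = solve-∀ ring
        undo′ : ∀ y → inv g * (g * y) ≡ y
        undo′ y = trans (e₂ g (inv g) y) (trans (cong (_* y) (inv-r g≢0)) (*-identityˡ y))
      pd : ∀ l → 0ℚ ≤ E l (λ g → E l (λ h → corr (g * inv h)))
      pd l = subst (0ℚ ≤_) (sym form) (*≥0 (<⇒≤ c>0) (sum≥0 K (λ k → square≥0 (E l (λ g → feature g k)))))
        where
        K₀ K : List ℚ
        K₀ = cartesianProductWith (λ p x → x * inv (proj₂ p)) l A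
        K = deduplicate _≟_ K₀
        keys : All (λ p → All (λ x → x * inv (proj₂ p) ∈ K) A) l
        keys = All.tabulate (λ mp → All.tabulate (λ mx → ∈-deduplicate⁺ _≟_ (∈-cartesianProductWith⁺ (λ p x → x * inv (proj₂ p)) mp mx)))
        form : E l (λ g → E l (λ h → corr (g * inv h))) ≡ c * sum K (λ k → E l (λ g → feature g k) * E l (λ g → feature g k))
        form = begin
          E l (λ g → E l (λ h → corr (g * inv h)))
            ≡⟨ E-cong∈ {l = l} {λ g → E l (λ h → corr (g * inv h))} {λ g → E l (λ h → c * sum K (λ k → feature g k * feature h k))} (All.map (λ {p} ks → E-cong l (λ h → corr-features {K} {proj₂ p} (deduplicate-! _≟_ K₀) ks h)) keys) ⟩
          E l (λ g → E l (λ h → c * sum K (λ k → feature g k * feature h k)))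
            ≡⟨ E-cong l (λ g → trans (E-* l c _) (cong (c *_) (trans (E-sum l K (λ h k → feature g k * feature h k)) (sum-cong K (λ k → E-* l (feature g k) (λ h → feature h k)))))) ⟩
          E l (λ g → c * sum K (λ k → feature g k * E l (λ h → feature h k)))
            ≡⟨ trans (E-* l c _) (cong (c *_) (trans (E-sum l K (λ g k → feature g k * E l (λ h → feature h k))) (sum-cong K (λ k → trans (E-cong l (λ g → *-comm (feature g k) (E l (λ h → feature h k)))) (E-* l (E l (λ h → feature h k)) (λ g → feature g k)))))) ⟩
          c * sum K (λ k → E l (λ g → feature g k) * E l (λ g → feature g k)) ∎
          where open ≡-Reasoning

    -- Cauchy–Schwarz over the set K of all x / g: Σ m² ≥ 2 t Σ m − t² |K| with t = 1 / D.
    corr-Mean : ∀ {D L K} → 0ℚ < D → Unique K → fromℕ (length K) ≤ D * N → All (λ g → g ≢ 0ℚ × All (λ x → x * inv g ∈ K) A) L → Mean (inv D) L corr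
    corr-Mean {D} {L} {K} D>0 u size keys Y Y⊂L = begin
      inv D ≡⟨ sym value ⟩
      c * (2ℚ * (t * N) - t * t * (D * N)) ≤⟨ *-monoˡ (<⇒≤ c>0) (≤-trans (≤-by (*≥0 (square≥0 t) (diff≥0 size)) (e₀ (2ℚ * (t * N)) (t * t) (fromℕ (length K)) (D * N))) squares) ⟩
      c * sum K (λ k → m k * m k) ≡⟨ sym form ⟩
      𝔼 Y (λ g → 𝔼 Y (λ h → corr (g * inv h))) ∎
      where
      open ≤-Reasoning
      t : ℚ
      t = inv D
      m : ℚ → ℚ
      m k = 𝔼 Y (λ g → feature g k)
      e₀ : ∀ a s k d → s * (d - k) ≡ a - s * k - (a - s * d)
      e₀ = solve-∀ ring
      Y-keys : Supp Y (λ g → g ≢ 0ℚ × All (λ x → x * inv g ∈ K) A)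
      Y-keys = All.map (All.lookup keys) Y⊂L
      value : c * (2ℚ * (t * N) - t * t * (D * N)) ≡ inv D
      value = trans (e c t N D) (trans (cong₂ (λ x y → x * ((1ℚ + 1ℚ) * t - t * y)) (inv-r (>⇒≢ N>0)) (inv-r (>⇒≢ D>0))) (e₁ t))
        where
        e : ∀ c t N D → c * ((1ℚ + 1ℚ) * (t * N) - t * t * (D * N)) ≡ N * c * ((1ℚ + 1ℚ) * t - t * (D * t))
        e = solve-∀ ring
        e₁ : ∀ t → 1ℚ * ((1ℚ + 1ℚ) * t - t * 1ℚ) ≡ t
        e₁ = solve-∀ ring
      total : sum K m ≡ N
      total = trans (sym (𝔼-sum Y K feature)) (trans (𝔼-cong∈ Y (All.map (λ { (g≢0 , ks) → one g≢0 ks }) Y-keys)) (𝔼-const Y N))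
        where
        one : ∀ {g} → g ≢ 0ℚ → All (λ x → x * inv g ∈ K) A → sum K (feature g) ≡ N
        one {g} g≢0 ks = trans (sum-* K (χ g) (λ k → sum A (λ x → δ k (x * inv g)))) (trans (cong (_* sum K (λ k → sum A (λ x → δ k (x * inv g)))) (χ-1 g≢0))
          (trans (*-identityˡ (sum K (λ k → sum A (λ x → δ k (x * inv g))))) (trans (sum-swap K A (λ k x → δ k (x * inv g)))
          (trans (sum-cong∈ (All.map (λ {x} mk → trans (sum-cong K (λ k → sym (*-identityʳ (δ k (x * inv g))))) (sum-δ-∈ u mk (λ _ → 1ℚ))) ks)) (sum-1 A)))))
      squares : 2ℚ * (t * N) - t * t * fromℕ (length K) ≤ sum K (λ k → m k * m k)
      squares = begin
        2ℚ * (t * N) - t * t * fromℕ (length K)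
          ≡⟨ cong₂ (λ x y → 2ℚ * (t * x) - t * t * y) (sym total) (sym (sum-1 K)) ⟩
        2ℚ * (t * sum K m) - t * t * sum K (λ _ → 1ℚ)
          ≡⟨ trans (e₁ t (sum K m) (sum K (λ _ → 1ℚ))) (trans (cong₂ _+_ (sym (sum-* K ((1ℚ + 1ℚ) * t) m)) (sym (sum-* K (- (t * t)) (λ _ → 1ℚ)))) (sym (sum-+ K (λ k → (1ℚ + 1ℚ) * t * m k) (λ _ → - (t * t) * 1ℚ)))) ⟩
        sum K (λ k → (1ℚ + 1ℚ) * t * m k + - (t * t) * 1ℚ) ≤⟨ sum-mono (All.universal (λ k → ≤-by (square≥0 (m k - t)) (e₂ t (m k))) K) ⟩
        sum K (λ k → m k * m k) ∎
        where
        e₁ : ∀ t s n → (1ℚ + 1ℚ) * (t * s) - t * t * n ≡ (1ℚ + 1ℚ) * t * s + - (t * t) * n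
        e₁ = solve-∀ ring
        e₂ : ∀ t m → (m - t) * (m - t) ≡ m * m - ((1ℚ + 1ℚ) * t * m + - (t * t) * 1ℚ)
        e₂ = solve-∀ ring
      form : 𝔼 Y (λ g → 𝔼 Y (λ h → corr (g * inv h))) ≡ c * sum K (λ k → m k * m k)
      form = begin-equality
        𝔼 Y (λ g → 𝔼 Y (λ h → corr (g * inv h)))
          ≡⟨ 𝔼-cong∈ Y (All.map (λ { (_ , ks) → 𝔼-cong Y (λ h → corr-features u ks h) }) Y-keys) ⟩
        𝔼 Y (λ g → 𝔼 Y (λ h → c * sum K (λ k → feature g k * feature h k)))
          ≡⟨ 𝔼-cong Y (λ g → trans (𝔼-* Y c _) (cong (c *_) (trans (𝔼-sum Y K (λ h k → feature g k * feature h k)) (sum-cong K (λ k → 𝔼-* Y (feature g k) (λ h → feature h k)))))) ⟩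
        𝔼 Y (λ g → c * sum K (λ k → feature g k * m k))
          ≡⟨ trans (𝔼-* Y c _) (cong (c *_) (trans (𝔼-sum Y K (λ g k → feature g k * m k)) (sum-cong K (λ k → trans (𝔼-cong Y (λ g → *-comm (feature g k) (m k))) (𝔼-* Y (m k) (λ g → feature g k)))))) ⟩
        c * sum K (λ k → m k * m k) ∎

    corr-pos : ∀ {r} → 0ℚ < corr r → Σ ℚ λ x → Σ ℚ λ y → x ∈ A × y ∈ A × x ≡ r * y
    corr-pos {r} p = go (sum-pos A (λ x → sum≥0 A (λ y → δ≥0 x (r * y))) positive-sum)
      where
      positive-sum : 0ℚ < sum A (λ x → sum A (λ y → δ x (r * y)))
      positive-sum = ≰⇒> (λ le → <-irrefl refl (<-≤-trans p (≤-trans (*-monoˡ (<⇒≤ c>0) le) (≤-reflexive (*-zeroʳ c)))))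
      go : (Σ ℚ λ x → x ∈ A × 0ℚ < sum A (λ y → δ x (r * y))) → Σ ℚ λ x → Σ ℚ λ y → x ∈ A × y ∈ A × x ≡ r * y
      go (x , mx , q) = go′ (sum-pos A (λ y → δ≥0 x (r * y)) q)
        where
        go′ : (Σ ℚ λ y → y ∈ A × 0ℚ < δ x (r * y)) → Σ ℚ λ x → Σ ℚ λ y → x ∈ A × y ∈ A × x ≡ r * y
        go′ (y , my , q′) = x , y , mx , my , δ-pos q′

open CorrelationState

-- Multiplying and dividing inside the windows Φ_M.

module PrimeWindows where
  open import Data.Fin.Base using (Fin; zero; suc; toℕ; fromℕ<)
  open import Data.Fin.Properties using (toℕ-fromℕ<; toℕ-injective; toℕ<n) renaming (_≟_ to _≟ᶠ_; suc-injective to Fin-suc-injective)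
  import Data.List.Relation.Unary.AllPairs.Properties as AllPairs
  open import Data.Nat.Base
  open import Data.Nat.Divisibility
  open import Data.Nat.Primality
  open import Data.Nat.Primality.Factorisation using (PrimeFactorisation; factorise)
  open import Data.Nat.Properties
  open import Data.Product.Base using (∃₂)
  open import Relation.Nullary.Decidable using (¬?)
  open import Relation.Unary using (Decidable)
  open import Defs

  primesBelow-suc : ∀ n → primesBelow (suc n) ≡ primesBelow n + length (filter prime? (n ∷ []))
  primesBelow-suc n = trans (cong (λ l → length (filter prime? l)) (sym (upTo-∷ʳ n)))
    (trans (cong length (filter-++ prime? (upTo n) (n ∷ []))) (length-++ (filter prime? (upTo n))))

  primesBelow-mono : ∀ {m n} → m ≤′ n → primesBelow m ≤ primesBelow n
  primesBelow-mono ≤′-refl = ≤-refl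
  primesBelow-mono {m} {suc n} (≤′-step h) = ≤-trans (primesBelow-mono h) (≤-trans (m≤m+n (primesBelow n) _) (≤-reflexive (sym (primesBelow-suc n))))

  primesBelow-< : ∀ {p q} → Prime p → p < q → primesBelow p < primesBelow q
  primesBelow-< {p} pp lt = ≤-trans (≤-reflexive (sym (trans (primesBelow-suc p)
    (trans (cong (λ l → primesBelow p + length l) (filter-accept prime? {p} {[]} pp)) (+-comm (primesBelow p) 1))))) (primesBelow-mono (≤⇒≤′ lt))

  primesBelow-≤ : ∀ n → primesBelow n ≤ n
  primesBelow-≤ n = ≤-trans (length-filter prime? (upTo n)) (≤-reflexive (length-upTo n))

  nth-unique : ∀ {i p q} → IsNthPrime i p → IsNthPrime i q → p ≡ q
  nth-unique {i} {p} {q} (pp , ep) (pq , eq) = go (<-cmp p q)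
    where
    go : _ → p ≡ q
    go (tri< lt _ _) = ⊥-elim (<-irrefl (trans ep (sym eq)) (primesBelow-< pp lt))
    go (tri≈ _ e _) = e
    go (tri> _ _ gt) = ⊥-elim (<-irrefl (trans eq (sym ep)) (primesBelow-< pq gt))

  prime≢1 : ∀ {p} → Prime p → p ≢ 1
  prime≢1 pp refl = ¬prime[1] pp

  prime-∣-prime : ∀ {p q} → Prime p → Prime q → p ∣ q → p ≡ q
  prime-∣-prime pp pq d = go (prime⇒irreducible pq d)
    where
    go : _ → _
    go (inj₁ e) = ⊥-elim (prime≢1 pp e)
    go (inj₂ e) = e

  prime-∣-^ : ∀ {p q} → Prime p → Prime q → ∀ k → p ∣ q ^ k → p ≡ q
  prime-∣-^ pp pq zero d = ⊥-elim (prime≢1 pp (∣1⇒≡1 d))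
  prime-∣-^ {q = q} pp pq (suc k) d = go (euclidsLemma q (q ^ k) pp d)
    where
    go : _ → _
    go (inj₁ e) = prime-∣-prime pp pq e
    go (inj₂ e) = prime-∣-^ pp pq k e

  prime-∣-prodFin : ∀ {p} → Prime p → ∀ M f → p ∣ prodFin M f → Σ (Fin M) λ i → p ∣ f i
  prime-∣-prodFin pp zero f d = ⊥-elim (prime≢1 pp (∣1⇒≡1 d))
  prime-∣-prodFin pp (suc M) f d = go (euclidsLemma (f zero) (prodFin M (f ∘ suc)) pp d)
    where
    go : _ → _
    go (inj₁ e) = zero , e
    go (inj₂ e) = let (i , h) = prime-∣-prodFin pp M (f ∘ suc) e in suc i , h

  rest : ∀ {M} → Fin M → (Fin M → ℕ) → ℕ
  rest {suc M} zero f = prodFin M (f ∘ suc)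
  rest {suc M} (suc i) f = f zero * rest i (f ∘ suc)

  prodFin-cong : ∀ M {f g} → (∀ i → f i ≡ g i) → prodFin M f ≡ prodFin M g
  prodFin-cong zero h = refl
  prodFin-cong (suc M) h = cong₂ _*_ (h zero) (prodFin-cong M (h ∘ suc))

  rest-cong : ∀ {M} (i : Fin M) {f g} → (∀ j → j ≢ i → f j ≡ g j) → rest i f ≡ rest i g
  rest-cong {suc M} zero h = prodFin-cong M (λ j → h (suc j) λ ())
  rest-cong {suc M} (suc i) h = cong₂ _*_ (h zero λ ()) (rest-cong i (λ j n → h (suc j) (λ { refl → n refl })))

  prodFin-rest : ∀ {M} (i : Fin M) f → prodFin M f ≡ f i * rest i f
  prodFin-rest {suc M} zero f = refl
  prodFin-rest {suc M} (suc i) f = trans (cong (f zero *_) (prodFin-rest i (f ∘ suc))) (trans (sym (*-assoc (f zero) (f (suc i)) _))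
    (trans (cong (_* rest i (f ∘ suc)) (*-comm (f zero) (f (suc i)))) (*-assoc (f (suc i)) (f zero) _)))

  prime-∣-rest : ∀ {p} → Prime p → ∀ {M} (i : Fin M) f → p ∣ rest i f → Σ (Fin M) λ j → j ≢ i × p ∣ f j
  prime-∣-rest pp {suc M} zero f d = let (j , h) = prime-∣-prodFin pp M (f ∘ suc) d in suc j , (λ ()) , h
  prime-∣-rest pp {suc M} (suc i) f d = go (euclidsLemma (f zero) (rest i (f ∘ suc)) pp d)
    where
    go : _ → _
    go (inj₁ e) = zero , (λ ()) , e
    go (inj₂ e) = let (j , n , h) = prime-∣-rest pp i (f ∘ suc) e in suc j , n ∘ Fin-suc-injective , h

  -- The head r of a full line r, q r, ..., q^M r inside Φ_M. Lines with different heads are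
  -- disjoint, so there are at most |Φ_M| / (M + 1) of them.
  Core : ℕ → ℕ → ℕ → Set
  Core M q r = ¬ (q ∣ r) × (∀ j → j ≤ M → InΦ M (q ^ j * r))

  -- The condition q < M puts q among the first M primes because `primesBelow q ≤ q`; its exponent
  -- can then be reset to any value up to M without touching the other primes.
  slot : ∀ {M q x} → Prime q → q < M → InΦ M x → Σ ℕ λ k → Σ ℕ λ r → x ≡ q ^ k * r × k ≤ M × Core M q r
  slot {M} {q} {x} pq q<M (p , k , nth , eq) =
    toℕ (k i) , r , trans eq (trans (prodFin-rest i (term k)) (cong (λ u → u ^ toℕ (k i) * r) p-i)) , s≤s⁻¹ (toℕ<n (k i)) , q∤r , dilate
    where
    term : (Fin M → Fin (suc M)) → Fin M → ℕ
    term k j = p j ^ toℕ (k j)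
    i<M : primesBelow q < M
    i<M = ≤-<-trans (primesBelow-≤ q) q<M
    i : Fin M
    i = fromℕ< i<M
    r : ℕ
    r = rest i (term k)
    p-i : p i ≡ q
    p-i = nth-unique (nth i) (pq , sym (toℕ-fromℕ< i<M))
    q∤r : ¬ (q ∣ r)
    q∤r d = let (j , n , h) = prime-∣-rest pq i (term k) d in
      n (toℕ-injective (trans (sym (proj₂ (nth j))) (trans (cong primesBelow (trans (sym (prime-∣-^ pq (proj₁ (nth j)) (toℕ (k j)) h)) (sym p-i))) (proj₂ (nth i)))))
    dilate : ∀ j → j ≤ M → InΦ M (q ^ j * r)
    dilate j j≤M = p , k′ , nth , sym (trans (prodFin-rest i (term k′)) (cong₂ _*_ at-i (rest-cong i away)))
      where
      pick : (l : Fin M) → Dec (l ≡ i) → Fin (suc M)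
      pick l (yes _) = fromℕ< (s≤s j≤M)
      pick l (no _) = k l
      k′ : Fin M → Fin (suc M)
      k′ l = pick l (l ≟ᶠ i)
      at-i : term k′ i ≡ q ^ j
      at-i = trans (go (i ≟ᶠ i)) (cong (_^ j) p-i)
        where
        go : (d : Dec (i ≡ i)) → p i ^ toℕ (pick i d) ≡ p i ^ j
        go (yes _) = cong (p i ^_) (toℕ-fromℕ< (s≤s j≤M))
        go (no n) = ⊥-elim (n refl)
      away : ∀ l → l ≢ i → term k′ l ≡ term k l
      away l n = go (l ≟ᶠ i)
        where
        go : (d : Dec (l ≡ i)) → p l ^ toℕ (pick l d) ≡ term k l
        go (yes e) = ⊥-elim (n e)
        go (no _) = refl

  prime-nonZero : ∀ {p} → Prime p → p ≢ 0
  prime-nonZero pp refl = ¬prime[0] pp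

  Φ-nonZero : ∀ {M x} → InΦ M x → x ≢ 0
  Φ-nonZero {M} (p , k , nth , eq) x≡0 = go M (λ i → p i ^ toℕ (k i)) (λ i z → prime-nonZero (proj₁ (nth i)) (m^n≡0⇒m≡0 (p i) (toℕ (k i)) z)) (trans (sym eq) x≡0)
    where
    go : ∀ M f → (∀ i → f i ≢ 0) → prodFin M f ≢ 0
    go (suc M) f n z = case (m*n≡0⇒m≡0∨n≡0 (f zero) z)
      where
      case : _ → _
      case (inj₁ e) = n zero e
      case (inj₂ e) = go M (f ∘ suc) (n ∘ suc) e

  unique-length : ∀ {A : Set} {xs ys : List A} → Unique xs → All (_∈ ys) xs → length xs ≤ length ys
  unique-length [] [] = z≤n
  unique-length {xs = x ∷ xs} {ys} (n ∷ u) (m ∷ ms) = go (∈-∃++ m)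
    where
    go : (∃₂ λ as bs → ys ≡ as ++ (x ∷ []) ++ bs) → suc (length xs) ≤ length ys
    go (as , bs , refl) = ≤-trans (s≤s (unique-length u (All.zipWith (λ { (ne , m) → drop ne (∈-++⁻ as m) }) (n , ms))))
      (≤-reflexive (trans (cong suc (length-++ as)) (trans (sym (+-suc (length as) (length bs))) (sym (length-++ as)))))
      where
      drop : ∀ {y} → x ≢ y → y ∈ as ⊎ y ∈ x ∷ bs → y ∈ as ++ bs
      drop ne (inj₁ m) = ∈-++⁺ˡ m
      drop ne (inj₂ (here e)) = ⊥-elim (ne (sym e))
      drop ne (inj₂ (there m)) = ∈-++⁺ʳ as m

  filter-split : ∀ {A : Set} {P : A → Set} (P? : Decidable P) xs → length xs ≡ length (filter P? xs) + length (filter (¬? ∘ P?) xs)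
  filter-split P? [] = refl
  filter-split P? (x ∷ xs) with P? x
  ... | yes _ = cong suc (filter-split P? xs)
  ... | no _ = trans (cong suc (filter-split P? xs)) (sym (+-suc (length (filter P? xs)) _))

  preimages : ∀ {f : ℕ → ℕ} {Q : ℕ → Set} {xs} → All (λ x → Σ ℕ λ y → x ≡ f y × Q y) xs → Unique xs →
    Σ (List ℕ) λ ys → Unique ys × All Q ys × length ys ≡ length xs
  preimages {f} {Q} {xs} h u = ys h , AllPairs.map (λ n e → n (cong f e)) (AllPairs.map⁻ (subst Unique (eq h) u)) , qs h , len h
    where
    ys : ∀ {xs} → All (λ x → Σ ℕ λ y → x ≡ f y × Q y) xs → List ℕ
    ys [] = []
    ys ((y , _) ∷ h) = y ∷ ys h
    eq : ∀ {xs} (h : All (λ x → Σ ℕ λ y → x ≡ f y × Q y) xs) → xs ≡ map f (ys h)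
    eq [] = refl
    eq ((y , e , _) ∷ h) = cong₂ _∷_ e (eq h)
    qs : ∀ {xs} (h : All (λ x → Σ ℕ λ y → x ≡ f y × Q y) xs) → All Q (ys h)
    qs [] = []
    qs ((_ , _ , q) ∷ h) = q ∷ qs h
    len : ∀ {xs} (h : All (λ x → Σ ℕ λ y → x ≡ f y × Q y) xs) → length (ys h) ≡ length xs
    len [] = refl
    len (_ ∷ h) = cong suc (len h)

  module Window (M : ℕ) (ys : List ℕ) (cover : ∀ x → InΦ M x → x ∈ ys) where

    module _ {q} (pq : Prime q) (q<M : q < M) where

      power : ∀ {r s} i k → q ^ (suc k + i) * r ≡ q ^ i * s → q ∣ s
      power {r} {s} i k eq = divides-refl′ (*-cancelˡ-≡ (q ^ suc k * r) s (q ^ i) {{m^n≢0 q i {{prime⇒nonZero pq}}}}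
        (trans (sym (*-assoc (q ^ i) (q ^ suc k) r)) (trans (cong (_* r) (trans (*-comm (q ^ i) (q ^ suc k)) (sym (^-distribˡ-+-* q (suc k) i)))) eq)))
        where
        divides-refl′ : q ^ suc k * r ≡ s → q ∣ s
        divides-refl′ e = subst (q ∣_) e (∣-trans (m∣m*n (q ^ k)) (m∣m*n r))

      dilates : ℕ → List ℕ → List ℕ
      dilates zero rs = []
      dilates (suc j) rs = map (q ^ j *_) rs ++ dilates j rs

      ∈-dilates : ∀ j {rs x} → x ∈ dilates j rs → Σ ℕ λ i → Σ ℕ λ r → i < j × r ∈ rs × x ≡ q ^ i * r
      ∈-dilates (suc j) {rs} m = go (∈-++⁻ (map (q ^ j *_) rs) m)
        where
        go : _ → _
        go (inj₁ m) = let (r , mr , e) = ∈-map⁻ (q ^ j *_) m in j , r , ≤-refl , mr , e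
        go (inj₂ m) = let (i , r , lt , mr , e) = ∈-dilates j m in i , r , m<n⇒m<1+n lt , mr , e

      length-dilates : ∀ j rs → length (dilates j rs) ≡ j * length rs
      length-dilates zero rs = refl
      length-dilates (suc j) rs = trans (length-++ (map (q ^ j *_) rs)) (cong₂ _+_ (length-map (q ^ j *_) rs) (length-dilates j rs))

      unique-dilates : ∀ j {rs} → Unique rs → All (λ r → ¬ (q ∣ r)) rs → Unique (dilates j rs)
      unique-dilates zero u n = []
      unique-dilates (suc j) {rs} u n = Unique.++⁺ (Unique.map⁺ (λ {x} {y} e → *-cancelˡ-≡ x y (q ^ j) {{m^n≢0 q j {{prime⇒nonZero pq}}}} e) u) (unique-dilates j u n) disjoint
        where
        disjoint : ∀ {v} → ¬ (v ∈ map (q ^ j *_) rs × v ∈ dilates j rs)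
        disjoint (m , m′) =
          let (r , mr , e) = ∈-map⁻ (q ^ j *_) m
              (i , r′ , lt , mr′ , e′) = ∈-dilates j m′
              (k , ek) = m<n⇒∃k lt
          in All.lookup n mr′ (power i k (trans (cong (λ u → q ^ u * r) ek) (trans (sym e) e′)))
          where
          m<n⇒∃k : ∀ {i j} → i < j → Σ ℕ λ k → suc k + i ≡ j
          m<n⇒∃k {i} {j} lt = j ∸ suc i , trans (sym (+-suc (j ∸ suc i) i)) (m∸n+n≡m lt)

      core-count : ∀ {rs} → Unique rs → All (Core M q) rs → suc M * length rs ≤ length ys
      core-count {rs} u h = ≤-trans (≤-reflexive (sym (length-dilates (suc M) rs)))
        (unique-length (unique-dilates (suc M) u (All.map proj₁ h)) (All.tabulate (λ m → inside (∈-dilates (suc M) m))))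
        where
        inside : ∀ {x} → (Σ ℕ λ i → Σ ℕ λ r → i < suc M × r ∈ rs × x ≡ q ^ i * r) → x ∈ ys
        inside (i , r , lt , mr , e) = cover _ (subst (InΦ M) (sym e) (proj₂ (All.lookup h mr) i (s≤s⁻¹ lt)))

      module _ {d} (len : length ys ≤ d) where

        cores : ∀ {xs : List ℕ} {f : ℕ → ℕ} {bs} → All (λ x → Σ ℕ λ r → x ≡ f r × Core M q r) bs → Unique bs → suc M * length bs ≤ d
        cores {xs} {f} {bs} h u = go (preimages {f} {Core M q} h u)
          where
          go : _ → suc M * length bs ≤ d
          go (rs , u , c , e) = ≤-trans (≤-reflexive (cong (suc M *_) (sym e))) (≤-trans (core-count u c) len)

        -- A loss of at most d / (M + 1) elements, with the denominator cleared.
        Kept : List ℕ → (ℕ → Set) → Set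
        Kept xs P = Σ (List ℕ) λ gs → Unique gs × All (_∈ xs) gs × All P gs × suc M * length xs ≤ suc M * length gs + d

        keep : ∀ {P B : ℕ → Set} {xs} → (B? : Decidable B) → Unique xs → (∀ {x} → x ∈ xs → ¬ B x → P x) → suc M * length (filter B? xs) ≤ d → Kept xs P
        keep {P} {B} {xs} B? u good bad = filter G? xs , Unique.filter⁺ G? u , All.tabulate (λ m → proj₁ (∈-filter⁻ G? m)) ,
          All.tabulate (λ m → let (m′ , n) = ∈-filter⁻ G? m in good m′ n) ,
          ≤-trans (≤-reflexive (trans (cong (suc M *_) (trans (filter-split B? xs) (+-comm (length (filter B? xs)) (length (filter G? xs))))) (*-distribˡ-+ (suc M) (length (filter G? xs)) (length (filter B? xs)))))
            (+-monoʳ-≤ (suc M * length (filter G? xs)) bad)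
          where
          G? : Decidable (λ x → ¬ B x)
          G? = ¬? ∘ B?

        -- Multiplication by q leaves the window only from the end of a line, where the exponent of
        -- q is M; ends of lines are as rare as heads.
        up : ∀ {w xs} → w ≢ 0 → Unique xs → All (λ x → InΦ M (x * w)) xs → Kept xs (λ x → InΦ M (x * (q * w)))
        up {w} {xs} w≢0 u h = keep {λ x → InΦ M (x * (q * w))} B? u good bad
          where
          B : ℕ → Set
          B x = q ^ M ∣ x * w
          B? : Decidable B
          B? x = q ^ M ∣? x * w
          good : ∀ {x} → x ∈ xs → ¬ B x → InΦ M (x * (q * w))
          good {x} m n = go (slot pq q<M (All.lookup h m))
            where
            go : _ → InΦ M (x * (q * w))
            go (k , r , e , k≤M , _ , dil) = subst (InΦ M) eq (dil (suc k) (≤∧≢⇒< k≤M (λ { refl → n (divides r (trans e (*-comm (q ^ k) r))) })))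
              where
              eq : q ^ suc k * r ≡ x * (q * w)
              eq = trans (*-assoc q (q ^ k) r) (trans (cong (q *_) (sym e)) (trans (sym (*-assoc q x w)) (trans (cong (_* w) (*-comm q x)) (*-assoc x q w))))
          bs : List ℕ
          bs = filter B? xs
          bad : suc M * length bs ≤ d
          bad = subst (λ n → suc M * n ≤ d) (length-map (_* w) bs)
            (cores {xs} {q ^ M *_} (map⁺ (All.tabulate (λ m → let (m′ , b) = ∈-filter⁻ B? m in full b (slot pq q<M (All.lookup h m′)))))
              (Unique.map⁺ (λ {x} {y} e → *-cancelʳ-≡ x y w {{≢-nonZero w≢0}} e) (Unique.filter⁺ B? u)))
            where
            full : ∀ {y} → q ^ M ∣ y → (Σ ℕ λ k → Σ ℕ λ r → y ≡ q ^ k * r × k ≤ M × Core M q r) → Σ ℕ λ r → y ≡ q ^ M * r × Core M q r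
            full {y} (divides t e′) (k , r , e , k≤M , core) = go (m≤n⇒m<n∨m≡n k≤M)
              where
              go : k < M ⊎ k ≡ M → Σ ℕ λ r → y ≡ q ^ M * r × Core M q r
              go (inj₂ refl) = r , e , core
              go (inj₁ lt) = ⊥-elim (proj₁ core (power {t} {r} k (M ∸ suc k) (trans (cong (λ u → q ^ u * t) (trans (sym (+-suc (M ∸ suc k) k)) (m∸n+n≡m lt))) (trans (*-comm (q ^ M) t) (trans (sym e′) e)))))

        -- Division by q fails only at the head of a line, where the exponent of q is 0.
        down : ∀ {w xs} → w ≢ 0 → Unique xs → All (λ x → Σ ℕ λ y → x ≡ w * y × InΦ M y) xs → Kept xs (λ x → Σ ℕ λ y → x ≡ q * w * y × InΦ M y)
        down {w} {xs} w≢0 u h = keep {λ x → Σ ℕ λ y → x ≡ q * w * y × InΦ M y} (¬? ∘ D?) u good bad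
          where
          D? : Decidable (λ x → q * w ∣ x)
          D? x = q * w ∣? x
          lower : ∀ {y} → InΦ M y → (q ∣ y → Σ ℕ λ y′ → y ≡ q * y′ × InΦ M y′) × (¬ (q ∣ y) → Core M q y)
          lower {y} φ = go (slot pq q<M φ)
            where
            go : _ → (q ∣ y → Σ ℕ λ y′ → y ≡ q * y′ × InΦ M y′) × (¬ (q ∣ y) → Core M q y)
            go (zero , r , e , _ , core) = (λ dv → ⊥-elim (proj₁ core (subst (q ∣_) (trans e (*-identityˡ r)) dv))) , λ _ → subst (Core M q) (sym (trans e (*-identityˡ r))) core
            go (suc k , r , e , k≤M , core) = (λ _ → q ^ k * r , trans e (*-assoc q (q ^ k) r) , proj₂ core k (<⇒≤ k≤M)) ,
              λ n → ⊥-elim (n (subst (q ∣_) (sym (trans e (*-assoc q (q ^ k) r))) (m∣m*n (q ^ k * r))))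
          wd : ∀ {x y} → x ≡ w * y → q * w ∣ x → q ∣ y
          wd {x} {y} e dv = *-cancelˡ-∣ w {{≢-nonZero w≢0}} (subst₂ _∣_ (*-comm q w) e dv)
          wd′ : ∀ {x y} → x ≡ w * y → q ∣ y → q * w ∣ x
          wd′ {x} {y} e dv = subst₂ _∣_ (*-comm w q) (sym e) (*-monoʳ-∣ w dv)
          good : ∀ {x} → x ∈ xs → ¬ ¬ (q * w ∣ x) → Σ ℕ λ y → x ≡ q * w * y × InΦ M y
          good {x} m nn = go (D? x) (All.lookup h m)
            where
            go : Dec (q * w ∣ x) → _ → Σ ℕ λ y → x ≡ q * w * y × InΦ M y
            go (no n) _ = ⊥-elim (nn n)
            go (yes dv) (y , e , φ) = let (y′ , e′ , φ′) = proj₁ (lower φ) (wd e dv) in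
              y′ , trans e (trans (cong (w *_) e′) (trans (sym (*-assoc w q y′)) (cong (_* y′) (*-comm w q)))) , φ′
          bad : suc M * length (filter (¬? ∘ D?) xs) ≤ d
          bad = cores {xs} {w *_} (All.tabulate (λ m → let (m′ , n) = ∈-filter⁻ (¬? ∘ D?) m ; (y , e , φ) = All.lookup h m′ in
            y , e , proj₂ (lower φ) (λ dv → n (wd′ e dv)))) (Unique.filter⁺ (¬? ∘ D?) u)

    module _ {d} (len : length ys ≤ d) where

      Kept* : ℕ → List ℕ → (ℕ → Set) → Set
      Kept* R xs P = Σ (List ℕ) λ gs → Unique gs × All (_∈ xs) gs × All P gs × suc M * length xs ≤ suc M * length gs + R * d

      chain : ∀ {xs P P′} R → (K : Kept* R xs P) → (∀ {gs} → Unique gs → All P gs → Σ (List ℕ) λ hs → Unique hs × All (_∈ gs) hs × All P′ hs × suc M * length gs ≤ suc M * length hs + d) → Kept* (suc R) xs P′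
      chain {xs} {P} {P′} R (gs , u , s , p , le) step = go (step u p)
        where
        go : _ → Kept* (suc R) xs P′
        go (hs , u′ , s′ , p′ , le′) = hs , u′ , All.map (All.lookup s) s′ , p′ ,
          ≤-trans le (≤-trans (+-monoˡ-≤ (R * d) le′) (≤-reflexive (+-assoc (suc M * length hs) d (R * d))))

      primes-product≢0 : ∀ {ps} → All Prime ps → product ps ≢ 0
      primes-product≢0 {p ∷ ps} (pp ∷ h) z = case (m*n≡0⇒m≡0∨n≡0 p z)
        where
        case : _ → _
        case (inj₁ e) = prime-nonZero pp e
        case (inj₂ e) = primes-product≢0 h e

      ups : ∀ {ps xs} → All Prime ps → All (_< M) ps → Unique xs → All (InΦ M) xs → Kept* (length ps) xs (λ x → InΦ M (x * product ps))
      ups {xs = xs} [] [] u h = xs , u , All.tabulate id , All.map (λ {x} → subst (InΦ M) (sym (*-identityʳ x))) h , m≤m+n (suc M * length xs) 0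
      ups {p ∷ ps} {xs} (pp ∷ ph) (lt ∷ lts) u h = chain {P = λ x → InΦ M (x * product ps)} (length ps) (ups ph lts u h) (λ u′ h′ → up pp lt len (primes-product≢0 ph) u′ h′)

      downs : ∀ {ps xs} → All Prime ps → All (_< M) ps → Unique xs → All (InΦ M) xs → Kept* (length ps) xs (λ x → Σ ℕ λ y → x ≡ product ps * y × InΦ M y)
      downs {xs = xs} [] [] u h = xs , u , All.tabulate id , All.map (λ {x} φ → x , sym (*-identityˡ x) , φ) h , m≤m+n (suc M * length xs) 0
      downs {p ∷ ps} {xs} (pp ∷ ph) (lt ∷ lts) u h = chain {P = λ x → Σ ℕ λ y → x ≡ product ps * y × InΦ M y} (length ps) (downs ph lts u h) (λ u′ h′ → down pp lt len (primes-product≢0 ph) u′ h′)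

      then : ∀ {xs P Q} R R′ → Kept* R xs P → (∀ {gs} → Unique gs → All (_∈ xs) gs → Kept* R′ gs Q) → Kept* (R + R′) xs (λ x → P x × Q x)
      then {xs} {P} {Q} R R′ (gs , u , s , p , le) step = go (step u s)
        where
        go : Kept* R′ gs Q → Kept* (R + R′) xs (λ x → P x × Q x)
        go (hs , u′ , s′ , q , le′) = hs , u′ , All.map (All.lookup s) s′ , All.zip (All.map (All.lookup p) s′ , q) ,
          ≤-trans le (≤-trans (+-monoˡ-≤ (R * d) le′) (≤-reflexive (trans (+-assoc (suc M * length hs) (R′ * d) (R * d))
            (cong (suc M * length hs +_) (trans (+-comm (R′ * d) (R * d)) (sym (*-distribʳ-+ d R R′)))))))

  record Factored (w : ℕ) : Set where
    field
      primes  : List ℕ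
      are-prime : All Prime primes
      value   : w ≡ product primes

  factored : ∀ {w} → w ≢ 0 → Factored w
  factored {w} w≢0 = record { primes = factors ; are-prime = factorsPrime ; value = isFactorisation }
    where
    open PrimeFactorisation (factorise w {{≢-nonZero w≢0}})

  bound-all : (l : List ℕ) → Σ ℕ λ B → All (_< B) l
  bound-all [] = 0 , []
  bound-all (x ∷ l) = let (B , h) = bound-all l in suc (x ⊔ B) , s≤s (m≤m⊔n x B) ∷ All.map (λ lt → ≤-trans lt (≤-trans (m≤n⊔m x B) (n≤1+n (x ⊔ B)))) h

  -- Each prime factor of u and of the wᵢ costs at most |Φ_M| / (M + 1) elements, which is what loss counts.
  record Demand (u : ℕ) (ws : List ℕ) : Set where
    field
      loss  : ℕ
      from  : ℕ
      meet  : ∀ {M ys d} → (∀ x → InΦ M x → x ∈ ys) → length ys ≤ d → from ≤ M → ∀ {xs} → Unique xs → All (InΦ M) xs →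
        Σ (List ℕ) λ gs → Unique gs × All (_∈ xs) gs × All (λ x → u ∣ x × All (λ w → x * w ∈ ys) ws) gs × suc M * length xs ≤ suc M * length gs + loss * d

  demand : ∀ {u ws} → u ≢ 0 → All (_≢ 0) ws → Demand u ws
  demand {u} {[]} u≢0 [] = record { loss = length primes ; from = proj₁ (bound-all primes) ; meet = λ {M} {ys} cover len le uniq φ →
      let open Window M ys cover
          (gs , u′ , s , p , c) = downs len are-prime (All.map (λ lt → ≤-trans lt le) (proj₂ (bound-all primes))) uniq φ
      in gs , u′ , s , All.map (λ { (y , e , _) → divides y (trans e (trans (*-comm (product primes) y) (cong (y *_) (sym value)))) , [] }) p , c }
    where open Factored (factored u≢0)
  demand {u} {w ∷ ws} u≢0 (w≢0 ∷ h) = record { loss = loss + length primes ; from = from ⊔ proj₁ (bound-all primes) ; meet = λ {M} {ys} cover len le uniq φ →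
      let open Window M ys cover
          (gs , u′ , s , p , c) = then len loss (length primes) (meet cover len (≤-trans (m≤m⊔n from _) le) uniq φ)
            (λ uniq′ s → ups len are-prime (All.map (λ lt → ≤-trans lt (≤-trans (m≤n⊔m from _) le)) (proj₂ (bound-all primes))) uniq′ (All.map (All.lookup φ) s))
      in gs , u′ , s , All.map (λ {x} → λ { ((dv , old) , φ′) → dv , subst (_∈ ys) (cong (x *_) (sym value)) (cover _ φ′) ∷ old }) p , c }
    where
    open Factored (factored w≢0)
    open Demand (demand u≢0 h)

  -- The loss R d / (M + 1) is at most d / (2 b) once 2 b R ≤ M, so at least half of the density 1 /
  -- b survives; hence 2 b in place of b.
  density-arithmetic : ∀ {b c d n m R M} → d < b * c → c ≤ m → suc M * m ≤ suc M * n + R * d → 2 * b * R ≤ M → d < 2 * b * n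
  density-arithmetic {b} {c} {d} {n} {m} {R} {M} dense c≤m le R≤M = +-cancelˡ-≤ d (suc d) (2 * b * n) (≤-trans (≤-trans (+-monoʳ-≤ d (n≤1+n (suc d))) (≤-reflexive (two d)))
      (*-cancelˡ-≤ (suc M) (begin
        suc M * (2 * suc d) ≤⟨ *-monoʳ-≤ (suc M) (*-monoʳ-≤ 2 (≤-trans dense (*-monoʳ-≤ b c≤m))) ⟩
        suc M * (2 * (b * m)) ≡⟨ r₁ (suc M) b m ⟩
        2 * b * (suc M * m) ≤⟨ *-monoʳ-≤ (2 * b) le ⟩
        2 * b * (suc M * n + R * d) ≡⟨ r₂ (2 * b) (suc M) n R d ⟩
        suc M * (2 * b * n) + 2 * b * R * d ≤⟨ +-monoʳ-≤ (suc M * (2 * b * n)) (*-monoˡ-≤ d (≤-trans R≤M (n≤1+n M))) ⟩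
        suc M * (2 * b * n) + suc M * d ≡⟨ trans (sym (*-distribˡ-+ (suc M) (2 * b * n) d)) (cong (suc M *_) (+-comm (2 * b * n) d)) ⟩
        suc M * (d + 2 * b * n) ∎)))
    where
    open ≤-Reasoning
    open import Data.Nat.Tactic.RingSolver using () renaming (solve-∀ to ℕ-solve-∀)
    two : ∀ d → d + suc (suc d) ≡ 2 * suc d
    two = ℕ-solve-∀
    r₁ : ∀ s b m → s * (2 * (b * m)) ≡ 2 * b * (s * m)
    r₁ = ℕ-solve-∀
    r₂ : ∀ t s n R d → t * (s * n + R * d) ≡ s * (t * n) + t * R * d
    r₂ = ℕ-solve-∀

  -- The density condition provides a window beyond any prescribed M, so M can be taken large
  -- compared with the prime factors of u and `ws` and with their number.
  select : ∀ {Ein} (dens : PositiveMultDensity Ein) {u ws} → u ≢ 0 → All (_≢ 0) ws →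
    Σ (List ℕ) λ gs → Σ (List ℕ) λ ys → Unique gs × All (λ x → Ein x × x ≢ 0 × u ∣ x × All (λ w → x * w ∈ ys) ws) gs × length ys < 2 * proj₁ dens * length gs
  select {Ein} (b , _ , dens) {u} {ws} u≢0 ws≢0 = go (dens (from ⊔ 2 * b * loss))
    where
    open Demand (demand u≢0 ws≢0)
    Result : Set
    Result = Σ (List ℕ) λ gs → Σ (List ℕ) λ ys → Unique gs × All (λ x → Ein x × x ≢ 0 × u ∣ x × All (λ w → x * w ∈ ys) ws) gs × length ys < 2 * b * length gs
    go : _ → Result
    go (M , le , c , d , (xs , uniq , inx , c≤) , (ys , cover , len) , dense) = fin (meet cover len (≤-trans (m≤m⊔n from _) le) uniq (All.map proj₂ inx))
      where
      fin : _ → Result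
      fin (gs , u′ , s , p , count) = gs , ys , u′ , All.zipWith (λ { (m , dv , ks) → proj₁ (All.lookup inx m) , Φ-nonZero (proj₂ (All.lookup inx m)) , dv , ks }) (s , p) ,
        ≤-<-trans len (density-arithmetic {b} {c} {d} {length gs} {length xs} {loss} {M} dense c≤ count (≤-trans (m≤n⊔m from _) le))

open PrimeWindows using (select)

-- The state of a set of positive density.

module DensityCorrelation where
  open import Data.Integer.Base using (+_; -[1+_])
  open import Data.Integer.Tactic.RingSolver using () renaming (solve-∀ to ℤ-solve-∀)
  open import Data.Nat.Divisibility using (_∣_)
  open import Data.Rational
  open import Data.Rational.Properties
  import Data.Rational.Unnormalised.Base as ℚᵘ
  import Data.Rational.Unnormalised.Properties as ℚᵘ
  open import Defs using (PositiveMultDensity)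

  abstract
    ι : ℤ → ℚ
    ι i = i / 1

    private
      ι-ᵘ : ∀ i → toℚᵘ (ι i) ℚᵘ.≃ ℚᵘ.mkℚᵘ i 0
      ι-ᵘ i = toℚᵘ-fromℚᵘ (ℚᵘ.mkℚᵘ i 0)

    ι-+ : ∀ i j → ι (i ℤ.+ j) ≡ ι i + ι j
    ι-+ i j = toℚᵘ-injective (ℚᵘ.≃-trans (ι-ᵘ (i ℤ.+ j)) (ℚᵘ.≃-trans (ℚᵘ.*≡* (e i j))
      (ℚᵘ.≃-sym (ℚᵘ.≃-trans (toℚᵘ-homo-+ (ι i) (ι j)) (ℚᵘ.+-cong {toℚᵘ (ι i)} {ℚᵘ.mkℚᵘ i 0} (ι-ᵘ i) (ι-ᵘ j))))))
      where
      e : ∀ i j → (i ℤ.+ j) ℤ.* (+ 1) ≡ (i ℤ.* (+ 1) ℤ.+ j ℤ.* (+ 1)) ℤ.* (+ 1)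
      e = ℤ-solve-∀

    ι-* : ∀ i j → ι (i ℤ.* j) ≡ ι i * ι j
    ι-* i j = toℚᵘ-injective (ℚᵘ.≃-trans (ι-ᵘ (i ℤ.* j))
      (ℚᵘ.≃-sym (ℚᵘ.≃-trans (toℚᵘ-homo-* (ι i) (ι j)) (ℚᵘ.*-cong {toℚᵘ (ι i)} {ℚᵘ.mkℚᵘ i 0} (ι-ᵘ i) (ι-ᵘ j)))))

    ι-injective : ∀ {i j} → ι i ≡ ι j → i ≡ j
    ι-injective {i} {j} eq = go (ℚᵘ.≃-trans (ℚᵘ.≃-sym (ι-ᵘ i)) (ℚᵘ.≃-trans (ℚᵘ.≃-reflexive (cong toℚᵘ eq)) (ι-ᵘ j)))
      where
      go : ℚᵘ.mkℚᵘ i 0 ℚᵘ.≃ ℚᵘ.mkℚᵘ j 0 → i ≡ j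
      go (ℚᵘ.*≡* e) = trans (sym (ℤ.*-identityʳ i)) (trans e (ℤ.*-identityʳ j))

    ι-fromℕ : ∀ n → ι (+ n) ≡ fromℕ n
    ι-fromℕ n = sym (fromℕ-/1 n)

    num-den : ∀ q → q * ι (↧ q) ≡ ι (↥ q)
    num-den q@(mkℚ n d _) = toℚᵘ-injective (ℚᵘ.≃-trans (toℚᵘ-homo-* q (ι (+ ℕ.suc d))) (ℚᵘ.≃-trans (ℚᵘ.*-cong {toℚᵘ q} ℚᵘ.≃-refl (ι-ᵘ (+ ℕ.suc d)))
      (ℚᵘ.≃-sym (ℚᵘ.≃-trans (ι-ᵘ n) (ℚᵘ.*≡* (trans (cong (λ k → n ℤ.* + k) (ℕ.*-identityʳ (ℕ.suc d))) (sym (ℤ.*-identityʳ (n ℤ.* + ℕ.suc d)))))))))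

  fromℕ-* : ∀ m n → fromℕ (m ℕ.* n) ≡ fromℕ m * fromℕ n
  fromℕ-* m n = trans (sym (ι-fromℕ (m ℕ.* n))) (trans (cong ι (ℤ.pos-* m n)) (trans (ι-* (+ m) (+ n)) (cong₂ _*_ (ι-fromℕ m) (ι-fromℕ n))))

  fromℕ-injective : ∀ {m n} → fromℕ m ≡ fromℕ n → m ≡ n
  fromℕ-injective {m} {n} eq = ℤ.+-injective (ι-injective (trans (ι-fromℕ m) (trans eq (sym (ι-fromℕ n)))))

  fromℕ-mono : ∀ {m n} → m ℕ.≤ n → fromℕ m ≤ fromℕ n
  fromℕ-mono {n = n} ℕ.z≤n = fromℕ≥0 n
  fromℕ-mono (ℕ.s≤s h) = +-monoʳ-≤ 1ℚ (fromℕ-mono h)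

  fromℕ>0 : ∀ {n} → n ≢ 0 → 0ℚ < fromℕ n
  fromℕ>0 {ℕ.zero} n = ⊥-elim (n refl)
  fromℕ>0 {ℕ.suc n} _ = fromℕ-suc>0 n

  ι-0 : ι (+ 0) ≡ 0ℚ
  ι-0 = ι-fromℕ 0

  ι-≢0 : ∀ {i} → i ≢ + 0 → ι i ≢ 0ℚ
  ι-≢0 n eq = n (ι-injective (trans eq (sym ι-0)))

  ι->0 : ∀ {i} → + 0 ℤ.< i → 0ℚ < ι i
  ι->0 {+ ℕ.zero} (ℤ.+<+ ())
  ι->0 {+ ℕ.suc n} _ = subst (0ℚ <_) (sym (ι-fromℕ (ℕ.suc n))) (fromℕ-suc>0 n)

  ι-pos⁻¹ : ∀ i → 0ℚ < ι i → Σ ℕ λ n → i ≡ + ℕ.suc n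
  ι-pos⁻¹ (+ ℕ.zero) p = ⊥-elim (<-irrefl (sym ι-0) p)
  ι-pos⁻¹ (+ ℕ.suc n) p = n , refl
  ι-pos⁻¹ -[1+ n ] p = ⊥-elim (<-irrefl (sym (trans (sym (ι-+ -[1+ n ] (+ ℕ.suc n))) (trans (cong ι (ℤ.+-inverseˡ (+ ℕ.suc n))) ι-0))) (+>0 p (<⇒≤ (subst (0ℚ <_) (sym (ι-fromℕ (ℕ.suc n))) (fromℕ-suc>0 n)))))

  fraction : ∀ {g} → 0ℚ < g → Σ ℕ λ u → Σ ℕ λ v → u ≢ 0 × v ≢ 0 × fromℕ v ≡ fromℕ u * inv g
  fraction {g} g>0 = go (ι-pos⁻¹ (↥ g) (subst (0ℚ <_) (num-den g) (*>0 g>0 den>0)))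
    where
    den>0 : 0ℚ < ι (↧ g)
    den>0 = subst (0ℚ <_) (sym (ι-fromℕ (↧ₙ g))) (fromℕ-suc>0 (ℚ.denominator-1 g))
    go : (Σ ℕ λ n → ↥ g ≡ + ℕ.suc n) → Σ ℕ λ u → Σ ℕ λ v → u ≢ 0 × v ≢ 0 × fromℕ v ≡ fromℕ u * inv g
    go (n , eq) = ℕ.suc n , ↧ₙ g , (λ ()) , (λ ()) , (begin
      fromℕ (↧ₙ g) ≡⟨ sym (ι-fromℕ (↧ₙ g)) ⟩
      ι (↧ g) ≡⟨ sym (*-identityˡ (ι (↧ g))) ⟩
      1ℚ * ι (↧ g) ≡⟨ cong (_* ι (↧ g)) (sym (inv-r (>⇒≢ g>0))) ⟩
      g * inv g * ι (↧ g) ≡⟨ e g (inv g) (ι (↧ g)) ⟩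
      g * ι (↧ g) * inv g ≡⟨ cong (_* inv g) (trans (num-den g) (trans (cong ι eq) (ι-fromℕ (ℕ.suc n)))) ⟩
      fromℕ (ℕ.suc n) * inv g ∎)
      where
      open ≡-Reasoning
      e : ∀ g i d → g * i * d ≡ g * d * i
      e = solve-∀ ring

  *≢0 : ∀ {m n} → m ≢ 0 → n ≢ 0 → m ℕ.* n ≢ 0
  *≢0 {m} {n} m≢0 n≢0 z = ℕ.≢-nonZero⁻¹ (m ℕ.* n) {{ℕ.m*n≢0 m n {{ℕ.≢-nonZero m≢0}} {{ℕ.≢-nonZero n≢0}}}} z

  -- With w = V / g, the condition x w ∈ `ys` says that x / g lies in `ys` / V, which is one set for
  -- all g.
  common-numerator : ∀ {L} → All (0ℚ <_) L → Σ ℕ λ V → V ≢ 0 × Σ (List ℕ) λ ws → All (_≢ 0) ws × All (λ g → Σ ℕ λ w → w ∈ ws × fromℕ w ≡ fromℕ V * inv g) L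
  common-numerator [] = 1 , (λ ()) , [] , [] , []
  common-numerator {g ∷ L} (g>0 ∷ h) = go (fraction g>0) (common-numerator h)
    where
    open import Data.List.Relation.Unary.Any using (here; there)
    go : _ → _ → _
    go (u , v , u≢0 , v≢0 , e) (V , V≢0 , ws , ws≢0 , h) = u ℕ.* V , *≢0 u≢0 V≢0 , v ℕ.* V ∷ map (u ℕ.*_) ws , *≢0 v≢0 V≢0 ∷ map⁺ (All.map (*≢0 u≢0) ws≢0) ,
      (v ℕ.* V , here refl , trans (fromℕ-* v V) (trans (cong (_* fromℕ V) e) (trans (r (fromℕ u) (inv g) (fromℕ V)) (cong (_* inv g) (sym (fromℕ-* u V)))))) ∷
      All.map (λ { {g′} (w , m , e′) → u ℕ.* w , there (∈-map⁺ (u ℕ.*_) m) , trans (fromℕ-* u w) (trans (cong (fromℕ u *_) e′) (trans (sym (*-assoc (fromℕ u) (fromℕ V) (inv g′))) (cong (_* inv g′) (sym (fromℕ-* u V))))) }) h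
      where
      r : ∀ u i V → u * i * V ≡ u * V * i
      r = solve-∀ ring

  record Correlated (Ein : ℕ → Set) (U : ℕ) (r : ℚ) : Set where
    field
      x y  : ℕ
      x∈E  : Ein x
      y∈E  : Ein y
      x≢0  : x ≢ 0
      y≢0  : y ≢ 0
      U∣x  : U ∣ x
      ratio : fromℕ x ≡ r * fromℕ y

  mean-bound : ∀ {Ein} → PositiveMultDensity Ein → ℚ
  mean-bound (b , _) = inv (fromℕ (2 ℕ.* b))

  mean-bound>0 : ∀ {Ein} (dens : PositiveMultDensity Ein) → 0ℚ < mean-bound dens
  mean-bound>0 (ℕ.suc b , _) = inv-pos (fromℕ>0 {2 ℕ.* ℕ.suc b} (λ ()))

  -- All quotients x / g lie in `K` = `ys` / V, which has at most 2 b |A| elements; `corr-Mean`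
  -- turns this into the bound 1 / (2 b). Divisibility by U is built into A because it cannot be
  -- imposed once φ is given.
  correlation : ∀ {Ein} (dens : PositiveMultDensity Ein) {L} → All (0ℚ <_) L → ∀ {U} → U ≢ 0 →
    Σ (ℚ → ℚ) λ φ → State φ × Mean (mean-bound dens) L φ × (∀ {r} → 0ℚ < φ r → Correlated Ein U r)
  correlation {Ein} dens@(ℕ.suc b , b≥1 , _) {L} L>0 {U} U≢0 = go (common-numerator L>0)
    where
    Result : Set
    Result = Σ (ℚ → ℚ) λ φ → State φ × Mean (mean-bound {Ein} dens) L φ × (∀ {r} → 0ℚ < φ r → Correlated Ein U r)
    go : (Σ ℕ λ V → V ≢ 0 × Σ (List ℕ) λ ws → All (_≢ 0) ws × All (λ g → Σ ℕ λ w → w ∈ ws × fromℕ w ≡ fromℕ V * inv g) L) → Result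
    go (V , V≢0 , ws , ws≢0 , nums) = fin (select dens U≢0 ws≢0)
      where
      fin : (Σ (List ℕ) λ gs → Σ (List ℕ) λ ys → Unique gs × All (λ x → Ein x × x ≢ 0 × U ∣ x × All (λ w → x ℕ.* w ∈ ys) ws) gs × length ys ℕ.< 2 ℕ.* ℕ.suc b ℕ.* length gs) → Result
      fin (gs , ys , uniq , props , size) = corr , corr-State , corr-Mean {fromℕ (2 ℕ.* ℕ.suc b)} {L} {K} (fromℕ>0 {2 ℕ.* ℕ.suc b} (λ ())) K-unique K-size keys , witness
        where
        A K : List ℚ
        A = map fromℕ gs
        ys′ : List ℕ
        ys′ = deduplicate ℕ._≟_ ys
        scale : ℕ → ℚ
        scale k = fromℕ k * inv (fromℕ V)
        K = map scale ys′
        V>0 : 0ℚ < fromℕ V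
        V>0 = fromℕ>0 V≢0
        nonempty : length gs ≢ 0
        nonempty z = ℕ.n≮0 (subst (length ys ℕ.<_) (trans (cong (2 ℕ.* ℕ.suc b ℕ.*_) z) (ℕ.*-zeroʳ (2 ℕ.* ℕ.suc b))) size)
        N>0 : 0ℚ < fromℕ (length A)
        N>0 = fromℕ>0 (λ z → nonempty (trans (sym (length-map fromℕ gs)) z))
        A-unique : Unique A
        A-unique = Unique.map⁺ {f = fromℕ} (λ {x} {y} → fromℕ-injective {x} {y}) uniq
        A≢0 : All (_≢ 0ℚ) A
        A≢0 = map⁺ (All.map (λ p → >⇒≢ (fromℕ>0 (proj₁ (proj₂ p)))) props)
        open Correlation A A-unique A≢0 N>0
        K-unique : Unique K
        K-unique = Unique.map⁺ (λ {x} {y} eq → fromℕ-injective (cancel-≡ {inv (fromℕ V)} {fromℕ x} {fromℕ y} (inv-≢0 (>⇒≢ V>0))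
          (trans (*-comm (inv (fromℕ V)) (fromℕ x)) (trans eq (*-comm (fromℕ y) (inv (fromℕ V))))))) (deduplicate-! ℕ._≟_ ys)
        K-size : fromℕ (length K) ≤ fromℕ (2 ℕ.* ℕ.suc b) * fromℕ (length A)
        K-size = subst₂ _≤_ (cong fromℕ (sym (length-map scale ys′))) (trans (fromℕ-* (2 ℕ.* ℕ.suc b) (length gs)) (cong (λ n → fromℕ (2 ℕ.* ℕ.suc b) * fromℕ n) (sym (length-map fromℕ gs))))
          (fromℕ-mono (ℕ.≤-trans (length-deduplicate ℕ._≟_ ys) (ℕ.<⇒≤ size)))
        keys : All (λ g → g ≢ 0ℚ × All (λ x → x * inv g ∈ K) A) L
        keys = All.zipWith (λ { {g} (g>0 , (w , mw , e)) → >⇒≢ g>0 , map⁺ (All.map (λ { {x} (_ , _ , _ , ks) → subst (_∈ K) (key x w g e) (∈-map⁺ scale (∈-deduplicate⁺ ℕ._≟_ (All.lookup ks mw))) }) props) }) (L>0 , nums)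
          where
          key : ∀ x w g → fromℕ w ≡ fromℕ V * inv g → scale (x ℕ.* w) ≡ fromℕ x * inv g
          key x w g e = trans (cong (_* inv (fromℕ V)) (trans (fromℕ-* x w) (cong (fromℕ x *_) e))) (trans (r (fromℕ x) (fromℕ V) (inv g) (inv (fromℕ V)))
            (trans (cong (_* (fromℕ x * inv g)) (inv-r (>⇒≢ V>0))) (*-identityˡ (fromℕ x * inv g))))
            where
            r : ∀ x v i j → x * (v * i) * j ≡ v * j * (x * i)
            r = solve-∀ ring
        witness : ∀ {r} → 0ℚ < corr r → Correlated Ein U r
        witness {r} p = go′ (corr-pos {r} p)
          where
          go′ : _ → Correlated Ein U r
          go′ (x , y , mx , my , e) = go″ (∈-map⁻ fromℕ mx) (∈-map⁻ fromℕ my)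
            where
            go″ : _ → _ → Correlated Ein U r
            go″ (x′ , mx′ , ex) (y′ , my′ , ey) = let (Ex , x≢0 , U∣x , _) = All.lookup props mx′ ; (Ey , y≢0 , _) = All.lookup props my′ in
              record { x = x′ ; y = y′ ; x∈E = Ex ; y∈E = Ey ; x≢0 = x≢0 ; y≢0 = y≢0 ; U∣x = U∣x ; ratio = trans (sym ex) (trans e (cong (r *_) ey)) }

open DensityCorrelation

-- Realising ratios of the two quadratic forms.

module FormRatios where
  open import Data.Integer.Tactic.RingSolver using () renaming (solve-∀ to ℤ-solve-∀)
  open import Data.Rational
  open import Data.Rational.Properties

  form : ℤ → ℤ → ℤ → ℤ → ℤ
  form ℓ ℓ′ m n = (m ℤ.+ ℓ ℤ.* n) ℤ.* (m ℤ.+ ℓ′ ℤ.* n)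

  record Hit (φ : ℚ → ℚ) (A B : ℤ) : Set where
    constructor hit
    field
      A≢0   : A ≢ 0ℤ
      B≢0   : B ≢ 0ℤ
      A≢B   : A ≢ B
      φ-pos : 0ℚ < φ (ι A * inv (ι B))

  -- The candidates `cs` come before φ: the set that defines φ is later taken inside the multiples
  -- of a number that depends on all of them.
  Solvable : ℤ → ℤ → ℤ → ℤ → Set
  Solvable ℓ₁ ℓ₂ ℓ₃ ℓ₄ = ∀ {δ₀} → 0ℚ < δ₀ → Σ (List ℚ) λ L → All (0ℚ <_) L × Σ (List (ℤ × ℤ)) λ cs →
    ∀ φ → State φ → Mean δ₀ L φ → Σ ℤ λ m → Σ ℤ λ n → (m , n) ∈ cs × Hit φ (form ℓ₁ ℓ₂ m n) (form ℓ₃ ℓ₄ m n)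

  Solvable-map : ∀ {ℓ₁ ℓ₂ ℓ₃ ℓ₄ ℓ₁′ ℓ₂′ ℓ₃′ ℓ₄′} →
    (∀ {φ} → State φ → ∀ m n → Hit φ (form ℓ₁ ℓ₂ m n) (form ℓ₃ ℓ₄ m n) → Hit φ (form ℓ₁′ ℓ₂′ m n) (form ℓ₃′ ℓ₄′ m n)) →
    Solvable ℓ₁ ℓ₂ ℓ₃ ℓ₄ → Solvable ℓ₁′ ℓ₂′ ℓ₃′ ℓ₄′
  Solvable-map f h δ>0 = go (h δ>0)
    where
    go : _ → _
    go (L , L>0 , cs , k) = L , L>0 , cs , λ φ S mean → let (m , n , mem , x) = k φ S mean in m , n , mem , f S m n x

  form-comm : ∀ ℓ ℓ′ m n → form ℓ ℓ′ m n ≡ form ℓ′ ℓ m n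
  form-comm ℓ ℓ′ m n = ℤ.*-comm (m ℤ.+ ℓ ℤ.* n) (m ℤ.+ ℓ′ ℤ.* n)

  swap₁₂ : ∀ {ℓ₁ ℓ₂ ℓ₃ ℓ₄} → Solvable ℓ₂ ℓ₁ ℓ₃ ℓ₄ → Solvable ℓ₁ ℓ₂ ℓ₃ ℓ₄
  swap₁₂ {ℓ₁} {ℓ₂} {ℓ₃} {ℓ₄} = Solvable-map {ℓ₂} {ℓ₁} {ℓ₃} {ℓ₄} {ℓ₁} {ℓ₂} {ℓ₃} {ℓ₄} (λ {φ} S m n → subst (λ A → Hit φ A (form ℓ₃ ℓ₄ m n)) (form-comm ℓ₂ ℓ₁ m n))

  swap₃₄ : ∀ {ℓ₁ ℓ₂ ℓ₃ ℓ₄} → Solvable ℓ₁ ℓ₂ ℓ₄ ℓ₃ → Solvable ℓ₁ ℓ₂ ℓ₃ ℓ₄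
  swap₃₄ {ℓ₁} {ℓ₂} {ℓ₃} {ℓ₄} = Solvable-map {ℓ₁} {ℓ₂} {ℓ₄} {ℓ₃} {ℓ₁} {ℓ₂} {ℓ₃} {ℓ₄} (λ {φ} S m n → subst (λ B → Hit φ (form ℓ₁ ℓ₂ m n) B) (form-comm ℓ₄ ℓ₃ m n))

  exchange : ∀ {ℓ₁ ℓ₂ ℓ₃ ℓ₄} → Solvable ℓ₃ ℓ₄ ℓ₁ ℓ₂ → Solvable ℓ₁ ℓ₂ ℓ₃ ℓ₄
  exchange {ℓ₁} {ℓ₂} {ℓ₃} {ℓ₄} = Solvable-map {ℓ₃} {ℓ₄} {ℓ₁} {ℓ₂} {ℓ₁} {ℓ₂} {ℓ₃} {ℓ₄} (λ {φ} S m n → λ { (hit a b ne p) →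
    hit b a (ne ∘ sym) (subst (0ℚ <_) (State.swap-ratio S (ι (form ℓ₃ ℓ₄ m n)) (ι (form ℓ₁ ℓ₂ m n))) p) })

  ι-difference>0 : ∀ {i j} → i ℤ.< j → 0ℚ < ι (j ℤ.- i)
  ι-difference>0 {i} {j} lt = ι->0 (subst (ℤ._< j ℤ.- i) (ℤ.+-inverseʳ i) (ℤ.+-monoˡ-< (ℤ.- i) lt))

  -- The least root ℓ₃ is moved to 0 by m ↦ m − ℓ₃ n; with q = n / m the ratio of the two forms is s q.
  solve-distinct : ∀ {ℓ₁ ℓ₂ ℓ₃ ℓ₄} → ℓ₃ ℤ.< ℓ₁ → ℓ₁ ℤ.< ℓ₂ → ℓ₃ ℤ.< ℓ₄ → ℓ₁ ≢ ℓ₄ → ℓ₂ ≢ ℓ₄ → Solvable ℓ₁ ℓ₂ ℓ₃ ℓ₄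
  -- Beyond e / (a b) the ratio s q exceeds 1, so the two forms take different values.
  solve-distinct {ℓ₁} {ℓ₂} {ℓ₃} {ℓ₄} lt₁ lt₁₂ lt₄ ne₁ ne₂ {δ₀} δ>0 = go (recurrence (Ev-∧ (Ev-> 0ℚ) (Ev-> (e * inv (a * b)))))
    where
    a b e : ℚ
    a = ι (ℓ₁ ℤ.- ℓ₃)
    b = ι (ℓ₂ ℤ.- ℓ₃)
    e = ι (ℓ₄ ℤ.- ℓ₃)
    a>0 : 0ℚ < a
    a>0 = ι-difference>0 lt₁
    b>0 : 0ℚ < b
    b>0 = ι-difference>0 (ℤ.<-trans lt₁ lt₁₂)
    e>0 : 0ℚ < e
    e>0 = ι-difference>0 lt₄
    distinct : ∀ {i j} → i ≢ j → ι (i ℤ.- ℓ₃) ≢ ι (j ℤ.- ℓ₃)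
    distinct {i} {j} n eq = n (trans (r i ℓ₃) (trans (cong (ℤ._+ ℓ₃) (ι-injective eq)) (sym (r j ℓ₃))))
      where
      r : ∀ i k → i ≡ i ℤ.- k ℤ.+ k
      r = ℤ-solve-∀
    a<b : a < b
    a<b = <-by (ι-difference>0 lt₁₂) (trans (r′ _ a) (cong (_- a) (trans (sym (ι-+ (ℓ₂ ℤ.- ℓ₁) (ℓ₁ ℤ.- ℓ₃))) (cong ι (r ℓ₁ ℓ₂ ℓ₃)))))
      where
      r : ∀ i j k → (j ℤ.- i) ℤ.+ (i ℤ.- k) ≡ j ℤ.- k
      r = ℤ-solve-∀
      r′ : ∀ x y → x ≡ x + y - y
      r′ = solve-∀ ring
    open Increment a b e a>0 b>0 e>0 (distinct ne₁) (distinct ne₂) a<b δ>0 using (recurrence; s; s-def)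
    point-of : ℚ → ℤ × ℤ
    point-of q = ↧ q ℤ.- ℓ₃ ℤ.* ↥ q , ↥ q
    module _ {q : ℚ} (q>0 : 0ℚ < q) (q-large : e * inv (a * b) < q) where
      m n : ℤ
      m = proj₁ (point-of q)
      n = proj₂ (point-of q)
      d : ℚ
      d = ι (↧ q)
      d>0 : 0ℚ < d
      d>0 = ι->0 (ℤ.+<+ ℕ.z<s)
      factor : ∀ ℓ → ι (m ℤ.+ ℓ ℤ.* n) ≡ d * (1ℚ + ι (ℓ ℤ.- ℓ₃) * q)
      factor ℓ = trans (cong ι (r (↧ q) (↥ q) ℓ ℓ₃)) (trans (ι-+ (↧ q) ((ℓ ℤ.- ℓ₃) ℤ.* ↥ q)) (trans (cong (d +_) (trans (ι-* (ℓ ℤ.- ℓ₃) (↥ q)) (cong (ι (ℓ ℤ.- ℓ₃) *_) (sym (num-den q))))) (r′ d (ι (ℓ ℤ.- ℓ₃)) q)))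
        where
        r : ∀ d u ℓ k → d ℤ.- k ℤ.* u ℤ.+ ℓ ℤ.* u ≡ d ℤ.+ (ℓ ℤ.- k) ℤ.* u
        r = ℤ-solve-∀
        r′ : ∀ d a q → d + a * (q * d) ≡ d * (1ℚ + a * q)
        r′ = solve-∀ ring
      root : ι (m ℤ.+ ℓ₃ ℤ.* n) ≡ d
      root = cong ι (r (↧ q) (↥ q) ℓ₃)
        where
        r : ∀ d u k → d ℤ.- k ℤ.* u ℤ.+ k ℤ.* u ≡ d
        r = ℤ-solve-∀
      A B : ℤ
      A = form ℓ₁ ℓ₂ m n
      B = form ℓ₃ ℓ₄ m n
      ιA : ι A ≡ d * d * ((1ℚ + a * q) * (1ℚ + b * q))
      ιA = trans (ι-* (m ℤ.+ ℓ₁ ℤ.* n) (m ℤ.+ ℓ₂ ℤ.* n)) (trans (cong₂ _*_ (factor ℓ₁) (factor ℓ₂)) (r d (1ℚ + a * q) (1ℚ + b * q)))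
        where
        r : ∀ d x y → d * x * (d * y) ≡ d * d * (x * y)
        r = solve-∀ ring
      ιB : ι B ≡ d * d * (1ℚ + e * q)
      ιB = trans (ι-* (m ℤ.+ ℓ₃ ℤ.* n) (m ℤ.+ ℓ₄ ℤ.* n)) (trans (cong₂ _*_ root (factor ℓ₄)) (sym (*-assoc d d (1ℚ + e * q))))
      dd>0 : 0ℚ < d * d
      dd>0 = *>0 d>0 d>0
      1+>0 : ∀ {c} → 0ℚ < c → 0ℚ < 1ℚ + c * q
      1+>0 c>0 = +>0 0<1 (<⇒≤ (*>0 c>0 q>0))
      ratio : ι A * inv (ι B) ≡ s q
      ratio = trans (cong₂ (λ x y → x * inv y) ιA ιB) (trans (cancel-ratio (>⇒≢ dd>0) ((1ℚ + a * q) * (1ℚ + b * q)) (1ℚ + e * q)) (sym (s-def q)))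
      nonzero : ∀ {i x} → ι i ≡ x → 0ℚ < x → i ≢ 0ℤ
      nonzero eq x>0 refl = >⇒≢ x>0 (trans (sym eq) ι-0)
      abq : e < a * b * q
      abq = subst (_< a * b * q) (trans (r (a * b) e (inv (a * b))) (trans (cong (_* e) (inv-r (>⇒≢ (*>0 a>0 b>0)))) (*-identityˡ e))) (*-monoʳ-<-pos (a * b) {{positive (*>0 a>0 b>0)}} q-large)
        where
        r : ∀ m e i → m * (e * i) ≡ m * i * e
        r = solve-∀ ring
      differ : A ≢ B
      differ eq = <-irrefl refl (<-≤-trans (*>0 q>0 (+>0 (diff>0 abq) (<⇒≤ (+>0 a>0 (<⇒≤ b>0)))))
        (≤-reflexive (trans (r a b e q) (≡⇒diff0 (cancel-≡ (>⇒≢ dd>0) (trans (sym ιA) (trans (cong ι eq) ιB)))))))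
        where
        r : ∀ a b e q → q * (a * b * q - e + (a + b)) ≡ (1ℚ + a * q) * (1ℚ + b * q) - (1ℚ + e * q)
        r = solve-∀ ring
      hits : ∀ {φ} → 0ℚ < φ (s q) → Hit φ A B
      hits {φ} p = hit (nonzero ιA (*>0 dd>0 (*>0 (1+>0 a>0) (1+>0 b>0)))) (nonzero ιB (*>0 dd>0 (1+>0 e>0))) differ (subst (λ x → 0ℚ < φ x) (sym ratio) p)
    Goal : Set
    Goal = Σ (List ℚ) λ L → All (0ℚ <_) L × Σ (List (ℤ × ℤ)) λ cs →
      ∀ φ → State φ → Mean δ₀ L φ → Σ ℤ λ m → Σ ℤ λ n → (m , n) ∈ cs × Hit φ (form ℓ₁ ℓ₂ m n) (form ℓ₃ ℓ₄ m n)
    go : (Σ (Law ℚ) λ d → (Supp d (0ℚ <_) × Supp d (e * inv (a * b) <_)) × Σ (List ℚ) λ L → All (0ℚ <_) L × (∀ φ → State φ → Mean δ₀ L φ → 0ℚ < 𝔼 d (λ q → φ (s q)))) → Goal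
    go (d , (q>0 , q-large) , L , L>0 , h) = L , L>0 , map point-of (support d) , λ φ S mean → fin φ (𝔼-pos d (h φ S mean))
      where
      fin : ∀ φ → (Σ ℚ λ q → q ∈ support d × 0ℚ < φ (s q)) → Σ ℤ λ m → Σ ℤ λ n → (m , n) ∈ map point-of (support d) × Hit φ (form ℓ₁ ℓ₂ m n) (form ℓ₃ ℓ₄ m n)
      fin φ (q , mq , p) = ↧ q ℤ.- ℓ₃ ℤ.* ↥ q , ↥ q , ∈-map⁺ point-of mq , hits (All.lookup q>0 mq) (All.lookup q-large mq) {φ} p

  -- With a common root c, m + p n and m + t n can be given any ratio u / v, by n = v − u and m = u t − v p.
  solve-common : ∀ {c p t} → c ≢ p → c ≢ t → p ≢ t → Solvable c p c t
  solve-common {c} {p} {t} c≢p c≢t p≢t {δ₀} δ>0 = support X′ , X′>0 , cs , solve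
    where
    ρ π τ : ℚ
    -- The two exceptional events, g = h and m + c n = 0, have probability at most δ₀/4 each, so
    -- that half of the mean survives.
    ρ = half (half δ₀)
    π = ι (p ℤ.- c)
    τ = ι (t ℤ.- c)
    difference≢0 : ∀ {i j} → i ≢ j → ι (j ℤ.- i) ≢ 0ℚ
    difference≢0 {i} {j} n = ι-≢0 (λ eq → n (sym (ℤ.i-j≡0⇒i≡j j i eq)))
    π≢0 : π ≢ 0ℚ
    π≢0 = difference≢0 c≢p
    open Grid (mkGrid {ρ} (half>0 (half>0 δ>0))) using (spread; inside) renaming (grid to X)
    X′ : Law ℚ
    X′ = image (1ℚ +_) X
    X′>0 : Supp X′ (0ℚ <_)
    X′>0 = Supp-image (1ℚ +_) X (All.map (λ h → +>0 0<1 (proj₁ h)) inside)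
    point-of : ℚ → ℚ → ℤ × ℤ
    point-of g h = let r = g * inv h in ↥ r ℤ.* t ℤ.- ↧ r ℤ.* p , ↧ r ℤ.- ↥ r
    cs : List (ℤ × ℤ)
    cs = cartesianProductWith point-of (support X′) (support X′)
    rare-diagonal : ∀ g → 𝔼 X′ (λ h → δ g h) ≤ ρ
    rare-diagonal g = ≤-trans (≤-reflexive (𝔼-image (1ℚ +_) X (δ g))) (spread-image {X = X} {c = g} {f = 1ℚ +_} (g - 1ℚ) spread (λ x eq → trans (cong (_- 1ℚ) eq) (e x)))
      where
      e : ∀ x → 1ℚ + x - 1ℚ ≡ x
      e = solve-∀ ring
    rare-root : ∀ k → 𝔼 X′ (λ h → δ k (π * h)) ≤ ρ
    rare-root k = ≤-trans (≤-reflexive (𝔼-image (1ℚ +_) X (λ h → δ k (π * h)))) (spread-image {X = X} {c = k} {f = λ x → π * (1ℚ + x)} (inv π * k - 1ℚ) spread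
        (λ x eq → trans (cong (λ u → inv π * u - 1ℚ) eq) (trans (e x π (inv π)) (trans (cong (λ u → u * (1ℚ + x) - 1ℚ) (inv-r π≢0)) (e′ x)))))
      where
      e : ∀ x p i → i * (p * (1ℚ + x)) - 1ℚ ≡ p * i * (1ℚ + x) - 1ℚ
      e = solve-∀ ring
      e′ : ∀ x → 1ℚ * (1ℚ + x) - 1ℚ ≡ x
      e′ = solve-∀ ring
    module _ {φ} (S : State φ) {g h : ℚ} (g>0 : 0ℚ < g) (h>0 : 0ℚ < h) (g≢h : g ≢ h) (off : τ * g ≢ π * h) (pos-φ : 0ℚ < φ (g * inv h)) where
      r : ℚ
      r = g * inv h
      r>0 : 0ℚ < r
      r>0 = *>0 g>0 (inv-pos h>0)
      u v m n : ℤ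
      u = ↥ r
      v = ↧ r
      m = u ℤ.* t ℤ.- v ℤ.* p
      n = v ℤ.- u
      ιv : ℚ
      ιv = ι v
      ιv≢0 : ιv ≢ 0ℚ
      ιv≢0 = >⇒≢ (ι->0 (ℤ.+<+ ℕ.z<s))
      w : ℚ
      w = ι (t ℤ.- p)
      w≢0 : w ≢ 0ℚ
      w≢0 = difference≢0 p≢t
      rh : r * h ≡ g
      rh = trans (*-assoc g (inv h) h) (trans (cong (g *_) (trans (*-comm (inv h) h) (inv-r (>⇒≢ h>0)))) (*-identityʳ g))
      C : ℚ
      C = ι (m ℤ.+ c ℤ.* n)
      -- Hence `off` expresses that the common factor m + c n does not vanish.
      C-eq : C ≡ ιv * (r * τ - π)
      C-eq = trans (recover (trans (sym (ι-+ (m ℤ.+ c ℤ.* n) (v ℤ.* (p ℤ.- c)))) (trans (cong ι (e u v t p c)) (trans (ι-* u (t ℤ.- c)) (cong (_* τ) (sym (num-den r)))))))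
        (trans (cong (λ x → r * ιv * τ - x) (ι-* v (p ℤ.- c))) (e′ r ιv τ π))
        where
        e : ∀ u v t p c → u ℤ.* t ℤ.- v ℤ.* p ℤ.+ c ℤ.* (v ℤ.- u) ℤ.+ v ℤ.* (p ℤ.- c) ≡ u ℤ.* (t ℤ.- c)
        e = ℤ-solve-∀
        e′ : ∀ r v t p → r * v * t - v * p ≡ v * (r * t - p)
        e′ = solve-∀ ring
        recover : ∀ {x y z} → x + y ≡ z → x ≡ z - y
        recover {x} {y} refl = e″ x y
          where
          e″ : ∀ x y → x ≡ x + y - y
          e″ = solve-∀ ring
      C≢0 : C ≢ 0ℚ
      C≢0 z = *-≢0 ιv≢0 (λ z′ → off (trans (cong (τ *_) (sym rh)) (trans (e τ r h) (cong (_* h) (trans (e′ (r * τ) π) (trans (cong (_+ π) z′) (+-identityˡ π))))))) (trans (sym C-eq) z)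
        where
        e : ∀ t r h → t * (r * h) ≡ r * t * h
        e = solve-∀ ring
        e′ : ∀ x p → x ≡ x - p + p
        e′ = solve-∀ ring
      A B : ℤ
      A = form c p m n
      B = form c t m n
      ιA : ι A ≡ r * (C * (ιv * w))
      ιA = trans (ι-* (m ℤ.+ c ℤ.* n) (m ℤ.+ p ℤ.* n)) (trans (cong (C *_) (trans (cong ι (e u v t p)) (trans (ι-* u (t ℤ.- p)) (cong (_* w) (sym (num-den r)))))) (e′ C r ιv w))
        where
        e : ∀ u v t p → u ℤ.* t ℤ.- v ℤ.* p ℤ.+ p ℤ.* (v ℤ.- u) ≡ u ℤ.* (t ℤ.- p)
        e = ℤ-solve-∀
        e′ : ∀ C r v w → C * (r * v * w) ≡ r * (C * (v * w))
        e′ = solve-∀ ring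
      ιB : ι B ≡ C * (ιv * w)
      ιB = trans (ι-* (m ℤ.+ c ℤ.* n) (m ℤ.+ t ℤ.* n)) (cong (C *_) (trans (cong ι (e u v t p)) (ι-* v (t ℤ.- p))))
        where
        e : ∀ u v t p → u ℤ.* t ℤ.- v ℤ.* p ℤ.+ t ℤ.* (v ℤ.- u) ≡ v ℤ.* (t ℤ.- p)
        e = ℤ-solve-∀
      b≢0 : C * (ιv * w) ≢ 0ℚ
      b≢0 = *-≢0 C≢0 (*-≢0 ιv≢0 w≢0)
      nonzero : ∀ {i x} → ι i ≡ x → x ≢ 0ℚ → i ≢ 0ℤ
      nonzero eq x≢0 refl = x≢0 (trans (sym eq) ι-0)
      hits : Hit φ A B
      hits = hit (nonzero ιA (*-≢0 (>⇒≢ r>0) b≢0)) (nonzero ιB b≢0) differ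
        (subst (λ x → 0ℚ < φ x) (sym (trans (cong₂ (λ x y → x * inv y) ιA ιB) (ratio-unique {r * (C * (ιv * w))} {C * (ιv * w)} {r} b≢0 refl))) pos-φ)
        where
        differ : A ≢ B
        differ eq = g≢h (trans (sym rh) (trans (cong (_* h) (cancel-≡ b≢0 (trans (*-comm (C * (ιv * w)) r) (trans (sym ιA) (trans (cong ι eq) (trans ιB (sym (*-identityʳ (C * (ιv * w)))))))))) (*-identityˡ h)))
    solve : ∀ φ → State φ → Mean δ₀ (support X′) φ → Σ ℤ λ m → Σ ℤ λ n → (m , n) ∈ cs × Hit φ (form c p m n) (form c t m n)
    solve φ S mean = go (𝔼-pos X′ (<-≤-trans positive-mean (≤-reflexive split)))
      where
      open State S
      -- Nonpositive on both exceptional events because φ ≤ 1, so a pair with a positive value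
      -- avoids them.
      f : ℚ → ℚ → ℚ
      f g h = φ (g * inv h) - δ g h - δ (τ * g) (π * h)
      split : 𝔼 X′ (λ g → 𝔼 X′ (λ h → φ (g * inv h))) - 𝔼 X′ (λ g → 𝔼 X′ (δ g)) - 𝔼 X′ (λ g → 𝔼 X′ (λ h → δ (τ * g) (π * h))) ≡ 𝔼 X′ (λ g → 𝔼 X′ (f g))
      split = sym (trans (𝔼-cong X′ (λ g → trans (𝔼-- X′ _ _) (cong (_- 𝔼 X′ (λ h → δ (τ * g) (π * h))) (𝔼-- X′ _ _))))
        (trans (𝔼-- X′ _ _) (cong (_- 𝔼 X′ (λ g → 𝔼 X′ (λ h → δ (τ * g) (π * h)))) (𝔼-- X′ _ _))))
      positive-mean : 0ℚ < 𝔼 X′ (λ g → 𝔼 X′ (λ h → φ (g * inv h))) - 𝔼 X′ (λ g → 𝔼 X′ (δ g)) - 𝔼 X′ (λ g → 𝔼 X′ (λ h → δ (τ * g) (π * h)))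
      positive-mean = <-by (+>0 (+>0 (+>0 (half>0 δ>0) (diff≥0 (mean X′ (All.tabulate id)))) (diff≥0 (𝔼-≤c X′ (Supp-all X′ rare-diagonal)))) (diff≥0 (𝔼-≤c X′ (Supp-all X′ (λ g → rare-root (τ * g))))))
        (trans (e (half δ₀) δ₀ (𝔼 X′ (λ g → 𝔼 X′ (λ h → φ (g * inv h)))) (𝔼 X′ (λ g → 𝔼 X′ (δ g))) (𝔼 X′ (λ g → 𝔼 X′ (λ h → δ (τ * g) (π * h)))) ρ)
          (trans (cong₂ (λ x y → half δ₀ + x - y + Rest) (half+half (half δ₀)) (sym (half+half δ₀))) (e′ (half δ₀) Rest)))
        where
        Rest : ℚ
        Rest = 𝔼 X′ (λ g → 𝔼 X′ (λ h → φ (g * inv h))) - 𝔼 X′ (λ g → 𝔼 X′ (δ g)) - 𝔼 X′ (λ g → 𝔼 X′ (λ h → δ (τ * g) (π * h)))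
        e : ∀ h d m x y r → h + (m - d) + (r - x) + (r - y) ≡ h + (r + r) - d + (m - x - y)
        e = solve-∀ ring
        e′ : ∀ h R → h + h - (h + h) + R ≡ R - 0ℚ
        e′ = solve-∀ ring
      Goal : Set
      Goal = Σ ℤ λ m → Σ ℤ λ n → (m , n) ∈ cs × Hit φ (form c p m n) (form c t m n)
      go : (Σ ℚ λ g → g ∈ support X′ × 0ℚ < 𝔼 X′ (f g)) → Goal
      go (g , mg , q) = go′ (𝔼-pos X′ q)
        where
        go′ : (Σ ℚ λ h → h ∈ support X′ × 0ℚ < f g h) → Goal
        go′ (h , mh , q) = proj₁ (point-of g h) , proj₂ (point-of g h) , ∈-cartesianProductWith⁺ point-of mg mh ,
          hits S (All.lookup X′>0 mg) (All.lookup X′>0 mh) (λ eq → absurd₁ (δ-≡ eq)) (λ eq → absurd₂ (δ-≡ eq))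
            (<-≤-trans q (≤-by (+≥0 (δ≥0 g h) (δ≥0 (τ * g) (π * h))) (e (φ (g * inv h)) (δ g h) (δ (τ * g) (π * h)))))
          where
          e : ∀ x y z → y + z ≡ x - (x - y - z)
          e = solve-∀ ring
          absurd₁ : δ g h ≢ 1ℚ
          absurd₁ one = <-irrefl refl (<-≤-trans q (≤-by (+≥0 (diff≥0 (φ≤1 (g * inv h))) (δ≥0 (τ * g) (π * h))) (trans (cong (λ y → y - φ (g * inv h) + δ (τ * g) (π * h)) (sym one)) (e₁ (φ (g * inv h)) (δ g h) (δ (τ * g) (π * h))))))
            where
            e₁ : ∀ x y z → y - x + z ≡ 0ℚ - (x - y - z)
            e₁ = solve-∀ ring
          absurd₂ : δ (τ * g) (π * h) ≢ 1ℚ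
          absurd₂ one = <-irrefl refl (<-≤-trans q (≤-by (+≥0 (diff≥0 (φ≤1 (g * inv h))) (δ≥0 g h)) (trans (cong (λ y → y - φ (g * inv h) + δ g h) (sym one)) (e₁ (φ (g * inv h)) (δ g h) (δ (τ * g) (π * h))))))
            where
            e₁ : ∀ x y z → z - x + y ≡ 0ℚ - (x - y - z)
            e₁ = solve-∀ ring

  -- `solve-distinct` wants the least of the four roots in the second form; if it lies in the first,
  -- the forms are exchanged.
  solve-sorted : ∀ {ℓ₁ ℓ₂ ℓ₃ ℓ₄} → ℓ₁ ℤ.< ℓ₂ → ℓ₃ ℤ.< ℓ₄ → ℓ₁ ≢ ℓ₃ → ℓ₁ ≢ ℓ₄ → ℓ₂ ≢ ℓ₃ → ℓ₂ ≢ ℓ₄ → Solvable ℓ₁ ℓ₂ ℓ₃ ℓ₄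
  solve-sorted {ℓ₁} {ℓ₂} {ℓ₃} {ℓ₄} lt lt′ n₁₃ n₁₄ n₂₃ n₂₄ = go (ℤ.<-cmp ℓ₁ ℓ₃)
    where
    go : _ → Solvable ℓ₁ ℓ₂ ℓ₃ ℓ₄
    go (tri< a _ _) = exchange {ℓ₁} {ℓ₂} {ℓ₃} {ℓ₄} (solve-distinct a lt′ lt (n₂₃ ∘ sym) (n₂₄ ∘ sym))
    go (tri≈ _ e _) = ⊥-elim (n₁₃ e)
    go (tri> _ _ b) = solve-distinct b lt lt′ n₁₄ n₂₄

  solvable : ∀ ℓ₁ ℓ₂ ℓ₃ ℓ₄ → ℓ₁ ≢ ℓ₂ → ℓ₃ ≢ ℓ₄ → ¬ ((ℓ₁ ≡ ℓ₃ × ℓ₂ ≡ ℓ₄) ⊎ (ℓ₁ ≡ ℓ₄ × ℓ₂ ≡ ℓ₃)) → Solvable ℓ₁ ℓ₂ ℓ₃ ℓ₄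
  solvable ℓ₁ ℓ₂ ℓ₃ ℓ₄ n₁₂ n₃₄ n = go (ℓ₁ ℤ.≟ ℓ₃) (ℓ₁ ℤ.≟ ℓ₄) (ℓ₂ ℤ.≟ ℓ₃) (ℓ₂ ℤ.≟ ℓ₄)
    where
    go : Dec (ℓ₁ ≡ ℓ₃) → Dec (ℓ₁ ≡ ℓ₄) → Dec (ℓ₂ ≡ ℓ₃) → Dec (ℓ₂ ≡ ℓ₄) → Solvable ℓ₁ ℓ₂ ℓ₃ ℓ₄
    go (yes refl) _ _ _ = solve-common n₁₂ n₃₄ (λ e → n (inj₁ (refl , e)))
    go (no _) (yes refl) _ _ = swap₃₄ {ℓ₁} {ℓ₂} {ℓ₃} {ℓ₁} (solve-common n₁₂ (n₃₄ ∘ sym) (λ e → n (inj₂ (refl , e))))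
    go (no _) (no _) (yes refl) _ = swap₁₂ {ℓ₁} {ℓ₂} {ℓ₂} {ℓ₄} (solve-common (n₁₂ ∘ sym) n₃₄ (λ e → n (inj₂ (e , refl))))
    go (no _) (no _) (no _) (yes refl) = swap₁₂ {ℓ₁} {ℓ₂} {ℓ₃} {ℓ₂} (swap₃₄ {ℓ₂} {ℓ₁} {ℓ₃} {ℓ₂} (solve-common (n₁₂ ∘ sym) (n₃₄ ∘ sym) (λ e → n (inj₁ (e , refl)))))
    go (no a) (no b) (no c) (no d) = sort (ℤ.<-cmp ℓ₁ ℓ₂) (ℤ.<-cmp ℓ₃ ℓ₄)
      where
      sort : _ → _ → Solvable ℓ₁ ℓ₂ ℓ₃ ℓ₄
      sort (tri≈ _ e _) _ = ⊥-elim (n₁₂ e)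
      sort _ (tri≈ _ e _) = ⊥-elim (n₃₄ e)
      sort (tri< l _ _) (tri< l′ _ _) = solve-sorted l l′ a b c d
      sort (tri< l _ _) (tri> _ _ g′) = swap₃₄ {ℓ₁} {ℓ₂} {ℓ₃} {ℓ₄} (solve-sorted l g′ b a d c)
      sort (tri> _ _ g) (tri< l′ _ _) = swap₁₂ {ℓ₁} {ℓ₂} {ℓ₃} {ℓ₄} (solve-sorted g l′ c d a b)
      sort (tri> _ _ g) (tri> _ _ g′) = swap₁₂ {ℓ₁} {ℓ₂} {ℓ₃} {ℓ₄} (swap₃₄ {ℓ₂} {ℓ₁} {ℓ₃} {ℓ₄} (solve-sorted g g′ d c b a))

open FormRatios

-- From correlated pairs to the pattern.

module Patterns where
  open import Data.Integer.Base using (+_)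
  open import Data.Integer.Tactic.RingSolver using () renaming (solve-∀ to ℤ-solve-∀)
  open import Data.Nat.Base as ℕ using (ℕ; zero; suc)
  open import Data.Nat.Divisibility using (_∣_; ∣-trans)
  open import Data.Nat.ListAction.Properties using (∈⇒∣product; product≢0)
  open import Data.Rational.Base as ℚ using (ℚ)
  import Data.Rational.Properties as ℚ
  open import Defs using (PositiveMultDensity; Admissible)

  clear-denominator : ∀ {A B : ℤ} {x y : ℕ} → B ≢ 0ℤ → fromℕ x ≡ ι A ℚ.* inv (ι B) ℚ.* fromℕ y → + x ℤ.* B ≡ + y ℤ.* A
  clear-denominator {A} {B} {x} {y} B≢0 eq = ι-injective (begin
    ι (+ x ℤ.* B) ≡⟨ trans (ι-* (+ x) B) (cong (ℚ._* ι B) (trans (ι-fromℕ x) eq)) ⟩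
    ι A ℚ.* inv (ι B) ℚ.* fromℕ y ℚ.* ι B ≡⟨ ℚ.*-assoc (ι A ℚ.* inv (ι B)) (fromℕ y) (ι B) ⟩
    ι A ℚ.* inv (ι B) ℚ.* (fromℕ y ℚ.* ι B) ≡⟨ cong (ι A ℚ.* inv (ι B) ℚ.*_) (ℚ.*-comm (fromℕ y) (ι B)) ⟩
    ι A ℚ.* inv (ι B) ℚ.* (ι B ℚ.* fromℕ y) ≡⟨ ℚ.*-assoc (ι A) (inv (ι B)) (ι B ℚ.* fromℕ y) ⟩
    ι A ℚ.* (inv (ι B) ℚ.* (ι B ℚ.* fromℕ y)) ≡⟨ cong (ι A ℚ.*_) (sym (ℚ.*-assoc (inv (ι B)) (ι B) (fromℕ y))) ⟩
    ι A ℚ.* (inv (ι B) ℚ.* ι B ℚ.* fromℕ y) ≡⟨ cong (λ u → ι A ℚ.* (u ℚ.* fromℕ y)) (trans (ℚ.*-comm (inv (ι B)) (ι B)) (inv-r (ι-≢0 B≢0))) ⟩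
    ι A ℚ.* (ℚ.1ℚ ℚ.* fromℕ y) ≡⟨ cong (ι A ℚ.*_) (trans (ℚ.*-identityˡ (fromℕ y)) (sym (ι-fromℕ y))) ⟩
    ι A ℚ.* ι (+ y) ≡⟨ trans (ℚ.*-comm (ι A) (ι (+ y))) (sym (ι-* (+ y) A)) ⟩
    ι (+ y ℤ.* A) ∎)
    where open ≡-Reasoning

  -- Divisibility makes k = x / (ℓ A) an integer, and x B = y A then gives the same k for y after
  -- cancelling A.
  common-factor : ∀ {ℓ A B : ℤ} {x y : ℕ} → A ≢ 0ℤ → ∣ ℓ ℤ.* A ∣ ∣ x → + x ℤ.* B ≡ + y ℤ.* A →
    Σ ℤ λ k → + x ≡ k ℤ.* ℓ ℤ.* A × + y ≡ k ℤ.* ℓ ℤ.* B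
  common-factor {ℓ} {A} {B} {x} {y} A≢0 dv eq = go (Signed.∣ᵤ⇒∣ {ℓ ℤ.* A} {+ x} dv)
    where
    go : ℓ ℤ.* A Signed.∣ + x → Σ ℤ λ k → + x ≡ k ℤ.* ℓ ℤ.* A × + y ≡ k ℤ.* ℓ ℤ.* B
    go (Signed.divides k e) = k , x-eq , ℤ.*-cancelʳ-≡ (+ y) (k ℤ.* ℓ ℤ.* B) A {{ℤ.≢-nonZero A≢0}}
        (trans (sym eq) (trans (cong (ℤ._* B) x-eq) (r (k ℤ.* ℓ) A B)))
      where
      x-eq : + x ≡ k ℤ.* ℓ ℤ.* A
      x-eq = trans e (sym (ℤ.*-assoc k ℓ A))
      r : ∀ u A B → u ℤ.* A ℤ.* B ≡ u ℤ.* B ℤ.* A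
      r = ℤ-solve-∀

  -- Zero entries are replaced by 1, so that a product over candidates stays nonzero.
  nonzero-part : ℕ → ℕ
  nonzero-part zero = 1
  nonzero-part (suc n) = suc n

  nonzero-part≢0 : ∀ n → ℕ.NonZero (nonzero-part n)
  nonzero-part≢0 zero = _
  nonzero-part≢0 (suc n) = _

  nonzero-part-id : ∀ {n} → n ≢ 0 → nonzero-part n ≡ n
  nonzero-part-id {zero} n = ⊥-elim (n refl)
  nonzero-part-id {suc n} _ = refl

  patterns : (ℓ₀ ℓ₁ ℓ₂ ℓ₃ ℓ₄ : ℤ) → Admissible ℓ₀ ℓ₁ ℓ₂ ℓ₃ ℓ₄ → (Ein : ℕ → Set) → PositiveMultDensity Ein →
    Σ ℕ λ x → Σ ℕ λ y → 1 ℕ.≤ x × 1 ℕ.≤ y × Ein x × Ein y × ¬ (x ≡ y) ×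
      Σ ℤ λ k → Σ ℤ λ m → Σ ℤ λ n →
        (+ x ≡ k ℤ.* ℓ₀ ℤ.* (m ℤ.+ ℓ₁ ℤ.* n) ℤ.* (m ℤ.+ ℓ₂ ℤ.* n)) ×
        (+ y ≡ k ℤ.* ℓ₀ ℤ.* (m ℤ.+ ℓ₃ ℤ.* n) ℤ.* (m ℤ.+ ℓ₄ ℤ.* n))
  patterns ℓ₀ ℓ₁ ℓ₂ ℓ₃ ℓ₄ (ℓ₀>0 , n₁₂ , n₃₄ , ne) Ein dens = go (solvable ℓ₁ ℓ₂ ℓ₃ ℓ₄ n₁₂ n₃₄ ne (mean-bound>0 dens))
    where
    Result : Set
    Result = Σ ℕ λ x → Σ ℕ λ y → 1 ℕ.≤ x × 1 ℕ.≤ y × Ein x × Ein y × ¬ (x ≡ y) ×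
      Σ ℤ λ k → Σ ℤ λ m → Σ ℤ λ n →
        (+ x ≡ k ℤ.* ℓ₀ ℤ.* (m ℤ.+ ℓ₁ ℤ.* n) ℤ.* (m ℤ.+ ℓ₂ ℤ.* n)) ×
        (+ y ≡ k ℤ.* ℓ₀ ℤ.* (m ℤ.+ ℓ₃ ℤ.* n) ℤ.* (m ℤ.+ ℓ₄ ℤ.* n))
    go : (Σ (List ℚ) λ L → All (ℚ.0ℚ ℚ.<_) L × Σ (List (ℤ × ℤ)) λ cs →
      ∀ φ → State φ → Mean (mean-bound dens) L φ → Σ ℤ λ m → Σ ℤ λ n → (m , n) ∈ cs × Hit φ (form ℓ₁ ℓ₂ m n) (form ℓ₃ ℓ₄ m n)) → Result
    go (L , L>0 , cs , h) = correlate (correlation dens L>0 U≢0)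
      where
      scaled-form : ℤ × ℤ → ℕ
      scaled-form (m , n) = ∣ ℓ₀ ℤ.* form ℓ₁ ℓ₂ m n ∣
      factors : List ℕ
      factors = map (λ c → nonzero-part (scaled-form c)) cs
      -- It is not known in advance which candidate will be hit, so U is made a multiple of ℓ₀ times
      -- the first form at every candidate where this is nonzero.
      U : ℕ
      U = product factors
      U≢0 : U ≢ 0
      U≢0 = ℕ.≢-nonZero⁻¹ U {{product≢0 (map⁺ (All.universal (λ c → nonzero-part≢0 (scaled-form c)) cs))}}
      correlate : (Σ (ℚ → ℚ) λ φ → State φ × Mean (mean-bound dens) L φ × (∀ {r} → ℚ.0ℚ ℚ.< φ r → Correlated Ein U r)) → Result
      correlate (φ , S , mean , corr) = found (h φ S mean)
        where
        found : (Σ ℤ λ m → Σ ℤ λ n → (m , n) ∈ cs × Hit φ (form ℓ₁ ℓ₂ m n) (form ℓ₃ ℓ₄ m n)) → Result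
        found (m , n , mem , hit A≢0 B≢0 A≢B pos) = finish (common-factor {ℓ₀} {A} {B} A≢0 (∣-trans divides-U U∣x) cross)
          where
          A B : ℤ
          A = form ℓ₁ ℓ₂ m n
          B = form ℓ₃ ℓ₄ m n
          open Correlated (corr pos)
          cross : + x ℤ.* B ≡ + y ℤ.* A
          cross = clear-denominator {A} {B} {x} {y} B≢0 ratio
          ℓA≢0 : ∣ ℓ₀ ℤ.* A ∣ ≢ 0
          ℓA≢0 z = ℕ.≢-nonZero⁻¹ ∣ ℓ₀ ℤ.* A ∣ {{ℤ.i*j≢0 ℓ₀ A {{ℤ.>-nonZero ℓ₀>0}} {{ℤ.≢-nonZero A≢0}}}} z
          divides-U : ∣ ℓ₀ ℤ.* A ∣ ∣ U
          divides-U = subst (_∣ U) (nonzero-part-id ℓA≢0) (∈⇒∣product (∈-map⁺ (λ c → nonzero-part (scaled-form c)) mem))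
          x≢y : x ≢ y
          x≢y eq = A≢B (sym (ℤ.*-cancelˡ-≡ (+ x) B A {{ℤ.≢-nonZero (λ z → x≢0 (ℤ.+-injective z))}} (trans cross (cong (λ k → + k ℤ.* A) (sym eq)))))
          finish : (Σ ℤ λ k → + x ≡ k ℤ.* ℓ₀ ℤ.* A × + y ≡ k ℤ.* ℓ₀ ℤ.* B) → Result
          finish (k , ex , ey) = x , y , ℕ.n≢0⇒n>0 x≢0 , ℕ.n≢0⇒n>0 y≢0 , x∈E , y∈E , x≢y , k , m , n ,
            trans ex (sym (ℤ.*-assoc (k ℤ.* ℓ₀) (m ℤ.+ ℓ₁ ℤ.* n) (m ℤ.+ ℓ₂ ℤ.* n))) ,
            trans ey (sym (ℤ.*-assoc (k ℤ.* ℓ₀) (m ℤ.+ ℓ₃ ℤ.* n) (m ℤ.+ ℓ₄ ℤ.* n)))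

open import Defs
open import Data.Nat using (ℕ; _≤_)
open import Data.Integer using (ℤ; +_; _+_; _*_)
open import Data.Product using (Σ; _×_)
open import Relation.Nullary using (¬_)
open import Relation.Binary.PropositionalEquality using (_≡_)

theorem10p2 : (ℓ₀ ℓ₁ ℓ₂ ℓ₃ ℓ₄ : ℤ) → Admissible ℓ₀ ℓ₁ ℓ₂ ℓ₃ ℓ₄ →
    (E : ℕ → Set) → PositiveMultDensity E →
    Σ ℕ λ x → Σ ℕ λ y → 1 ≤ x × 1 ≤ y × E x × E y × ¬ (x ≡ y) ×
      Σ ℤ λ k → Σ ℤ λ m → Σ ℤ λ n →
        (+ x ≡ k * ℓ₀ * (m + ℓ₁ * n) * (m + ℓ₂ * n)) ×
        (+ y ≡ k * ℓ₀ * (m + ℓ₃ * n) * (m + ℓ₄ * n))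
theorem10p2 = Patterns.patterns
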